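{- Let $f$ be an edge ordering of $K_n$ chosen uniformly at random from all bijections $E(K_n)\to\{1,2,\dots,\binom n2\}$, and let $H_n$ be the number of $f$-increasing Hamiltonian paths. Then $\mathrm{E}[H_n^2]=(1+o(1))\,e\,n^2$ as $n\to\infty$.
   Context: A Hamiltonian path is regarded as directed, i.e. as a permutation $(v_1,\dots,v_n)$ of the $n$ vertices of $K_n$. It is $f$-increasing if $f(v_1v_2)<f(v_2v_3)<\cdots<f(v_{n-1}v_n)$. -}

module Defs where

open import Algebra.Bundles using (CommutativeMonoid)
open import Data.Fin.Base as Fin using (Fin; Fin′; zero; suc; toℕ; fromℕ<)
import Data.Fin.Properties as Fin
open import Data.Integer.Base as ℤ using (+_; +[1+_])
import Data.Integer.Properties as ℤ
open import Data.List.Base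
  using (List; []; _∷_; map; length; filter; mapMaybe; tabulate; allFin; cartesianProductWith)
open import Data.List.Relation.Unary.Linked as Linked using (Linked; []; [-]; _∷_)
import Data.List.Relation.Unary.Linked.Properties as Linked
import Data.List.Relation.Unary.Unique.Propositional.Properties as Unique
import Data.Maybe.Base as Maybe
open import Data.Nat.Base as ℕ using (ℕ; zero; suc; _!)
open import Data.Nat.Combinatorics using (_C_)
open import Data.Nat.ListAction using (sum)
import Data.Nat.Properties as ℕ
open import Data.Product.Base using (Σ-syntax; ∃; _,_; curry; uncurry)
import Data.Product.Properties as Product
open import Data.Rational.Base hiding (NonZero)
open import Data.Rational.Properties as ℚ using ()
import Data.Rational.Unnormalised.Base as ℚᵘ
import Data.Rational.Unnormalised.Properties as ℚᵘ
open import Data.Sum.Base using (inj₁; inj₂)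
open import Function.Base using (_∘_)
open import Function.Bundles using (_⤖_; mk⤖; module Bijection)
open import Function.Consequences.Propositional using (strictlySurjective⇒surjective)
open import Function.Definitions using (Injective; Bijective; StrictlySurjective)
open import Relation.Binary.Definitions using (DecidableEquality; tri<; tri≈; tri>)
open import Relation.Binary.PropositionalEquality
open import Relation.Nullary.Decidable using (Dec; map′; _×-dec_; _→-dec_; dec⇒maybe)
open import Relation.Nullary.Negation using (contradiction)
open import Relation.Unary using (Decidable)

------------------------------------------------------------------------
-- Enumerating bijections between finite types

functions : ∀ n {B : Fin n → Set} → (∀ i → List (B i)) → List (∀ i → B i)
functions zero    bs = (λ ()) ∷ []
functions (suc n) bs = cartesianProductWith Fin.∀-cons (bs zero) (functions n (bs ∘ suc))

-- A type is searchable when quantification over it preserves decidability.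
record Searchable (A : Set) : Set₁ where
  field
    _≟_  : DecidableEquality A
    all? : {P : A → Set} → Decidable P → Dec (∀ x → P x)
    any? : {P : A → Set} → Decidable P → Dec (∃ P)

bijective? : {A B : Set} → Searchable A → Searchable B →
             (f : A → B) → Dec (Bijective _≡_ _≡_ f)
bijective? A? B? f = injective? ×-dec surjective?
  where
  module A = Searchable A?
  module B = Searchable B?

  injective? : Dec (Injective _≡_ _≡_ f)
  injective? = map′ (λ inj {x} {y} → inj x y) (λ inj x y → inj {x} {y})
    (A.all? λ x → A.all? λ y → (f x B.≟ f y) →-dec (x A.≟ y))

  surjective? = map′ strictlySurjective⇒surjective
    (λ surj y → let (x , fx≡y) = surj y in x , fx≡y refl)
    (B.all? λ y → A.any? λ x → f x B.≟ y)

-- Applied to a list of all functions, gives every bijection exactly once, up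
-- to pointwise equality.
bijections : {A B : Set} → Searchable A → Searchable B → List (A → B) → List (A ⤖ B)
bijections A? B? = mapMaybe λ f → Maybe.map mk⤖ (dec⇒maybe (bijective? A? B? f))

searchFin : ∀ {n} → Searchable (Fin n)
searchFin = record { _≟_ = Fin._≟_ ; all? = Fin.all? ; any? = Fin.any? }

------------------------------------------------------------------------
-- The complete graph on the vertex set Fin n

-- The edge {i , j} with i < j is stored as its larger endpoint j together
-- with i, seen as an element of Fin′ j = Fin (toℕ j).
Edge : ℕ → Set
Edge n = Σ[ j ∈ Fin n ] Fin′ j

edge : ∀ {n} (u v : Fin n) → u ≢ v → Edge n
edge u v u≢v with Fin.<-cmp u v
... | tri< u<v _ _ = v , fromℕ< u<v
... | tri≈ _ u≡v _ = contradiction u≡v u≢v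
... | tri> _ _ v<u = u , fromℕ< v<u

searchEdge : ∀ {n} → Searchable (Edge n)
searchEdge = record
  { _≟_  = Product.≡-dec Fin._≟_ Fin._≟_
  ; all? = λ P? → map′ uncurry curry (Fin.all? λ j → Fin.all? λ i → P? (j , i))
  ; any? = λ P? → map′ (λ (j , i , p) → (j , i) , p) (λ ((j , i) , p) → j , i , p)
                    (Fin.any? λ j → Fin.any? λ i → P? (j , i))
  }

-- The labels 1 < 2 < … < n C 2 are the elements of Fin (n C 2), in order.
EdgeOrdering : ℕ → Set
EdgeOrdering n = Edge n ⤖ Fin (n C 2)

edgeOrderings : ∀ n → List (EdgeOrdering n)
edgeOrderings n = bijections searchEdge searchFin
  (map uncurry (functions n λ j → functions (toℕ j) λ _ → allFin (n C 2)))

-- A directed Hamiltonian path (v₁ , … , vₙ) is the permutation i ↦ vᵢ.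
HamiltonianPath : ℕ → Set
HamiltonianPath n = Fin n ⤖ Fin n

hamiltonianPaths : ∀ n → List (HamiltonianPath n)
hamiltonianPaths n = bijections searchFin searchFin (functions n λ _ → allFin n)

walkEdges : ∀ {n} {vs : List (Fin n)} → Linked _≢_ vs → List (Edge n)
walkEdges []                          = []
walkEdges [-]                         = []
walkEdges (_∷_ {x = u} {y = v} u≢v l) = edge u v u≢v ∷ walkEdges l

-- v₁v₂ , v₂v₃ , … , vₙ₋₁vₙ
pathEdges : ∀ {n} → HamiltonianPath n → List (Edge n)
pathEdges v = walkEdges (Linked.AllPairs⇒Linked (Unique.tabulate⁺ (Bijection.injective v)))

Increasing : ∀ {n} → EdgeOrdering n → HamiltonianPath n → Set
Increasing f v = Linked Fin._<_ (map (Bijection.to f) (pathEdges v))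

increasing? : ∀ {n} (f : EdgeOrdering n) → Decidable (Increasing f)
increasing? f v = Linked.linked? Fin._<?_ (map (Bijection.to f) (pathEdges v))

H : ∀ {n} → EdgeOrdering n → ℕ
H {n} f = length (filter (increasing? f) (hamiltonianPaths n))

------------------------------------------------------------------------
-- Expectation

-- The expectation of X at a uniformly random entry of a nonempty list
-- (0 on the empty list, by convention; edgeOrderings n has (n C 2)! entries).
𝔼 : {A : Set} → List A → (A → ℕ) → ℚ
𝔼 []         X = 0ℚ
𝔼 Ω@(_ ∷ _) X = (+ sum (map X Ω)) / length Ω

𝔼[H²] : ℕ → ℚ
𝔼[H²] n = 𝔼 (edgeOrderings n) (λ f → H f ℕ.^ 2)

------------------------------------------------------------------------
-- Cauchy real numbers

Cauchy : (ℕ → ℚ) → Set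
Cauchy s = ∀ ε → 0ℚ < ε → ∃ λ N → ∀ m n → N ℕ.≤ m → N ℕ.≤ n → ∣ s m - s n ∣ ≤ ε

record ℝ : Set where
  constructor mkℝ
  field
    approx : ℕ → ℚ
    cauchy : Cauchy approx

open ℝ public

infix  4 _≤ᵣ_
infixl 6 _-ᵣ_
infixl 7 _·_

_≤ᵣ_ : ℝ → ℝ → Set
x ≤ᵣ y = ∀ ε → 0ℚ < ε → ∃ λ N → ∀ k → N ℕ.≤ k → approx x k ≤ approx y k + ε

fromℚ : ℚ → ℝ
fromℚ q = mkℝ (λ _ → q) λ ε 0<ε → 0 , λ _ _ _ _ →
  ℚ.≤-trans (ℚ.≤-reflexive (cong ∣_∣ (ℚ.+-inverseʳ q))) (ℚ.<⇒≤ 0<ε)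

private
  open import Algebra.Properties.Group ℚ.+-0-group using (⁻¹-involutive)
  open import Algebra.Properties.CommutativeSemigroup
    (CommutativeMonoid.commutativeSemigroup ℚ.+-0-commutativeMonoid)
    using (interchange)

  half+half : ∀ ε → ½ * ε + ½ * ε ≡ ε
  half+half ε = trans (sym (ℚ.*-distribʳ-+ ε ½ ½)) (ℚ.*-identityˡ ε)

  0<*  : ∀ {p q} → 0ℚ < p → 0ℚ < q → 0ℚ < p * q
  0<* {p} {q} 0<p 0<q = ℚ.positive⁻¹ (p * q)
    {{ℚ.pos*pos⇒pos p {{positive 0<p}} q {{positive 0<q}}}}

  0<½ : 0ℚ < ½
  0<½ = ℚ.positive⁻¹ ½

  sub-sub : ∀ a b c d → (a - b) - (c - d) ≡ (a - c) - (b - d)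
  sub-sub a b c d = begin
    (a - b) - (c - d)       ≡⟨ cong (λ r → (a - b) + r) (ℚ.neg-distrib-+ c (- d)) ⟩
    (a - b) + (- c - - d)   ≡⟨ interchange a (- b) (- c) (- - d) ⟩
    (a - c) + (- b - - d)   ≡⟨ cong (λ r → (a - c) + r) (ℚ.neg-distrib-+ b (- d)) ⟨
    (a - c) - (b - d)       ∎
    where open ≡-Reasoning

  p≤∣p∣ : ∀ p → p ≤ ∣ p ∣
  p≤∣p∣ p with ℚ.≤-total 0ℚ p
  ... | inj₁ 0≤p = ℚ.≤-reflexive (sym (ℚ.0≤p⇒∣p∣≡p 0≤p))
  ... | inj₂ p≤0 = ℚ.≤-trans p≤0 (ℚ.0≤∣p∣ p)

  ∣p∣≤ : ∀ {p q} → p ≤ q → - p ≤ q → ∣ p ∣ ≤ q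
  ∣p∣≤ {p} p≤q -p≤q with ℚ.∣p∣≡p∨∣p∣≡-p p
  ... | inj₁ eq = ℚ.≤-trans (ℚ.≤-reflexive eq) p≤q
  ... | inj₂ eq = ℚ.≤-trans (ℚ.≤-reflexive eq) -p≤q

  neg-sub : ∀ p q → - (p - q) ≡ q - p
  neg-sub p q = begin
    - (p - q)   ≡⟨ ℚ.neg-distrib-+ p (- q) ⟩
    - p - - q   ≡⟨ cong (λ r → - p + r) (⁻¹-involutive q) ⟩
    - p + q     ≡⟨ ℚ.+-comm (- p) q ⟩
    q - p       ∎
    where open ≡-Reasoning

  sub-swap : ∀ p q → ∣ p - q ∣ ≡ ∣ q - p ∣
  sub-swap p q = trans (sym (ℚ.∣-p∣≡∣p∣ (p - q))) (cong ∣_∣ (neg-sub p q))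

  sub-add : ∀ p q → (p - q) + q ≡ p
  sub-add p q = trans (ℚ.+-assoc p (- q) q)
    (trans (cong (λ r → p + r) (ℚ.+-inverseˡ q)) (ℚ.+-identityʳ p))

  add-sub : ∀ p q → (p + q) - q ≡ p
  add-sub p q = trans (ℚ.+-assoc p q (- q))
    (trans (cong (λ r → p + r) (ℚ.+-inverseʳ q)) (ℚ.+-identityʳ p))

  abs-sub-≤ : ∀ p q → ∣ p ∣ - ∣ q ∣ ≤ ∣ p - q ∣
  abs-sub-≤ p q = begin
    ∣ p ∣ - ∣ q ∣                  ≡⟨ cong (λ r → ∣ r ∣ - ∣ q ∣) (sub-add p q) ⟨
    ∣ (p - q) + q ∣ - ∣ q ∣        ≤⟨ ℚ.+-monoˡ-≤ (- ∣ q ∣) (ℚ.∣p+q∣≤∣p∣+∣q∣ (p - q) q) ⟩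
    (∣ p - q ∣ + ∣ q ∣) - ∣ q ∣    ≡⟨ add-sub ∣ p - q ∣ ∣ q ∣ ⟩
    ∣ p - q ∣                      ∎
    where open ℚ.≤-Reasoning

  abs-abs-≤ : ∀ p q → ∣ ∣ p ∣ - ∣ q ∣ ∣ ≤ ∣ p - q ∣
  abs-abs-≤ p q = ∣p∣≤ (abs-sub-≤ p q)
    (subst₂ _≤_ (sym (neg-sub ∣ p ∣ ∣ q ∣)) (sub-swap q p) (abs-sub-≤ q p))

_-ᵣ_ : ℝ → ℝ → ℝ
(mkℝ s s-cauchy) -ᵣ (mkℝ t t-cauchy) = mkℝ (λ k → s k - t k) λ ε 0<ε →
  let (M , s-close) = s-cauchy (½ * ε) (0<* 0<½ 0<ε)
      (N , t-close) = t-cauchy (½ * ε) (0<* 0<½ 0<ε)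
      open ℚ.≤-Reasoning
  in M ℕ.⊔ N , λ m n ≤m ≤n → begin
    ∣ (s m - t m) - (s n - t n) ∣      ≡⟨ cong ∣_∣ (sub-sub (s m) (t m) (s n) (t n)) ⟩
    ∣ (s m - s n) - (t m - t n) ∣      ≤⟨ ℚ.∣p-q∣≤∣p∣+∣q∣ (s m - s n) (t m - t n) ⟩
    ∣ s m - s n ∣ + ∣ t m - t n ∣      ≤⟨ ℚ.+-mono-≤
      (s-close m n (ℕ.m⊔n≤o⇒m≤o M N ≤m) (ℕ.m⊔n≤o⇒m≤o M N ≤n))
      (t-close m n (ℕ.m⊔n≤o⇒n≤o M N ≤m) (ℕ.m⊔n≤o⇒n≤o M N ≤n)) ⟩
    ½ * ε + ½ * ε                      ≡⟨ half+half ε ⟩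
    ε                                  ∎

∣_∣ᵣ : ℝ → ℝ
∣ mkℝ s s-cauchy ∣ᵣ = mkℝ (λ k → ∣ s k ∣) λ ε 0<ε →
  let (N , s-close) = s-cauchy ε 0<ε
  in N , λ m n ≤m ≤n → ℚ.≤-trans (abs-abs-≤ (s m) (s n)) (s-close m n ≤m ≤n)

_·_ : ℚ → ℝ → ℝ
q · (mkℝ s s-cauchy) = mkℝ (λ k → q * s k) λ ε 0<ε →
  let c = 1ℚ + ∣ q ∣
      instance
        c-pos : Positive c
        c-pos = ℚ.pos+nonNeg⇒pos 1ℚ ∣ q ∣ {{ℚ.∣-∣-nonNeg q}}
        c-nonZero = ℚ.pos⇒nonZero c
      (N , s-close) = s-cauchy (1/ c * ε) (0<* (ℚ.positive⁻¹ (1/ c) {{ℚ.1/pos⇒pos c}}) 0<ε)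
      open ℚ.≤-Reasoning
  in N , λ m n ≤m ≤n → begin
    ∣ q * s m - q * s n ∣   ≡⟨ cong (λ r → ∣ q * s m + r ∣) (ℚ.neg-distribʳ-* q (s n)) ⟩
    ∣ q * s m + q * - s n ∣ ≡⟨ cong ∣_∣ (ℚ.*-distribˡ-+ q (s m) (- s n)) ⟨
    ∣ q * (s m - s n) ∣     ≡⟨ ℚ.∣p*q∣≡∣p∣*∣q∣ q (s m - s n) ⟩
    ∣ q ∣ * ∣ s m - s n ∣   ≤⟨ ℚ.*-monoʳ-≤-nonNeg ∣ s m - s n ∣ {{ℚ.∣-∣-nonNeg (s m - s n)}}
      (ℚ.≤-trans (ℚ.≤-reflexive (sym (ℚ.+-identityˡ ∣ q ∣)))
                 (ℚ.+-monoˡ-≤ ∣ q ∣ (ℚ.<⇒≤ (ℚ.positive⁻¹ 1ℚ)))) ⟩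
    c * ∣ s m - s n ∣       ≤⟨ ℚ.*-monoˡ-≤-nonNeg c {{ℚ.pos⇒nonNeg c}} (s-close m n ≤m ≤n) ⟩
    c * (1/ c * ε)          ≡⟨ ℚ.*-assoc c (1/ c) ε ⟨
    c * 1/ c * ε            ≡⟨ cong (_* ε) (ℚ.*-inverseʳ c) ⟩
    1ℚ * ε                  ≡⟨ ℚ.*-identityˡ ε ⟩
    ε                       ∎

-- a n = (1 + o(1)) b n as n → ∞
infix 4 _∼_
_∼_ : (ℕ → ℝ) → (ℕ → ℝ) → Set
a ∼ b = ∀ ε → 0ℚ < ε → ∃ λ N → ∀ n → N ℕ.≤ n → ∣ a n -ᵣ b n ∣ᵣ ≤ᵣ ε · ∣ b n ∣ᵣ

------------------------------------------------------------------------
-- Euler's number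

inv! : ℕ → ℚ
inv! k = (+ 1 / (k !)) {{ℕ._!≢0 k}}

-- ∑ⱼ₌₀ᵏ 1/j!
e-sum : ℕ → ℚ
e-sum zero    = inv! 0
e-sum (suc k) = e-sum k + inv! (suc k)

private
  0≤inv! : ∀ k → 0ℚ ≤ inv! k
  0≤inv! k = ℚ.nonNegative⁻¹ (inv! k) {{ℚ.normalize-nonNeg 1 (k !) {{ℕ._!≢0 k}}}}

  e-sum-mono : ∀ {m n} → m ℕ.≤′ n → e-sum m ≤ e-sum n
  e-sum-mono ℕ.≤′-refl       = ℚ.≤-refl
  e-sum-mono (ℕ.≤′-step {n} m≤n) = ℚ.≤-trans (e-sum-mono m≤n)
    (ℚ.≤-trans (ℚ.≤-reflexive (sym (ℚ.+-identityʳ (e-sum n))))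
               (ℚ.+-monoʳ-≤ (e-sum n) (0≤inv! (suc n))))

  1/suc : ℕ → ℚ
  1/suc k = + 1 / suc k

  toℚᵘ-1/ : ∀ d .{{_ : ℕ.NonZero d}} → toℚᵘ (+ 1 / d) ℚᵘ.≃ (+ 1 ℚᵘ./ d)
  toℚᵘ-1/ (suc d) = ℚ.toℚᵘ-fromℚᵘ (ℚᵘ.mkℚᵘ (+ 1) d)

  unit-sum-≤ : ∀ a b c .{{_ : ℕ.NonZero a}} .{{_ : ℕ.NonZero b}} .{{_ : ℕ.NonZero c}} →
               (b ℕ.+ a) ℕ.* c ℕ.≤ a ℕ.* b → + 1 / a + + 1 / b ≤ + 1 / c
  unit-sum-≤ a@(suc _) b@(suc _) c@(suc _) le = ℚ.toℚᵘ-cancel-≤ (begin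
    toℚᵘ (+ 1 / a + + 1 / b)             ≃⟨ ℚ.toℚᵘ-homo-+ (+ 1 / a) (+ 1 / b) ⟩
    toℚᵘ (+ 1 / a) ℚᵘ.+ toℚᵘ (+ 1 / b)   ≃⟨ ℚᵘ.+-cong (toℚᵘ-1/ a) (toℚᵘ-1/ b) ⟩
    (+ 1 ℚᵘ./ a) ℚᵘ.+ (+ 1 ℚᵘ./ b)       ≤⟨ ℚᵘ.*≤* (subst₂ ℤ._≤_
      (cong (ℤ._* + c) (cong₂ ℤ._+_ (sym (ℤ.*-identityˡ (+ b))) (sym (ℤ.*-identityˡ (+ a)))))
      (sym (ℤ.*-identityˡ (+ (a ℕ.* b))))
      (subst (ℤ._≤ + (a ℕ.* b)) (ℤ.pos-* (b ℕ.+ a) c) (ℤ.+≤+ le))) ⟩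
    + 1 ℚᵘ./ c                           ≃⟨ toℚᵘ-1/ c ⟨
    toℚᵘ (+ 1 / c)                       ∎)
    where open ℚᵘ.≤-Reasoning

  tail-step : ∀ k → inv! (suc (suc k)) + 1/suc (suc k) ≤ 1/suc k
  tail-step k = unit-sum-≤ F (2 ℕ.+ k) (1 ℕ.+ k) (begin
    (2 ℕ.+ k ℕ.+ F) ℕ.* (1 ℕ.+ k)                    ≡⟨ ℕ.*-distribʳ-+ (1 ℕ.+ k) (2 ℕ.+ k) F ⟩
    (2 ℕ.+ k) ℕ.* (1 ℕ.+ k) ℕ.+ F ℕ.* (1 ℕ.+ k)      ≤⟨ ℕ.+-monoˡ-≤ (F ℕ.* (1 ℕ.+ k))
      (ℕ.*-monoʳ-≤ (2 ℕ.+ k) (ℕ.m≤m*n (1 ℕ.+ k) (k !) {{ℕ._!≢0 k}})) ⟩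
    F ℕ.+ F ℕ.* (1 ℕ.+ k)                            ≡⟨ ℕ.*-suc F (1 ℕ.+ k) ⟨
    F ℕ.* (2 ℕ.+ k)                                  ∎)
    where
    open ℕ.≤-Reasoning
    F = (2 ℕ.+ k) !
    instance
      F≢0 : ℕ.NonZero F
      F≢0 = ℕ._!≢0 (2 ℕ.+ k)

  upper-antitone : ∀ {m n} → m ℕ.≤′ n → e-sum (suc n) + 1/suc n ≤ e-sum (suc m) + 1/suc m
  upper-antitone ℕ.≤′-refl           = ℚ.≤-refl
  upper-antitone (ℕ.≤′-step {n} m≤n) = ℚ.≤-trans
    (ℚ.≤-trans (ℚ.≤-reflexive (ℚ.+-assoc (e-sum (suc n)) (inv! (suc (suc n))) (1/suc (suc n))))
               (ℚ.+-monoʳ-≤ (e-sum (suc n)) (tail-step n)))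
    (upper-antitone m≤n)

  e-sum-close : ∀ {N m n} → N ℕ.≤ m → N ℕ.≤ n → e-sum (suc m) - e-sum (suc n) ≤ 1/suc N
  e-sum-close {N} {m} {n} N≤m N≤n = begin
    e-sum (suc m) - e-sum (suc n)              ≡⟨ cong (_- e-sum (suc n)) (ℚ.+-identityʳ (e-sum (suc m))) ⟨
    e-sum (suc m) + 0ℚ - e-sum (suc n)         ≤⟨ ℚ.+-mono-≤
      (ℚ.≤-trans (ℚ.+-monoʳ-≤ (e-sum (suc m)) (ℚ.nonNegative⁻¹ (1/suc m) {{ℚ.normalize-nonNeg 1 (suc m)}}))
                 (upper-antitone (ℕ.≤⇒≤′ N≤m)))
      (ℚ.neg-antimono-≤ (e-sum-mono (ℕ.≤⇒≤′ (ℕ.s≤s N≤n)))) ⟩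
    e-sum (suc N) + 1/suc N - e-sum (suc N)    ≡⟨ cong (_- e-sum (suc N)) (ℚ.+-comm (e-sum (suc N)) (1/suc N)) ⟩
    1/suc N + e-sum (suc N) - e-sum (suc N)    ≡⟨ add-sub (1/suc N) (e-sum (suc N)) ⟩
    1/suc N                                    ∎
    where open ℚ.≤-Reasoning

  archimedean : ∀ ε → 0ℚ < ε → ∃ λ N → 1/suc N ≤ ε
  archimedean ε@(mkℚ (+ zero)   d _) 0<ε = contradiction (ℚ.drop-*<* 0<ε) λ { (ℤ.+<+ ()) }
  archimedean ε@(mkℚ (ℤ.-[1+ n ]) d _) 0<ε = contradiction (ℚ.drop-*<* 0<ε) λ ()
  archimedean ε@(mkℚ +[1+ n ]   d _) 0<ε = d , ℚ.toℚᵘ-cancel-≤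
    (ℚᵘ.≤-trans (ℚᵘ.≤-reflexive (toℚᵘ-1/ (suc d)))
      (ℚᵘ.*≤* (ℤ.*-monoʳ-≤-nonNeg (+ suc d) (ℤ.+≤+ {1} {suc n} (ℕ.s≤s ℕ.z≤n)))))

  e-sum-cauchy : Cauchy e-sum
  e-sum-cauchy ε 0<ε = let (N , 1/N≤ε) = archimedean ε 0<ε in
    suc N , λ { (suc m) (suc n) (ℕ.s≤s N≤m) (ℕ.s≤s N≤n) → ℚ.≤-trans
      (∣p∣≤ (e-sum-close N≤m N≤n)
            (ℚ.≤-trans (ℚ.≤-reflexive (neg-sub (e-sum (suc m)) (e-sum (suc n))))
                       (e-sum-close N≤n N≤m)))
      1/N≤ε }

e : ℝ
e = mkℝ e-sum e-sum-cauchy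

{-# OPTIONS --safe #-}
-- Let n = N + 1. Summing over pairs of paths (v , v ∘ R) and over the ways to merge their edges into one
-- increasing sequence, E[H²] is a sum over merge words (steps P and Q along one path only, and blocks of
-- consecutive common edges, of length l ≥ 1 in the same direction or of length 1 reversed) of the probability that R
-- produces exactly these common edges, divided by the factorial of the length of the word. Fixing the values of R
-- demanded by a word changes the law of the number of further common edges by O(1/N) (switching), and in the limit this
-- number is Poisson with mean 2 (Stein–Chen), hence zero with probability e⁻². A word with c blocks and k common edges
-- contributes (2ᶜ / 2ᵏ c!) n² e⁻², and the blocks of all lengths sum to (2 (½ + ½ + ¼ + ⅛ + …))ᶜ = 3ᶜ. The total
-- is n² e⁻² e³. Words with many common edges are negligible uniformly in n.
module Submission where

open import Algebra.Bundles using (CommutativeRing)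
open import Algebra.Structures using (IsCommutativeSemiring)
open import Data.Bool.Base using (if_then_else_; true; false; Bool)
import Data.Bool.Properties as Bool
open import Data.Empty using (⊥)
open import Data.Fin.Base as Fin using (Fin; zero; suc; toℕ; fromℕ<)
import Data.Fin.Properties as Fin
import Data.Integer.Properties as ℤ
open import Data.List.Base
 using (List; []; _∷_; map; _++_; concatMap; length; mapMaybe; cartesianProductWith; allFin; tabulate; [_]; upTo; cartesianProduct; applyUpTo; filter)
import Data.List.Membership.DecPropositional as DecMembership
open import Data.List.Membership.Propositional using (_∈_; _∉_)
open import Data.List.Membership.Propositional.Properties
 using (∈-++⁺ˡ; ∈-++⁺ʳ; ∈-map⁻; ∈-++⁻; ∈-upTo⁺; ∈-upTo⁻; ∈-map⁺; ∈-cartesianProduct⁺; ∈-cartesianProduct⁻; ∈-cartesianProductWith⁺; ∈-cartesianProductWith⁻; ∈-filter⁻)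
import Data.List.Properties as List
open import Data.List.Relation.Binary.Disjoint.Propositional using (Disjoint)
open import Data.List.Relation.Unary.All as All using (All; []; _∷_)
import Data.List.Relation.Unary.All.Properties as All
open import Data.List.Relation.Unary.AllPairs as AllPairs using (AllPairs; []; _∷_; allPairs?)
import Data.List.Relation.Unary.AllPairs.Properties as AllPairs
open import Data.List.Relation.Unary.Any using (here; there)
open import Data.List.Relation.Unary.Linked as Linked using (Linked; []; [-]; _∷_)
import Data.List.Relation.Unary.Linked.Properties as Linked
import Data.List.Relation.Unary.Unique.DecPropositional as DecUnique
open import Data.List.Relation.Unary.Unique.Propositional using (Unique)
import Data.List.Relation.Unary.Unique.Propositional.Properties as Unique
open import Data.Maybe.Base as Maybe using (Maybe; just; nothing; maybe)
open import Data.Nat.ListAction using (sum)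
import Data.Nat.Properties as ℕ
open import Data.Product.Base using (_×_; _,_; proj₁; proj₂; uncurry; ∃)
open import Data.Product.Properties as Product using (,-injective)
import Data.Rational.Properties as ℚ
import Data.Rational.Unnormalised.Base as ℚᵘ
import Data.Rational.Unnormalised.Properties as ℚᵘ
open import Data.Sum.Base using (_⊎_; inj₁; inj₂)
open import Data.Unit.Base using (⊤; tt)
open import Function.Base using (_∘_; id; case_of_)
open import Function.Bundles using (_⤖_; mk⤖; module Bijection)
open import Function.Definitions using (Injective; Bijective)
open import Relation.Binary.Definitions using (DecidableEquality; tri<; tri≈; tri>)
open import Relation.Binary.PropositionalEquality hiding ([_])
open import Relation.Nullary.Decidable using (Dec; yes; no; does; _×-dec_; _⊎-dec_; dec⇒maybe; ¬?)
open import Relation.Nullary.Negation using (¬_) renaming (contradiction to absurd)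
open import Relation.Unary using (Decidable)
open import Tactic.RingSolver.Core.AlmostCommutativeRing using (AlmostCommutativeRing; fromCommutativeRing)

-- The two bounds use different families of words. If two blocks nearly touch, a word may demand
-- contradictory values or force common edges that it does not list; the upper estimate survives
-- this, the lower one does not. So the lower bound keeps only words in which each block is followed
-- by a separator of fixed length containing both letters. A letter weighs ½ in the limit, almost
-- all strings of a given length are separators, and the loss tends to 0. No real exponential is
-- built. The probability p of no further common edge stays an unknown: the recursion makes P(X ≤ K)
-- asymptotic to p times a partial sum of exp 2, and Markov's inequality fixes p. A switching error
-- is absolute, of order 1 / n, hence affordable only for boundedly many common edges. Beyond a
-- cut-off that probability is bounded by 1 and the number of words decides: either each path keeps
-- at least 1 / 128 of its edges to itself and every common edge gains a factor 128 / 129, or the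
-- block lists are counted directly and contribute O(1 / n) in total.

module Combinatorics where

 open import Data.Nat.Combinatorics using (_C_; nCk+nC[k+1]≡[n+1]C[k+1]; nC1≡n)
 open import Data.Nat.Base using (ℕ; zero; suc; _+_; _*_; _^_; _∸_; _≤_; _<_; z≤n; s≤s; _!; NonZero; >-nonZero)
 open import Data.Nat.Tactic.RingSolver using (solve-∀)
 open import Defs using (functions; Searchable; bijective?; bijections; searchFin; searchEdge; Edge; edge; EdgeOrdering; edgeOrderings; HamiltonianPath; hamiltonianPaths; walkEdges; pathEdges; Increasing; increasing?)
 open import Data.Nat.Properties using (*-assoc; *-distribˡ-+; *-identityʳ; *-identityˡ; *-mono-≤; *-monoʳ-≤; *-monoˡ-≤; *-zeroʳ; +-cancelʳ-≡; +-identityʳ; +-mono-≤; +-monoʳ-≤; +-monoˡ-<; +-monoˡ-≤; +-suc; <-cmp; <-trans; <-≤-trans; ^-distribˡ-+-*; ^-monoˡ-≤; module ≤-Reasoning; m∸n+n≡m; m≢1+n+m; m≤m+n; m≤n+m; m≤n⇒m≤1+n; n≤1+n; suc-injective; ≤-antisym; ≤-refl; ≤-reflexive; ≤-trans)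

 ≡≤ : ∀ {a b c} -> a ≡ b -> b ≤ c -> a ≤ c
 ≡≤ refl b≤c = b≤c

 ≤≡ : ∀ {a b c} -> a ≤ b -> b ≡ c -> a ≤ c
 ≤≡ a≤b refl = a≤b

 -- Finite sums over lists

 module Summation {C : Set} {_⊕_ _⊛_ : C -> C -> C} {0# 1# : C}
  (isCSR : IsCommutativeSemiring _≡_ _⊕_ _⊛_ 0# 1#)
  (_≼_ : C -> C -> Set) (≼-refl : ∀ {x} -> x ≼ x)
  (⊕-mono : ∀ {a b c d} -> a ≼ b -> c ≼ d -> (a ⊕ c) ≼ (b ⊕ d)) where

  open IsCommutativeSemiring isCSR using (+-identityˡ; +-assoc; +-comm; *-comm; zeroʳ; distribˡ)

  ∑ : {I : Set} -> List I -> (I -> C) -> C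
  ∑ [] f = 0#
  ∑ (x ∷ xs) f = f x ⊕ ∑ xs f

  module _ {I : Set} where

   ∑-cong-∈ : ∀ (xs : List I) {f g : I -> C} -> (∀ {x} -> x ∈ xs -> f x ≡ g x) -> ∑ xs f ≡ ∑ xs g
   ∑-cong-∈ [] f≡g = refl
   ∑-cong-∈ (x ∷ xs) f≡g = cong₂ _⊕_ (f≡g (here refl)) (∑-cong-∈ xs (f≡g ∘ there))

   ∑-cong : ∀ (xs : List I) {f g : I -> C} -> (∀ x -> f x ≡ g x) -> ∑ xs f ≡ ∑ xs g
   ∑-cong xs f≡g = ∑-cong-∈ xs (λ {x} _ -> f≡g x)

   ∑-mono-∈ : ∀ (xs : List I) {f g : I -> C} -> (∀ {x} -> x ∈ xs -> f x ≼ g x) -> ∑ xs f ≼ ∑ xs g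
   ∑-mono-∈ [] f≤g = ≼-refl
   ∑-mono-∈ (x ∷ xs) f≤g = ⊕-mono (f≤g (here refl)) (∑-mono-∈ xs (f≤g ∘ there))

   ∑-mono : ∀ (xs : List I) {f g : I -> C} -> (∀ x -> f x ≼ g x) -> ∑ xs f ≼ ∑ xs g
   ∑-mono xs f≤g = ∑-mono-∈ xs (λ {x} _ -> f≤g x)

   ∑-zero : ∀ (xs : List I) -> ∑ xs (λ _ -> 0#) ≡ 0#
   ∑-zero [] = refl
   ∑-zero (x ∷ xs) = trans (cong (0# ⊕_) (∑-zero xs)) (+-identityˡ 0#)

   ∑-⊕ : ∀ (xs : List I) (f g : I -> C) -> ∑ xs (λ x -> f x ⊕ g x) ≡ ∑ xs f ⊕ ∑ xs g
   ∑-⊕ [] f g = sym (+-identityˡ 0#)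
   ∑-⊕ (x ∷ xs) f g = begin
    (f x ⊕ g x) ⊕ ∑ xs (λ x -> f x ⊕ g x) ≡⟨ cong ((f x ⊕ g x) ⊕_) (∑-⊕ xs f g) ⟩
    (f x ⊕ g x) ⊕ (∑ xs f ⊕ ∑ xs g) ≡⟨ +-assoc (f x) (g x) _ ⟩
    f x ⊕ (g x ⊕ (∑ xs f ⊕ ∑ xs g)) ≡⟨ cong (f x ⊕_) (+-assoc (g x) _ _) ⟨
    f x ⊕ ((g x ⊕ ∑ xs f) ⊕ ∑ xs g) ≡⟨ cong (λ z -> f x ⊕ (z ⊕ ∑ xs g)) (+-comm (g x) _) ⟩
    f x ⊕ ((∑ xs f ⊕ g x) ⊕ ∑ xs g) ≡⟨ cong (f x ⊕_) (+-assoc _ (g x) _) ⟩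
    f x ⊕ (∑ xs f ⊕ (g x ⊕ ∑ xs g)) ≡⟨ +-assoc (f x) _ _ ⟨
    (f x ⊕ ∑ xs f) ⊕ (g x ⊕ ∑ xs g) ∎
    where open ≡-Reasoning

   ∑-*ˡ : ∀ (xs : List I) c (f : I -> C) -> ∑ xs (λ x -> c ⊛ f x) ≡ c ⊛ ∑ xs f
   ∑-*ˡ [] c f = sym (zeroʳ c)
   ∑-*ˡ (x ∷ xs) c f = trans (cong ((c ⊛ f x) ⊕_) (∑-*ˡ xs c f)) (sym (distribˡ c (f x) (∑ xs f)))

   ∑-*ʳ : ∀ (xs : List I) c (f : I -> C) -> ∑ xs (λ x -> f x ⊛ c) ≡ ∑ xs f ⊛ c
   ∑-*ʳ xs c f = trans (∑-cong xs (λ x -> *-comm (f x) c)) (trans (∑-*ˡ xs c f) (*-comm c _))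

   ∑-++ : ∀ (xs ys : List I) (f : I -> C) -> ∑ (xs ++ ys) f ≡ ∑ xs f ⊕ ∑ ys f
   ∑-++ [] ys f = sym (+-identityˡ _)
   ∑-++ (x ∷ xs) ys f = trans (cong (f x ⊕_) (∑-++ xs ys f)) (sym (+-assoc (f x) _ _))

  module _ {I J : Set} where

   ∑-swap : ∀ (xs : List I) (ys : List J) (f : I -> J -> C) ->
        ∑ xs (λ x -> ∑ ys (f x)) ≡ ∑ ys (λ y -> ∑ xs (λ x -> f x y))
   ∑-swap [] ys f = sym (∑-zero ys)
   ∑-swap (x ∷ xs) ys f = trans (cong (∑ ys (f x) ⊕_) (∑-swap xs ys f))
    (sym (∑-⊕ ys (f x) (λ y -> ∑ xs (λ x -> f x y))))

   ∑-map : ∀ (xs : List I) (h : I -> J) (f : J -> C) -> ∑ (map h xs) f ≡ ∑ xs (f ∘ h)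
   ∑-map [] h f = refl
   ∑-map (x ∷ xs) h f = cong (f (h x) ⊕_) (∑-map xs h f)

   ∑-concatMap : ∀ (xs : List I) (h : I -> List J) (f : J -> C) ->
         ∑ (concatMap h xs) f ≡ ∑ xs (λ x -> ∑ (h x) f)
   ∑-concatMap [] h f = refl
   ∑-concatMap (x ∷ xs) h f = trans (∑-++ (h x) (concatMap h xs) f) (cong (∑ (h x) f ⊕_) (∑-concatMap xs h f))

   ∑-mapMaybe : ∀ (xs : List I) (h : I -> Maybe J) (f : J -> C) ->
         ∑ (mapMaybe h xs) f ≡ ∑ xs (λ x -> maybe f 0# (h x))
   ∑-mapMaybe [] h f = refl
   ∑-mapMaybe (x ∷ xs) h f with h x
   ... | just y = cong (f y ⊕_) (∑-mapMaybe xs h f)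
   ... | nothing = trans (∑-mapMaybe xs h f) (sym (+-identityˡ _))

  ∑-cartesianProductWith : ∀ {I J K : Set} (h : I -> J -> K) (xs : List I) (ys : List J) (f : K -> C) ->
   ∑ (cartesianProductWith h xs ys) f ≡ ∑ xs (λ x -> ∑ ys (λ y -> f (h x y)))
  ∑-cartesianProductWith h [] ys f = refl
  ∑-cartesianProductWith h (x ∷ xs) ys f = trans (∑-++ (map (h x) ys) _ f)
   (cong₂ _⊕_ (∑-map ys (h x) f) (∑-cartesianProductWith h xs ys f))

 open Summation ℕ.+-*-isCommutativeSemiring _≤_ ≤-refl +-mono-≤ public

 sum≡∑ : {I : Set} (xs : List I) (f : I -> ℕ) -> sum (map f xs) ≡ ∑ xs f
 sum≡∑ [] f = refl
 sum≡∑ (x ∷ xs) f = cong (f x +_) (sum≡∑ xs f)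

 ∑-const : {I : Set} (xs : List I) (c : ℕ) -> ∑ xs (λ _ -> c) ≡ length xs * c
 ∑-const [] c = refl
 ∑-const (x ∷ xs) c = cong (c +_) (∑-const xs c)

 ∑-member : {I : Set} {xs : List I} {x : I} (f : I -> ℕ) -> x ∈ xs -> f x ≤ ∑ xs f
 ∑-member {xs = y ∷ ys} f (here refl) = m≤m+n (f y) _
 ∑-member {xs = y ∷ ys} f (there x∈) = ≤-trans (∑-member f x∈) (m≤n+m _ (f y))

 -- Indicators of decidable propositions and exact enumerations

 abstract

  -- Abstract, so that comparisons of whole paths or orderings are never evaluated; later arguments
  -- see only the laws of this block.
  ⟦_⟧ : {P : Set} -> Dec P -> ℕ
  ⟦ p ⟧ = if does p then 1 else 0

  ⟦⟧-yes : {P : Set} (p : Dec P) -> P -> ⟦ p ⟧ ≡ 1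
  ⟦⟧-yes (yes _) _ = refl
  ⟦⟧-yes (no ¬p) p = absurd p ¬p

  ⟦⟧-no : {P : Set} (p : Dec P) -> ¬ P -> ⟦ p ⟧ ≡ 0
  ⟦⟧-no (yes p) ¬p = absurd p ¬p
  ⟦⟧-no (no _) _ = refl

  ⟦⟧≤1 : {P : Set} (p : Dec P) -> ⟦ p ⟧ ≤ 1
  ⟦⟧≤1 (yes _) = ≤-refl
  ⟦⟧≤1 (no _) = z≤n

  ⟦⟧*-≤ : {P : Set} (p : Dec P) {a b : ℕ} -> (P -> a ≤ b) -> ⟦ p ⟧ * a ≤ ⟦ p ⟧ * b
  ⟦⟧*-≤ (yes p) a≤b = +-mono-≤ (a≤b p) z≤n
  ⟦⟧*-≤ (no _) _ = z≤n

  ⟦⟧*-≡ : {P : Set} (p : Dec P) {a b : ℕ} -> (P -> a ≡ b) -> ⟦ p ⟧ * a ≡ ⟦ p ⟧ * b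
  ⟦⟧*-≡ (yes p) a≡b = cong (_+ 0) (a≡b p)
  ⟦⟧*-≡ (no _) _ = refl

  ⟦⟧*≤ : {P : Set} (p : Dec P) (a : ℕ) -> ⟦ p ⟧ * a ≤ a
  ⟦⟧*≤ (yes _) a = ≤-reflexive (+-identityʳ a)
  ⟦⟧*≤ (no _) a = z≤n

  ⟦⟧≤ : {P : Set} (p : Dec P) {a : ℕ} -> (P -> 1 ≤ a) -> ⟦ p ⟧ ≤ a
  ⟦⟧≤ (yes p) h = h p
  ⟦⟧≤ (no _) h = z≤n

  ⟦⟧*≤' : {P : Set} (p : Dec P) {a b : ℕ} -> (P -> a ≤ b) -> ⟦ p ⟧ * a ≤ b
  ⟦⟧*≤' p {b = b} a≤b = ≤-trans (⟦⟧*-≤ p a≤b) (⟦⟧*≤ p b)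

  ⟦⟧-mono : {P Q : Set} (p : Dec P) (q : Dec Q) -> (P -> Q) -> ⟦ p ⟧ ≤ ⟦ q ⟧
  ⟦⟧-mono (yes p) (yes _) _ = ≤-refl
  ⟦⟧-mono (yes p) (no ¬q) f = absurd (f p) ¬q
  ⟦⟧-mono (no _) q _ = z≤n

  ⟦⟧-× : {P Q : Set} (p : Dec P) (q : Dec Q) -> ⟦ p ×-dec q ⟧ ≡ ⟦ p ⟧ * ⟦ q ⟧
  ⟦⟧-× (yes _) (yes _) = refl
  ⟦⟧-× (yes _) (no _) = refl
  ⟦⟧-× (no _) _ = refl

  ⟦⟧-⊎ : {P Q : Set} (p : Dec P) (q : Dec Q) -> ⟦ p ⊎-dec q ⟧ ≤ ⟦ p ⟧ + ⟦ q ⟧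
  ⟦⟧-⊎ (yes _) (yes _) = s≤s z≤n
  ⟦⟧-⊎ (yes _) (no _) = s≤s z≤n
  ⟦⟧-⊎ (no _) (yes _) = s≤s z≤n
  ⟦⟧-⊎ (no _) (no _) = z≤n

  ⟦⟧-cong : {P Q : Set} (p : Dec P) (q : Dec Q) -> (P -> Q) -> (Q -> P) -> ⟦ p ⟧ ≡ ⟦ q ⟧
  ⟦⟧-cong p q f g = ≤-antisym (⟦⟧-mono p q f) (⟦⟧-mono q p g)

 ∑-⟦⟧-≥ : {I : Set} {P : I -> Set} (P? : ∀ i -> Dec (P i)) {xs : List I} {x : I} ->
      x ∈ xs -> P x -> 1 ≤ ∑ xs (λ x -> ⟦ P? x ⟧)
 ∑-⟦⟧-≥ P? x∈ px = ≡≤ (sym (⟦⟧-yes (P? _) px)) (∑-member (λ x -> ⟦ P? x ⟧) x∈)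

 -- Functions and bijections can only be compared pointwise, so occurring exactly once is expressed
 -- by counting matches of a decidable relation.
 Enumerates : {A : Set} {_≈_ : A -> A -> Set} -> (∀ a b -> Dec (a ≈ b)) -> List A -> Set
 Enumerates _≈?_ xs = ∀ a -> ∑ xs (λ x -> ⟦ x ≈? a ⟧) ≡ 1

 -- Each `F (Φ a)` is multiplied by 1, written as the number of `b ≈ Φ a`. After exchanging the
 -- sums, the two implications turn this into the number of `a ≈ Ψ b`, which is again 1.
 reindex : {A B : Set} {_≈ᴬ_ : A -> A -> Set} {_≈ᴮ_ : B -> B -> Set}
      (_≈ᴬ?_ : ∀ a a' -> Dec (a ≈ᴬ a')) (_≈ᴮ?_ : ∀ b b' -> Dec (b ≈ᴮ b')) (xs : List A) (ys : List B) ->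
      Enumerates _≈ᴬ?_ xs -> Enumerates _≈ᴮ?_ ys ->
      (Φ : A -> B) (Ψ : B -> A) -> (∀ {a b} -> b ≈ᴮ Φ a -> a ≈ᴬ Ψ b) -> (∀ {a b} -> a ≈ᴬ Ψ b -> b ≈ᴮ Φ a) ->
      (F : B -> ℕ) -> (∀ {b b'} -> b ≈ᴮ b' -> F b ≡ F b') -> ∑ xs (F ∘ Φ) ≡ ∑ ys F
 reindex _≈ᴬ?_ _≈ᴮ?_ xs ys enumᴬ enumᴮ Φ Ψ to from F F-resp = begin
  ∑ xs (F ∘ Φ) ≡⟨ ∑-cong xs (λ a -> begin
   F (Φ a) ≡⟨ *-identityˡ _ ⟨
   1 * F (Φ a) ≡⟨ cong (_* F (Φ a)) (enumᴮ (Φ a)) ⟨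
   ∑ ys (λ b -> ⟦ b ≈ᴮ? Φ a ⟧) * F (Φ a) ≡⟨ ∑-*ʳ ys (F (Φ a)) _ ⟨
   ∑ ys (λ b -> ⟦ b ≈ᴮ? Φ a ⟧ * F (Φ a)) ≡⟨ ∑-cong ys (λ b ->
    trans (⟦⟧*-≡ (b ≈ᴮ? Φ a) (λ b≈ -> sym (F-resp b≈)))
       (cong (_* F b) (⟦⟧-cong (b ≈ᴮ? Φ a) (a ≈ᴬ? Ψ b) to from))) ⟩
   ∑ ys (λ b -> ⟦ a ≈ᴬ? Ψ b ⟧ * F b) ∎) ⟩
  ∑ xs (λ a -> ∑ ys (λ b -> ⟦ a ≈ᴬ? Ψ b ⟧ * F b)) ≡⟨ ∑-swap xs ys _ ⟩
  ∑ ys (λ b -> ∑ xs (λ a -> ⟦ a ≈ᴬ? Ψ b ⟧ * F b)) ≡⟨ ∑-cong ys (λ b ->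
   trans (∑-*ʳ xs (F b) _) (trans (cong (_* F b) (enumᴬ (Ψ b))) (*-identityˡ (F b)))) ⟩
  ∑ ys F ∎
  where open ≡-Reasoning

 allFin-enumerates : ∀ n -> Enumerates Fin._≟_ (allFin n)
 allFin-enumerates (suc n) a = trans (cong (λ xs -> ⟦ zero Fin.≟ a ⟧ + ∑ xs (λ x -> ⟦ x Fin.≟ a ⟧)) (sym (List.map-tabulate id suc)))
  (trans (cong (⟦ zero Fin.≟ a ⟧ +_) (∑-map (allFin n) suc _)) (by-cases a))
  where
  by-cases : ∀ a -> ⟦ zero Fin.≟ a ⟧ + ∑ (allFin n) (λ x -> ⟦ suc x Fin.≟ a ⟧) ≡ 1
  by-cases zero = cong₂ _+_ (⟦⟧-yes (zero Fin.≟ zero) refl)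
   (trans (∑-cong (allFin n) (λ x -> ⟦⟧-no (suc x Fin.≟ zero) (λ ()))) (∑-zero (allFin n)))
  by-cases (suc a) = cong₂ _+_ (⟦⟧-no (zero Fin.≟ suc a) (λ ())) (trans (∑-cong (allFin n) (λ x -> ⟦⟧-cong (suc x Fin.≟ suc a) (x Fin.≟ a) Fin.suc-injective (cong suc)))
   (allFin-enumerates n a))

 Pointwise? : ∀ {n} {B : Fin n -> Set} {_≈_ : ∀ {i} -> B i -> B i -> Set} -> (∀ {i} (b b' : B i) -> Dec (b ≈ b')) ->
       (f g : ∀ i -> B i) -> Dec (∀ i -> f i ≈ g i)
 Pointwise? _≈?_ f g = Fin.all? λ i -> f i ≈? g i

 functions-enumerates : ∀ n {B : Fin n -> Set} {_≈_ : ∀ {i} -> B i -> B i -> Set} (_≈?_ : ∀ {i} (b b' : B i) -> Dec (b ≈ b'))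
  (bs : ∀ i -> List (B i)) -> (∀ i -> Enumerates (_≈?_ {i}) (bs i)) -> Enumerates (Pointwise? {_≈_ = _≈_} _≈?_) (functions n bs)
 functions-enumerates zero {_≈_ = _≈_} _≈?_ bs enum g = trans (+-identityʳ _) (⟦⟧-yes (Pointwise? {_≈_ = _≈_} _≈?_ (λ ()) g) (λ ()))
 functions-enumerates (suc n) {B} {_≈_} _≈?_ bs enum g = begin
  ∑ (functions (suc n) bs) (λ f -> ⟦ Pointwise? {_≈_ = _≈_} _≈?_ f g ⟧)
   ≡⟨ ∑-cartesianProductWith (Fin.∀-cons {P = B}) (bs zero) (functions n (bs ∘ suc)) (λ f -> ⟦ Pointwise? {_≈_ = _≈_} _≈?_ f g ⟧) ⟩
  ∑ (bs zero) (λ b -> ∑ (functions n (bs ∘ suc)) (λ f -> ⟦ Pointwise? {_≈_ = _≈_} _≈?_ (Fin.∀-cons {P = B} b f) g ⟧))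
   ≡⟨ ∑-cong (bs zero) (λ b -> ∑-cong (functions n (bs ∘ suc)) (λ f -> trans
    (⟦⟧-cong (Pointwise? {_≈_ = _≈_} _≈?_ (Fin.∀-cons {P = B} b f) g) (b ≈? g zero ×-dec Pointwise? {_≈_ = _≈_} _≈?_ f (g ∘ suc))
      (λ eq -> eq zero , eq ∘ suc) (λ (eq0 , eq) -> λ { zero -> eq0 ; (suc i) -> eq i }))
    (⟦⟧-× (b ≈? g zero) (Pointwise? {_≈_ = _≈_} _≈?_ f (g ∘ suc))))) ⟩
  ∑ (bs zero) (λ b -> ∑ (functions n (bs ∘ suc)) (λ f -> ⟦ b ≈? g zero ⟧ * ⟦ Pointwise? {_≈_ = _≈_} _≈?_ f (g ∘ suc) ⟧))
   ≡⟨ ∑-cong (bs zero) (λ b -> trans (∑-*ˡ (functions n (bs ∘ suc)) ⟦ b ≈? g zero ⟧ (λ f -> ⟦ Pointwise? {_≈_ = _≈_} _≈?_ f (g ∘ suc) ⟧))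
    (trans (cong (⟦ b ≈? g zero ⟧ *_) (functions-enumerates n {_≈_ = _≈_} _≈?_ (bs ∘ suc) (enum ∘ suc) (g ∘ suc)))
        (*-identityʳ _))) ⟩
  ∑ (bs zero) (λ b -> ⟦ b ≈? g zero ⟧)
   ≡⟨ enum zero (g zero) ⟩
  1 ∎
  where open ≡-Reasoning

 module _ {A B : Set} (A? : Searchable A) (B? : Searchable B) where

  private
   module A = Searchable A?
   module B = Searchable B?

  infix 4 _≗?_
  _≗?_ : (f g : A -> B) -> Dec (f ≗ g)
  f ≗? g = A.all? λ x -> f x B.≟ g x

  ⤖-≗? : (f g : A ⤖ B) -> Dec (Bijection.to f ≗ Bijection.to g)
  ⤖-≗? f g = Bijection.to f ≗? Bijection.to g

  bijective-resp-≗ : {f g : A -> B} -> f ≗ g -> Bijective _≡_ _≡_ g -> Bijective _≡_ _≡_ f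
  bijective-resp-≗ f≗g (inj , surj) =
   (λ {x} {y} fx≡fy -> inj (trans (sym (f≗g x)) (trans fx≡fy (f≗g y)))) ,
   (λ y -> let (x , gx≡y) = surj y in x , λ {z} z≡x -> trans (f≗g z) (gx≡y z≡x))

  bijections-enumerates : ∀ fs -> Enumerates _≗?_ fs -> Enumerates ⤖-≗? (bijections A? B? fs)
  bijections-enumerates fs enum g = trans
   (∑-mapMaybe fs (λ f -> Maybe.map mk⤖ (dec⇒maybe (bijective? A? B? f))) (λ f -> ⟦ ⤖-≗? f g ⟧))
   (trans (∑-cong fs (λ f -> by-cases f (bijective? A? B? f))) (enum (Bijection.to g)))
   where
   by-cases : ∀ f (b : Dec (Bijective _≡_ _≡_ f)) ->
        Maybe.maybe (λ h -> ⟦ ⤖-≗? h g ⟧) 0 (Maybe.map mk⤖ (dec⇒maybe b)) ≡ ⟦ f ≗? Bijection.to g ⟧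
   by-cases f (yes _) = refl
   by-cases f (no ¬b) = sym (⟦⟧-no (f ≗? Bijection.to g) (λ f≗g -> ¬b (bijective-resp-≗ f≗g (Bijection.bijective g))))

 hamiltonianPaths-enumerates : ∀ n -> Enumerates (⤖-≗? (searchFin {n}) searchFin) (hamiltonianPaths n)
 hamiltonianPaths-enumerates n = bijections-enumerates searchFin searchFin (functions n λ _ -> allFin n)
  (functions-enumerates n {_≈_ = _≡_} Fin._≟_ (λ _ -> allFin n) (λ _ -> allFin-enumerates n))

 edgeOrderings-enumerates : ∀ n -> Enumerates (⤖-≗? (searchEdge {n}) searchFin) (edgeOrderings n)
 edgeOrderings-enumerates n = bijections-enumerates searchEdge searchFin (map uncurry (functions n λ j -> functions (toℕ j) λ _ -> allFin (n C 2))) λ g -> begin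
  ∑ (map uncurry fs) (λ f -> ⟦ _≗?_ searchEdge searchFin f g ⟧) ≡⟨ ∑-map fs uncurry (λ f -> ⟦ _≗?_ searchEdge searchFin f g ⟧) ⟩
  ∑ fs (λ f -> ⟦ _≗?_ searchEdge searchFin (uncurry f) g ⟧) ≡⟨ ∑-cong fs (λ f ->
   ⟦⟧-cong (_≗?_ searchEdge searchFin (uncurry f) g) (rows? f (λ j i -> g (j , i)))
    (λ eq j i -> eq (j , i)) (λ eq (j , i) -> eq j i)) ⟩
  ∑ fs (λ f -> ⟦ rows? f (λ j i -> g (j , i)) ⟧)
   ≡⟨ functions-enumerates n {_≈_ = λ f g -> ∀ i -> f i ≡ g i} row? (λ j -> functions (toℕ j) λ _ -> allFin (n C 2))
     (λ j -> functions-enumerates (toℕ j) {_≈_ = _≡_} Fin._≟_ (λ _ -> allFin (n C 2)) (λ _ -> allFin-enumerates (n C 2))) (λ j i -> g (j , i)) ⟩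
  1 ∎
  where
  open ≡-Reasoning
  fs = functions n λ j -> functions (toℕ j) λ _ -> allFin (n C 2)
  row? : ∀ {j : Fin n} (f g : Fin (toℕ j) -> Fin (n C 2)) -> Dec (∀ i -> f i ≡ g i)
  row? = Pointwise? {_≈_ = _≡_} Fin._≟_
  rows? : (f g : ∀ j -> Fin (toℕ j) -> Fin (n C 2)) -> Dec (∀ j i -> f j i ≡ g j i)
  rows? = Pointwise? {_≈_ = λ f g -> ∀ i -> f i ≡ g i} row?

 -- Transpositions and bijections

 module Transposition {A : Set} (_≟_ : DecidableEquality A) where

  abstract

   swap : A -> A -> A -> A
   swap x y z with z ≟ x
   ... | yes _ = y
   ... | no _ with z ≟ y
   ... | yes _ = x
   ... | no _ = z

   swap-left : ∀ x y -> swap x y x ≡ y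
   swap-left x y with x ≟ x
   ... | yes _ = refl
   ... | no x≢x = absurd refl x≢x

   swap-right : ∀ x y -> swap x y y ≡ x
   swap-right x y with y ≟ x
   ... | yes y≡x = y≡x
   ... | no _ with y ≟ y
   ... | yes _ = refl
   ... | no y≢y = absurd refl y≢y

   swap-other : ∀ {x y z} -> z ≢ x -> z ≢ y -> swap x y z ≡ z
   swap-other {x} {y} {z} z≢x z≢y with z ≟ x
   ... | yes z≡x = absurd z≡x z≢x
   ... | no _ with z ≟ y
   ... | yes z≡y = absurd z≡y z≢y
   ... | no _ = refl

   swap-involutive : ∀ x y z -> swap x y (swap x y z) ≡ z
   swap-involutive x y z with z ≟ x
   ... | yes refl = swap-right z y
   ... | no z≢x with z ≟ y
   ... | yes refl = swap-left x z
   ... | no z≢y = swap-other z≢x z≢y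

 module _ {A B : Set} where

  mkBijection : (f : A -> B) (g : B -> A) -> (∀ b -> f (g b) ≡ b) -> (∀ a -> g (f a) ≡ a) -> A ⤖ B
  mkBijection f g fg gf = mk⤖ {to = f}
   ((λ {x} {y} fx≡fy -> trans (sym (gf x)) (trans (cong g fx≡fy) (gf y))) ,
    λ b -> g b , λ { refl -> fg b })

  inverse : A ⤖ B -> B -> A
  inverse f b = proj₁ (Bijection.surjective f b)

  to-inverse : (f : A ⤖ B) -> ∀ b -> Bijection.to f (inverse f b) ≡ b
  to-inverse f b = proj₂ (Bijection.surjective f b) refl

  inverse-to : (f : A ⤖ B) -> ∀ a -> inverse f (Bijection.to f a) ≡ a
  inverse-to f a = Bijection.injective f (to-inverse f (Bijection.to f a))

 infixr 9 _∘⤖_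
 _∘⤖_ : {A B C : Set} -> B ⤖ C -> A ⤖ B -> A ⤖ C
 g ∘⤖ f = mkBijection (Bijection.to g ∘ Bijection.to f) (inverse f ∘ inverse g)
  (λ c -> trans (cong (Bijection.to g) (to-inverse f _)) (to-inverse g c))
  (λ a -> trans (cong (inverse f) (inverse-to g _)) (inverse-to f a))

 _⁻¹⤖ : {A B : Set} -> A ⤖ B -> B ⤖ A
 f ⁻¹⤖ = mkBijection (inverse f) (Bijection.to f) (inverse-to f) (to-inverse f)

 -- The edges of Kₙ can be ordered: {i , j} with i < j gets position j C 2 + i

 [1+n]C2 : ∀ n -> suc n C 2 ≡ n + n C 2
 [1+n]C2 n = trans (sym (nCk+nC[k+1]≡[n+1]C[k+1] n 1)) (cong (_+ n C 2) (nC1≡n n))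

 C2-mono : ∀ {m n} -> m ≤ n -> m C 2 ≤ n C 2
 C2-mono {n = n} z≤n = z≤n
 C2-mono {suc m} {suc n} (s≤s m≤n) = subst₂ _≤_ (sym ([1+n]C2 m)) (sym ([1+n]C2 n)) (+-mono-≤ m≤n (C2-mono m≤n))

 key : ℕ -> ℕ -> ℕ
 key j i = i + j C 2

 key-< : ∀ {n j i} -> i < j -> j < n -> key j i < n C 2
 key-< {n} {j} {i} i<j j<n = <-≤-trans
  (subst (key j i <_) (sym ([1+n]C2 j)) (+-monoˡ-< (j C 2) i<j)) (C2-mono j<n)

 key-injective : ∀ {j i j' i'} -> i < j -> i' < j' -> key j i ≡ key j' i' -> j ≡ j'
 key-injective {j} {i} {j'} {i'} i<j i'<j' eq with <-cmp j j'
 ... | tri≈ _ j≡j' _ = j≡j'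
 ... | tri< j<j' _ _ = absurd eq
  (ℕ.<⇒≢ (<-≤-trans (key-< i<j j<j') (m≤n+m (j' C 2) i')))
 ... | tri> _ _ j'<j = absurd (sym eq)
  (ℕ.<⇒≢ (<-≤-trans (key-< i'<j' j'<j) (m≤n+m (j C 2) i)))

 key-surjective : ∀ n {y} -> y < n C 2 -> ∃ λ j -> ∃ λ i -> j < n × i < j × key j i ≡ y
 key-surjective zero ()
 key-surjective (suc n) {y} y< with y ℕ.<? n C 2
 ... | yes y<' = let (j , i , j<n , i<j , eq) = key-surjective n y<' in j , i , m≤n⇒m≤1+n j<n , i<j , eq
 ... | no y≮ = n , y ∸ n C 2 , ≤-refl ,
  ℕ.+-cancelʳ-< (n C 2) _ _ (subst₂ _<_ (sym (m∸n+n≡m (ℕ.≮⇒≥ y≮))) ([1+n]C2 n) y<) , m∸n+n≡m (ℕ.≮⇒≥ y≮)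

 -- A witness that the list of edge orderings is nonempty, so that `𝔼` is a genuine average and not
 -- its default value 0.
 someEdgeOrdering : ∀ n -> EdgeOrdering n
 someEdgeOrdering n = mk⤖ {to = number} (inj , surj)
  where
  number : Edge n -> Fin (n C 2)
  number (j , i) = fromℕ< (key-< (Fin.toℕ<n i) (Fin.toℕ<n j))
  inj : Injective _≡_ _≡_ number
  inj {j , i} {j' , i'} eq with keys ← trans (sym (Fin.toℕ-fromℕ< _)) (trans (cong toℕ eq) (Fin.toℕ-fromℕ< (key-< (Fin.toℕ<n i') (Fin.toℕ<n j'))))
   with refl ← Fin.toℕ-injective (key-injective (Fin.toℕ<n i) (Fin.toℕ<n i') keys)
   = cong (j ,_) (Fin.toℕ-injective (+-cancelʳ-≡ (toℕ j C 2) _ _ keys))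
  surj : ∀ y -> ∃ λ x -> ∀ {z} -> z ≡ x -> number z ≡ y
  surj y with key-surjective n (Fin.toℕ<n y)
  ... | j , i , j<n , i<j , eq = (fromℕ< j<n , fromℕ< i<j') , λ { refl -> Fin.toℕ-injective (trans (Fin.toℕ-fromℕ< _)
     (trans (cong₂ (λ i j -> key j i) (Fin.toℕ-fromℕ< i<j') (Fin.toℕ-fromℕ< j<n)) eq)) }
   where i<j' = subst (i <_) (sym (Fin.toℕ-fromℕ< j<n)) i<j

 -- The probability that a random ordering sorts a given list

 insertions : {A : Set} -> A -> List A -> List (List A)
 insertions x [] = [ [ x ] ]
 insertions x (y ∷ l) = (x ∷ y ∷ l) ∷ map (y ∷_) (insertions x l)

 length-insertions : {A : Set} (x : A) (l : List A) -> length (insertions x l) ≡ suc (length l)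
 length-insertions x [] = refl
 length-insertions x (y ∷ l) = cong suc (trans (List.length-map (y ∷_) (insertions x l)) (length-insertions x l))

 insertions-All : {A : Set} {P : A -> Set} {x : A} (l : List A) {l' : List A} -> l' ∈ insertions x l ->
        (All P l' -> P x × All P l) × (P x × All P l -> All P l')
 insertions-All [] (here refl) = (λ { (px ∷ []) -> px , [] }) , λ (px , _) -> px ∷ []
 insertions-All (y ∷ l) (here refl) = (λ { (px ∷ pl) -> px , pl }) , λ (px , pl) -> px ∷ pl
 insertions-All {x = x} (y ∷ l) (there l'∈) with l″ , l″∈ , refl ← ∈-map⁻ (y ∷_) l'∈ =
  let (to , from) = insertions-All l l″∈ in
  (λ { (py ∷ pl″) -> let (px , pl) = to pl″ in px , py ∷ pl }) , λ { (px , py ∷ pl) -> py ∷ from (px , pl) }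

 Ordered : {A : Set} -> (A -> ℕ) -> List A -> Set
 Ordered κ = AllPairs (λ a b -> κ a < κ b)

 ordered? : {A : Set} (κ : A -> ℕ) (l : List A) -> Dec (Ordered κ l)
 ordered? κ = allPairs? (λ a b -> κ a ℕ.<? κ b)

 Ordered⇒Unique : {A : Set} {κ : A -> ℕ} {l : List A} -> Ordered κ l -> Unique l
 Ordered⇒Unique {κ = κ} = AllPairs.map (λ κa<κb a≡b -> ℕ.<⇒≢ κa<κb (cong κ a≡b))

 module _ {A : Set} (κ : A -> ℕ) where

  private
   below? : ∀ y l -> Dec (All (λ b -> κ y < κ b) l)
   below? y = All.all? (λ b -> κ y ℕ.<? κ b)

   ordered-∷ : ∀ y l -> ⟦ ordered? κ (y ∷ l) ⟧ ≡ ⟦ below? y l ⟧ * ⟦ ordered? κ l ⟧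
   ordered-∷ y l = trans (⟦⟧-cong (ordered? κ (y ∷ l)) (below? y l ×-dec ordered? κ l)
    (λ { (b ∷ o) -> b , o }) (λ (b , o) -> b ∷ o)) (⟦⟧-× (below? y l) (ordered? κ l))

  -- In an ordered list a new key has exactly one admissible place, and an insertion never repairs a
  -- disordered list.
  ∑-insertions : ∀ x l -> All (λ y -> κ x ≢ κ y) l -> ∑ (insertions x l) (λ l' -> ⟦ ordered? κ l' ⟧) ≡ ⟦ ordered? κ l ⟧
  ∑-insertions x [] [] = trans (+-identityʳ _)
   (⟦⟧-cong (ordered? κ [ x ]) (ordered? κ []) (λ _ -> []) (λ _ -> [] ∷ []))
  ∑-insertions x (y ∷ l) (x≢y ∷ x∉) = begin
   ⟦ ordered? κ (x ∷ y ∷ l) ⟧ + ∑ (map (y ∷_) (insertions x l)) (λ l' -> ⟦ ordered? κ l' ⟧)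
    ≡⟨ cong₂ _+_ first rest ⟩
   ⟦ κ x ℕ.<? κ y ⟧ * o + ⟦ κ y ℕ.<? κ x ⟧ * o
    ≡⟨ ℕ.*-distribʳ-+ o ⟦ κ x ℕ.<? κ y ⟧ _ ⟨
   (⟦ κ x ℕ.<? κ y ⟧ + ⟦ κ y ℕ.<? κ x ⟧) * o
    ≡⟨ cong (_* o) exactly-one ⟩
   1 * o
    ≡⟨ *-identityˡ o ⟩
   o ∎
   where
   open ≡-Reasoning
   o = ⟦ ordered? κ (y ∷ l) ⟧
   exactly-one : ⟦ κ x ℕ.<? κ y ⟧ + ⟦ κ y ℕ.<? κ x ⟧ ≡ 1
   exactly-one with <-cmp (κ x) (κ y)
   ... | tri< x<y _ y≮x = cong₂ _+_ (⟦⟧-yes (κ x ℕ.<? κ y) x<y) (⟦⟧-no (κ y ℕ.<? κ x) y≮x)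
   ... | tri≈ _ x≡y _ = absurd x≡y x≢y
   ... | tri> x≮y _ y<x = cong₂ _+_ (⟦⟧-no (κ x ℕ.<? κ y) x≮y) (⟦⟧-yes (κ y ℕ.<? κ x) y<x)
   first : ⟦ ordered? κ (x ∷ y ∷ l) ⟧ ≡ ⟦ κ x ℕ.<? κ y ⟧ * o
   first = trans (⟦⟧-cong (ordered? κ (x ∷ y ∷ l)) (κ x ℕ.<? κ y ×-dec ordered? κ (y ∷ l))
    (λ { ((x<y ∷ _) ∷ o) -> x<y , o })
    (λ { (x<y , o@(y<l ∷ _)) -> (x<y ∷ All.map (<-trans x<y) y<l) ∷ o }))
    (⟦⟧-× (κ x ℕ.<? κ y) (ordered? κ (y ∷ l)))
   b = ⟦ below? y l ⟧
   rest : ∑ (map (y ∷_) (insertions x l)) (λ l' -> ⟦ ordered? κ l' ⟧) ≡ ⟦ κ y ℕ.<? κ x ⟧ * o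
   rest = begin
    ∑ (map (y ∷_) (insertions x l)) (λ l' -> ⟦ ordered? κ l' ⟧)
     ≡⟨ ∑-map (insertions x l) (y ∷_) (λ l' -> ⟦ ordered? κ l' ⟧) ⟩
    ∑ (insertions x l) (λ l' -> ⟦ ordered? κ (y ∷ l') ⟧)
     ≡⟨ ∑-cong-∈ (insertions x l) (λ {l'} l'∈ -> trans (ordered-∷ y l') (cong (_* ⟦ ordered? κ l' ⟧)
        (let (to , from) = insertions-All l l'∈ in
         trans (⟦⟧-cong (below? y l') (κ y ℕ.<? κ x ×-dec below? y l) to from)
            (⟦⟧-× (κ y ℕ.<? κ x) (below? y l))))) ⟩
    ∑ (insertions x l) (λ l' -> ⟦ κ y ℕ.<? κ x ⟧ * b * ⟦ ordered? κ l' ⟧)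
     ≡⟨ ∑-*ˡ (insertions x l) (⟦ κ y ℕ.<? κ x ⟧ * b) (λ l' -> ⟦ ordered? κ l' ⟧) ⟩
    ⟦ κ y ℕ.<? κ x ⟧ * b * ∑ (insertions x l) (λ l' -> ⟦ ordered? κ l' ⟧)
     ≡⟨ cong (⟦ κ y ℕ.<? κ x ⟧ * b *_) (∑-insertions x l x∉) ⟩
    ⟦ κ y ℕ.<? κ x ⟧ * b * ⟦ ordered? κ l ⟧
     ≡⟨ *-assoc ⟦ κ y ℕ.<? κ x ⟧ b _ ⟩
    ⟦ κ y ℕ.<? κ x ⟧ * (b * ⟦ ordered? κ l ⟧)
     ≡⟨ cong (⟦ κ y ℕ.<? κ x ⟧ *_) (ordered-∷ y l) ⟨
    ⟦ κ y ℕ.<? κ x ⟧ * o ∎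

 module Labelling {A : Set} (A? : Searchable A) {m : ℕ} {Ω : List (A ⤖ Fin m)}
  (Ω-enumerates : Enumerates (⤖-≗? A? (searchFin {m})) Ω) where

  open Searchable A? using (_≟_)
  open Transposition _≟_

  label : A ⤖ Fin m -> A -> ℕ
  label f a = toℕ (Bijection.to f a)

  label-injective : ∀ f {a b} -> label f a ≡ label f b -> a ≡ b
  label-injective f eq = Bijection.injective f (Fin.toℕ-injective eq)

  sorting : List A -> ℕ
  sorting l = ∑ Ω (λ f -> ⟦ ordered? (label f) l ⟧)

  private
   swap⤖ : A -> A -> A ⤖ A
   swap⤖ x y = mkBijection (swap x y) (swap x y) (swap-involutive x y) (swap-involutive x y)

   sorting-map-swap : ∀ x y l -> sorting (map (swap x y) l) ≡ sorting l
   sorting-map-swap x y l = trans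
    (∑-cong Ω (λ f -> ⟦⟧-cong (ordered? (label f) (map (swap x y) l)) (ordered? (label (f ∘⤖ swap⤖ x y)) l) AllPairs.map⁻ AllPairs.map⁺))
    (reindex (⤖-≗? A? searchFin) (⤖-≗? A? searchFin) Ω Ω Ω-enumerates Ω-enumerates
     (_∘⤖ swap⤖ x y) (_∘⤖ swap⤖ x y)
     (λ {f} {g} eq a -> trans (cong (Bijection.to f) (sym (swap-involutive x y a))) (sym (eq (swap x y a))))
     (λ {f} {g} eq a -> sym (trans (eq (swap x y a)) (cong (Bijection.to g) (swap-involutive x y a))))
     (λ g -> ⟦ ordered? (label g) l ⟧)
     (λ {g} {h} eq -> ⟦⟧-cong (ordered? (label g) l) (ordered? (label h) l)
      (AllPairs.map (λ {a} {b} -> subst₂ (λ u v -> toℕ u < toℕ v) (eq a) (eq b)))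
      (AllPairs.map (λ {a} {b} -> subst₂ (λ u v -> toℕ u < toℕ v) (sym (eq a)) (sym (eq b))))))

   map-swap-fixes : ∀ {x y} l -> x ∉ l -> y ∉ l -> map (swap x y) l ≡ l
   map-swap-fixes [] _ _ = refl
   map-swap-fixes (z ∷ l) x∉ y∉ = cong₂ _∷_ (swap-other (x∉ ∘ here ∘ sym) (y∉ ∘ here ∘ sym))
    (map-swap-fixes l (x∉ ∘ there) (y∉ ∘ there))

   sorting-adjacent : ∀ p x y l -> x ∉ p -> y ∉ p -> x ∉ l -> y ∉ l ->
          sorting (p ++ y ∷ x ∷ l) ≡ sorting (p ++ x ∷ y ∷ l)
   sorting-adjacent p x y l x∉p y∉p x∉l y∉l = trans (cong sorting (sym (begin
    map (swap x y) (p ++ x ∷ y ∷ l) ≡⟨ List.map-++ (swap x y) p (x ∷ y ∷ l) ⟩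
    map (swap x y) p ++ swap x y x ∷ swap x y y ∷ map (swap x y) l ≡⟨ cong₂ _++_ (map-swap-fixes p x∉p y∉p)
     (cong₂ _∷_ (swap-left x y) (cong₂ _∷_ (swap-right x y) (map-swap-fixes l x∉l y∉l))) ⟩
    p ++ y ∷ x ∷ l ∎)))
    (sorting-map-swap x y (p ++ x ∷ y ∷ l))
    where open ≡-Reasoning

   Unique-middle : ∀ p {y : A} {l} -> Unique (p ++ y ∷ l) -> y ∉ p × y ∉ l
   Unique-middle [] (y≢ ∷ _) = (λ ()) , λ y∈ -> All.lookup y≢ y∈ refl
   Unique-middle (z ∷ p) (z≢ ∷ u) = let (y∉p , y∉l) = Unique-middle p u in
    (λ { (here refl) -> All.lookup z≢ (∈-++⁺ʳ p (here refl)) refl ; (there y∈) -> y∉p y∈ }) , y∉l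

   sorting-insertions : ∀ p x l -> x ∉ p -> x ∉ l -> Unique (p ++ l) -> ∀ {l'} -> l' ∈ insertions x l ->
           sorting (p ++ l') ≡ sorting (p ++ x ∷ l)
   sorting-insertions p x [] x∉p x∉l u (here refl) = refl
   sorting-insertions p x (y ∷ l) x∉p x∉l u (here refl) = refl
   sorting-insertions p x (y ∷ l) x∉p x∉l u (there l'∈) with l″ , l″∈ , refl ← ∈-map⁻ (y ∷_) l'∈ = begin
    sorting (p ++ y ∷ l″) ≡⟨ cong sorting (List.++-assoc p [ y ] l″) ⟨
    sorting ((p ++ [ y ]) ++ l″) ≡⟨ sorting-insertions (p ++ [ y ]) x l x∉p' (x∉l ∘ there)
                (subst Unique (sym (List.++-assoc p [ y ] l)) u) l″∈ ⟩
    sorting ((p ++ [ y ]) ++ x ∷ l) ≡⟨ cong sorting (List.++-assoc p [ y ] (x ∷ l)) ⟩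
    sorting (p ++ y ∷ x ∷ l) ≡⟨ sorting-adjacent p x y l x∉p (proj₁ y∉) (x∉l ∘ there) (proj₂ y∉) ⟩
    sorting (p ++ x ∷ y ∷ l) ∎
    where
    open ≡-Reasoning
    y∉ = Unique-middle p u
    x∉p' : x ∉ p ++ [ y ]
    x∉p' x∈ with ∈-++⁻ p x∈
    ... | inj₁ x∈p = x∉p x∈p
    ... | inj₂ (here refl) = x∉l (here refl)

  -- By symmetry all `suc (length l)` places of `x` are equally likely, and by `∑-insertions`
  -- together they account for the labellings that sort `l`. So a list of distinct elements is
  -- sorted with probability 1 / (length l)!.
  sorting-count : ∀ l -> Unique l -> sorting l * (length l) ! ≡ length Ω
  sorting-count [] _ = trans (*-identityʳ _) (trans (∑-cong Ω (λ f -> ⟦⟧-yes (ordered? (label f) []) [])) (trans (∑-const Ω 1) (*-identityʳ _)))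
  sorting-count (x ∷ l) (x≢ ∷ u) = begin
   sorting (x ∷ l) * (suc (length l) * length l !) ≡⟨ *-assoc (sorting (x ∷ l)) _ _ ⟨
   sorting (x ∷ l) * suc (length l) * length l ! ≡⟨ cong (_* length l !) step ⟩
   sorting l * length l ! ≡⟨ sorting-count l u ⟩
   length Ω ∎
   where
   open ≡-Reasoning
   step : sorting (x ∷ l) * suc (length l) ≡ sorting l
   step = begin
    sorting (x ∷ l) * suc (length l) ≡⟨ ℕ.*-comm (sorting (x ∷ l)) _ ⟩
    suc (length l) * sorting (x ∷ l) ≡⟨ cong (_* sorting (x ∷ l)) (length-insertions x l) ⟨
    length (insertions x l) * sorting (x ∷ l) ≡⟨ ∑-const (insertions x l) (sorting (x ∷ l)) ⟨
    ∑ (insertions x l) (λ _ -> sorting (x ∷ l)) ≡⟨ ∑-cong-∈ (insertions x l) (λ l'∈ ->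
     sym (sorting-insertions [] x l (λ ()) (λ x∈ -> All.lookup x≢ x∈ refl) u l'∈)) ⟩
    ∑ (insertions x l) sorting ≡⟨ ∑-swap (insertions x l) Ω (λ l' f -> ⟦ ordered? (label f) l' ⟧) ⟩
    ∑ Ω (λ f -> ∑ (insertions x l) (λ l' -> ⟦ ordered? (label f) l' ⟧))
     ≡⟨ ∑-cong Ω (λ f -> ∑-insertions (label f) x l (All.map (_∘ label-injective f) x≢)) ⟩
    sorting l ∎

 open Transposition ℕ._≟_ public

 ∑-at-most-one : {I : Set} {P : I -> Set} (P? : ∀ i -> Dec (P i)) (xs : List I) -> Unique xs ->
       (∀ {x y} -> P x -> P y -> x ≡ y) -> ∑ xs (λ x -> ⟦ P? x ⟧) ≤ 1
 ∑-at-most-one P? [] _ _ = z≤n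
 ∑-at-most-one {P = P} P? (x ∷ xs) (x≢ ∷ u) one with P? x
 ... | no ¬px = ≡≤ (cong (_+ ∑ xs (λ x -> ⟦ P? x ⟧)) (⟦⟧-no (no ¬px) ¬px)) (∑-at-most-one P? xs u one)
 ... | yes px = ≡≤ (cong (⟦ yes px ⟧ +_)
  (trans (∑-cong-∈ xs (λ {y} y∈ -> ⟦⟧-no (P? y) (λ py -> All.lookup x≢ y∈ (one px py)))) (∑-zero xs)))
  (≡≤ (+-identityʳ _) (⟦⟧≤1 (yes px)))

 -- Permutations with prescribed values

 Assignment : Set
 Assignment = List (ℕ × ℕ)

 dom ran : Assignment -> List ℕ
 dom = map proj₁
 ran = map proj₂

 Sat : (ℕ -> ℕ) -> Assignment -> Set
 Sat ρ = All (λ (j , i) -> ρ j ≡ i)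

 sat? : ∀ ρ τ -> Dec (Sat ρ τ)
 sat? ρ = All.all? (λ (j , i) -> ρ j ℕ.≟ i)

 _∈ᴺ?_ : ∀ (x : ℕ) xs -> Dec (x ∈ xs)
 _∈ᴺ?_ = DecMembership._∈?_ ℕ._≟_

 free? : ∀ τ u -> Dec (u ∉ dom τ)
 free? τ u = ¬? (u ∈ᴺ? dom τ)

 freeCount : ℕ -> Assignment -> ℕ
 freeCount n τ = ∑ (upTo n) (λ u -> ⟦ free? τ u ⟧)

 record Valid (n : ℕ) (τ : Assignment) : Set where
  field
   dom-< : All (_< n) (dom τ)
   ran-< : All (_< n) (ran τ)
   dom-unique : Unique (dom τ)
   ran-unique : Unique (ran τ)

 Valid-tail : ∀ {n c τ} -> Valid n (c ∷ τ) -> Valid n τ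
 Valid-tail v = record { dom-< = All.tail dom-< ; ran-< = All.tail ran-< ; dom-unique = AllPairs.tail dom-unique ; ran-unique = AllPairs.tail ran-unique }
  where open Valid v

 Unique-head : {A : Set} {x : A} {xs : List A} -> Unique (x ∷ xs) -> x ∉ xs
 Unique-head (x≢ ∷ _) x∈ = All.lookup x≢ x∈ refl

 Sat-resp : ∀ {ρ ρ'} τ -> (∀ {j} -> j ∈ dom τ -> ρ j ≡ ρ' j) -> Sat ρ τ -> Sat ρ' τ
 Sat-resp [] eq [] = []
 Sat-resp (c ∷ τ) eq (ρj≡i ∷ s) = trans (sym (eq (here refl))) ρj≡i ∷ Sat-resp τ (eq ∘ there) s

 Sat-ran : ∀ {ρ} {τ : Assignment} {u} -> Sat ρ τ -> u ∈ dom τ -> ρ u ∈ ran τ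
 Sat-ran (eq ∷ s) (here refl) = here eq
 Sat-ran (eq ∷ s) (there u∈) = there (Sat-ran s u∈)

 Sat⇒∈ : ∀ {ρ} {τ : Assignment} {u} -> Sat ρ τ -> u ∈ dom τ -> (u , ρ u) ∈ τ
 Sat⇒∈ {u = u} (eq ∷ s) (here refl) = here (cong (u ,_) eq)
 Sat⇒∈ (eq ∷ s) (there u∈) = there (Sat⇒∈ s u∈)

 ≡?-count : ∀ n {x} -> x < n -> ∑ (upTo n) (λ u -> ⟦ u ℕ.≟ x ⟧) ≡ 1
 ≡?-count n {x} x<n = ≤-antisym
  (∑-at-most-one (ℕ._≟ x) (upTo n) (Unique.upTo⁺ n) (λ { refl refl -> refl }))
  (∑-⟦⟧-≥ (ℕ._≟ x) (∈-upTo⁺ x<n) refl)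

 length-upTo : ∀ n -> length (upTo n) ≡ n
 length-upTo = List.length-upTo

 freeCount-+ : ∀ n τ -> All (_< n) (dom τ) -> Unique (dom τ) -> freeCount n τ + length τ ≡ n
 freeCount-+ n [] _ _ = trans (+-identityʳ _) (trans (∑-cong (upTo n) (λ u -> ⟦⟧-yes (free? [] u) (λ ())))
  (trans (∑-const (upTo n) 1) (trans (*-identityʳ _) (length-upTo n))))
 freeCount-+ n τ'@((w , v) ∷ τ) (w<n ∷ dom<) u@(_ ∷ u') = begin
  freeCount n τ' + suc (length τ) ≡⟨ +-suc _ _ ⟩
  suc (freeCount n τ') + length τ ≡⟨ cong (λ z -> z + freeCount n τ' + length τ) (≡?-count n w<n) ⟨
  ∑ (upTo n) (λ u -> ⟦ u ℕ.≟ w ⟧) + freeCount n τ' + length τ ≡⟨ cong (_+ length τ) (∑-⊕ (upTo n) (λ u -> ⟦ u ℕ.≟ w ⟧) (λ u -> ⟦ free? τ' u ⟧)) ⟨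
  ∑ (upTo n) (λ u -> ⟦ u ℕ.≟ w ⟧ + ⟦ free? τ' u ⟧) + length τ ≡⟨ cong (_+ length τ) (∑-cong (upTo n) split) ⟩
  freeCount n τ + length τ ≡⟨ freeCount-+ n τ dom< u' ⟩
  n ∎
  where
  open ≡-Reasoning
  split : ∀ u -> ⟦ u ℕ.≟ w ⟧ + ⟦ free? τ' u ⟧ ≡ ⟦ free? τ u ⟧
  split x = case x ℕ.≟ w of λ where
   (yes refl) -> trans (cong₂ _+_ (⟦⟧-yes (x ℕ.≟ x) refl) (⟦⟧-no (free? τ' x) (λ ∉ -> ∉ (here refl))))
          (sym (⟦⟧-yes (free? τ x) (Unique-head u)))
   (no x≢w) -> trans (cong (_+ ⟦ free? τ' x ⟧) (⟦⟧-no (x ℕ.≟ w) x≢w))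
          (⟦⟧-cong (free? τ' x) (free? τ x) (_∘ there) (λ ∉ -> λ { (here eq) -> x≢w eq ; (there x∈) -> ∉ x∈ }))

 -- Adjacent values at adjacent positions

 Adj : ℕ -> ℕ -> Set
 Adj x y = x ≡ suc y ⊎ suc x ≡ y

 adj? : ∀ x y -> Dec (Adj x y)
 adj? x y = (x ℕ.≟ suc y) ⊎-dec (suc x ℕ.≟ y)

 Adj-sym : ∀ {x y} -> Adj x y -> Adj y x
 Adj-sym (inj₁ eq) = inj₂ (sym eq)
 Adj-sym (inj₂ eq) = inj₁ (sym eq)

 neighbours : ℕ -> List ℕ
 neighbours zero = 1 ∷ []
 neighbours (suc a) = suc (suc a) ∷ a ∷ []

 ∈-neighbours : ∀ {a b} -> Adj a b -> b ∈ neighbours a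
 ∈-neighbours {suc a} (inj₁ refl) = there (here refl)
 ∈-neighbours {zero} (inj₂ refl) = here refl
 ∈-neighbours {suc a} (inj₂ refl) = here refl

 neighbours-Adj : ∀ a {b} -> b ∈ neighbours a -> Adj a b
 neighbours-Adj zero (here refl) = inj₂ refl
 neighbours-Adj (suc a) (here refl) = inj₂ refl
 neighbours-Adj (suc a) (there (here refl)) = inj₁ refl

 Adj-≢ : ∀ {a b} -> Adj a b -> b ≢ a
 Adj-≢ (inj₁ eq) refl = ℕ.m≢1+m+n _ (trans eq (cong suc (sym (+-identityʳ _))))
 Adj-≢ (inj₂ eq) refl = ℕ.m≢1+m+n _ (trans (sym eq) (cong suc (sym (+-identityʳ _))))

 ∑-neighbours-≤ : ∀ a {c} (f : ℕ -> ℕ) -> (∀ {b} -> b ∈ neighbours a -> f b ≤ c) -> ∑ (neighbours a) f ≤ 2 * c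
 ∑-neighbours-≤ zero {c} f f≤ = +-mono-≤ (f≤ (here refl)) z≤n
 ∑-neighbours-≤ (suc a) {c} f f≤ = +-mono-≤ (f≤ (here refl)) (+-mono-≤ (f≤ (there (here refl))) z≤n)

 ∑-neighbours-count : ∀ a y -> ∑ (neighbours a) (λ b -> ⟦ b ℕ.≟ y ⟧) ≡ ⟦ adj? a y ⟧
 ∑-neighbours-count a y = ≤-antisym
  (≤-trans (∑-mono-∈ (neighbours a) (λ {b} b∈ -> bound b b∈)) (upper a))
  (⟦⟧≤ (adj? a y) (λ adj -> ∑-⟦⟧-≥ (ℕ._≟ y) (∈-neighbours adj) refl))
  where
  bound : ∀ b -> b ∈ neighbours a -> ⟦ b ℕ.≟ y ⟧ ≤ ⟦ adj? a y ⟧ * ⟦ b ℕ.≟ y ⟧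
  bound b b∈ = ≤-trans (⟦⟧≤ (b ℕ.≟ y) (λ { refl -> ≤-reflexive (sym (cong₂ _*_ (⟦⟧-yes (adj? a b) (neighbours-Adj a b∈)) (⟦⟧-yes (b ℕ.≟ b) refl))) })) ≤-refl
  nUnique : ∀ a -> Unique (neighbours a)
  nUnique zero = [] ∷ []
  nUnique (suc a) = ((λ ()) ∷ []) ∷ [] ∷ []
  upper : ∀ a -> ∑ (neighbours a) (λ b -> ⟦ adj? a y ⟧ * ⟦ b ℕ.≟ y ⟧) ≤ ⟦ adj? a y ⟧
  upper a = ≡≤ (∑-*ˡ (neighbours a) ⟦ adj? a y ⟧ (λ b -> ⟦ b ℕ.≟ y ⟧))
   (≤≡ (*-monoʳ-≤ ⟦ adj? a y ⟧ (∑-at-most-one (ℕ._≟ y) (neighbours a) (nUnique a) (λ { refl refl -> refl })))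
    (*-identityʳ _))

 -- Counts the coincidences that touch position `a`. Neighbours are not confined to the range below
 -- n; at worst this adds a spurious coincidence at the boundary, and it makes the count symmetric
 -- under inversion (`contacts-inverse`).
 contacts : (ℕ -> ℕ) -> ℕ -> ℕ
 contacts ρ a = ∑ (neighbours a) (λ b -> ⟦ adj? (ρ a) (ρ b) ⟧)

 module Transpositions (n : ℕ) {Ω : Set} (perms : List Ω) (at : Ω -> ℕ -> ℕ)
  (at-injective : ∀ ω {a b} -> at ω a ≡ at ω b -> a ≡ b)
  (invariant : ∀ {w u} -> w < n -> u < n -> (F : (ℕ -> ℕ) -> ℕ) -> (∀ {ρ ρ'} -> ρ ≗ ρ' -> F ρ ≡ F ρ') ->
        ∑ perms (λ ω -> F (at ω ∘ swap w u)) ≡ ∑ perms (F ∘ at)) where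

  #S : Assignment -> ℕ
  #S τ = ∑ perms (λ ω -> ⟦ sat? (at ω) τ ⟧)

  private
   adj-count : ∀ ω y -> ∑ (upTo n) (λ u -> ⟦ adj? (at ω u) y ⟧) ≤ 2
   adj-count ω y = ≤-trans (∑-mono (upTo n) (λ u -> ⟦⟧-⊎ (at ω u ℕ.≟ suc y) (suc (at ω u) ℕ.≟ y)))
    (≡≤ (∑-⊕ (upTo n) (λ u -> ⟦ at ω u ℕ.≟ suc y ⟧) (λ u -> ⟦ suc (at ω u) ℕ.≟ y ⟧))
     (+-mono-≤ (∑-at-most-one (λ u -> at ω u ℕ.≟ suc y) (upTo n) (Unique.upTo⁺ n) (λ p q -> at-injective ω (trans p (sym q))))
      (∑-at-most-one (λ u -> suc (at ω u) ℕ.≟ y) (upTo n) (Unique.upTo⁺ n) (λ p q -> at-injective ω (suc-injective (trans p (sym q)))))))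

  -- Exchanging the value at w with that at a free position u ≢ w' keeps the value at w', so a
  -- permutation with adjacent values at w and w' is recovered, up to two choices, from its image.
  adjacent-values : ∀ {τ w w'} -> w < n -> w ∉ dom τ -> w' ≢ w ->
   (freeCount n τ ∸ 1) * ∑ perms (λ ω -> ⟦ sat? (at ω) τ ⟧ * ⟦ adj? (at ω w) (at ω w') ⟧) ≤ 2 * #S τ
  adjacent-values {τ} {w} {w'} w<n w∉ w'≢w = begin
   (freeCount n τ ∸ 1) * T ≤⟨ *-monoˡ-≤ T choices ⟩
   ∑ (upTo n) choice * T ≡⟨ ∑-*ʳ (upTo n) T choice ⟨
   ∑ (upTo n) (λ u -> choice u * T) ≤⟨ ∑-mono-∈ (upTo n) (λ {u} u∈ -> moved u (∈-upTo⁻ u∈)) ⟩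
   ∑ (upTo n) (λ u -> ∑ perms (λ ω -> ⟦ sat? (at ω) τ ⟧ * ⟦ adj? (at ω u) (at ω w') ⟧))
                     ≡⟨ ∑-swap (upTo n) perms _ ⟩
   ∑ perms (λ ω -> ∑ (upTo n) (λ u -> ⟦ sat? (at ω) τ ⟧ * ⟦ adj? (at ω u) (at ω w') ⟧))
    ≤⟨ ∑-mono perms (λ ω -> ≤-trans
       (≤-reflexive (∑-*ˡ (upTo n) ⟦ sat? (at ω) τ ⟧ (λ u -> ⟦ adj? (at ω u) (at ω w') ⟧)))
       (*-monoʳ-≤ ⟦ sat? (at ω) τ ⟧ (adj-count ω (at ω w')))) ⟩
   ∑ perms (λ ω -> ⟦ sat? (at ω) τ ⟧ * 2) ≡⟨ ∑-*ʳ perms 2 _ ⟩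
   #S τ * 2 ≡⟨ ℕ.*-comm (#S τ) 2 ⟩
   2 * #S τ ∎
   where
   open ≤-Reasoning
   F : (ℕ -> ℕ) -> ℕ
   F ρ = ⟦ sat? ρ τ ⟧ * ⟦ adj? (ρ w) (ρ w') ⟧
   F-resp : ∀ {ρ ρ'} -> ρ ≗ ρ' -> F ρ ≡ F ρ'
   F-resp {ρ} {ρ'} eq = cong₂ _*_
    (⟦⟧-cong (sat? ρ τ) (sat? ρ' τ) (Sat-resp τ (λ {j} _ -> eq j)) (Sat-resp τ (λ {j} _ -> sym (eq j))))
    (cong₂ (λ a b -> ⟦ adj? a b ⟧) (eq w) (eq w'))
   T = ∑ perms (F ∘ at)
   choice : ℕ -> ℕ
   choice u = ⟦ free? τ u ×-dec ¬? (u ℕ.≟ w') ⟧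
   choices : freeCount n τ ∸ 1 ≤ ∑ (upTo n) choice
   choices = ℕ.m≤n+o⇒m∸n≤o (freeCount n τ) 1 (begin
    freeCount n τ ≤⟨ ∑-mono (upTo n) split ⟩
    ∑ (upTo n) (λ u -> ⟦ u ℕ.≟ w' ⟧ + choice u) ≡⟨ ∑-⊕ (upTo n) _ _ ⟩
    ∑ (upTo n) (λ u -> ⟦ u ℕ.≟ w' ⟧) + ∑ (upTo n) choice
     ≤⟨ +-monoˡ-≤ _ (∑-at-most-one (ℕ._≟ w') (upTo n) (Unique.upTo⁺ n) (λ { refl refl -> refl })) ⟩
    1 + ∑ (upTo n) choice ∎)
    where
    split : ∀ u -> ⟦ free? τ u ⟧ ≤ ⟦ u ℕ.≟ w' ⟧ + choice u
    split u = case u ℕ.≟ w' of λ where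
     (yes eq) -> ≤-trans (⟦⟧≤1 (free? τ u)) (≡≤ (sym (⟦⟧-yes (u ℕ.≟ w') eq)) (m≤m+n _ _))
     (no u≢w') -> ≤-trans (⟦⟧-mono (free? τ u) (free? τ u ×-dec ¬? (u ℕ.≟ w')) (λ u∉ -> u∉ , u≢w')) (m≤n+m _ ⟦ u ℕ.≟ w' ⟧)
   moved : ∀ u -> u < n -> choice u * T ≤ ∑ perms (λ ω -> ⟦ sat? (at ω) τ ⟧ * ⟦ adj? (at ω u) (at ω w') ⟧)
   moved u u<n = ⟦⟧*≤' (free? τ u ×-dec ¬? (u ℕ.≟ w')) λ (u∉ , u≢w') -> ≤-reflexive
    (trans (sym (invariant w<n u<n F F-resp)) (∑-cong perms (λ ω -> cong₂ _*_
     (⟦⟧-cong (sat? (at ω ∘ swap w u) τ) (sat? (at ω) τ)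
      (Sat-resp τ (λ j∈ -> cong (at ω) (swap-other (λ { refl -> w∉ j∈ }) (λ { refl -> u∉ j∈ }))))
      (Sat-resp τ (λ j∈ -> cong (at ω) (sym (swap-other (λ { refl -> w∉ j∈ }) (λ { refl -> u∉ j∈ }))))))
     (cong₂ (λ a b -> ⟦ adj? (at ω a) (at ω b) ⟧) (swap-left w u) (swap-other w'≢w (u≢w' ∘ sym))))))

  contacts-bound : ∀ {τ w} -> w < n -> w ∉ dom τ ->
   (freeCount n τ ∸ 1) * ∑ perms (λ ω -> ⟦ sat? (at ω) τ ⟧ * contacts (at ω) w) ≤ 4 * #S τ
  contacts-bound {τ} {w} w<n w∉ = begin
   m * ∑ perms (λ ω -> ⟦ sat? (at ω) τ ⟧ * contacts (at ω) w)
    ≡⟨ cong (m *_) (trans (∑-cong perms (λ ω -> sym (∑-*ˡ (neighbours w) ⟦ sat? (at ω) τ ⟧ (λ b -> ⟦ adj? (at ω w) (at ω b) ⟧))))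
       (∑-swap perms (neighbours w) (λ ω b -> ⟦ sat? (at ω) τ ⟧ * ⟦ adj? (at ω w) (at ω b) ⟧))) ⟩
   m * ∑ (neighbours w) (λ b -> T b) ≡⟨ ∑-*ˡ (neighbours w) m T ⟨
   ∑ (neighbours w) (λ b -> m * T b)
    ≤⟨ ∑-neighbours-≤ w (λ b -> m * T b) (λ b∈ -> adjacent-values w<n w∉ (Adj-≢ (neighbours-Adj w b∈))) ⟩
   2 * (2 * #S τ) ≡⟨ *-assoc 2 2 (#S τ) ⟨
   4 * #S τ ∎
   where
   open ≤-Reasoning
   m = freeCount n τ ∸ 1
   T : ℕ -> ℕ
   T b = ∑ perms (λ ω -> ⟦ sat? (at ω) τ ⟧ * ⟦ adj? (at ω w) (at ω b) ⟧)

 -- (i , j , o): the values at positions j , j + 1 are i , i + 1 (o = true) or i + 1 , i (o = false).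
 Cell : Set
 Cell = ℕ × ℕ × Bool

 Coin : (ℕ -> ℕ) -> Cell -> Set
 Coin ρ (i , j , true) = ρ j ≡ i × ρ (suc j) ≡ suc i
 Coin ρ (i , j , false) = ρ j ≡ suc i × ρ (suc j) ≡ i

 coin? : ∀ ρ c -> Dec (Coin ρ c)
 coin? ρ (i , j , true) = (ρ j ℕ.≟ i) ×-dec (ρ (suc j) ℕ.≟ suc i)
 coin? ρ (i , j , false) = (ρ j ℕ.≟ suc i) ×-dec (ρ (suc j) ℕ.≟ i)

 Coin-resp : ∀ {ρ ρ' i j} o -> ρ j ≡ ρ' j -> ρ (suc j) ≡ ρ' (suc j) -> Coin ρ (i , j , o) -> Coin ρ' (i , j , o)
 Coin-resp true eq eq' (p , q) = trans (sym eq) p , trans (sym eq') q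
 Coin-resp false eq eq' (p , q) = trans (sym eq) p , trans (sym eq') q

 Coin-Adj : ∀ {ρ i j} o -> Coin ρ (i , j , o) -> Adj (ρ j) (ρ (suc j))
 Coin-Adj true (p , q) = inj₂ (trans (cong suc p) (sym q))
 Coin-Adj false (p , q) = inj₁ (trans p (cong suc (sym q)))

 _∈ᶜ?_ : ∀ (c : Cell) D -> Dec (c ∈ D)
 _∈ᶜ?_ = DecMembership._∈?_ (Product.≡-dec ℕ._≟_ (Product.≡-dec ℕ._≟_ Bool._≟_))

 cells : ℕ -> List Cell
 cells N = cartesianProduct (upTo N) (cartesianProduct (upTo N) (true ∷ false ∷ []))

 ∈-cells⁺ : ∀ {N i j} o -> i < N -> j < N -> (i , j , o) ∈ cells N
 ∈-cells⁺ o i<N j<N = ∈-cartesianProduct⁺ (∈-upTo⁺ i<N) (∈-cartesianProduct⁺ (∈-upTo⁺ j<N) (∈-orientations o))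
  where
  ∈-orientations : ∀ o -> o ∈ true ∷ false ∷ []
  ∈-orientations true = here refl
  ∈-orientations false = there (here refl)

 ∈-cells⁻ : ∀ {N i j o} -> (i , j , o) ∈ cells N -> i < N × j < N
 ∈-cells⁻ {N} c∈ = let (i∈ , jo∈) = ∈-cartesianProduct⁻ (upTo N) _ c∈ in
  ∈-upTo⁻ i∈ , ∈-upTo⁻ (proj₁ (∈-cartesianProduct⁻ (upTo N) _ jo∈))

 extra? : ∀ D ρ c -> Dec (Coin ρ c × c ∉ D)
 extra? D ρ c = coin? ρ c ×-dec ¬? (c ∈ᶜ? D)

 extras : ℕ -> List Cell -> (ℕ -> ℕ) -> ℕ
 extras N D ρ = ∑ (cells N) (λ c -> ⟦ extra? D ρ c ⟧)

 Coin-≗ : ∀ {ρ ρ'} -> ρ ≗ ρ' -> ∀ c -> Coin ρ c -> Coin ρ' c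
 Coin-≗ eq (i , j , o) = Coin-resp o (eq j) (eq (suc j))

 extras-resp : ∀ N D {ρ ρ'} -> ρ ≗ ρ' -> extras N D ρ ≡ extras N D ρ'
 extras-resp N D {ρ} {ρ'} eq = ∑-cong (cells N) (λ c -> ⟦⟧-cong (extra? D ρ c) (extra? D ρ' c)
  (λ (p , q) -> Coin-≗ eq c p , q) (λ (p , q) -> Coin-≗ (sym ∘ eq) c p , q))

 contacts-pos : ∀ ρ {a b} -> Adj a b -> Adj (ρ a) (ρ b) -> 1 ≤ contacts ρ a
 contacts-pos ρ {a} a~b ρa~ρb = ∑-⟦⟧-≥ (λ b -> adj? (ρ a) (ρ b)) (∈-neighbours a~b) ρa~ρb

 -- Double counting: both sides count the pairs of a neighbour `b` of the position `ρ⁻ y` and a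
 -- neighbour `z` of the value `y` with `z ≡ ρ b`. It trades contacts at a random position for
 -- contacts at a fixed value.
 contacts-inverse : ∀ {ρ ρ⁻ : ℕ -> ℕ} -> (∀ a -> ρ⁻ (ρ a) ≡ a) -> (∀ y -> ρ (ρ⁻ y) ≡ y) ->
        ∀ y -> contacts ρ (ρ⁻ y) ≡ contacts ρ⁻ y
 contacts-inverse {ρ} {ρ⁻} ρ⁻ρ ρρ⁻ y = begin
  ∑ (neighbours a) (λ b -> ⟦ adj? (ρ a) (ρ b) ⟧) ≡⟨ ∑-cong (neighbours a) (λ b ->
   trans (cong (λ z -> ⟦ adj? z (ρ b) ⟧) (ρρ⁻ y)) (sym (∑-neighbours-count y (ρ b)))) ⟩
  ∑ (neighbours a) (λ b -> ∑ (neighbours y) (λ z -> ⟦ z ℕ.≟ ρ b ⟧)) ≡⟨ ∑-swap (neighbours a) (neighbours y) _ ⟩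
  ∑ (neighbours y) (λ z -> ∑ (neighbours a) (λ b -> ⟦ z ℕ.≟ ρ b ⟧)) ≡⟨ ∑-cong (neighbours y) (λ z ->
   trans (∑-cong (neighbours a) (λ b -> ⟦⟧-cong (z ℕ.≟ ρ b) (b ℕ.≟ ρ⁻ z)
    (λ { refl -> sym (ρ⁻ρ b) }) (λ { refl -> sym (ρρ⁻ z) }))) (∑-neighbours-count a (ρ⁻ z))) ⟩
  ∑ (neighbours y) (λ z -> ⟦ adj? a (ρ⁻ z) ⟧) ∎
  where
  open ≡-Reasoning
  a = ρ⁻ y

 -- Switching: prescribing one more value

 record System (n : ℕ) : Set1 where
  field
   Ω : Set
   perms : List Ω
   at at⁻ : Ω -> ℕ -> ℕ
   at⁻-at : ∀ ω j -> at⁻ ω (at ω j) ≡ j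
   at-at⁻ : ∀ ω i -> at ω (at⁻ ω i) ≡ i
   at⁻-< : ∀ ω {i} -> i < n -> at⁻ ω i < n
   -- Uniformity enters the switching argument only through these two laws, for the permutation and
   -- for its inverse. The second one makes `contacts-bound` available for values as well as for
   -- positions.
   invariant : ∀ {w u} -> w < n -> u < n -> (F : (ℕ -> ℕ) -> ℕ) -> (∀ {ρ ρ'} -> ρ ≗ ρ' -> F ρ ≡ F ρ') ->
        ∑ perms (λ ω -> F (at ω ∘ swap w u)) ≡ ∑ perms (F ∘ at)
   invariant⁻ : ∀ {w u} -> w < n -> u < n -> (F : (ℕ -> ℕ) -> ℕ) -> (∀ {ρ ρ'} -> ρ ≗ ρ' -> F ρ ≡ F ρ') ->
         ∑ perms (λ ω -> F (at⁻ ω ∘ swap w u)) ≡ ∑ perms (F ∘ at⁻)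

  at-injective : ∀ ω {a b} -> at ω a ≡ at ω b -> a ≡ b
  at-injective ω eq = trans (sym (at⁻-at ω _)) (trans (cong (at⁻ ω) eq) (at⁻-at ω _))

  at⁻-injective : ∀ ω {a b} -> at⁻ ω a ≡ at⁻ ω b -> a ≡ b
  at⁻-injective ω eq = trans (sym (at-at⁻ ω _)) (trans (cong (at ω) eq) (at-at⁻ ω _))

 -- n (n - 1) ⋯ (n - t + 1)
 fall : ℕ -> ℕ -> ℕ
 fall n zero = 1
 fall n (suc t) = fall n t * (n ∸ t)

 module Exchange (N : ℕ) (sys : System (suc N)) where

  open System sys
  private n = suc N

  open Transpositions n perms at at-injective invariant public
  private
   module Dual = Transpositions n perms at⁻ at⁻-injective invariant⁻

  few? : ∀ D x ρ -> Dec (extras N D ρ ≤ x)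
  few? D x ρ = extras N D ρ ℕ.≤? x

  #A : List Cell -> ℕ -> Assignment -> ℕ
  #A D x τ = ∑ perms (λ ω -> ⟦ sat? (at ω) τ ⟧ * ⟦ few? D x (at ω) ⟧)

  #A-≤-#S : ∀ D x τ -> #A D x τ ≤ #S τ
  #A-≤-#S D x τ = ∑-mono perms (λ ω -> ≤≡ (*-monoʳ-≤ ⟦ sat? (at ω) τ ⟧ (⟦⟧≤1 (few? D x (at ω)))) (*-identityʳ _))

  private
   sat-swap : ∀ {ρ w u v τ} -> w ∉ dom τ -> v ∉ ran τ ->
    ⟦ free? τ u ⟧ * ⟦ sat? (ρ ∘ swap w u) ((w , v) ∷ τ) ⟧ ≡ ⟦ sat? ρ τ ⟧ * ⟦ ρ u ℕ.≟ v ⟧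
   sat-swap {ρ} {w} {u} {v} {τ} w∉ v∉ = trans (sym (⟦⟧-× (free? τ u) (sat? (ρ ∘ swap w u) ((w , v) ∷ τ))))
    (trans (⟦⟧-cong (free? τ u ×-dec sat? (ρ ∘ swap w u) ((w , v) ∷ τ)) (sat? ρ τ ×-dec (ρ u ℕ.≟ v))
     (λ { (u∉ , eq ∷ s) -> Sat-resp τ (λ j∈ -> cong ρ (fixed u∉ j∈)) s , trans (cong ρ (sym (swap-left w u))) eq })
     (λ (s , eq) -> let u∉ = λ u∈ -> v∉ (subst (_∈ ran τ) eq (Sat-ran s u∈)) in
      u∉ , trans (cong ρ (swap-left w u)) eq ∷ Sat-resp τ (λ j∈ -> cong ρ (sym (fixed u∉ j∈))) s))
    (⟦⟧-× (sat? ρ τ) (ρ u ℕ.≟ v)))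
    where
    fixed : u ∉ dom τ -> ∀ {j} -> j ∈ dom τ -> swap w u j ≡ j
    fixed u∉ j∈ = swap-other (λ { refl -> w∉ j∈ }) (λ { refl -> u∉ j∈ })

   pick : ∀ ω {v} (g : ℕ -> ℕ) -> v < n -> ∑ (upTo n) (λ u -> ⟦ at ω u ℕ.≟ v ⟧ * g u) ≡ g (at⁻ ω v)
   pick ω {v} g v<n = begin
    ∑ (upTo n) (λ u -> ⟦ at ω u ℕ.≟ v ⟧ * g u) ≡⟨ ∑-cong (upTo n) (λ u ->
     trans (cong (_* g u) (⟦⟧-cong (at ω u ℕ.≟ v) (u ℕ.≟ at⁻ ω v) (λ { refl -> sym (at⁻-at ω u) }) (λ { refl -> at-at⁻ ω v })))
        (⟦⟧*-≡ (u ℕ.≟ at⁻ ω v) (cong g))) ⟩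
    ∑ (upTo n) (λ u -> ⟦ u ℕ.≟ at⁻ ω v ⟧ * g (at⁻ ω v)) ≡⟨ ∑-*ʳ (upTo n) (g (at⁻ ω v)) (λ u -> ⟦ u ℕ.≟ at⁻ ω v ⟧) ⟩
    ∑ (upTo n) (λ u -> ⟦ u ℕ.≟ at⁻ ω v ⟧) * g (at⁻ ω v) ≡⟨ cong (_* g (at⁻ ω v)) (≡?-count n (at⁻-< ω v<n)) ⟩
    1 * g (at⁻ ω v) ≡⟨ *-identityˡ _ ⟩
    g (at⁻ ω v) ∎
    where open ≡-Reasoning

  -- A permutation satisfying τ arises from exactly one that moreover has value v at w, by
  -- exchanging the values at w and at a free position u.
  transfer : ∀ {w v τ} -> w < n -> v < n -> w ∉ dom τ -> v ∉ ran τ ->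
   (G : (ℕ -> ℕ) -> ℕ -> ℕ) -> (∀ {ρ ρ'} -> ρ ≗ ρ' -> ∀ u -> G ρ u ≡ G ρ' u) ->
   ∑ (upTo n) (λ u -> ⟦ free? τ u ⟧ * ∑ perms (λ ω -> ⟦ sat? (at ω) ((w , v) ∷ τ) ⟧ * G (at ω ∘ swap w u) u))
   ≡ ∑ perms (λ ω -> ⟦ sat? (at ω) τ ⟧ * G (at ω) (at⁻ ω v))
  transfer {w} {v} {τ} w<n v<n w∉ v∉ G G-resp = begin
   ∑ (upTo n) (λ u -> ⟦ free? τ u ⟧ * ∑ perms (λ ω -> ⟦ sat? (at ω) τ' ⟧ * G (at ω ∘ swap w u) u))
    ≡⟨ ∑-cong-∈ (upTo n) (λ {u} u∈ -> begin
     ⟦ free? τ u ⟧ * ∑ perms (λ ω -> ⟦ sat? (at ω) τ' ⟧ * G (at ω ∘ swap w u) u)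
      ≡⟨ cong (⟦ free? τ u ⟧ *_) (∑-cong perms (λ ω -> cong (_* G (at ω ∘ swap w u) u)
         (sat-resp (λ j -> cong (at ω) (sym (swap-involutive w u j)))))) ⟩
     ⟦ free? τ u ⟧ * ∑ perms (λ ω -> H u (at ω ∘ swap w u))
      ≡⟨ cong (⟦ free? τ u ⟧ *_) (invariant w<n (∈-upTo⁻ u∈) (H u) (λ eq -> cong₂ _*_ (sat-resp (eq ∘ swap w u)) (G-resp eq u))) ⟩
     ⟦ free? τ u ⟧ * ∑ perms (λ ω -> H u (at ω))
      ≡⟨ ∑-*ˡ perms ⟦ free? τ u ⟧ (λ ω -> H u (at ω)) ⟨
     ∑ perms (λ ω -> ⟦ free? τ u ⟧ * H u (at ω))
      ≡⟨ ∑-cong perms (λ ω -> trans (sym (*-assoc ⟦ free? τ u ⟧ _ _))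
         (trans (cong (_* G (at ω) u) (sat-swap {at ω} w∉ v∉)) (*-assoc ⟦ sat? (at ω) τ ⟧ _ _))) ⟩
     ∑ perms (λ ω -> ⟦ sat? (at ω) τ ⟧ * (⟦ at ω u ℕ.≟ v ⟧ * G (at ω) u)) ∎) ⟩
   ∑ (upTo n) (λ u -> ∑ perms (λ ω -> ⟦ sat? (at ω) τ ⟧ * (⟦ at ω u ℕ.≟ v ⟧ * G (at ω) u)))
    ≡⟨ ∑-swap (upTo n) perms _ ⟩
   ∑ perms (λ ω -> ∑ (upTo n) (λ u -> ⟦ sat? (at ω) τ ⟧ * (⟦ at ω u ℕ.≟ v ⟧ * G (at ω) u)))
    ≡⟨ ∑-cong perms (λ ω -> trans (∑-*ˡ (upTo n) ⟦ sat? (at ω) τ ⟧ (λ u -> ⟦ at ω u ℕ.≟ v ⟧ * G (at ω) u))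
       (cong (⟦ sat? (at ω) τ ⟧ *_) (pick ω (G (at ω)) v<n))) ⟩
   ∑ perms (λ ω -> ⟦ sat? (at ω) τ ⟧ * G (at ω) (at⁻ ω v)) ∎
   where
   open ≡-Reasoning
   τ' = (w , v) ∷ τ
   sat-resp : ∀ {ρ ρ'} -> ρ ≗ ρ' -> ⟦ sat? ρ τ' ⟧ ≡ ⟦ sat? ρ' τ' ⟧
   sat-resp {ρ} {ρ'} eq = ⟦⟧-cong (sat? ρ τ') (sat? ρ' τ') (Sat-resp τ' (λ {j} _ -> eq j)) (Sat-resp τ' (λ {j} _ -> sym (eq j)))
   H : ℕ -> (ℕ -> ℕ) -> ℕ
   H u ρ = ⟦ sat? (ρ ∘ swap w u) τ' ⟧ * G ρ u

  few-resp : ∀ D x {ρ ρ'} -> ρ ≗ ρ' -> ⟦ few? D x ρ ⟧ ≡ ⟦ few? D x ρ' ⟧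
  few-resp D x eq = cong (λ k -> ⟦ k ℕ.≤? x ⟧) (extras-resp N D eq)

  contacts-resp : ∀ {ρ ρ'} -> ρ ≗ ρ' -> ∀ a -> contacts ρ a ≡ contacts ρ' a
  contacts-resp eq a = ∑-cong (neighbours a) (λ b -> cong₂ (λ x y -> ⟦ adj? x y ⟧) (eq a) (eq b))

  #S-step : ∀ {w v τ} -> w < n -> v < n -> w ∉ dom τ -> v ∉ ran τ -> freeCount n τ * #S ((w , v) ∷ τ) ≡ #S τ
  #S-step {w} {v} {τ} w<n v<n w∉ v∉ = begin
   freeCount n τ * #S τ' ≡⟨ ∑-*ʳ (upTo n) (#S τ') (λ u -> ⟦ free? τ u ⟧) ⟨
   ∑ (upTo n) (λ u -> ⟦ free? τ u ⟧ * #S τ') ≡⟨ ∑-cong (upTo n) (λ u -> cong (⟦ free? τ u ⟧ *_)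
    (∑-cong perms (λ ω -> sym (*-identityʳ _)))) ⟩
   ∑ (upTo n) (λ u -> ⟦ free? τ u ⟧ * ∑ perms (λ ω -> ⟦ sat? (at ω) τ' ⟧ * 1))
                    ≡⟨ transfer w<n v<n w∉ v∉ (λ _ _ -> 1) (λ _ _ -> refl) ⟩
   ∑ perms (λ ω -> ⟦ sat? (at ω) τ ⟧ * 1) ≡⟨ ∑-cong perms (λ ω -> *-identityʳ _) ⟩
   #S τ ∎
   where
   open ≡-Reasoning
   τ' = (w , v) ∷ τ

  private
   flip' : Assignment -> Assignment
   flip' = map (λ (j , i) -> i , j)

   dom-flip : ∀ τ -> dom (flip' τ) ≡ ran τ
   dom-flip [] = refl
   dom-flip (c ∷ τ) = cong (_ ∷_) (dom-flip τ)

   sat-flip : ∀ ω τ -> ⟦ sat? (at ω) τ ⟧ ≡ ⟦ sat? (at⁻ ω) (flip' τ) ⟧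
   sat-flip ω τ = ⟦⟧-cong (sat? (at ω) τ) (sat? (at⁻ ω) (flip' τ)) (to τ) (from τ)
    where
    to : ∀ τ -> Sat (at ω) τ -> Sat (at⁻ ω) (flip' τ)
    to [] [] = []
    to (c ∷ τ) (refl ∷ s) = at⁻-at ω _ ∷ to τ s
    from : ∀ τ -> Sat (at⁻ ω) (flip' τ) -> Sat (at ω) τ
    from [] [] = []
    from (c ∷ τ) (refl ∷ s) = at-at⁻ ω _ ∷ from τ s

  contacts-bound⁻ : ∀ {τ v} -> Valid n τ -> v < n -> v ∉ ran τ ->
   (freeCount n τ ∸ 1) * ∑ perms (λ ω -> ⟦ sat? (at ω) τ ⟧ * contacts (at⁻ ω) v) ≤ 4 * #S τ
  contacts-bound⁻ {τ} {v} valid v<n v∉ = subst₂ _≤_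
   (cong₂ _*_ (cong (_∸ 1) (sym (+-cancelʳ-≡ (length τ) _ _ (trans (freeCount-+ n τ dom-< dom-unique)
     (sym (trans (cong (freeCount n (flip' τ) +_) (sym (List.length-map _ τ)))
      (freeCount-+ n (flip' τ) (subst (All (_< n)) (sym (dom-flip τ)) ran-<) (subst Unique (sym (dom-flip τ)) ran-unique))))))))
    (∑-cong perms (λ ω -> cong (_* contacts (at⁻ ω) v) (sym (sat-flip ω τ)))))
   (cong (4 *_) (∑-cong perms (λ ω -> sym (sat-flip ω τ))))
   (Dual.contacts-bound v<n (λ v∈ -> v∉ (subst (v ∈_) (dom-flip τ) v∈)))
   where open Valid valid

  private
   extras-mono : ∀ D {ρ ρ'} -> (∀ {i j} o -> i < N -> j < N -> (i , j , o) ∉ D -> Coin ρ (i , j , o) -> Coin ρ' (i , j , o)) ->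
         extras N D ρ ≤ extras N D ρ'
   extras-mono D {ρ} {ρ'} sub = ∑-mono-∈ (cells N) λ {(i , j , o)} c∈ -> let (i<N , j<N) = ∈-cells⁻ c∈ in
    ⟦⟧-mono (extra? D ρ (i , j , o)) (extra? D ρ' (i , j , o)) (λ (p , q) -> sub o i<N j<N q p , q)

   drop : ∀ {P Q : Set} (p : Dec P) (q : Dec Q) {a} -> (a ≡ 0 -> P -> Q) -> ⟦ p ⟧ ≤ ⟦ q ⟧ + a
   drop p q {zero} f = ≤-trans (⟦⟧-mono p q (f refl)) (m≤m+n _ 0)
   drop p q {suc a} f = ≤-trans (⟦⟧≤1 p) (≤-trans (s≤s z≤n) (m≤n+m _ ⟦ q ⟧))

   1≤0 : ∀ {a} {X : Set} -> 1 ≤ a -> a ≡ 0 -> X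
   1≤0 () refl

   -- If no coincidence of the exchanged permutation touches `w` or `u`, then all its coincidences
   -- were present before the exchange, and there are still few of them. Otherwise one of the two
   -- contact numbers is positive and pays for the loss.
   few-drop : ∀ D x ρ w u -> ⟦ few? D x ρ ⟧ ≤ ⟦ few? D x (ρ ∘ swap w u) ⟧ + (contacts (ρ ∘ swap w u) w + contacts (ρ ∘ swap w u) u)
   few-drop D x ρ w u = drop (few? D x ρ) (few? D x ρ') λ none few ->
    let noneʷ = ℕ.m+n≡0⇒m≡0 (contacts ρ' w) none ; noneᵘ = ℕ.m+n≡0⇒n≡0 (contacts ρ' w) none
        untouched : ∀ {i j} o -> Coin ρ' (i , j , o) -> ∀ {a} -> contacts ρ' a ≡ 0 -> j ≢ a × suc j ≢ a
        untouched o co z = (λ { refl -> 1≤0 (contacts-pos ρ' (inj₂ refl) (Coin-Adj o co)) z }) ,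
               (λ { refl -> 1≤0 (contacts-pos ρ' (inj₁ refl) (Adj-sym (Coin-Adj o co))) z })
    in ≤-trans (extras-mono D (λ {i} {j} o _ _ _ co ->
     let (j≢w , sj≢w) = untouched o co noneʷ ; (j≢u , sj≢u) = untouched o co noneᵘ in
     Coin-resp o (cong ρ (swap-other j≢w j≢u)) (cong ρ (swap-other sj≢w sj≢u)) co)) few
    where ρ' = ρ ∘ swap w u

  module _ {w v τ} (valid : Valid n ((w , v) ∷ τ)) (D : List Cell) (x : ℕ) where

   private
    open Valid valid
    τ' = (w , v) ∷ τ
    w<n = All.head dom-<
    v<n = All.head ran-<
    w∉ = Unique-head dom-unique
    v∉ = Unique-head ran-unique
    s = freeCount n τ

    s≡1+s' : s ≡ suc (freeCount n τ')
    s≡1+s' = +-cancelʳ-≡ (length τ) _ _ (trans (freeCount-+ n τ (All.tail dom-<) (AllPairs.tail dom-unique))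
     (sym (trans (sym (+-suc _ _)) (freeCount-+ n τ' dom-< dom-unique))))

    few-at-inverse : ∑ perms (λ ω -> ⟦ sat? (at ω) τ ⟧ * ⟦ few? D x (at ω) ⟧) ≡
     ∑ (upTo n) (λ u -> ⟦ free? τ u ⟧ * ∑ perms (λ ω -> ⟦ sat? (at ω) τ' ⟧ * ⟦ few? D x (at ω ∘ swap w u) ⟧))
    few-at-inverse = sym (transfer w<n v<n w∉ v∉ (λ ρ _ -> ⟦ few? D x ρ ⟧) (λ eq _ -> few-resp D x eq))

   -- `transfer` moves the contacts at the varying position `u` to the position of the value `v`,
   -- where `contacts-inverse` makes them contacts of the inverse at `v`. Each of the two error
   -- terms, at `w` and at `v`, is at most 4 / (s - 1) of `#S τ`.
   exchange-≤ : (s ∸ 1) * (s * #A D x τ') ≤ (s ∸ 1) * #A D x τ + 8 * #S τ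
   exchange-≤ = begin
    m * (s * #A D x τ') ≤⟨ *-monoʳ-≤ m main ⟩
    m * (#A D x τ + (Tʷ + Tᵛ)) ≡⟨ *-distribˡ-+ m (#A D x τ) _ ⟩
    m * #A D x τ + m * (Tʷ + Tᵛ) ≡⟨ cong (m * #A D x τ +_) (*-distribˡ-+ m Tʷ Tᵛ) ⟩
    m * #A D x τ + (m * Tʷ + m * Tᵛ) ≤⟨ +-monoʳ-≤ (m * #A D x τ)
     (+-mono-≤ (contacts-bound w<n w∉) (contacts-bound⁻ (Valid-tail valid) v<n v∉)) ⟩
    m * #A D x τ + (4 * #S τ + 4 * #S τ) ≡⟨ cong (m * #A D x τ +_) (ℕ.*-distribʳ-+ (#S τ) 4 4) ⟨
    m * #A D x τ + 8 * #S τ ∎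
    where
    open ≤-Reasoning
    m = s ∸ 1
    Tʷ = ∑ perms (λ ω -> ⟦ sat? (at ω) τ ⟧ * contacts (at ω) w)
    Tᵛ = ∑ perms (λ ω -> ⟦ sat? (at ω) τ ⟧ * contacts (at⁻ ω) v)
    G : (ℕ -> ℕ) -> ℕ -> ℕ
    G ρ u = ⟦ few? D x ρ ⟧ + (contacts ρ w + contacts ρ u)
    main : s * #A D x τ' ≤ #A D x τ + (Tʷ + Tᵛ)
    main = begin
     s * #A D x τ' ≡⟨ ∑-*ʳ (upTo n) (#A D x τ') (λ u -> ⟦ free? τ u ⟧) ⟨
     ∑ (upTo n) (λ u -> ⟦ free? τ u ⟧ * #A D x τ') ≤⟨ ∑-mono (upTo n) (λ u -> *-monoʳ-≤ ⟦ free? τ u ⟧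
      (∑-mono perms (λ ω -> *-monoʳ-≤ ⟦ sat? (at ω) τ' ⟧ (few-drop D x (at ω) w u)))) ⟩
     ∑ (upTo n) (λ u -> ⟦ free? τ u ⟧ * ∑ perms (λ ω -> ⟦ sat? (at ω) τ' ⟧ * G (at ω ∘ swap w u) u))
      ≡⟨ transfer w<n v<n w∉ v∉ G (λ eq u -> cong₂ _+_ (few-resp D x eq) (cong₂ _+_ (contacts-resp eq w) (contacts-resp eq u))) ⟩
     ∑ perms (λ ω -> ⟦ sat? (at ω) τ ⟧ * G (at ω) (at⁻ ω v)) ≡⟨ ∑-cong perms (λ ω ->
      trans (*-distribˡ-+ ⟦ sat? (at ω) τ ⟧ ⟦ few? D x (at ω) ⟧ _) (cong (⟦ sat? (at ω) τ ⟧ * ⟦ few? D x (at ω) ⟧ +_)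
       (trans (cong (λ z -> ⟦ sat? (at ω) τ ⟧ * (contacts (at ω) w + z)) (contacts-inverse (at⁻-at ω) (at-at⁻ ω) v))
        (*-distribˡ-+ ⟦ sat? (at ω) τ ⟧ (contacts (at ω) w) (contacts (at⁻ ω) v))))) ⟩
     ∑ perms (λ ω -> ⟦ sat? (at ω) τ ⟧ * ⟦ few? D x (at ω) ⟧ + (⟦ sat? (at ω) τ ⟧ * contacts (at ω) w + ⟦ sat? (at ω) τ ⟧ * contacts (at⁻ ω) v))
      ≡⟨ trans (∑-⊕ perms (λ ω -> ⟦ sat? (at ω) τ ⟧ * ⟦ few? D x (at ω) ⟧) _)
         (cong (#A D x τ +_) (∑-⊕ perms (λ ω -> ⟦ sat? (at ω) τ ⟧ * contacts (at ω) w) (λ ω -> ⟦ sat? (at ω) τ ⟧ * contacts (at⁻ ω) v))) ⟩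
     #A D x τ + (Tʷ + Tᵛ) ∎

   -- Positions next to w that are already assigned may only produce coincidences inside D.
   Closed : Set
   Closed = ∀ {ρ} -> Sat ρ τ' -> ∀ {i j} o -> Coin ρ (i , j , o) ->
        (j ≡ w × suc j ∈ dom τ) ⊎ (suc j ≡ w × j ∈ dom τ) -> (i , j , o) ∈ D

   -- Now the values are prescribed before the exchange, so contacts of `w` with assigned neighbours
   -- need not be rare; `closed` puts those coincidences into `D`, where they do not count. What
   -- remains are contacts of `w` with free neighbours (`E`) and contacts at the exchanged position
   -- `u` (`C`), both rare.
   exchange-≥ : Closed -> (s ∸ 2) * #A D x τ ≤ (s ∸ 2) * (s * #A D x τ') + 8 * #S τ
   exchange-≥ closed = begin
    m * #A D x τ ≤⟨ *-monoʳ-≤ m main ⟩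
    m * (s * #A D x τ' + (s * E + ∑ (upTo n) C)) ≡⟨ *-distribˡ-+ m (s * #A D x τ') _ ⟩
    m * (s * #A D x τ') + m * (s * E + ∑ (upTo n) C) ≤⟨ +-monoʳ-≤ (m * (s * #A D x τ')) (begin
     m * (s * E + ∑ (upTo n) C) ≡⟨ *-distribˡ-+ m (s * E) _ ⟩
     m * (s * E) + m * ∑ (upTo n) C ≡⟨ cong₂ _+_ (x∙yz≈y∙xz m s E) (sym (∑-*ˡ (upTo n) m C)) ⟩
     s * (m * E) + ∑ (upTo n) (λ u -> m * C u) ≤⟨ +-mono-≤ (*-monoʳ-≤ s E-bound)
      (≤≡ (∑-mono-∈ (upTo n) (λ u∈ -> C-bound (∈-upTo⁻ u∈))) (∑-*ʳ (upTo n) (4 * #S τ') (λ u -> ⟦ free? τ u ⟧))) ⟩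
     s * (4 * #S τ') + s * (4 * #S τ') ≡⟨ double s (#S τ') ⟩
     8 * (s * #S τ') ≡⟨ cong (8 *_) (#S-step w<n v<n w∉ v∉) ⟩
     8 * #S τ ∎) ⟩
    m * (s * #A D x τ') + 8 * #S τ ∎
    where
    open ≤-Reasoning
    x∙yz≈y∙xz : ∀ x y z -> x * (y * z) ≡ y * (x * z)
    x∙yz≈y∙xz = solve-∀
    double : ∀ s a -> s * (4 * a) + s * (4 * a) ≡ 8 * (s * a)
    double = solve-∀
    m = s ∸ 2
    m≡ : freeCount n τ' ∸ 1 ≡ m
    m≡ = cong (_∸ 2) (sym s≡1+s')
    near? : ∀ b -> Dec (b ∉ dom τ' × b < n)
    near? b = free? τ' b ×-dec (b ℕ.<? n)
    ext : (ℕ -> ℕ) -> ℕ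
    ext ρ = ∑ (neighbours w) (λ b -> ⟦ near? b ⟧ * ⟦ adj? (ρ b) (ρ w) ⟧)
    E = ∑ perms (λ ω -> ⟦ sat? (at ω) τ' ⟧ * ext (at ω))
    away? : ∀ u -> Dec (u ∉ dom τ × u ≢ w)
    away? u = free? τ u ×-dec ¬? (u ℕ.≟ w)
    K : ℕ -> ℕ
    K u = ∑ perms (λ ω -> ⟦ sat? (at ω) τ' ⟧ * contacts (at ω) u)
    C : ℕ -> ℕ
    C u = ⟦ away? u ⟧ * K u
    E-bound : m * E ≤ 4 * #S τ'
    E-bound = begin
     m * E ≡⟨ cong (m *_) (trans
      (∑-cong perms (λ ω -> trans (sym (∑-*ˡ (neighbours w) ⟦ sat? (at ω) τ' ⟧ (λ b -> ⟦ near? b ⟧ * ⟦ adj? (at ω b) (at ω w) ⟧)))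
       (∑-cong (neighbours w) (λ b -> x∙yz≈y∙xz ⟦ sat? (at ω) τ' ⟧ ⟦ near? b ⟧ ⟦ adj? (at ω b) (at ω w) ⟧))))
      (∑-swap perms (neighbours w) (λ ω b -> ⟦ near? b ⟧ * (⟦ sat? (at ω) τ' ⟧ * ⟦ adj? (at ω b) (at ω w) ⟧)))) ⟩
     m * ∑ (neighbours w) (λ b -> ∑ perms (λ ω -> ⟦ near? b ⟧ * (⟦ sat? (at ω) τ' ⟧ * ⟦ adj? (at ω b) (at ω w) ⟧)))
      ≡⟨ ∑-*ˡ (neighbours w) m (λ b -> ∑ perms (λ ω -> ⟦ near? b ⟧ * (⟦ sat? (at ω) τ' ⟧ * ⟦ adj? (at ω b) (at ω w) ⟧))) ⟨
     ∑ (neighbours w) (λ b -> m * ∑ perms (λ ω -> ⟦ near? b ⟧ * (⟦ sat? (at ω) τ' ⟧ * ⟦ adj? (at ω b) (at ω w) ⟧)))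
      ≤⟨ ∑-neighbours-≤ w _ (λ {b} b∈ -> begin
       m * ∑ perms (λ ω -> ⟦ near? b ⟧ * (⟦ sat? (at ω) τ' ⟧ * ⟦ adj? (at ω b) (at ω w) ⟧))
        ≡⟨ cong (m *_) (∑-*ˡ perms ⟦ near? b ⟧ (λ ω -> ⟦ sat? (at ω) τ' ⟧ * ⟦ adj? (at ω b) (at ω w) ⟧)) ⟩
       m * (⟦ near? b ⟧ * ∑ perms (λ ω -> ⟦ sat? (at ω) τ' ⟧ * ⟦ adj? (at ω b) (at ω w) ⟧))
        ≡⟨ x∙yz≈y∙xz m ⟦ near? b ⟧ _ ⟩
       ⟦ near? b ⟧ * (m * ∑ perms (λ ω -> ⟦ sat? (at ω) τ' ⟧ * ⟦ adj? (at ω b) (at ω w) ⟧))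
        ≤⟨ ⟦⟧*≤' (near? b) (λ (b∉ , b<n) -> subst (λ m -> m * ∑ perms (λ ω -> ⟦ sat? (at ω) τ' ⟧ * ⟦ adj? (at ω b) (at ω w) ⟧) ≤ 2 * #S τ') m≡
           (adjacent-values {τ'} b<n b∉ (Adj-≢ (neighbours-Adj w b∈) ∘ sym))) ⟩
       2 * #S τ' ∎) ⟩
     2 * (2 * #S τ') ≡⟨ *-assoc 2 2 (#S τ') ⟨
     4 * #S τ' ∎
    C-bound : ∀ {u} -> u < n -> m * C u ≤ ⟦ free? τ u ⟧ * (4 * #S τ')
    C-bound {u} u<n = begin
     m * (⟦ away? u ⟧ * K u) ≡⟨ x∙yz≈y∙xz m ⟦ away? u ⟧ (K u) ⟩
     ⟦ away? u ⟧ * (m * K u) ≤⟨ ⟦⟧*-≤ (away? u) (λ (u∉ , u≢w) ->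
      subst (λ m -> m * K u ≤ 4 * #S τ') m≡ (contacts-bound {τ'} u<n (λ { (here u≡w) -> u≢w u≡w ; (there u∈) -> u∉ u∈ }))) ⟩
     ⟦ away? u ⟧ * (4 * #S τ') ≤⟨ *-monoˡ-≤ (4 * #S τ') (⟦⟧-mono (away? u) (free? τ u) proj₁) ⟩
     ⟦ free? τ u ⟧ * (4 * #S τ') ∎
    few-drop' : ∀ ρ u -> ⟦ free? τ u ⟧ * (⟦ sat? ρ τ' ⟧ * ⟦ few? D x (ρ ∘ swap w u) ⟧) ≤
     ⟦ free? τ u ⟧ * (⟦ sat? ρ τ' ⟧ * ⟦ few? D x ρ ⟧ + ⟦ sat? ρ τ' ⟧ * ext ρ) + ⟦ away? u ⟧ * (⟦ sat? ρ τ' ⟧ * contacts ρ u)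
    few-drop' ρ u = begin
     f * (σ * ⟦ few? D x (ρ ∘ swap w u) ⟧) ≤⟨ ⟦⟧*-≤ (free? τ u) (λ u∉ -> ⟦⟧*-≤ (sat? ρ τ') (λ s -> core u∉ s)) ⟩
     f * (σ * (⟦ few? D x ρ ⟧ + (ext ρ + ⟦ ¬? (u ℕ.≟ w) ⟧ * contacts ρ u)))
                        ≡⟨ regroup f σ ⟦ few? D x ρ ⟧ (ext ρ) ⟦ ¬? (u ℕ.≟ w) ⟧ (contacts ρ u) ⟩
     f * (σ * ⟦ few? D x ρ ⟧ + σ * ext ρ) + f * ⟦ ¬? (u ℕ.≟ w) ⟧ * (σ * contacts ρ u)
      ≡⟨ cong (λ z -> f * (σ * ⟦ few? D x ρ ⟧ + σ * ext ρ) + z * (σ * contacts ρ u)) (⟦⟧-× (free? τ u) (¬? (u ℕ.≟ w))) ⟨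
     f * (σ * ⟦ few? D x ρ ⟧ + σ * ext ρ) + ⟦ away? u ⟧ * (σ * contacts ρ u) ∎
     where
     f = ⟦ free? τ u ⟧
     σ = ⟦ sat? ρ τ' ⟧
     regroup : ∀ f σ a b d k -> f * (σ * (a + (b + d * k))) ≡ f * (σ * a + σ * b) + f * d * (σ * k)
     regroup = solve-∀
     core : u ∉ dom τ -> Sat ρ τ' -> ⟦ few? D x (ρ ∘ swap w u) ⟧ ≤ ⟦ few? D x ρ ⟧ + (ext ρ + ⟦ ¬? (u ℕ.≟ w) ⟧ * contacts ρ u)
     core u∉ sat = case u ℕ.≟ w of λ where
        -- For `u ≡ w` nothing is exchanged. This case must be split off because `w` is assigned by
        -- `τ'`, so `contacts-bound` says nothing about it.
        (yes refl) -> ≡≤ (few-resp D x (λ j -> cong ρ (swap-self w j))) (m≤m+n _ _)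
        (no u≢w) -> drop (few? D x (ρ ∘ swap w u)) (few? D x ρ) λ none few ->
         let noneᴱ = ℕ.m+n≡0⇒m≡0 (ext ρ) none
             noneᵘ = trans (sym (trans (cong (_* contacts ρ u) (⟦⟧-yes (¬? (u ℕ.≟ w)) u≢w)) (*-identityˡ _))) (ℕ.m+n≡0⇒n≡0 (ext ρ) none)
         in ≤-trans (extras-mono D (λ {i} {j} o i<N j<N ∉D co ->
          let j≢u = λ { refl -> 1≤0 (contacts-pos ρ (inj₂ refl) (Coin-Adj o co)) noneᵘ }
              sj≢u = λ { refl -> 1≤0 (contacts-pos ρ (inj₁ refl) (Adj-sym (Coin-Adj o co))) noneᵘ }
              j≢w = λ { refl -> neighbour noneᴱ (s≤s j<N) (inj₂ refl) (Adj-sym (Coin-Adj o co))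
                     (λ sj∈ -> ∉D (closed sat o co (inj₁ (refl , sj∈)))) }
              sj≢w = λ { refl -> neighbour noneᴱ (m≤n⇒m≤1+n j<N) (inj₁ refl) (Coin-Adj o co)
                     (λ j∈ -> ∉D (closed sat o co (inj₂ (refl , j∈)))) }
          in Coin-resp o (cong ρ (sym (swap-other j≢w j≢u))) (cong ρ (sym (swap-other sj≢w sj≢u))) co)) few
      where
      swap-self : ∀ w j -> swap w w j ≡ j
      swap-self w j = case j ℕ.≟ w of λ where
       (yes refl) -> swap-left j j
       (no j≢w) -> swap-other j≢w j≢w
      neighbour : ext ρ ≡ 0 -> ∀ {b} -> b < n -> Adj w b -> Adj (ρ b) (ρ w) -> b ∉ dom τ -> ∀ {X : Set} -> X
      neighbour none {b} b<n w~b adj b∉ = 1≤0 (≤-trans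
       (≤-reflexive (sym (cong₂ _*_ (⟦⟧-yes (near? b) ((λ { (here b≡w) -> Adj-≢ w~b b≡w ; (there b∈) -> b∉ b∈ }) , b<n))
                 (⟦⟧-yes (adj? (ρ b) (ρ w)) adj))))
       (∑-member (λ b -> ⟦ near? b ⟧ * ⟦ adj? (ρ b) (ρ w) ⟧) (∈-neighbours w~b))) none
    main : #A D x τ ≤ s * #A D x τ' + (s * E + ∑ (upTo n) C)
    main = begin
     #A D x τ ≡⟨ few-at-inverse ⟩
     ∑ (upTo n) (λ u -> ⟦ free? τ u ⟧ * ∑ perms (λ ω -> ⟦ sat? (at ω) τ' ⟧ * ⟦ few? D x (at ω ∘ swap w u) ⟧))
      ≤⟨ ∑-mono (upTo n) (λ u -> begin
       ⟦ free? τ u ⟧ * ∑ perms (λ ω -> ⟦ sat? (at ω) τ' ⟧ * ⟦ few? D x (at ω ∘ swap w u) ⟧)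
        ≡⟨ ∑-*ˡ perms ⟦ free? τ u ⟧ (λ ω -> ⟦ sat? (at ω) τ' ⟧ * ⟦ few? D x (at ω ∘ swap w u) ⟧) ⟨
       ∑ perms (λ ω -> ⟦ free? τ u ⟧ * (⟦ sat? (at ω) τ' ⟧ * ⟦ few? D x (at ω ∘ swap w u) ⟧))
        ≤⟨ ∑-mono perms (λ ω -> few-drop' (at ω) u) ⟩
       ∑ perms (λ ω -> ⟦ free? τ u ⟧ * (A' ω + E' ω) + ⟦ away? u ⟧ * (⟦ sat? (at ω) τ' ⟧ * contacts (at ω) u))
        ≡⟨ trans (∑-⊕ perms (λ ω -> ⟦ free? τ u ⟧ * (A' ω + E' ω)) _) (cong₂ _+_
           (trans (∑-*ˡ perms ⟦ free? τ u ⟧ (λ ω -> A' ω + E' ω)) (cong (⟦ free? τ u ⟧ *_) (∑-⊕ perms A' E')))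
           (∑-*ˡ perms ⟦ away? u ⟧ (λ ω -> ⟦ sat? (at ω) τ' ⟧ * contacts (at ω) u))) ⟩
       ⟦ free? τ u ⟧ * (#A D x τ' + E) + C u ∎) ⟩
     ∑ (upTo n) (λ u -> ⟦ free? τ u ⟧ * (#A D x τ' + E) + C u) ≡⟨ ∑-⊕ (upTo n) (λ u -> ⟦ free? τ u ⟧ * (#A D x τ' + E)) C ⟩
     ∑ (upTo n) (λ u -> ⟦ free? τ u ⟧ * (#A D x τ' + E)) + ∑ (upTo n) C ≡⟨ cong (_+ ∑ (upTo n) C) (∑-*ʳ (upTo n) (#A D x τ' + E) (λ u -> ⟦ free? τ u ⟧)) ⟩
     s * (#A D x τ' + E) + ∑ (upTo n) C ≡⟨ regroup s (#A D x τ') E (∑ (upTo n) C) ⟩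
     s * #A D x τ' + (s * E + ∑ (upTo n) C) ∎
     where
     A' E' : Ω -> ℕ
     A' ω = ⟦ sat? (at ω) τ' ⟧ * ⟦ few? D x (at ω) ⟧
     E' ω = ⟦ sat? (at ω) τ' ⟧ * ext (at ω)
     regroup : ∀ s a e c -> s * (a + e) + c ≡ s * a + (s * e + c)
     regroup = solve-∀

 -- Permutations of `Fin n` as permutations of the natural numbers

 module _ {n : ℕ} where

  -- Being the identity from n on turns a permutation of `Fin n` into one of ℕ, so inverses and
  -- transpositions can be handled on plain numbers.
  extend : (Fin n -> Fin n) -> ℕ -> ℕ
  extend g j with j ℕ.<? n
  ... | yes j<n = toℕ (g (fromℕ< j<n))
  ... | no _ = j

  extend-toℕ : ∀ g (a : Fin n) -> extend g (toℕ a) ≡ toℕ (g a)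
  extend-toℕ g a with toℕ a ℕ.<? n
  ... | yes a<n = cong (toℕ ∘ g) (Fin.fromℕ<-toℕ a a<n)
  ... | no a≮n = absurd (Fin.toℕ<n a) a≮n

  extend-≥ : ∀ g {j} -> ¬ j < n -> extend g j ≡ j
  extend-≥ g {j} j≮n with j ℕ.<? n
  ... | yes j<n = absurd j<n j≮n
  ... | no _ = refl

  -- To prove something about all natural numbers, treat those of the form toℕ a and those ≥ n.
  by-range : (P : ℕ -> Set) -> (∀ a -> P (toℕ a)) -> (∀ {j} -> ¬ j < n -> P j) -> ∀ j -> P j
  by-range P below above j with j ℕ.<? n
  ... | yes j<n = subst P (Fin.toℕ-fromℕ< j<n) (below (fromℕ< j<n))
  ... | no j≮n = above j≮n

  extend-cong : ∀ {g h} -> g ≗ h -> extend g ≗ extend h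
  extend-cong {g} {h} eq = by-range _
   (λ a -> trans (extend-toℕ g a) (trans (cong toℕ (eq a)) (sym (extend-toℕ h a))))
   (λ j≮n -> trans (extend-≥ g j≮n) (sym (extend-≥ h j≮n)))

  extend-∘ : ∀ g h -> extend (g ∘ h) ≗ extend g ∘ extend h
  extend-∘ g h = by-range _
   (λ a -> trans (extend-toℕ (g ∘ h) a) (sym (trans (cong (extend g) (extend-toℕ h a)) (extend-toℕ g (h a)))))
   (λ j≮n -> trans (extend-≥ (g ∘ h) j≮n) (sym (trans (cong (extend g) (extend-≥ h j≮n)) (extend-≥ g j≮n))))

  extend-id : ∀ g -> (∀ a -> g a ≡ a) -> ∀ j -> extend g j ≡ j
  extend-id g eq = by-range _ (λ a -> trans (extend-toℕ g a) (cong toℕ (eq a))) (extend-≥ g)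

  extend-< : ∀ g {j} -> j < n -> extend g j < n
  extend-< g {j} j<n = subst (_< n) (trans (sym (extend-toℕ g (fromℕ< j<n))) (cong (extend g) (Fin.toℕ-fromℕ< j<n))) (Fin.toℕ<n _)

  private
   module Fin-swap = Transposition (Fin._≟_ {n})

   extend-swap : ∀ a b -> extend (Fin-swap.swap a b) ≗ swap (toℕ a) (toℕ b)
   extend-swap a b = by-range _
    (λ c -> trans (extend-toℕ (Fin-swap.swap a b) c) (case c Fin.≟ a of λ where
     (yes refl) -> trans (cong toℕ (Fin-swap.swap-left c b)) (sym (swap-left (toℕ c) (toℕ b)))
     (no c≢a) -> case c Fin.≟ b of λ where
      (yes refl) -> trans (cong toℕ (Fin-swap.swap-right a c)) (sym (swap-right (toℕ a) (toℕ c)))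
      (no c≢b) -> trans (cong toℕ (Fin-swap.swap-other c≢a c≢b)) (sym (swap-other (c≢a ∘ Fin.toℕ-injective) (c≢b ∘ Fin.toℕ-injective)))))
    (λ j≮n -> trans (extend-≥ (Fin-swap.swap a b) j≮n)
     (sym (swap-other (λ { refl -> j≮n (Fin.toℕ<n a) }) (λ { refl -> j≮n (Fin.toℕ<n b) }))))

   swap⤖ : Fin n -> Fin n -> HamiltonianPath n
   swap⤖ a b = mkBijection (Fin-swap.swap a b) (Fin-swap.swap a b) (Fin-swap.swap-involutive a b) (Fin-swap.swap-involutive a b)

   paths = hamiltonianPaths n

   invariance : (Φ : HamiltonianPath n -> HamiltonianPath n) ->
    (∀ {f g} -> Bijection.to g ≗ Bijection.to (Φ f) -> Bijection.to f ≗ Bijection.to (Φ g)) ->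
    (F : HamiltonianPath n -> ℕ) -> (∀ {f g} -> Bijection.to f ≗ Bijection.to g -> F f ≡ F g) ->
    ∑ paths (F ∘ Φ) ≡ ∑ paths F
   invariance Φ sym-Φ = reindex (⤖-≗? searchFin searchFin) (⤖-≗? searchFin searchFin) paths paths
    (hamiltonianPaths-enumerates n) (hamiltonianPaths-enumerates n) Φ Φ (λ {f} {g} -> sym-Φ {f} {g})
    (λ {f} {g} -> sym-Φ {g} {f})

   inverse-cong : ∀ {f g : HamiltonianPath n} -> Bijection.to f ≗ Bijection.to g -> inverse f ≗ inverse g
   inverse-cong {f} {g} eq b = Bijection.injective g (trans (sym (eq (inverse f b))) (trans (to-inverse f b) (sym (to-inverse g b))))

  permutationSystem : System n
  permutationSystem = record
   { Ω = HamiltonianPath n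
   ; perms = paths
   ; at = at
   ; at⁻ = at⁻
   ; at⁻-at = λ f j -> trans (sym (extend-∘ (inverse f) (Bijection.to f) j)) (extend-id _ (inverse-to f) j)
   ; at-at⁻ = λ f j -> trans (sym (extend-∘ (Bijection.to f) (inverse f) j)) (extend-id _ (to-inverse f) j)
   ; at⁻-< = λ f -> extend-< (inverse f)
   ; invariant = λ {w} {u} w<n u<n F F-resp -> trans
     (∑-cong paths (λ f -> F-resp (λ j -> sym (trans (extend-∘ (Bijection.to f) (Fin-swap.swap (fromℕ< w<n) (fromℕ< u<n)) j)
      (cong (at f) (trans (extend-swap (fromℕ< w<n) (fromℕ< u<n) j) (cong₂ (λ a b -> swap a b j) (Fin.toℕ-fromℕ< w<n) (Fin.toℕ-fromℕ< u<n))))))))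
     (invariance (_∘⤖ swap⤖ (fromℕ< w<n) (fromℕ< u<n))
      (λ {f} {g} eq a -> trans (cong (Bijection.to f) (sym (Fin-swap.swap-involutive _ _ a))) (sym (eq (Fin-swap.swap _ _ a))))
      (F ∘ at) (λ eq -> F-resp (extend-cong eq)))
   ; invariant⁻ = λ {w} {u} w<n u<n F F-resp -> trans
     (∑-cong paths (λ f -> F-resp (λ j -> sym (trans (extend-∘ (inverse f) (Fin-swap.swap (fromℕ< w<n) (fromℕ< u<n)) j)
      (cong (at⁻ f) (trans (extend-swap (fromℕ< w<n) (fromℕ< u<n) j) (cong₂ (λ a b -> swap a b j) (Fin.toℕ-fromℕ< w<n) (Fin.toℕ-fromℕ< u<n))))))))
     (invariance (swap⤖ (fromℕ< w<n) (fromℕ< u<n) ∘⤖_)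
      (λ {f} {g} eq a -> trans (sym (Fin-swap.swap-involutive _ _ (Bijection.to f a))) (cong (Fin-swap.swap _ _) (sym (eq a))))
      (F ∘ at⁻) (λ {f} {g} eq -> F-resp (extend-cong (inverse-cong {f} {g} eq))))
   }
   where
   at at⁻ : HamiltonianPath n -> ℕ -> ℕ
   at f = extend (Bijection.to f)
   at⁻ f = extend (inverse f)

 -- Prescribing several values in succession

 fall-! : ∀ n t -> t ≤ n -> fall n t * (n ∸ t) ! ≡ n !
 fall-! n zero _ = *-identityˡ _
 fall-! n (suc t) t<n = begin
  fall n t * (n ∸ t) * (n ∸ suc t) ! ≡⟨ *-assoc (fall n t) _ _ ⟩
  fall n t * ((n ∸ t) * (n ∸ suc t) !) ≡⟨ cong (λ k -> fall n t * (k * (n ∸ suc t) !)) (ℕ.+-∸-assoc 1 t<n) ⟩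
  fall n t * (suc (n ∸ suc t) * (n ∸ suc t) !) ≡⟨ cong (λ k -> fall n t * k !) (ℕ.+-∸-assoc 1 t<n) ⟨
  fall n t * (n ∸ t) ! ≡⟨ fall-! n t (ℕ.<⇒≤ t<n) ⟩
  n ! ∎
  where open ≡-Reasoning

 -- Every coincidence forced by `τ` lies in `D`. Unlike `Closed` this does not single out the entry
 -- assigned last, and it passes to tails, as the induction along `τ` requires.
 PairClosed : List Cell -> Assignment -> Set
 PairClosed D τ = ∀ {i j} -> ((j , i) ∈ τ -> (suc j , suc i) ∈ τ -> (i , j , true) ∈ D) ×
          ((j , suc i) ∈ τ -> (suc j , i) ∈ τ -> (i , j , false) ∈ D)

 module Counting (N : ℕ) where

  private n = suc N

  open System (permutationSystem {n}) public
  open Exchange N permutationSystem public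

  freeCount≡ : ∀ {τ} -> Valid n τ -> freeCount n τ ≡ n ∸ length τ
  freeCount≡ {τ} valid = trans (sym (ℕ.m+n∸n≡m _ (length τ))) (cong (_∸ length τ) (freeCount-+ n τ dom-< dom-unique))
   where open Valid valid

  fall-#S : ∀ τ -> Valid n τ -> fall n (length τ) * #S τ ≡ #S []
  fall-#S [] _ = *-identityˡ _
  fall-#S ((w , v) ∷ τ) valid = begin
   fall n (length τ) * (n ∸ length τ) * #S ((w , v) ∷ τ) ≡⟨ *-assoc (fall n (length τ)) _ _ ⟩
   fall n (length τ) * ((n ∸ length τ) * #S ((w , v) ∷ τ)) ≡⟨ cong (λ s -> fall n (length τ) * (s * #S ((w , v) ∷ τ))) (freeCount≡ (Valid-tail valid)) ⟨
   fall n (length τ) * (freeCount n τ * #S ((w , v) ∷ τ)) ≡⟨ cong (fall n (length τ) *_)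
    (#S-step (All.head dom-<) (All.head ran-<) (Unique-head dom-unique) (Unique-head ran-unique)) ⟩
   fall n (length τ) * #S τ ≡⟨ fall-#S τ (Valid-tail valid) ⟩
   #S [] ∎
   where
   open ≡-Reasoning
   open Valid valid

  private
   identity : Assignment
   identity = map (λ j -> j , j) (upTo n)

   dom-identity : dom identity ≡ upTo n
   dom-identity = trans (sym (List.map-∘ (upTo n))) (List.map-id (upTo n))

   ran-identity : ran identity ≡ upTo n
   ran-identity = trans (sym (List.map-∘ (upTo n))) (List.map-id (upTo n))

   identity-valid : Valid n identity
   identity-valid = record
    { dom-< = subst (All (_< n)) (sym dom-identity) below
    ; ran-< = subst (All (_< n)) (sym ran-identity) below
    ; dom-unique = subst Unique (sym dom-identity) (Unique.upTo⁺ n)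
    ; ran-unique = subst Unique (sym ran-identity) (Unique.upTo⁺ n)
    }
    where
    below : All (_< n) (upTo n)
    below = All.tabulate ∈-upTo⁻

   id⤖ : HamiltonianPath n
   id⤖ = mkBijection id id (λ _ -> refl) (λ _ -> refl)

   #S-identity : #S identity ≡ 1
   #S-identity = trans (∑-cong perms (λ f -> ⟦⟧-cong (sat? (at f) identity) (⤖-≗? searchFin searchFin f id⤖)
    (λ s a -> Fin.toℕ-injective (trans (sym (extend-toℕ (Bijection.to f) a))
     (All.lookup s (∈-map⁺ (λ j -> j , j) (∈-upTo⁺ (Fin.toℕ<n a))))))
    (λ eq -> All.map⁺ (All.tabulate {xs = upTo n} λ {j} _ -> extend-id (Bijection.to f) eq j))))
    (hamiltonianPaths-enumerates n id⤖)

  -- Exactly one permutation satisfies the assignment that fixes every value as in the identity;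
  -- `fall-#S` leads back from it to the empty assignment.
  #S-[] : #S [] ≡ n !
  #S-[] = begin
   #S [] ≡⟨ fall-#S identity identity-valid ⟨
   fall n (length identity) * #S identity ≡⟨ cong₂ _*_ (cong (fall n) (trans (List.length-map _ (upTo n)) (length-upTo n))) #S-identity ⟩
   fall n n * 1 ≡⟨ cong (λ k -> fall n n * k !) (ℕ.n∸n≡0 n) ⟨
   fall n n * (n ∸ n) ! ≡⟨ fall-! n n ≤-refl ⟩
   n ! ∎
   where open ≡-Reasoning

  length-perms : length perms ≡ n !
  length-perms = trans (trans (sym (*-identityʳ _)) (trans (sym (∑-const perms 1)) (∑-cong perms (λ ω -> sym (⟦⟧-yes (sat? (at ω) []) []))))) #S-[]

  private
   -- An estimate m (X - Y) ≤ Z survives a smaller multiplier, as only X ≥ Y is in question. It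
   -- replaces the multipliers of successive exchanges, which shrink with the number of free
   -- positions, by one common `q`.
   weaken : ∀ {q m} X Y Z -> q ≤ m -> m * X ≤ m * Y + Z -> q * X ≤ q * Y + Z
   weaken {q} {m} X Y Z q≤m le = case ℕ.≤-total X Y of λ where
    (inj₁ X≤Y) -> ≤-trans (*-monoʳ-≤ q X≤Y) (m≤m+n _ Z)
    (inj₂ Y≤X) -> let d = X ∸ Y ; X≡ = sym (ℕ.m+[n∸m]≡n Y≤X) in subst (λ X -> q * X ≤ q * Y + Z) (sym X≡)
     (≡≤ (*-distribˡ-+ q Y d) (+-monoʳ-≤ (q * Y) (≤-trans (*-monoˡ-≤ d q≤m)
      (ℕ.+-cancelˡ-≤ (m * Y) _ _ (subst (_≤ m * Y + Z) (trans (cong (m *_) X≡) (*-distribˡ-+ m Y d)) le)))))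

   pair∈ : ∀ {ρ} {τ : Assignment} {u i} -> Sat ρ τ -> u ∈ dom τ -> ρ u ≡ i -> (u , i) ∈ τ
   pair∈ s u∈ refl = Sat⇒∈ s u∈

   PairClosed⇒Closed : ∀ {c τ D x} (valid : Valid n (c ∷ τ)) -> PairClosed D (c ∷ τ) -> Closed valid D x
   PairClosed⇒Closed valid closed sat true (p , q) (inj₁ (refl , sj∈)) = proj₁ closed (pair∈ sat (here refl) p) (pair∈ sat (there sj∈) q)
   PairClosed⇒Closed valid closed sat true (p , q) (inj₂ (refl , j∈)) = proj₁ closed (pair∈ sat (there j∈) p) (pair∈ sat (here refl) q)
   PairClosed⇒Closed valid closed sat false (p , q) (inj₁ (refl , sj∈)) = proj₂ closed (pair∈ sat (here refl) p) (pair∈ sat (there sj∈) q)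
   PairClosed⇒Closed valid closed sat false (p , q) (inj₂ (refl , j∈)) = proj₂ closed (pair∈ sat (there j∈) p) (pair∈ sat (here refl) q)

   PairClosed-tail : ∀ {c τ D} -> PairClosed D (c ∷ τ) -> PairClosed D τ
   PairClosed-tail closed = (λ a b -> proj₁ closed (there a) (there b)) , (λ a b -> proj₂ closed (there a) (there b))

   sx∸ : ∀ {q l} -> suc (q + suc l) ≤ n -> q ≤ n ∸ l ∸ 2
   sx∸ {q} {l} le = subst (q ≤_) (sym (ℕ.∸-+-assoc n l 2)) (ℕ.m+n≤o⇒m≤o∸n q (subst (_≤ n) (shift q l) le))
    where
    shift : ∀ q l -> suc (q + suc l) ≡ q + (l + 2)
    shift = solve-∀

  module _ (D : List Cell) (x : ℕ) where

   private
    regroup1 : ∀ q f s a -> q * (f * s * a) ≡ f * (q * (s * a))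
    regroup1 = solve-∀
    regroup2 : ∀ f q a b -> f * (q * a + 8 * b) ≡ q * (f * a) + 8 * (f * b)
    regroup2 = solve-∀
    regroup3 : ∀ q a t b -> q * a + 8 * t * b + 8 * b ≡ q * a + 8 * suc t * b
    regroup3 = solve-∀
    regroup₄ : ∀ f q s a b -> f * (q * (s * a) + 8 * b) ≡ q * (f * s * a) + 8 * (f * b)
    regroup₄ = solve-∀
    regroup₅ : ∀ f q a -> q * (f * a) ≡ f * (q * a)
    regroup₅ = solve-∀
    regroup₆ : ∀ a t b -> a + 8 * b + 8 * t * b ≡ a + 8 * suc t * b
    regroup₆ = solve-∀

   -- Chains the exchanges, each at a cost of 8 / q. In terms of probabilities: given `τ`, the
   -- chance of at most `x` coincidences outside `D` exceeds the unconditional one by at most 8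
   -- (length τ) / q. `assign-≥` is the converse for pair-closed assignments.
   assign-≤ : ∀ q τ -> Valid n τ -> suc (q + length τ) ≤ n ->
    q * (fall n (length τ) * #A D x τ) ≤ q * #A D x [] + 8 * length τ * #S []
   assign-≤ q [] _ _ = ≡≤ (cong (q *_) (*-identityˡ _)) (m≤m+n _ _)
   assign-≤ q τ'@((w , v) ∷ τ) valid le = begin
    q * (f * (n ∸ length τ) * #A D x τ') ≡⟨ regroup1 q f (n ∸ length τ) _ ⟩
    f * (q * ((n ∸ length τ) * #A D x τ')) ≡⟨ cong (λ s -> f * (q * (s * #A D x τ'))) s≡ ⟨
    f * (q * (freeCount n τ * #A D x τ')) ≤⟨ *-monoʳ-≤ f (weaken (freeCount n τ * #A D x τ') (#A D x τ) (8 * #S τ)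
     (≤-trans (sx∸ le) (≡≤ (cong (_∸ 2) (sym s≡)) (ℕ.∸-monoʳ-≤ (freeCount n τ) (s≤s (z≤n {1}))))) (exchange-≤ valid D x)) ⟩
    f * (q * #A D x τ + 8 * #S τ) ≡⟨ regroup2 f q _ _ ⟩
    q * (f * #A D x τ) + 8 * (f * #S τ) ≤⟨ +-mono-≤ (assign-≤ q τ (Valid-tail valid) (≤-trans (s≤s (+-monoʳ-≤ q (n≤1+n _))) le))
                  (≤-reflexive (cong (8 *_) (fall-#S τ (Valid-tail valid)))) ⟩
    q * #A D x [] + 8 * length τ * #S [] + 8 * #S [] ≡⟨ regroup3 q (#A D x []) (length τ) (#S []) ⟩
    q * #A D x [] + 8 * suc (length τ) * #S [] ∎
    where
    open ≤-Reasoning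
    f = fall n (length τ)
    s≡ = freeCount≡ (Valid-tail valid)

   assign-≥ : ∀ q τ -> Valid n τ -> PairClosed D τ -> suc (q + length τ) ≤ n ->
    q * #A D x [] ≤ q * (fall n (length τ) * #A D x τ) + 8 * length τ * #S []
   assign-≥ q [] _ _ _ = ≡≤ (cong (q *_) (sym (*-identityˡ _))) (m≤m+n _ _)
   assign-≥ q τ'@((w , v) ∷ τ) valid closed le = begin
    q * #A D x [] ≤⟨ assign-≥ q τ (Valid-tail valid) (PairClosed-tail {D = D} closed)
                        (≤-trans (s≤s (+-monoʳ-≤ q (n≤1+n _))) le) ⟩
    q * (f * #A D x τ) + 8 * length τ * #S [] ≡⟨ cong (_+ 8 * length τ * #S []) (regroup₅ f q _) ⟩
    f * (q * #A D x τ) + 8 * length τ * #S [] ≤⟨ +-monoˡ-≤ _ (*-monoʳ-≤ f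
     (weaken (#A D x τ) (freeCount n τ * #A D x τ') (8 * #S τ) (≤≡ (sx∸ le) (cong (_∸ 2) (sym s≡)))
      (exchange-≥ valid D x (λ s o -> PairClosed⇒Closed {D = D} {x = x} valid closed s o)))) ⟩
    f * (q * (freeCount n τ * #A D x τ') + 8 * #S τ) + 8 * length τ * #S []
                       ≡⟨ cong (_+ 8 * length τ * #S []) (regroup₄ f q (freeCount n τ) _ _) ⟩
    q * (f * freeCount n τ * #A D x τ') + 8 * (f * #S τ) + 8 * length τ * #S []
     ≡⟨ cong₂ (λ s S -> q * (f * s * #A D x τ') + 8 * S + 8 * length τ * #S []) s≡ (fall-#S τ (Valid-tail valid)) ⟩
    q * (f * (n ∸ length τ) * #A D x τ') + 8 * #S [] + 8 * length τ * #S []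
                       ≡⟨ regroup₆ (q * (f * (n ∸ length τ) * #A D x τ')) (length τ) (#S []) ⟩
    q * (f * (n ∸ length τ) * #A D x τ') + 8 * suc (length τ) * #S [] ∎
    where
    open ≤-Reasoning
    f = fall n (length τ)
    s≡ = freeCount≡ (Valid-tail valid)

 -- Stein-Chen recursion for the number of coincidences

 cells-unique : ∀ N -> Unique (cells N)
 cells-unique N = Unique.cartesianProduct⁺ (Unique.upTo⁺ N)
  (Unique.cartesianProduct⁺ (Unique.upTo⁺ N) (((λ ()) ∷ []) ∷ [] ∷ []))

 length-cartesianProduct : {A B : Set} (xs : List A) (ys : List B) -> length (cartesianProduct xs ys) ≡ length xs * length ys
 length-cartesianProduct [] ys = refl
 length-cartesianProduct (x ∷ xs) ys = trans (List.length-++ (map (x ,_) ys))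
  (cong₂ _+_ (List.length-map (x ,_) ys) (length-cartesianProduct xs ys))

 length-cells : ∀ N -> length (cells N) ≡ N * (N * 2)
 length-cells N = trans (length-cartesianProduct (upTo N) _)
  (cong₂ _*_ (length-upTo N) (trans (length-cartesianProduct (upTo N) _) (cong (_* 2) (length-upTo N))))

 extras-⊆ : ∀ N D ρ -> extras N D ρ ≤ extras N [] ρ
 extras-⊆ N D ρ = ∑-mono (cells N) (λ c -> ⟦⟧-mono (extra? D ρ c) (extra? [] ρ c) (λ (p , _) -> p , λ ()))

 extras-split : ∀ N ρ {c} -> c ∈ cells N -> extras N [] ρ ≡ ⟦ coin? ρ c ⟧ + extras N (c ∷ []) ρ
 extras-split N ρ {c} c∈ = begin
  ∑ (cells N) (λ d -> ⟦ extra? [] ρ d ⟧) ≡⟨ ∑-cong (cells N) split ⟩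
  ∑ (cells N) (λ d -> ⟦ d ∈ᶜ? (c ∷ []) ⟧ * ⟦ coin? ρ c ⟧ + ⟦ extra? (c ∷ []) ρ d ⟧) ≡⟨ ∑-⊕ (cells N) _ _ ⟩
  ∑ (cells N) (λ d -> ⟦ d ∈ᶜ? (c ∷ []) ⟧ * ⟦ coin? ρ c ⟧) + extras N (c ∷ []) ρ ≡⟨ cong (_+ extras N (c ∷ []) ρ)
   (trans (∑-*ʳ (cells N) ⟦ coin? ρ c ⟧ (λ d -> ⟦ d ∈ᶜ? (c ∷ []) ⟧)) (trans (cong (_* ⟦ coin? ρ c ⟧) once) (*-identityˡ _))) ⟩
  ⟦ coin? ρ c ⟧ + extras N (c ∷ []) ρ ∎
  where
  open ≡-Reasoning
  once : ∑ (cells N) (λ d -> ⟦ d ∈ᶜ? (c ∷ []) ⟧) ≡ 1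
  once = ≤-antisym (∑-at-most-one (_∈ᶜ? (c ∷ [])) (cells N) (cells-unique N) (λ { (here refl) (here refl) -> refl }))
   (∑-⟦⟧-≥ (_∈ᶜ? (c ∷ [])) c∈ (here refl))
  split : ∀ d -> ⟦ extra? [] ρ d ⟧ ≡ ⟦ d ∈ᶜ? (c ∷ []) ⟧ * ⟦ coin? ρ c ⟧ + ⟦ extra? (c ∷ []) ρ d ⟧
  split d = case d ∈ᶜ? (c ∷ []) of λ where
   d∈@(yes (here refl)) -> trans (⟦⟧-cong (extra? [] ρ d) (coin? ρ d) proj₁ (λ p -> p , λ ()))
    (sym (trans (cong₂ _+_ (trans (cong (_* ⟦ coin? ρ c ⟧) (⟦⟧-yes (d ∈ᶜ? (c ∷ [])) (here refl))) (*-identityˡ _))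
     (⟦⟧-no (extra? (c ∷ []) ρ d) (λ (_ , d∉) -> d∉ (here refl)))) (+-identityʳ _)))
   (no d∉) -> trans (⟦⟧-cong (extra? [] ρ d) (extra? (c ∷ []) ρ d) (λ (p , _) -> p , d∉) (λ (p , _) -> p , λ ()))
    (cong (λ z -> z * ⟦ coin? ρ c ⟧ + ⟦ extra? (c ∷ []) ρ d ⟧) (sym (⟦⟧-no (d ∈ᶜ? (c ∷ [])) d∉)))

 coinAssignment : Cell -> Assignment
 coinAssignment (i , j , true) = (j , i) ∷ (suc j , suc i) ∷ []
 coinAssignment (i , j , false) = (j , suc i) ∷ (suc j , i) ∷ []

 coin⇔sat : ∀ ρ c -> ⟦ coin? ρ c ⟧ ≡ ⟦ sat? ρ (coinAssignment c) ⟧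
 coin⇔sat ρ (i , j , true) = ⟦⟧-cong (coin? ρ (i , j , true)) (sat? ρ _) (λ (p , q) -> p ∷ q ∷ []) (λ { (p ∷ q ∷ []) -> p , q })
 coin⇔sat ρ (i , j , false) = ⟦⟧-cong (coin? ρ (i , j , false)) (sat? ρ _) (λ (p , q) -> p ∷ q ∷ []) (λ { (p ∷ q ∷ []) -> p , q })

 coinAssignment-length : ∀ c -> length (coinAssignment c) ≡ 2
 coinAssignment-length (i , j , true) = refl
 coinAssignment-length (i , j , false) = refl

 x≢1+x : ∀ {x} -> x ≢ suc x
 x≢1+x eq = ℕ.<⇒≢ ≤-refl eq

 coinAssignment-valid : ∀ {N i j} o -> i < N -> j < N -> Valid (suc N) (coinAssignment (i , j , o))
 coinAssignment-valid true i<N j<N = record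
  { dom-< = m≤n⇒m≤1+n j<N ∷ s≤s j<N ∷ []
  ; ran-< = m≤n⇒m≤1+n i<N ∷ s≤s i<N ∷ []
  ; dom-unique = (x≢1+x ∷ []) ∷ [] ∷ []
  ; ran-unique = (x≢1+x ∷ []) ∷ [] ∷ []
  }
 coinAssignment-valid false i<N j<N = record
  { dom-< = m≤n⇒m≤1+n j<N ∷ s≤s j<N ∷ []
  ; ran-< = s≤s i<N ∷ m≤n⇒m≤1+n i<N ∷ []
  ; dom-unique = (x≢1+x ∷ []) ∷ [] ∷ []
  ; ran-unique = ((x≢1+x ∘ sym) ∷ []) ∷ [] ∷ []
  }

 coinAssignment-closed : ∀ c -> PairClosed (c ∷ []) (coinAssignment c)
 coinAssignment-closed (i , j , true) =
  (λ { (here refl) (there (here refl)) -> here refl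
    ; (there (here refl)) (there (here eq)) -> absurd (sym (cong proj₁ eq)) x≢1+x
    ; (there (here refl)) (here eq) -> absurd (cong proj₁ eq) (m≢1+n+m _ ∘ sym)
    ; (here refl) (here eq) -> absurd (sym (cong proj₁ eq)) x≢1+x }) ,
  (λ { (here refl) (here eq) -> absurd (sym (cong proj₁ eq)) x≢1+x
    ; (here refl) (there (here eq)) -> absurd (cong proj₂ eq) (m≢1+n+m _)
    ; (there (here refl)) (here eq) -> absurd (cong proj₁ eq) (m≢1+n+m _ ∘ sym)
    ; (there (here refl)) (there (here eq)) -> absurd (sym (cong proj₁ eq)) x≢1+x })
 coinAssignment-closed (i , j , false) =
  (λ { (here refl) (here eq) -> absurd (sym (cong proj₁ eq)) x≢1+x
    ; (here refl) (there (here eq)) -> absurd (sym (cong proj₂ eq)) (m≢1+n+m _)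
    ; (there (here refl)) (here eq) -> absurd (cong proj₁ eq) (m≢1+n+m _ ∘ sym)
    ; (there (here refl)) (there (here eq)) -> absurd (sym (cong proj₁ eq)) x≢1+x }) ,
  (λ { (here refl) (there (here refl)) -> here refl
    ; (there (here refl)) (there (here eq)) -> absurd (sym (cong proj₁ eq)) x≢1+x
    ; (there (here refl)) (here eq) -> absurd (cong proj₁ eq) (m≢1+n+m _ ∘ sym)
    ; (here refl) (here eq) -> absurd (sym (cong proj₁ eq)) x≢1+x })

 -- The Stein–Chen recursion for the number X of coincidences: E[X ; X ≤ y + 1] is the sum over
 -- cells c of P(c ; at most y other coincidences), and P(at most y others | c) is close to P(X ≤ y).
 module SteinChen (N : ℕ) where

  open Counting N
  private
   n = suc N
   X : Ω -> ℕ
   X ω = extras N [] (at ω)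

  -- `n !` times P(X ≤ y) and E[X ; X ≤ y].
  F G : ℕ -> ℕ
  F y = #A [] y []
  G y = ∑ perms (λ ω -> X ω * ⟦ few? [] y (at ω) ⟧)

  #A-[]≡ : ∀ D y -> #A D y [] ≡ ∑ perms (λ ω -> ⟦ few? D y (at ω) ⟧)
  #A-[]≡ D y = ∑-cong perms (λ ω -> trans (cong (_* ⟦ few? D y (at ω) ⟧) (⟦⟧-yes (sat? (at ω) []) [])) (*-identityˡ _))

  F-≤-#A : ∀ D y -> F y ≤ #A D y []
  F-≤-#A D y = ∑-mono perms (λ ω -> *-monoʳ-≤ ⟦ sat? (at ω) [] ⟧
   (⟦⟧-mono (few? [] y (at ω)) (few? D y (at ω)) (≤-trans (extras-⊆ N D (at ω)))))

  -- Leaving the cell `c` out of the count matters only when `c` occurs.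
  #A-≤-F : ∀ c y -> c ∈ cells N -> #A (c ∷ []) y [] ≤ F y + #S (coinAssignment c)
  #A-≤-F c y c∈ = begin
   #A (c ∷ []) y [] ≡⟨ #A-[]≡ (c ∷ []) y ⟩
   ∑ perms (λ ω -> ⟦ few? (c ∷ []) y (at ω) ⟧) ≤⟨ ∑-mono perms pointwise ⟩
   ∑ perms (λ ω -> ⟦ few? [] y (at ω) ⟧ + ⟦ sat? (at ω) (coinAssignment c) ⟧) ≡⟨ ∑-⊕ perms _ _ ⟩
   ∑ perms (λ ω -> ⟦ few? [] y (at ω) ⟧) + #S (coinAssignment c) ≡⟨ cong (_+ #S (coinAssignment c)) (#A-[]≡ [] y) ⟨
   F y + #S (coinAssignment c) ∎
   where
   open ≤-Reasoning
   pointwise : ∀ ω -> ⟦ few? (c ∷ []) y (at ω) ⟧ ≤ ⟦ few? [] y (at ω) ⟧ + ⟦ sat? (at ω) (coinAssignment c) ⟧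
   pointwise ω = case coin? (at ω) c of λ where
    (yes co) -> ≤-trans (⟦⟧≤1 (few? (c ∷ []) y (at ω)))
     (≡≤ (trans (sym (⟦⟧-yes (coin? (at ω) c) co)) (coin⇔sat (at ω) c)) (m≤n+m _ ⟦ few? [] y (at ω) ⟧))
    (no ¬co) -> ≤-trans (⟦⟧-mono (few? (c ∷ []) y (at ω)) (few? [] y (at ω))
     (subst (_≤ y) (sym (trans (extras-split N (at ω) c∈) (cong (_+ extras N (c ∷ []) (at ω)) (⟦⟧-no (coin? (at ω) c) ¬co))))))
     (m≤m+n _ _)

  ∑X*≡ : (h : Ω -> ℕ) -> ∑ perms (λ ω -> X ω * h ω) ≡ ∑ (cells N) (λ c -> ∑ perms (λ ω -> ⟦ sat? (at ω) (coinAssignment c) ⟧ * h ω))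
  ∑X*≡ h = trans (∑-cong perms (λ ω -> sym (∑-*ʳ (cells N) (h ω) (λ c -> ⟦ extra? [] (at ω) c ⟧))))
   (trans (∑-swap perms (cells N) (λ ω c -> ⟦ extra? [] (at ω) c ⟧ * h ω))
    (∑-cong (cells N) (λ c -> ∑-cong perms (λ ω -> cong (_* h ω)
     (trans (⟦⟧-cong (extra? [] (at ω) c) (coin? (at ω) c) proj₁ (λ p -> p , λ ())) (coin⇔sat (at ω) c))))))

  G-suc : ∀ y -> G (suc y) ≡ ∑ (cells N) (λ c -> #A (c ∷ []) y (coinAssignment c))
  G-suc y = trans (∑X*≡ (λ ω -> ⟦ few? [] (suc y) (at ω) ⟧)) (∑-cong-∈ (cells N) (λ {c} c∈ -> ∑-cong perms (λ ω ->
   ⟦⟧*-≡ (sat? (at ω) (coinAssignment c)) (λ s -> ⟦⟧-cong (few? [] (suc y) (at ω)) (few? (c ∷ []) y (at ω))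
    (λ le -> ℕ.≤-pred (subst (_≤ suc y) (split {c} {ω} c∈ s) le)) (λ le -> subst (_≤ suc y) (sym (split {c} {ω} c∈ s)) (s≤s le))))))
   where
   split : ∀ {c ω} -> c ∈ cells N -> Sat (at ω) (coinAssignment c) -> extras N [] (at ω) ≡ suc (extras N (c ∷ []) (at ω))
   split {c} {ω} c∈ s = trans (extras-split N (at ω) c∈) (cong (_+ extras N (c ∷ []) (at ω))
    (trans (coin⇔sat (at ω) c) (⟦⟧-yes (sat? (at ω) (coinAssignment c)) s)))

  G-zero : G 0 ≡ 0
  G-zero = trans (∑-cong perms (λ ω -> pointwise ω)) (∑-zero perms)
   where
   pointwise : ∀ ω -> X ω * ⟦ few? [] 0 (at ω) ⟧ ≡ 0
   pointwise ω = trans (ℕ.*-comm (X ω) _) (trans (⟦⟧*-≡ (few? [] 0 (at ω)) ℕ.n≤0⇒n≡0) (*-zeroʳ ⟦ few? [] 0 (at ω) ⟧))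

  -- On the event X = y + 1 the factor X is y + 1, so the increments of `G` are y + 1 times those of
  -- `F`; both differences are written without subtraction.
  G-increment : ∀ y -> G (suc y) + suc y * F y ≡ G y + suc y * F (suc y)
  G-increment y = begin
   G (suc y) + suc y * F y ≡⟨ cong (G (suc y) +_) (suc-F y) ⟩
   G (suc y) + ∑ perms (λ ω -> suc y * ⟦ few? [] y (at ω) ⟧) ≡⟨ ∑-⊕ perms _ _ ⟨
   ∑ perms (λ ω -> X ω * ⟦ few? [] (suc y) (at ω) ⟧ + suc y * ⟦ few? [] y (at ω) ⟧) ≡⟨ ∑-cong perms pointwise ⟩
   ∑ perms (λ ω -> X ω * ⟦ few? [] y (at ω) ⟧ + suc y * ⟦ few? [] (suc y) (at ω) ⟧) ≡⟨ ∑-⊕ perms _ _ ⟩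
   G y + ∑ perms (λ ω -> suc y * ⟦ few? [] (suc y) (at ω) ⟧) ≡⟨ cong (G y +_) (suc-F (suc y)) ⟨
   G y + suc y * F (suc y) ∎
   where
   open ≡-Reasoning
   suc-F : ∀ z -> suc y * F z ≡ ∑ perms (λ ω -> suc y * ⟦ few? [] z (at ω) ⟧)
   suc-F z = trans (cong (suc y *_) (#A-[]≡ [] z)) (sym (∑-*ˡ perms (suc y) _))
   pointwise : ∀ ω -> X ω * ⟦ few? [] (suc y) (at ω) ⟧ + suc y * ⟦ few? [] y (at ω) ⟧ ≡
          X ω * ⟦ few? [] y (at ω) ⟧ + suc y * ⟦ few? [] (suc y) (at ω) ⟧
   pointwise ω = case X ω ℕ.≤? y of λ where
    (yes le) -> cong₂ (λ a b -> X ω * a + suc y * b)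
     (trans (⟦⟧-yes (few? [] (suc y) (at ω)) (m≤n⇒m≤1+n le)) (sym (⟦⟧-yes (few? [] y (at ω)) le)))
     (trans (⟦⟧-yes (few? [] y (at ω)) le) (sym (⟦⟧-yes (few? [] (suc y) (at ω)) (m≤n⇒m≤1+n le))))
    (no ¬le) -> let z = ⟦⟧-no (few? [] y (at ω)) ¬le in trans
     (cong₂ _+_ (trans (ℕ.*-comm (X ω) _) (trans (⟦⟧*-≡ (few? [] (suc y) (at ω)) (λ le' -> ≤-antisym le' (ℕ.≰⇒> ¬le))) (ℕ.*-comm _ (suc y))))
          (trans (cong (suc y *_) z) (*-zeroʳ (suc y))))
     (trans (ℕ.+-comm _ 0) (cong (_+ suc y * ⟦ few? [] (suc y) (at ω) ⟧) (sym (trans (cong (X ω *_) z) (*-zeroʳ (X ω))))))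

  fall2-#S : ∀ {c} -> c ∈ cells N -> fall n 2 * #S (coinAssignment c) ≡ n !
  fall2-#S {c@(i , j , o)} c∈ = let (i<N , j<N) = ∈-cells⁻ c∈ in
   trans (cong (λ t -> fall n t * #S (coinAssignment c)) (sym (coinAssignment-length c)))
    (trans (fall-#S (coinAssignment c) (coinAssignment-valid o i<N j<N)) #S-[])

  private
   ∑cells-const : ∀ a -> ∑ (cells N) (λ _ -> a) ≡ N * (N * 2) * a
   ∑cells-const a = trans (∑-const (cells N) a) (cong (_* a) (length-cells N))

   cells-bound : ∀ q {f : Cell -> ℕ} {a} -> (∀ {c} -> c ∈ cells N -> q * (fall n 2 * f c) ≤ a) ->
         q * (fall n 2 * ∑ (cells N) f) ≤ N * (N * 2) * a
   cells-bound q {f} {a} h = ≡≤ (trans (cong (q *_) (sym (∑-*ˡ (cells N) (fall n 2) f)))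
    (sym (∑-*ˡ (cells N) q (λ c -> fall n 2 * f c)))) (≤≡ (∑-mono-∈ (cells N) h) (∑cells-const a))

  -- One factor `fall n 2` normalises the count given a cell. The other clears the probability 1 /
  -- `fall n 2` of the cell itself, the price of passing from at most y other coincidences to X ≤ y.
  -- There are N (N * 2) cells, and 16 = 8 * 2 since a cell prescribes two values.
  G-≤ : ∀ q y -> suc (q + 2) ≤ n -> q * (fall n 2 * (fall n 2 * G (suc y))) ≤ N * (N * 2) * (fall n 2 * (q * F y) + q * n ! + fall n 2 * (16 * n !))
  G-≤ q y le = ≡≤ (cong (λ g -> q * (f * (f * g))) (G-suc y)) (≤-trans
   (≤-reflexive (cong (λ z -> q * (f * z)) (sym (∑-*ˡ (cells N) f _))))
   (cells-bound q (λ {c} c∈ -> begin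
    q * (f * (f * A c)) ≡⟨ rg1 q f (A c) ⟩
    f * (q * (f * A c)) ≤⟨ *-monoʳ-≤ f (step c c∈) ⟩
    f * (q * #A (c ∷ []) y [] + 16 * n !) ≤⟨ *-monoʳ-≤ f (+-monoˡ-≤ (16 * n !) (*-monoʳ-≤ q (#A-≤-F c y c∈))) ⟩
    f * (q * (F y + #S (coinAssignment c)) + 16 * n !) ≡⟨ rg2 f q (F y) (#S (coinAssignment c)) (16 * n !) ⟩
    f * (q * F y) + q * (f * #S (coinAssignment c)) + f * (16 * n !) ≡⟨ cong (λ z -> f * (q * F y) + q * z + f * (16 * n !)) (fall2-#S c∈) ⟩
    f * (q * F y) + q * n ! + f * (16 * n !) ∎)))
   where
   open ≤-Reasoning
   f = fall n 2
   A : Cell -> ℕ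
   A c = #A (c ∷ []) y (coinAssignment c)
   rg1 : ∀ q f a -> q * (f * (f * a)) ≡ f * (q * (f * a))
   rg1 = solve-∀
   rg2 : ∀ f q a b e -> f * (q * (a + b) + e) ≡ f * (q * a) + q * (f * b) + f * e
   rg2 = solve-∀
   step : ∀ c -> c ∈ cells N -> q * (f * A c) ≤ q * #A (c ∷ []) y [] + 16 * n !
   step c@(i , j , o) c∈ = let (i<N , j<N) = ∈-cells⁻ c∈ in
    subst₂ _≤_ (cong (λ t -> q * (fall n t * A c)) (coinAssignment-length c))
     (cong₂ (λ t s -> q * #A (c ∷ []) y [] + 8 * t * s) (coinAssignment-length c) #S-[])
     (assign-≤ (c ∷ []) y q (coinAssignment c) (coinAssignment-valid o i<N j<N)
      (subst (λ t -> suc (q + t) ≤ n) (sym (coinAssignment-length c)) le))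

  G-≥ : ∀ q y -> suc (q + 2) ≤ n -> N * (N * 2) * (q * F y) ≤ q * (fall n 2 * G (suc y)) + N * (N * 2) * (16 * n !)
  G-≥ q y le = begin
   N * (N * 2) * (q * F y) ≡⟨ ∑cells-const (q * F y) ⟨
   ∑ (cells N) (λ _ -> q * F y) ≤⟨ ∑-mono-∈ (cells N) (λ {c} -> step c) ⟩
   ∑ (cells N) (λ c -> q * (f * A c) + 16 * n !) ≡⟨ ∑-⊕ (cells N) (λ c -> q * (f * A c)) (λ _ -> 16 * n !) ⟩
   ∑ (cells N) (λ c -> q * (f * A c)) + ∑ (cells N) (λ _ -> 16 * n !)
    ≡⟨ cong₂ _+_ (trans (∑-*ˡ (cells N) q (λ c -> f * A c)) (cong (q *_) (trans (∑-*ˡ (cells N) f A) (cong (f *_) (sym (G-suc y))))))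
       (∑cells-const (16 * n !)) ⟩
   q * (f * G (suc y)) + N * (N * 2) * (16 * n !) ∎
   where
   open ≤-Reasoning
   f = fall n 2
   A : Cell -> ℕ
   A c = #A (c ∷ []) y (coinAssignment c)
   step : ∀ c -> c ∈ cells N -> q * F y ≤ q * (f * A c) + 16 * n !
   step c@(i , j , o) c∈ = let (i<N , j<N) = ∈-cells⁻ c∈ in
    ≤-trans (*-monoʳ-≤ q (F-≤-#A (c ∷ []) y)) (subst₂ _≤_ refl
     (cong₂ (λ t u -> q * (fall n t * A c) + u) (coinAssignment-length c)
      (cong₂ (λ t s -> 8 * t * s) (coinAssignment-length c) #S-[]))
     (assign-≥ (c ∷ []) y q (coinAssignment c) (coinAssignment-valid o i<N j<N) (coinAssignment-closed c)
      (subst (λ t -> suc (q + t) ≤ n) (sym (coinAssignment-length c)) le)))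

  -- Markov's inequality for X, with E[X] = 2 N² / (n N).
  markov : ∀ y -> fall n 2 * (suc y * n !) ≤ fall n 2 * (suc y * F y) + N * (N * 2) * n !
  markov y = begin
   f * (suc y * n !) ≡⟨ cong (λ s -> f * (suc y * s)) (trans (sym length-perms) (sym (*-identityʳ _))) ⟩
   f * (suc y * (length perms * 1)) ≡⟨ cong (λ s -> f * (suc y * s)) (∑-const perms 1) ⟨
   f * (suc y * ∑ perms (λ _ -> 1)) ≡⟨ cong (f *_) (∑-*ˡ perms (suc y) (λ _ -> 1)) ⟨
   f * ∑ perms (λ _ -> suc y * 1) ≤⟨ *-monoʳ-≤ f (∑-mono perms pointwise) ⟩
   f * ∑ perms (λ ω -> suc y * ⟦ few? [] y (at ω) ⟧ + X ω * 1) ≡⟨ cong (f *_) (trans (∑-⊕ perms _ _) (cong₂ _+_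
    (trans (∑-*ˡ perms (suc y) _) (cong (suc y *_) (sym (#A-[]≡ [] y)))) (∑X*≡ (λ _ -> 1)))) ⟩
   f * (suc y * F y + ∑ (cells N) S) ≡⟨ *-distribˡ-+ f _ _ ⟩
   f * (suc y * F y) + f * ∑ (cells N) S ≡⟨ cong (f * (suc y * F y) +_) (trans (sym (∑-*ˡ (cells N) f S))
    (trans (∑-cong-∈ (cells N) (λ {c} c∈ -> trans (cong (f *_) (∑-cong perms (λ ω -> *-identityʳ _))) (fall2-#S c∈))) (∑cells-const (n !)))) ⟩
   f * (suc y * F y) + N * (N * 2) * n ! ∎
   where
   open ≤-Reasoning
   f = fall n 2
   S : Cell -> ℕ
   S c = ∑ perms (λ ω -> ⟦ sat? (at ω) (coinAssignment c) ⟧ * 1)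
   pointwise : ∀ ω -> suc y * 1 ≤ suc y * ⟦ few? [] y (at ω) ⟧ + X ω * 1
   pointwise ω = case X ω ℕ.≤? y of λ where
    (yes le) -> ≡≤ (cong (suc y *_) (sym (⟦⟧-yes (few? [] y (at ω)) le))) (m≤m+n _ _)
    (no ¬le) -> ≤-trans (*-monoˡ-≤ 1 (ℕ.≰⇒> ¬le)) (m≤n+m _ (suc y * ⟦ few? [] y (at ω) ⟧))

 -- Words: ways to interleave two paths

 -- A word describes how two paths are traversed together: P and Q advance the first and the second
 -- path alone, blk 0 both along one common edge in opposite directions, and blk (1 + l) both along
 -- 1 + l successive common edges in the same direction.
 data Letter : Set where
  P Q : Letter
  blk : ℕ -> Letter

 Word : Set
 Word = List Letter

 len : ℕ -> ℕ
 len zero = 1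
 len (suc l) = suc l

 -- Addition with an accumulator, matching the recursion of `run`: a block prolonged at its front
 -- ends definitionally where it ended before, which `join` exploits.
 shift : ℕ -> ℕ -> ℕ
 shift zero i = i
 shift (suc m) i = shift m (suc i)

 shift≡ : ∀ m i -> shift m i ≡ m + i
 shift≡ zero i = refl
 shift≡ (suc m) i = trans (shift≡ m (suc i)) (+-suc m i)

 ≤-shift : ∀ m i -> i ≤ shift m i
 ≤-shift m i = subst (i ≤_) (sym (shift≡ m i)) (m≤n+m i m)

 run : ℕ -> ℕ -> ℕ -> Assignment
 run zero i j = []
 run (suc m) i j = (j , i) ∷ run m (suc i) (suc j)

 cellRun : ℕ -> ℕ -> ℕ -> List Cell
 cellRun zero i j = []
 cellRun (suc m) i j = (i , j , true) ∷ cellRun m (suc i) (suc j)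

 blockAssignment : ℕ -> ℕ -> ℕ -> Assignment
 blockAssignment zero i j = coinAssignment (i , j , false)
 blockAssignment (suc l) i j = run (suc (suc l)) i j

 blockCells : ℕ -> ℕ -> ℕ -> List Cell
 blockCells zero i j = (i , j , false) ∷ []
 blockCells (suc l) i j = cellRun (suc l) i j

 assignment : Word -> ℕ -> ℕ -> Assignment
 assignment [] i j = []
 assignment (P ∷ w) i j = assignment w (suc i) j
 assignment (Q ∷ w) i j = assignment w i (suc j)
 assignment (blk b ∷ w) i j = blockAssignment b i j ++ assignment w (shift (len b) i) (shift (len b) j)

 commonCells : Word -> ℕ -> ℕ -> List Cell
 commonCells [] i j = []
 commonCells (P ∷ w) i j = commonCells w (suc i) j
 commonCells (Q ∷ w) i j = commonCells w i (suc j)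
 commonCells (blk b ∷ w) i j = blockCells b i j ++ commonCells w (shift (len b) i) (shift (len b) j)

 endP endQ : Word -> ℕ -> ℕ
 endP [] i = i
 endP (P ∷ w) i = endP w (suc i)
 endP (Q ∷ w) i = endP w i
 endP (blk b ∷ w) i = endP w (shift (len b) i)
 endQ [] j = j
 endQ (P ∷ w) j = endQ w j
 endQ (Q ∷ w) j = endQ w (suc j)
 endQ (blk b ∷ w) j = endQ w (shift (len b) j)

 ≤-endP : ∀ w i -> i ≤ endP w i
 ≤-endP [] i = ≤-refl
 ≤-endP (P ∷ w) i = ≤-trans (n≤1+n i) (≤-endP w (suc i))
 ≤-endP (Q ∷ w) i = ≤-endP w i
 ≤-endP (blk b ∷ w) i = ≤-trans (≤-shift (len b) i) (≤-endP w _)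

 ≤-endQ : ∀ w j -> j ≤ endQ w j
 ≤-endQ [] j = ≤-refl
 ≤-endQ (P ∷ w) j = ≤-endQ w j
 ≤-endQ (Q ∷ w) j = ≤-trans (n≤1+n j) (≤-endQ w (suc j))
 ≤-endQ (blk b ∷ w) j = ≤-trans (≤-shift (len b) j) (≤-endQ w _)

 BlockFree : Word -> Set
 BlockFree (blk _ ∷ _) = ⊥
 BlockFree _ = ⊤

 -- Successive common edges must form a single block. This maximality makes the word of a pair of
 -- increasing paths unique.
 NoAdj : Word -> Set
 NoAdj [] = ⊤
 NoAdj (P ∷ w) = NoAdj w
 NoAdj (Q ∷ w) = NoAdj w
 NoAdj (blk _ ∷ w) = BlockFree w × NoAdj w

 blockFree? : ∀ w -> Dec (BlockFree w)
 blockFree? [] = yes tt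
 blockFree? (P ∷ w) = yes tt
 blockFree? (Q ∷ w) = yes tt
 blockFree? (blk _ ∷ w) = no λ ()

 ∈-run : ∀ m {i j p v} -> (p , v) ∈ run m i j -> ∃ λ x -> x < m × p ≡ x + j × v ≡ x + i
 ∈-run (suc m) (here refl) = 0 , s≤s z≤n , refl , refl
 ∈-run (suc m) (there c∈) = let (x , x<m , p≡ , v≡) = ∈-run m c∈ in
  suc x , s≤s x<m , trans p≡ (+-suc x _) , trans v≡ (+-suc x _)

 ∈-cellRun⁺ : ∀ {m x} i j -> x < m -> (x + i , x + j , true) ∈ cellRun m i j
 ∈-cellRun⁺ {suc m} {zero} i j _ = here refl
 ∈-cellRun⁺ {suc m} {suc x} i j (s≤s x<m) = there (subst₂ (λ a b -> (a , b , true) ∈ cellRun m (suc i) (suc j))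
  (+-suc x i) (+-suc x j) (∈-cellRun⁺ (suc i) (suc j) x<m))

 ∈-cellRun⁻ : ∀ m {i j i0 j0 o} -> (i0 , j0 , o) ∈ cellRun m i j -> ∃ λ x -> x < m × i0 ≡ x + i × j0 ≡ x + j × o ≡ true
 ∈-cellRun⁻ (suc m) (here refl) = 0 , s≤s z≤n , refl , refl , refl
 ∈-cellRun⁻ (suc m) (there c∈) = let (x , x<m , p≡ , v≡ , o≡) = ∈-cellRun⁻ m c∈ in
  suc x , s≤s x<m , trans p≡ (+-suc x _) , trans v≡ (+-suc x _) , o≡

 block-bounds : ∀ b {i j p v} -> (p , v) ∈ blockAssignment b i j -> (j ≤ p × i ≤ v) × (p ≤ shift (len b) j × v ≤ shift (len b) i)
 block-bounds zero (here refl) = (≤-refl , n≤1+n _) , (n≤1+n _ , ≤-refl)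
 block-bounds zero (there (here refl)) = (n≤1+n _ , ≤-refl) , (≤-refl , n≤1+n _)
 block-bounds (suc l) {i} {j} c∈ with x , s≤s x≤ , refl , refl ← ∈-run (suc (suc l)) c∈ =
  (m≤n+m j x , m≤n+m i x) ,
  (subst (x + j ≤_) (sym (shift≡ (suc l) j)) (+-monoˡ-≤ j x≤) , subst (x + i ≤_) (sym (shift≡ (suc l) i)) (+-monoˡ-≤ i x≤))

 blockCells-bounds : ∀ b {i j i0 j0 o} -> (i0 , j0 , o) ∈ blockCells b i j -> i0 < shift (len b) i × j0 < shift (len b) j
 blockCells-bounds zero (here refl) = ≤-refl , ≤-refl
 blockCells-bounds (suc l) {i} {j} c∈ with x , x< , refl , refl , _ ← ∈-cellRun⁻ (suc l) c∈ =
  subst (x + i <_) (sym (shift≡ (suc l) i)) (+-monoˡ-< i x<) , subst (x + j <_) (sym (shift≡ (suc l) j)) (+-monoˡ-< j x<)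

 assignment-≥ : ∀ w {i j p v} -> (p , v) ∈ assignment w i j -> j ≤ p × i ≤ v
 assignment-≥ (P ∷ w) c∈ = let (a , b) = assignment-≥ w c∈ in a , ℕ.<⇒≤ b
 assignment-≥ (Q ∷ w) c∈ = let (a , b) = assignment-≥ w c∈ in ℕ.<⇒≤ a , b
 assignment-≥ (blk b ∷ w) {i} {j} c∈ with ∈-++⁻ (blockAssignment b i j) c∈
 ... | inj₁ c∈b = proj₁ (block-bounds b c∈b)
 ... | inj₂ c∈w = let (p≥ , v≥) = assignment-≥ w c∈w in ≤-trans (≤-shift (len b) j) p≥ , ≤-trans (≤-shift (len b) i) v≥

 assignment-≤ : ∀ w {i j p v} -> (p , v) ∈ assignment w i j -> p ≤ endQ w j × v ≤ endP w i
 assignment-≤ (P ∷ w) c∈ = assignment-≤ w c∈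
 assignment-≤ (Q ∷ w) c∈ = assignment-≤ w c∈
 assignment-≤ (blk b ∷ w) {i} {j} c∈ with ∈-++⁻ (blockAssignment b i j) c∈
 ... | inj₁ c∈b = let (p≤ , v≤) = proj₂ (block-bounds b c∈b) in ≤-trans p≤ (≤-endQ w _) , ≤-trans v≤ (≤-endP w _)
 ... | inj₂ c∈w = assignment-≤ w c∈w

 commonCells-≥ : ∀ w {i j i0 j0 o} -> (i0 , j0 , o) ∈ commonCells w i j -> i ≤ i0 × j ≤ j0
 commonCells-≥ (P ∷ w) c∈ = let (a , b) = commonCells-≥ w c∈ in ℕ.<⇒≤ a , b
 commonCells-≥ (Q ∷ w) c∈ = let (a , b) = commonCells-≥ w c∈ in a , ℕ.<⇒≤ b
 commonCells-≥ (blk b ∷ w) {i} {j} c∈ with ∈-++⁻ (blockCells b i j) c∈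
 ... | inj₂ c∈w = let (i≤ , j≤) = commonCells-≥ w c∈w in ≤-trans (≤-shift (len b) i) i≤ , ≤-trans (≤-shift (len b) j) j≤
 ... | inj₁ c∈b with b | c∈b
 ... | zero | here refl = ≤-refl , ≤-refl
 ... | suc l | c∈r with x , _ , refl , refl , _ ← ∈-cellRun⁻ (suc l) c∈r = m≤n+m i x , m≤n+m j x

 run-unique : ∀ m i j -> Unique (dom (run m i j)) × Unique (ran (run m i j))
 run-unique zero i j = [] , []
 run-unique (suc m) i j = let (u , u') = run-unique m (suc i) (suc j) in
  (dom-> m (suc i) ≤-refl ∷ u) , (ran-> m (suc j) ≤-refl ∷ u')
  where
  dom-> : ∀ m i {j j'} -> j < j' -> All (j ≢_) (dom (run m i j'))
  dom-> zero i j<j' = []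
  dom-> (suc m) i j<j' = ℕ.<⇒≢ j<j' ∷ dom-> m (suc i) (m≤n⇒m≤1+n j<j')
  ran-> : ∀ m {i i'} j -> i < i' -> All (i ≢_) (ran (run m i' j))
  ran-> zero j i<i' = []
  ran-> (suc m) j i<i' = ℕ.<⇒≢ i<i' ∷ ran-> m (suc j) (m≤n⇒m≤1+n i<i')

 block-unique : ∀ b i j -> Unique (dom (blockAssignment b i j)) × Unique (ran (blockAssignment b i j))
 block-unique zero i j = ((ℕ.<⇒≢ ≤-refl ∷ []) ∷ [] ∷ []) , ((ℕ.<⇒≢ ≤-refl ∘ sym) ∷ []) ∷ [] ∷ []
 block-unique (suc l) i j = run-unique (suc (suc l)) i j

 -- Distinctness as pairs is all that can be expected without separators: positions or values alone
 -- may repeat, and then no permutation satisfies the assignment.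
 assignment-unique : ∀ w i j -> NoAdj w -> Unique (assignment w i j)
 assignment-unique [] i j _ = []
 assignment-unique (P ∷ w) i j na = assignment-unique w (suc i) j na
 assignment-unique (Q ∷ w) i j na = assignment-unique w i (suc j) na
 assignment-unique (blk b ∷ w) i j (bf , na) =
  Unique.++⁺ (AllPairs.map (λ ≢ -> λ { refl -> ≢ refl }) (AllPairs.map⁻ (proj₁ (block-unique b i j))))
   (assignment-unique w _ _ na) (disjoint w bf)
  where
  disjoint : ∀ w -> BlockFree w -> Disjoint (blockAssignment b i j) (assignment w (shift (len b) i) (shift (len b) j))
  disjoint (P ∷ w) _ (c∈ , c∈w) = ℕ.<⇒≱ (proj₂ (assignment-≥ w c∈w)) (proj₂ (proj₂ (block-bounds b c∈)))
  disjoint (Q ∷ w) _ (c∈ , c∈w) = ℕ.<⇒≱ (proj₁ (assignment-≥ w c∈w)) (proj₁ (proj₂ (block-bounds b c∈)))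

 -- Measured from the end of a block. Larger positions and values exclude a shared entry and a
 -- reversed coincidence with the block. A coincidence in the same direction raises position plus
 -- value by 2, so a total distance of 3 excludes it too.
 FarFrom : ℕ -> ℕ -> Assignment -> Set
 FarFrom i j = All (λ (p , v) -> j < p × i < v × 3 + (i + j) ≤ v + p)

 Spread : Word -> ℕ -> ℕ -> Set
 Spread [] i j = ⊤
 Spread (P ∷ w) i j = Spread w (suc i) j
 Spread (Q ∷ w) i j = Spread w i (suc j)
 Spread (blk b ∷ w) i j = let i' = shift (len b) i ; j' = shift (len b) j in FarFrom i' j' (assignment w i' j') × Spread w i' j'

 Spread-unique : ∀ w i j -> Spread w i j -> Unique (dom (assignment w i j)) × Unique (ran (assignment w i j))
 Spread-unique [] i j _ = [] , []
 Spread-unique (P ∷ w) i j s = Spread-unique w (suc i) j s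
 Spread-unique (Q ∷ w) i j s = Spread-unique w i (suc j) s
 Spread-unique (blk b ∷ w) i j (far , s) = let (u , u') = Spread-unique w _ _ s ; (v , v') = block-unique b i j in
  subst Unique (sym (List.map-++ proj₁ (blockAssignment b i j) _)) (AllPairs.++⁺ v u
   (All.map⁺ (All.tabulate (λ c∈ -> All.map⁺ (All.map (λ (j<p , _) -> ℕ.<⇒≢ (ℕ.≤-<-trans (proj₁ (proj₂ (block-bounds b c∈))) j<p)) far))))) ,
  subst Unique (sym (List.map-++ proj₂ (blockAssignment b i j) _)) (AllPairs.++⁺ v' u'
   (All.map⁺ (All.tabulate (λ c∈ -> All.map⁺ (All.map (λ (_ , i<v , _) -> ℕ.<⇒≢ (ℕ.≤-<-trans (proj₂ (proj₂ (block-bounds b c∈))) i<v)) far)))))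

 diagonal : ∀ x y {j p} -> p ≡ x + j -> suc p ≡ y + j -> y ≡ suc x
 diagonal x y {j} refl eq = +-cancelʳ-≡ j _ _ (sym eq)

 block-closed : ∀ b i j -> PairClosed (blockCells b i j) (blockAssignment b i j)
 block-closed zero i j = coinAssignment-closed (i , j , false)
 block-closed (suc l) i j = parallel , crossed
  where
  parallel : ∀ {i0 j0} -> (j0 , i0) ∈ run (suc (suc l)) i j -> (suc j0 , suc i0) ∈ run (suc (suc l)) i j -> (i0 , j0 , true) ∈ cellRun (suc l) i j
  parallel a∈ b∈ with x , _ , refl , refl ← ∈-run (suc (suc l)) a∈ | y , s≤s y≤ , p , q ← ∈-run (suc (suc l)) b∈
   with refl ← diagonal x y refl p = ∈-cellRun⁺ i j y≤
  crossed : ∀ {i0 j0} -> (j0 , suc i0) ∈ run (suc (suc l)) i j -> (suc j0 , i0) ∈ run (suc (suc l)) i j -> (i0 , j0 , false) ∈ cellRun (suc l) i j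
  crossed a∈ b∈ with x , _ , refl , p ← ∈-run (suc (suc l)) a∈ | y , _ , q , refl ← ∈-run (suc (suc l)) b∈
   with refl ← diagonal x y refl q = absurd p (m≢1+n+m (x + i) {1} ∘ sym)

 Spread-closed : ∀ w i j -> Spread w i j -> PairClosed (commonCells w i j) (assignment w i j)
 Spread-closed [] i j _ = (λ ()) , λ ()
 Spread-closed (P ∷ w) i j s = Spread-closed w (suc i) j s
 Spread-closed (Q ∷ w) i j s = Spread-closed w i (suc j) s
 Spread-closed (blk b ∷ w) i j (far , s) {i0} {j0} = parallel , crossed
  where
  B = blockAssignment b i j
  rest = Spread-closed w _ _ s
  i' = shift (len b) i
  j' = shift (len b) j
  sum-≤ : j0 ≤ j' × i0 ≤ i' -> suc i0 + suc j0 ≤ 2 + (i' + j')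
  sum-≤ (j≤ , i≤) = subst (_≤ 2 + (i' + j')) (sym (cong suc (+-suc i0 j0))) (s≤s (s≤s (+-mono-≤ i≤ j≤)))
  parallel : (j0 , i0) ∈ B ++ _ -> (suc j0 , suc i0) ∈ B ++ _ -> (i0 , j0 , true) ∈ blockCells b i j ++ _
  parallel c∈ d∈ with ∈-++⁻ B c∈ | ∈-++⁻ B d∈
  ... | inj₁ c∈ | inj₁ d∈ = ∈-++⁺ˡ (proj₁ (block-closed b i j) c∈ d∈)
  ... | inj₂ c∈ | inj₂ d∈ = ∈-++⁺ʳ _ (proj₁ rest c∈ d∈)
  ... | inj₁ c∈ | inj₂ d∈ = absurd (proj₂ (proj₂ (All.lookup far d∈)))
   (ℕ.<⇒≱ (s≤s (sum-≤ (proj₂ (block-bounds b c∈)))))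
  ... | inj₂ c∈ | inj₁ d∈ = absurd (proj₁ (proj₂ (block-bounds b d∈))) (ℕ.<⇒≱ (m≤n⇒m≤1+n (proj₁ (All.lookup far c∈))))
  crossed : (j0 , suc i0) ∈ B ++ _ -> (suc j0 , i0) ∈ B ++ _ -> (i0 , j0 , false) ∈ blockCells b i j ++ _
  crossed c∈ d∈ with ∈-++⁻ B c∈ | ∈-++⁻ B d∈
  ... | inj₁ c∈ | inj₁ d∈ = ∈-++⁺ˡ (proj₂ (block-closed b i j) c∈ d∈)
  ... | inj₂ c∈ | inj₂ d∈ = ∈-++⁺ʳ _ (proj₂ rest c∈ d∈)
  ... | inj₁ c∈ | inj₂ d∈ = absurd (proj₂ (proj₂ (block-bounds b c∈))) (ℕ.<⇒≱ (m≤n⇒m≤1+n (proj₁ (proj₂ (All.lookup far d∈)))))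
  ... | inj₂ c∈ | inj₁ d∈ = absurd (proj₁ (proj₂ (block-bounds b d∈))) (ℕ.<⇒≱ (m≤n⇒m≤1+n (proj₁ (All.lookup far c∈))))

 Spread-valid : ∀ w {N} -> endP w 0 ≡ N -> endQ w 0 ≡ N -> Spread w 0 0 -> Valid (suc N) (assignment w 0 0)
 Spread-valid w refl endQ≡ s = record
  { dom-< = All.map⁺ (All.tabulate (λ c∈ -> s≤s (subst (_ ≤_) endQ≡ (proj₁ (assignment-≤ w c∈)))))
  ; ran-< = All.map⁺ (All.tabulate (λ c∈ -> s≤s (proj₂ (assignment-≤ w c∈))))
  ; dom-unique = proj₁ (Spread-unique w 0 0 s)
  ; ran-unique = proj₂ (Spread-unique w 0 0 s)
  }

 -- Merging two increasing paths into a word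

 ≤⇒≡⊎< : ∀ {i i0} -> i ≤ i0 -> i ≡ i0 ⊎ i < i0
 ≤⇒≡⊎< i≤ = case ℕ.m≤n⇒m<n∨m≡n i≤ of λ where
  (inj₁ lt) -> inj₂ lt
  (inj₂ eq) -> inj₁ eq

 AllPairs-++⁻ : {A : Set} {R : A -> A -> Set} (xs : List A) {ys : List A} -> AllPairs R (xs ++ ys) ->
       AllPairs R ys × (∀ {x y} -> x ∈ xs -> y ∈ ys -> R x y)
 AllPairs-++⁻ [] p = p , λ ()
 AllPairs-++⁻ (x ∷ xs) (h ∷ p) = let (q , r) = AllPairs-++⁻ xs p in
  q , λ { (here refl) y∈ -> All.lookup h (∈-++⁺ʳ xs y∈) ; (there x∈) y∈ -> r x∈ y∈ }

 -- The edges of two Hamiltonian paths are eP i and eQ j (i, j < N), and the coincidences of ρ say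
 -- which of them are equal.
 module Merging (N : ℕ) {A : Set} (eP eQ : ℕ -> A) (ρ : ℕ -> ℕ)
  (eP-injective : ∀ {i i'} -> i < N -> i' < N -> eP i ≡ eP i' -> i ≡ i')
  (eQ-injective : ∀ {j j'} -> j < N -> j' < N -> eQ j ≡ eQ j' -> j ≡ j')
  (common⇒coin : ∀ {i j} -> i < N -> j < N -> eP i ≡ eQ j -> ∃ λ o -> Coin ρ (i , j , o))
  (coin⇒common : ∀ {i j} o -> i < N -> j < N -> Coin ρ (i , j , o) -> eP i ≡ eQ j) where

  segment : ℕ -> ℕ -> List A
  segment zero i = []
  segment (suc m) i = eP i ∷ segment m (suc i)

  merged : Word -> ℕ -> ℕ -> List A
  merged [] i j = []
  merged (P ∷ w) i j = eP i ∷ merged w (suc i) j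
  merged (Q ∷ w) i j = eQ j ∷ merged w i (suc j)
  merged (blk b ∷ w) i j = segment (len b) i ++ merged w (shift (len b) i) (shift (len b) j)

  private
   ∈-segment⁺ : ∀ m i {i0} -> i ≤ i0 -> i0 < shift m i -> eP i0 ∈ segment m i
   ∈-segment⁺ zero i i≤ <i = absurd i≤ (ℕ.<⇒≱ <i)
   ∈-segment⁺ (suc m) i i≤ <i = case ≤⇒≡⊎< i≤ of λ where
    (inj₁ refl) -> here refl
    (inj₂ i<) -> there (∈-segment⁺ m (suc i) i< <i)

   ∈-segment⁻ : ∀ m i {e} -> e ∈ segment m i -> ∃ λ i0 -> i ≤ i0 × i0 < shift m i × e ≡ eP i0
   ∈-segment⁻ (suc m) i (here refl) = i , ≤-refl , ≤-shift m (suc i) , refl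
   ∈-segment⁻ (suc m) i (there e∈) = let (i0 , i≤ , <i , eq) = ∈-segment⁻ m (suc i) e∈ in i0 , ℕ.<⇒≤ i≤ , <i , eq

   ∈-merged⁻ : ∀ w i j {e} -> e ∈ merged w i j ->
        (∃ λ i0 -> i ≤ i0 × i0 < endP w i × e ≡ eP i0) ⊎ (∃ λ j0 -> j ≤ j0 × j0 < endQ w j × e ≡ eQ j0)
   ∈-merged⁻ (P ∷ w) i j (here refl) = inj₁ (i , ≤-refl , ≤-endP w (suc i) , refl)
   ∈-merged⁻ (P ∷ w) i j (there e∈) = case ∈-merged⁻ w (suc i) j e∈ of λ where
    (inj₁ (i0 , i≤ , rest)) -> inj₁ (i0 , ℕ.<⇒≤ i≤ , rest)
    (inj₂ r) -> inj₂ r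
   ∈-merged⁻ (Q ∷ w) i j (here refl) = inj₂ (j , ≤-refl , ≤-endQ w (suc j) , refl)
   ∈-merged⁻ (Q ∷ w) i j (there e∈) = case ∈-merged⁻ w i (suc j) e∈ of λ where
    (inj₁ r) -> inj₁ r
    (inj₂ (j0 , j≤ , rest)) -> inj₂ (j0 , ℕ.<⇒≤ j≤ , rest)
   ∈-merged⁻ (blk b ∷ w) i j e∈ with ∈-++⁻ (segment (len b) i) e∈
   ... | inj₁ e∈s = let (i0 , i≤ , <i , eq) = ∈-segment⁻ (len b) i e∈s in inj₁ (i0 , i≤ , <-≤-trans <i (≤-endP w _) , eq)
   ... | inj₂ e∈w = case ∈-merged⁻ w _ _ e∈w of λ where
    (inj₁ (i0 , i≤ , rest)) -> inj₁ (i0 , ≤-trans (≤-shift (len b) i) i≤ , rest)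
    (inj₂ (j0 , j≤ , rest)) -> inj₂ (j0 , ≤-trans (≤-shift (len b) j) j≤ , rest)

   run-sat : ∀ m {i j} x -> x ≤ m -> Sat ρ (run (suc m) i j) -> ρ (x + j) ≡ x + i
   run-sat m zero _ (eq ∷ _) = eq
   run-sat (suc m) {i} {j} (suc x) (s≤s x≤) (_ ∷ s) =
    trans (cong ρ (sym (+-suc x j))) (trans (run-sat m x x≤ s) (+-suc x i))

   block-common : ∀ b {i j} -> Sat ρ (blockAssignment b i j) -> shift (len b) i ≤ N -> shift (len b) j ≤ N ->
         ∀ x -> x < len b -> (∃ λ o -> Coin ρ (x + i , x + j , o)) × eP (x + i) ≡ eQ (x + j)
   block-common zero (p ∷ q ∷ []) i≤ j≤ zero _ = (false , p , q) , coin⇒common false i≤ j≤ (p , q)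
   block-common zero s i≤ j≤ (suc x) (s≤s ())
   block-common (suc l) {i} {j} s i≤ j≤ x (s≤s x≤) = (true , co) , coin⇒common true (bound i i≤) (bound j j≤) co
    where
    co : Coin ρ (x + i , x + j , true)
    co = run-sat (suc l) x (m≤n⇒m≤1+n x≤) s , run-sat (suc l) (suc x) (s≤s x≤) s
    bound : ∀ i -> shift (suc l) i ≤ N -> x + i < N
    bound i i≤ = <-≤-trans (+-monoˡ-< i (s≤s x≤)) (subst (_≤ N) (shift≡ (suc l) i) i≤)

   Sat-++⁻ : ∀ τ {τ'} -> Sat ρ (τ ++ τ') -> Sat ρ τ × Sat ρ τ'
   Sat-++⁻ τ = All.++⁻ τ

   split-shift : ∀ m {i i0} -> i ≤ i0 -> i0 < shift m i -> ∃ λ x -> x < m × i0 ≡ x + i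
   split-shift m {i} {i0} i≤ <i = i0 ∸ i , ℕ.+-cancelʳ-< i _ _ (subst₂ _<_ (sym (m∸n+n≡m i≤)) (shift≡ m i) <i) , sym (m∸n+n≡m i≤)

   ∈-mergedP : ∀ w i j {i0} -> i ≤ i0 -> i0 < endP w i -> eP i0 ∈ merged w i j
   ∈-mergedP [] i j i≤ <i = absurd i≤ (ℕ.<⇒≱ <i)
   ∈-mergedP (P ∷ w) i j i≤ <i = case ≤⇒≡⊎< i≤ of λ where
    (inj₁ refl) -> here refl
    (inj₂ i<) -> there (∈-mergedP w (suc i) j i< <i)
   ∈-mergedP (Q ∷ w) i j i≤ <i = there (∈-mergedP w i (suc j) i≤ <i)
   ∈-mergedP (blk b ∷ w) i j {i0} i≤ <i = case i0 ℕ.<? shift (len b) i of λ where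
    (yes in-block) -> ∈-++⁺ˡ (∈-segment⁺ (len b) i i≤ in-block)
    (no beyond) -> ∈-++⁺ʳ (segment (len b) i) (∈-mergedP w _ _ (ℕ.≮⇒≥ beyond) <i)

   ∈-mergedQ : ∀ w i j {j0} -> endP w i ≤ N -> endQ w j ≤ N -> Sat ρ (assignment w i j) -> j ≤ j0 -> j0 < endQ w j -> eQ j0 ∈ merged w i j
   ∈-mergedQ [] i j _ _ s j≤ <j = absurd j≤ (ℕ.<⇒≱ <j)
   ∈-mergedQ (P ∷ w) i j ≤P ≤Q s j≤ <j = there (∈-mergedQ w (suc i) j ≤P ≤Q s j≤ <j)
   ∈-mergedQ (Q ∷ w) i j ≤P ≤Q s j≤ <j = case ≤⇒≡⊎< j≤ of λ where
    (inj₁ refl) -> here refl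
    (inj₂ j<) -> there (∈-mergedQ w i (suc j) ≤P ≤Q s j< <j)
   ∈-mergedQ (blk b ∷ w) i j {j0} ≤P ≤Q s j≤ <j = let (sb , sw) = Sat-++⁻ (blockAssignment b i j) s in
    case j0 ℕ.<? shift (len b) j of λ where
     (yes in-block) -> let (x , x< , j₀≡) = split-shift (len b) j≤ in-block in
      subst (_∈ merged (blk b ∷ w) i j) (trans (proj₂ (block-common b sb (≤-trans (≤-endP w _) ≤P) (≤-trans (≤-endQ w _) ≤Q) x x<)) (cong eQ (sym j₀≡)))
       (∈-++⁺ˡ (∈-segment⁺ (len b) i (m≤n+m i x) (subst (x + i <_) (sym (shift≡ (len b) i)) (+-monoˡ-< i x<))))
     (no beyond) -> ∈-++⁺ʳ (segment (len b) i) (∈-mergedQ w _ _ ≤P ≤Q sw (ℕ.≮⇒≥ beyond) <j)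

   coin-orientation : ∀ {c i} o o' -> Coin ρ (i , c , o) -> Coin ρ (i , c , o') -> o ≡ o'
   coin-orientation true true _ _ = refl
   coin-orientation false false _ _ = refl
   coin-orientation true false (p , _) (q , _) = absurd (trans (sym p) q) (ℕ.<⇒≢ ≤-refl)
   coin-orientation false true (p , _) (q , _) = absurd (trans (sym q) p) (ℕ.<⇒≢ ≤-refl)

  -- A common edge outside the blocks of `w` would be listed twice in the merged list, once for each
  -- path.
  covers : ∀ w i j -> endP w i ≤ N -> endQ w j ≤ N -> Sat ρ (assignment w i j) -> Unique (merged w i j) ->
       ∀ {i0 j0} o -> i ≤ i0 -> i0 < endP w i -> j ≤ j0 -> j0 < endQ w j -> Coin ρ (i0 , j0 , o) -> (i0 , j0 , o) ∈ commonCells w i j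
  covers [] i j _ _ _ _ o i≤ <i = absurd i≤ (ℕ.<⇒≱ <i)
  covers (P ∷ w) i j ≤P ≤Q s (e∉ ∷ u) o i≤ <i j≤ <j co = case ≤⇒≡⊎< i≤ of λ where
   (inj₁ refl) -> absurd (coin⇒common o (<-≤-trans <i ≤P) (<-≤-trans <j ≤Q) co) (All.lookup e∉ (∈-mergedQ w (suc i) j ≤P ≤Q s j≤ <j))
   (inj₂ i<) -> covers w (suc i) j ≤P ≤Q s u o i< <i j≤ <j co
  covers (Q ∷ w) i j ≤P ≤Q s (e∉ ∷ u) o i≤ <i j≤ <j co = case ≤⇒≡⊎< j≤ of λ where
   (inj₁ refl) -> absurd (sym (coin⇒common o (<-≤-trans <i ≤P) (<-≤-trans <j ≤Q) co)) (All.lookup e∉ (∈-mergedP w i (suc j) i≤ <i))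
   (inj₂ j<) -> covers w i (suc j) ≤P ≤Q s u o i≤ <i j< <j co
  covers (blk b ∷ w) i j ≤P ≤Q s u {i0} {j0} o i≤ <i j≤ <j co
   with i0 ℕ.<? shift (len b) i | j0 ℕ.<? shift (len b) j
  ... | no i≮ | no j≮ = ∈-++⁺ʳ (blockCells b i j) (covers w _ _ ≤P ≤Q (proj₂ (Sat-++⁻ (blockAssignment b i j) s))
      (proj₁ (AllPairs-++⁻ (segment (len b) i) u)) o (ℕ.≮⇒≥ i≮) <i (ℕ.≮⇒≥ j≮) <j co)
  ... | yes i< | no j≮ = absurd (coin⇒common o (<-≤-trans <i ≤P) (<-≤-trans <j ≤Q) co)
      (proj₂ (AllPairs-++⁻ (segment (len b) i) u) (∈-segment⁺ (len b) i i≤ i<)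
       (∈-mergedQ w _ _ ≤P ≤Q (proj₂ (Sat-++⁻ (blockAssignment b i j) s)) (ℕ.≮⇒≥ j≮) <j))
  ... | no i≮ | yes j< with y , y< , refl ← split-shift (len b) j≤ j< =
      absurd (trans (proj₂ (block-common b (proj₁ (Sat-++⁻ (blockAssignment b i j) s)) (≤-trans (≤-endP w _) ≤P) (≤-trans (≤-endQ w _) ≤Q) y y<))
        (sym (coin⇒common o (<-≤-trans <i ≤P) (<-≤-trans <j ≤Q) co)))
       (proj₂ (AllPairs-++⁻ (segment (len b) i) u)
        (∈-segment⁺ (len b) i (m≤n+m i y) (subst (y + i <_) (sym (shift≡ (len b) i)) (+-monoˡ-< i y<)))
        (∈-mergedP w _ _ (ℕ.≮⇒≥ i≮) <i))
  ... | yes i< | yes j< with x , x< , refl ← split-shift (len b) i≤ i< | y , y< , refl ← split-shift (len b) j≤ j<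
    with (o' , co') , eq ← block-common b (proj₁ (Sat-++⁻ (blockAssignment b i j) s)) (≤-trans (≤-endP w _) ≤P) (≤-trans (≤-endQ w _) ≤Q) y y<
    with refl ← +-cancelʳ-≡ i x y (eP-injective (<-≤-trans <i ≤P)
        (<-≤-trans (subst (y + i <_) (sym (shift≡ (len b) i)) (+-monoˡ-< i y<)) (≤-trans (≤-endP w _) ≤P))
        (trans (coin⇒common o (<-≤-trans <i ≤P) (<-≤-trans <j ≤Q) co) (sym eq)))
   = ∈-++⁺ˡ (in-block b x< (proj₁ (Sat-++⁻ (blockAssignment b i j) s)) co)
   where
   in-block : ∀ b -> x < len b -> Sat ρ (blockAssignment b i j) -> Coin ρ (x + i , x + j , o) -> (x + i , x + j , o) ∈ blockCells b i j
   in-block zero (s≤s z≤n) (p ∷ q ∷ []) co with refl ← coin-orientation o false co (p , q) = here refl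
   in-block (suc l) (s≤s x≤) sb co
    with refl ← coin-orientation o true co (run-sat (suc l) x (m≤n⇒m≤1+n x≤) sb , run-sat (suc l) (suc x) (s≤s x≤) sb) = ∈-cellRun⁺ i j (s≤s x≤)

  Covered : Word -> ℕ -> ℕ -> Set
  Covered w i j = ∀ {i0 j0} o -> i ≤ i0 -> i0 < N -> j ≤ j0 -> j0 < N -> Coin ρ (i0 , j0 , o) -> (i0 , j0 , o) ∈ commonCells w i j

  private
   segment-unique : ∀ m i -> shift m i ≤ N -> Unique (segment m i)
   segment-unique zero i _ = []
   segment-unique (suc m) i ≤N = All.tabulate (λ e∈ -> λ { refl -> let (i0 , i< , <i , eq) = ∈-segment⁻ m (suc i) e∈ in
    ℕ.<⇒≢ i< (eP-injective (<-≤-trans (≤-shift m (suc i)) ≤N) (<-≤-trans <i ≤N) eq) }) ∷ segment-unique m (suc i) ≤N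

  -- An edge repeated in the merged list belongs to both paths, so `Covered` places its cell inside
  -- a block; there the word lists it only once.
  merged-unique : ∀ w i j -> endP w i ≤ N -> endQ w j ≤ N -> Covered w i j -> Unique (merged w i j)
  merged-unique [] i j _ _ _ = []
  merged-unique (P ∷ w) i j ≤P ≤Q cov = All.tabulate fresh ∷ merged-unique w (suc i) j ≤P ≤Q (λ o i< -> cov o (ℕ.<⇒≤ i<))
   where
   i<N = <-≤-trans (≤-endP w (suc i)) ≤P
   fresh : ∀ {e} -> e ∈ merged w (suc i) j -> eP i ≢ e
   fresh e∈ refl = case ∈-merged⁻ w (suc i) j e∈ of λ where
    (inj₁ (i0 , i< , <i , eq)) -> ℕ.<⇒≢ i< (eP-injective i<N (<-≤-trans <i ≤P) eq)
    (inj₂ (j0 , j≤ , <j , eq)) -> let j<N = <-≤-trans <j ≤Q ; (o , co) = common⇒coin i<N j<N eq in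
     ℕ.<⇒≱ ≤-refl (proj₁ (commonCells-≥ w (cov o ≤-refl i<N j≤ j<N co)))
  merged-unique (Q ∷ w) i j ≤P ≤Q cov = All.tabulate fresh ∷ merged-unique w i (suc j) ≤P ≤Q (λ o i≤ <i j< -> cov o i≤ <i (ℕ.<⇒≤ j<))
   where
   j<N = <-≤-trans (≤-endQ w (suc j)) ≤Q
   fresh : ∀ {e} -> e ∈ merged w i (suc j) -> eQ j ≢ e
   fresh e∈ refl = case ∈-merged⁻ w i (suc j) e∈ of λ where
    (inj₂ (j0 , j< , <j , eq)) -> ℕ.<⇒≢ j< (eQ-injective j<N (<-≤-trans <j ≤Q) eq)
    (inj₁ (i0 , i≤ , <i , eq)) -> let i<N = <-≤-trans <i ≤P ; (o , co) = common⇒coin i<N j<N (sym eq) in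
     ℕ.<⇒≱ ≤-refl (proj₂ (commonCells-≥ w (cov o i≤ i<N ≤-refl j<N co)))
  merged-unique (blk b ∷ w) i j ≤P ≤Q cov = AllPairs.++⁺ (segment-unique (len b) i (≤-trans (≤-endP w _) ≤P))
   (merged-unique w _ _ ≤P ≤Q rest) (All.tabulate (λ e∈ -> All.tabulate (fresh e∈)))
   where
   rest : Covered w (shift (len b) i) (shift (len b) j)
   rest o i≤ <i j≤ <j co with ∈-++⁻ (blockCells b i j) (cov o (≤-trans (≤-shift (len b) i) i≤) <i (≤-trans (≤-shift (len b) j) j≤) <j co)
   ... | inj₁ c∈ = absurd i≤ (ℕ.<⇒≱ (proj₁ (blockCells-bounds b c∈)))
   ... | inj₂ c∈ = c∈
   fresh : ∀ {e e'} -> e ∈ segment (len b) i -> e' ∈ merged w _ _ -> e ≢ e'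
   fresh e∈ e'∈ refl with i0 , i≤ , <i , refl ← ∈-segment⁻ (len b) i e∈ | ∈-merged⁻ w _ _ e'∈
   ... | inj₁ (i1 , ≤i₁ , i₁< , eq) = ℕ.<⇒≢ (<-≤-trans <i ≤i₁) (eP-injective (<-≤-trans <i (≤-trans (≤-endP w _) ≤P)) (<-≤-trans i₁< ≤P) eq)
   ... | inj₂ (j1 , ≤j₁ , j₁< , eq) =
    let i₀<N = <-≤-trans <i (≤-trans (≤-endP w _) ≤P) ; j₁<N = <-≤-trans j₁< ≤Q
        (o , co) = common⇒coin i₀<N j₁<N eq in
    case ∈-++⁻ (blockCells b i j) (cov o i≤ i₀<N (≤-trans (≤-shift (len b) j) ≤j₁) j₁<N co) of λ where
     (inj₁ c∈) -> ℕ.<⇒≱ (proj₂ (blockCells-bounds b c∈)) ≤j₁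
     (inj₂ c∈) -> ℕ.<⇒≱ <i (proj₁ (commonCells-≥ w c∈))

  module _ (κ : A -> ℕ) (κ-injective : ∀ {a a'} -> κ a ≡ κ a' -> a ≡ a') where

   Increases : (ℕ -> A) -> Set
   Increases e = ∀ {i i'} -> i < i' -> i' < N -> κ (e i) < κ (e i')

   private
    merged-All : ∀ w {i j} {R : A -> Set} -> endP w i ≡ N -> endQ w j ≡ N -> (∀ {i0} -> i ≤ i0 -> i0 < N -> R (eP i0)) ->
          (∀ {j0} -> j ≤ j0 -> j0 < N -> R (eQ j0)) -> All R (merged w i j)
    merged-All w refl ≡Q rp rq = All.tabulate λ e∈ -> case ∈-merged⁻ w _ _ e∈ of λ where
     (inj₁ (i0 , i≤ , <i , refl)) -> rp i≤ <i
     (inj₂ (j0 , j≤ , <j , refl)) -> rq j≤ (subst (_ <_) ≡Q <j)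

    -- The common edge starts a new block, or prolongs the next one if both run in the same
    -- direction. A reversed edge cannot touch another block, because the two would prescribe
    -- different values at position `suc j`.
    join : ∀ {i j} o w -> i < N -> j < N -> Coin ρ (i , j , o) -> NoAdj w -> Sat ρ (assignment w (suc i) (suc j)) -> ∃ λ w' ->
        NoAdj w' × Sat ρ (assignment w' i j) × merged w' i j ≡ eP i ∷ merged w (suc i) (suc j) × endP w' i ≡ endP w (suc i) × endQ w' j ≡ endQ w (suc j)
    join true [] _ _ (p , q) na s = blk 1 ∷ [] , (tt , tt) , p ∷ q ∷ s , refl , refl , refl
    join true (P ∷ w) _ _ (p , q) na s = blk 1 ∷ P ∷ w , (tt , na) , p ∷ q ∷ s , refl , refl , refl
    join true (Q ∷ w) _ _ (p , q) na s = blk 1 ∷ Q ∷ w , (tt , na) , p ∷ q ∷ s , refl , refl , refl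
    join true (blk zero ∷ w) _ _ (p , q) na (p' ∷ s) = absurd (trans (sym q) p') (ℕ.<⇒≢ ≤-refl)
    join true (blk (suc l) ∷ w) _ _ (p , q) na s = blk (suc (suc l)) ∷ w , na , p ∷ s , refl , refl , refl
    join false [] _ _ (p , q) na s = blk 0 ∷ [] , (tt , tt) , p ∷ q ∷ s , refl , refl , refl
    join false (P ∷ w) _ _ (p , q) na s = blk 0 ∷ P ∷ w , (tt , na) , p ∷ q ∷ s , refl , refl , refl
    join false (Q ∷ w) _ _ (p , q) na s = blk 0 ∷ Q ∷ w , (tt , na) , p ∷ q ∷ s , refl , refl , refl
    join false (blk zero ∷ w) _ _ (p , q) na (p' ∷ s) = absurd (trans (sym q) p') (m≢1+n+m _ {1})
    join false (blk (suc l) ∷ w) _ _ (p , q) na (p' ∷ s) = absurd (trans (sym q) p') (ℕ.<⇒≢ ≤-refl)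

   module _ (incP : Increases eP) (incQ : Increases eQ) where

    private
     Result : ℕ -> ℕ -> Set
     Result i j = ∃ λ w -> NoAdj w × Sat ρ (assignment w i j) × Ordered κ (merged w i j) × endP w i ≡ N × endQ w j ≡ N

     -- The usual merge of two increasing sequences, steered by their next labels. Since labels are
     -- injective, a tie is a common edge.
     search : ∀ a b i j -> a + i ≡ N -> b + j ≡ N -> Result i j
     stepP : ∀ a b i j -> a + suc i ≡ N -> b + j ≡ N -> (∀ {j0} -> j ≤ j0 -> j0 < N -> κ (eP i) < κ (eQ j0)) -> Result i j
     stepQ : ∀ a b i j -> a + i ≡ N -> b + suc j ≡ N -> (∀ {i0} -> i ≤ i0 -> i0 < N -> κ (eQ j) < κ (eP i0)) -> Result i j

     stepP a b i j ≡i ≡j below with w , na , s , ord , ≡P , ≡Q ← search a b (suc i) j ≡i ≡j =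
      P ∷ w , na , s , merged-All w ≡P ≡Q (λ i< -> incP i<) below ∷ ord , ≡P , ≡Q

     stepQ a b i j ≡i ≡j below with w , na , s , ord , ≡P , ≡Q ← search a b i (suc j) ≡i ≡j =
      Q ∷ w , na , s , merged-All w ≡P ≡Q below (λ j< -> incQ j<) ∷ ord , ≡P , ≡Q

     prolong : ∀ {e : ℕ -> A} (inc : Increases e) {v i i0} -> v < κ (e i) -> i ≤ i0 -> i0 < N -> v < κ (e i0)
     prolong inc v< i≤ <N = case ≤⇒≡⊎< i≤ of λ where
      (inj₁ refl) -> v<
      (inj₂ i<) -> <-trans v< (inc i< <N)

     <N : ∀ a {i} -> suc a + i ≡ N -> i < N
     <N a refl = s≤s (m≤n+m _ a)

     search zero zero i j refl refl = [] , tt , [] , [] , refl , sym (sym refl)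
     search (suc a) zero i j ≡i ≡j = stepP a zero i j (trans (+-suc a i) ≡i) ≡j
      (λ j≤ <j -> absurd (≡≤ (sym ≡j) j≤) (ℕ.<⇒≱ <j))
     search zero (suc b) i j ≡i ≡j = stepQ zero b i j ≡i (trans (+-suc b j) ≡j)
      (λ i≤ <i -> absurd (≡≤ (sym ≡i) i≤) (ℕ.<⇒≱ <i))
     search (suc a) (suc b) i j ≡i ≡j with <-cmp (κ (eP i)) (κ (eQ j))
     ... | tri< lt _ _ = stepP a (suc b) i j (trans (+-suc a i) ≡i) ≡j (prolong incQ lt)
     ... | tri> _ _ gt = stepQ (suc a) b i j ≡i (trans (+-suc b j) ≡j) (prolong incP gt)
     ... | tri≈ _ eq _ with o , co ← common⇒coin (<N a ≡i) (<N b ≡j) (κ-injective eq)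
       with w , na , s , ord , ≡P , ≡Q ← search a b (suc i) (suc j) (trans (+-suc a i) ≡i) (trans (+-suc b j) ≡j)
       with w' , na' , s' , merged≡ , P≡ , Q≡ ← join o w (<N a ≡i) (<N b ≡j) co na s =
      w' , na' , s' , subst (Ordered κ) (sym merged≡)
       (merged-All w ≡P ≡Q (λ i< -> incP i<) (λ j< <j -> subst (_< κ (eQ _)) (sym eq) (incQ j< <j)) ∷ ord) , trans P≡ ≡P , trans Q≡ ≡Q

    merge-exists : ∃ λ w -> NoAdj w × Sat ρ (assignment w 0 0) × Ordered κ (merged w 0 0) × endP w 0 ≡ N × endQ w 0 ≡ N
    merge-exists = search N N 0 0 (+-identityʳ N) (+-identityʳ N)

   Merges : Word -> ℕ -> ℕ -> Set
   Merges w i j = NoAdj w × Sat ρ (assignment w i j) × Ordered κ (merged w i j) × endP w i ≡ N × endQ w j ≡ N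

   private
    merges-P : ∀ {w i j} -> Merges (P ∷ w) i j -> Merges w (suc i) j × (∀ {i0} -> i < i0 -> i0 < N -> κ (eP i) < κ (eP i0)) × (∀ {j0} -> j ≤ j0 -> j0 < N -> κ (eP i) < κ (eQ j0))
    merges-P {w} (na , s , h ∷ ord , refl , ≡Q) = (na , s , ord , refl , ≡Q) ,
     (λ i< <i -> All.lookup h (∈-mergedP w _ _ i< <i)) ,
     (λ j≤ <j -> All.lookup h (∈-mergedQ w _ _ ≤-refl (≤-reflexive ≡Q) s j≤ (subst (_ <_) (sym ≡Q) <j)))

    merges-Q : ∀ {w i j} -> Merges (Q ∷ w) i j -> Merges w i (suc j) × (∀ {i0} -> i ≤ i0 -> i0 < N -> κ (eQ j) < κ (eP i0)) × (∀ {j0} -> j < j0 -> j0 < N -> κ (eQ j) < κ (eQ j0))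
    merges-Q {w} (na , s , h ∷ ord , refl , ≡Q) = (na , s , ord , refl , ≡Q) ,
     (λ i≤ <i -> All.lookup h (∈-mergedP w _ _ i≤ <i)) ,
     (λ j< <j -> All.lookup h (∈-mergedQ w _ _ ≤-refl (≤-reflexive ≡Q) s j< (subst (_ <_) (sym ≡Q) <j)))

    merges-blk : ∀ {b w i j} -> Merges (blk b ∷ w) i j -> BlockFree w × Sat ρ (blockAssignment b i j) × Merges w (shift (len b) i) (shift (len b) j)
    merges-blk {b} {w} {i} {j} ((bf , na) , s , ord , ≡P , ≡Q) = let (sb , sw) = Sat-++⁻ (blockAssignment b i j) s in
     bf , sb , na , sw , proj₁ (AllPairs-++⁻ (segment (len b) i) ord) , ≡P , ≡Q

    merges-<N : ∀ {b w i j} -> Merges (blk b ∷ w) i j -> shift (len b) i ≤ N × shift (len b) j ≤ N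
    merges-<N {b} {w} (_ , _ , _ , refl , ≡Q) = ≤-endP w _ , ≤≡ (≤-endQ w _) ≡Q

    not-tied : ∀ w {i j} -> BlockFree w -> Merges w i j -> i < N -> j < N -> eP i ≢ eQ j
    not-tied [] bf (_ , _ , _ , refl , _) i<N _ _ = ℕ.<⇒≢ i<N refl
    not-tied (P ∷ w) bf m i<N j<N eq = ℕ.<⇒≢ (proj₂ (proj₂ (merges-P {w} m)) ≤-refl j<N) (cong κ eq)
    not-tied (Q ∷ w) bf m i<N j<N eq = ℕ.<⇒≢ (proj₁ (proj₂ (merges-Q {w} m)) ≤-refl i<N) (cong κ (sym eq))

    <-shift : ∀ b i -> i < shift (len b) i
    <-shift zero i = ≤-refl
    <-shift (suc l) i = ≤-shift l (suc i)

    blk-tied : ∀ {b w i j} -> Merges (blk b ∷ w) i j -> i < N × j < N × eP i ≡ eQ j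
    blk-tied {b} {w} {i} {j} m = let (_ , sb , _) = merges-blk {b} {w} m ; (i≤ , j≤) = merges-<N {b} {w} m in
     <-≤-trans (<-shift b i) i≤ , <-≤-trans (<-shift b j) j≤ ,
     proj₂ (block-common b sb i≤ j≤ 0 (0<len b))
     where
     0<len : ∀ b -> 0 < len b
     0<len zero = s≤s z≤n
     0<len (suc l) = s≤s z≤n

    -- No block follows the shorter run, so by `not-tied` the next edges of the two paths differ;
    -- the longer run makes them equal.
    longer-run : ∀ l l' {w w' i j} -> l < l' -> Merges (blk (suc l) ∷ w) i j -> ¬ Merges (blk (suc l') ∷ w') i j
    longer-run l l' {w} {w'} {i} {j} l<l' m m' =
     let (bf , _ , mw) = merges-blk {suc l} {w} m ; (_ , sb' , _) = merges-blk {suc l'} {w'} m'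
         (i≤ , j≤) = merges-<N {suc l'} {w'} m'
         bound : ∀ i -> shift (suc l') i ≤ N -> shift (suc l) i < N
         bound i i≤ = ≤-trans (subst₂ _≤_ (cong suc (sym (shift≡ (suc l) i))) (sym (shift≡ (suc l') i)) (+-monoˡ-≤ i (s≤s l<l'))) i≤
     in not-tied w bf mw (bound i i≤) (bound j j≤)
        (subst₂ (λ a b -> eP a ≡ eQ b) (sym (shift≡ (suc l) i)) (sym (shift≡ (suc l) j)) (proj₂ (block-common (suc l') sb' i≤ j≤ (suc l) (s≤s l<l'))))

   -- Comparing the next labels of the two paths decides the next letter, and maximality of blocks
   -- decides their lengths.
   merge-unique : ∀ w w' {i j} -> Merges w i j -> Merges w' i j -> w ≡ w'
   merge-unique [] [] _ _ = refl
   merge-unique [] (P ∷ w') (_ , _ , _ , refl , _) (_ , _ , _ , ≡P , _) = absurd (≤≡ (≤-endP w' _) ≡P) (ℕ.<⇒≱ ≤-refl)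
   merge-unique [] (Q ∷ w') (_ , _ , _ , _ , refl) (_ , _ , _ , _ , ≡Q) = absurd (≤≡ (≤-endQ w' _) ≡Q) (ℕ.<⇒≱ ≤-refl)
   merge-unique [] (blk b ∷ w') m m' = let (i< , j< , eq) = blk-tied {b} {w'} m' in absurd eq (not-tied [] tt m i< j<)
   merge-unique (P ∷ w) [] (_ , _ , _ , ≡P , _) (_ , _ , _ , refl , _) = absurd (≤≡ (≤-endP w _) ≡P) (ℕ.<⇒≱ ≤-refl)
   merge-unique (Q ∷ w) [] (_ , _ , _ , _ , ≡Q) (_ , _ , _ , _ , refl) = absurd (≤≡ (≤-endQ w _) ≡Q) (ℕ.<⇒≱ ≤-refl)
   merge-unique (blk b ∷ w) [] m m' = let (i< , j< , eq) = blk-tied {b} {w} m in absurd eq (not-tied [] tt m' i< j<)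
   merge-unique (P ∷ w) (P ∷ w') m m' = cong (P ∷_) (merge-unique w w' (proj₁ (merges-P {w} m)) (proj₁ (merges-P {w'} m')))
   merge-unique (Q ∷ w) (Q ∷ w') m m' = cong (Q ∷_) (merge-unique w w' (proj₁ (merges-Q {w} m)) (proj₁ (merges-Q {w'} m')))
   merge-unique (P ∷ w) (Q ∷ w') m m' = absurd (proj₂ (proj₂ (merges-P {w} m)) ≤-refl (jN m')) (ℕ.<⇒≯ (proj₁ (proj₂ (merges-Q {w'} m')) ≤-refl (iN m)))
    where
    iN : ∀ {i j} -> Merges (P ∷ w) i j -> i < N
    iN (_ , _ , _ , refl , _) = ≤-endP w _
    jN : ∀ {i j} -> Merges (Q ∷ w') i j -> j < N
    jN (_ , _ , _ , _ , refl) = ≤-endQ w' _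
   merge-unique (Q ∷ w) (P ∷ w') m m' = absurd (proj₂ (proj₂ (merges-P {w'} m')) ≤-refl (jN m)) (ℕ.<⇒≯ (proj₁ (proj₂ (merges-Q {w} m)) ≤-refl (iN m')))
    where
    iN : ∀ {i j} -> Merges (P ∷ w') i j -> i < N
    iN (_ , _ , _ , refl , _) = ≤-endP w' _
    jN : ∀ {i j} -> Merges (Q ∷ w) i j -> j < N
    jN (_ , _ , _ , _ , refl) = ≤-endQ w _
   merge-unique (P ∷ w) (blk b ∷ w') m m' = let (i< , j< , eq) = blk-tied {b} {w'} m' in absurd eq (not-tied (P ∷ w) tt m i< j<)
   merge-unique (Q ∷ w) (blk b ∷ w') m m' = let (i< , j< , eq) = blk-tied {b} {w'} m' in absurd eq (not-tied (Q ∷ w) tt m i< j<)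
   merge-unique (blk b ∷ w) (P ∷ w') m m' = let (i< , j< , eq) = blk-tied {b} {w} m in absurd eq (not-tied (P ∷ w') tt m' i< j<)
   merge-unique (blk b ∷ w) (Q ∷ w') m m' = let (i< , j< , eq) = blk-tied {b} {w} m in absurd eq (not-tied (Q ∷ w') tt m' i< j<)
   merge-unique (blk zero ∷ w) (blk zero ∷ w') m m' =
    cong (blk zero ∷_) (merge-unique w w' (proj₂ (proj₂ (merges-blk {zero} {w} m))) (proj₂ (proj₂ (merges-blk {zero} {w'} m'))))
   merge-unique (blk zero ∷ w) (blk (suc l) ∷ w') (_ , p ∷ _ , _) (_ , q ∷ _ , _) = absurd (trans (sym q) p) (ℕ.<⇒≢ ≤-refl)
   merge-unique (blk (suc l) ∷ w) (blk zero ∷ w') (_ , p ∷ _ , _) (_ , q ∷ _ , _) = absurd (trans (sym p) q) (ℕ.<⇒≢ ≤-refl)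
   merge-unique (blk (suc l) ∷ w) (blk (suc l') ∷ w') m m' with <-cmp l l'
   ... | tri< l<l' _ _ = absurd m' (longer-run l l' {w} {w'} l<l' m)
   ... | tri> _ _ l'<l = absurd m (longer-run l' l {w'} {w} l'<l m')
   ... | tri≈ _ refl _ = cong (blk (suc l) ∷_) (merge-unique w w' (proj₂ (proj₂ (merges-blk {suc l} {w} m))) (proj₂ (proj₂ (merges-blk {suc l} {w'} m'))))

   merges⇒increasing : ∀ w {i j} -> Merges w i j -> (∀ {i0 i1} -> i ≤ i0 -> i0 < i1 -> i1 < N -> κ (eP i0) < κ (eP i1)) × (∀ {j0 j1} -> j ≤ j0 -> j0 < j1 -> j1 < N -> κ (eQ j0) < κ (eQ j1))
   merges⇒increasing [] (_ , _ , _ , refl , refl) =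
    (λ i≤ i< <N -> absurd (<-trans i< <N) (ℕ.≤⇒≯ i≤)) , (λ j≤ j< <N -> absurd (<-trans j< <N) (ℕ.≤⇒≯ j≤))
   merges⇒increasing (P ∷ w) m = let (mw , below , _) = merges-P {w} m ; (incP , incQ) = merges⇒increasing w mw in
    (λ i≤ i< <N -> case ≤⇒≡⊎< i≤ of λ { (inj₁ refl) -> below i< <N ; (inj₂ i<₀) -> incP i<₀ i< <N }) , incQ
   merges⇒increasing (Q ∷ w) m = let (mw , _ , below) = merges-Q {w} m ; (incP , incQ) = merges⇒increasing w mw in
    incP , (λ j≤ j< <N -> case ≤⇒≡⊎< j≤ of λ { (inj₁ refl) -> below j< <N ; (inj₂ j<₀) -> incQ j<₀ j< <N })
   merges⇒increasing (blk b ∷ w) {i} {j} m@(_ , s , ord , ≡P , ≡Q) = incP' , incQ'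
    where
    sb = proj₁ (proj₂ (merges-blk {b} {w} m))
    sw = proj₁ (proj₂ (proj₂ (proj₂ (merges-blk {b} {w} m))))
    ends = merges-<N {b} {w} m
    rest = merges⇒increasing w (proj₂ (proj₂ (merges-blk {b} {w} m)))
    segment-ordered : ∀ m {i ys} -> Ordered κ (segment m i ++ ys) -> ∀ {i0 i1} -> i ≤ i0 -> i0 < i1 -> i1 < shift m i -> κ (eP i0) < κ (eP i1)
    segment-ordered zero ord i≤ i< <i = absurd (<-trans i< <i) (ℕ.≤⇒≯ i≤)
    segment-ordered (suc m) {i} (h ∷ ord) i≤ i< <i = case ≤⇒≡⊎< i≤ of λ where
     (inj₁ refl) -> All.lookup h (∈-++⁺ˡ (∈-segment⁺ m (suc i) i< <i))
     (inj₂ i<₀) -> segment-ordered m ord i<₀ i< <i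
    before : ∀ {i0 e} -> i ≤ i0 -> i0 < shift (len b) i -> e ∈ merged w _ _ -> κ (eP i0) < κ e
    before i≤ <i e∈ = proj₂ (AllPairs-++⁻ (segment (len b) i) ord) (∈-segment⁺ (len b) i i≤ <i) e∈
    incP' : ∀ {i0 i1} -> i ≤ i0 -> i0 < i1 -> i1 < N -> κ (eP i0) < κ (eP i1)
    incP' {i0} {i1} i≤ i< <N with i0 ℕ.<? shift (len b) i | i1 ℕ.<? shift (len b) i
    ... | no i≮ | _ = proj₁ rest (ℕ.≮⇒≥ i≮) i< <N
    ... | yes <i | yes i₁< = segment-ordered (len b) ord i≤ i< i₁<
    ... | yes <i | no i₁≮ = before i≤ <i (∈-mergedP w _ _ (ℕ.≮⇒≥ i₁≮) (subst (i1 <_) (sym ≡P) <N))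
    common : ∀ {j0} -> j ≤ j0 -> j0 < shift (len b) j -> ∃ λ x -> x + i < shift (len b) i × j0 ≡ x + j × eP (x + i) ≡ eQ j0
    common j≤ <j = let (x , x< , j₀≡) = split-shift (len b) j≤ <j in
     x , subst (x + i <_) (sym (shift≡ (len b) i)) (+-monoˡ-< i x<) , j₀≡ ,
     trans (proj₂ (block-common b sb (proj₁ ends) (proj₂ ends) x x<)) (cong eQ (sym j₀≡))
    incQ' : ∀ {j0 j1} -> j ≤ j0 -> j0 < j1 -> j1 < N -> κ (eQ j0) < κ (eQ j1)
    incQ' {j0} {j1} j≤ j< <N with j0 ℕ.<? shift (len b) j | j1 ℕ.<? shift (len b) j
    ... | no j≮ | _ = proj₂ rest (ℕ.≮⇒≥ j≮) j< <N
    ... | yes <j | yes j₁< with x , x< , refl , eq ← common j≤ <j | y , y< , refl , eq' ← common (≤-trans j≤ (ℕ.<⇒≤ j<)) j₁< =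
     subst₂ (λ a b -> κ a < κ b) eq eq' (segment-ordered (len b) ord (m≤n+m i x) (+-monoˡ-< i (ℕ.+-cancelʳ-< j x y j<)) y<)
    ... | yes <j | no j₁≮ with x , x< , refl , eq ← common j≤ <j =
     subst (λ a -> κ a < κ (eQ j1)) eq (before (m≤n+m i x) x<
      (∈-mergedQ w _ _ (≤-reflexive ≡P) (≤-reflexive ≡Q) sw (ℕ.≮⇒≥ j₁≮) (subst (j1 <_) (sym ≡Q) <N)))

 -- Counting words with given blocks

 -- A block followed by a prescribed sequence of letters P (true) and Q (false).
 Tag : Set
 Tag = ℕ × List Bool

 letter : Bool -> Letter
 letter true = P
 letter false = Q

 #P #Q : List Bool -> ℕ
 #P [] = 0
 #P (true ∷ u) = suc (#P u)
 #P (false ∷ u) = #P u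
 #Q [] = 0
 #Q (true ∷ u) = #Q u
 #Q (false ∷ u) = suc (#Q u)

 ΣP ΣQ Σlen : List Tag -> ℕ
 ΣP [] = 0
 ΣP ((b , u) ∷ σ) = #P u + ΣP σ
 ΣQ [] = 0
 ΣQ ((b , u) ∷ σ) = #Q u + ΣQ σ
 Σlen [] = 0
 Σlen ((b , u) ∷ σ) = len b + Σlen σ

 -- All words with e free letters P, f free letters Q and the tagged blocks σ, in this order.
 words goP goQ goB stop : ℕ -> ℕ -> List Tag -> List Word
 words e f σ = stop e f σ ++ goP e f σ ++ goQ e f σ ++ goB e f σ
 stop zero zero [] = [] ∷ []
 stop _ _ _ = []
 goP zero f σ = []
 goP (suc e) f σ = map (P ∷_) (words e f σ)
 goQ e zero σ = []
 goQ e (suc f) σ = map (Q ∷_) (words e f σ)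
 goB e f [] = []
 goB e f ((b , u) ∷ σ) = map (λ w -> blk b ∷ map letter u ++ w) (words e f σ)

 data Case (e f : ℕ) (σ : List Tag) (w : Word) : Set where
  stopped : e ≡ 0 -> f ≡ 0 -> σ ≡ [] -> w ≡ [] -> Case e f σ w
  byP : ∀ {e' w'} -> e ≡ suc e' -> w ≡ P ∷ w' -> w' ∈ words e' f σ -> Case e f σ w
  byQ : ∀ {f' w'} -> f ≡ suc f' -> w ≡ Q ∷ w' -> w' ∈ words e f' σ -> Case e f σ w
  byB : ∀ {b u σ' w'} -> σ ≡ (b , u) ∷ σ' -> w ≡ blk b ∷ map letter u ++ w' -> w' ∈ words e f σ' -> Case e f σ w

 words-case : ∀ e f σ {w} -> w ∈ words e f σ -> Case e f σ w
 words-case e f σ w∈ with ∈-++⁻ (stop e f σ) w∈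
 words-case zero zero [] w∈ | inj₁ (here refl) = stopped refl refl refl refl
 ... | inj₂ w∈₁ with ∈-++⁻ (goP e f σ) w∈₁
 words-case (suc e) f σ w∈ | inj₂ w∈₁ | inj₁ w∈P with w' , w'∈ , refl ← ∈-map⁻ (P ∷_) w∈P = byP refl refl w'∈
 ... | inj₂ w∈₂ with ∈-++⁻ (goQ e f σ) w∈₂
 words-case e (suc f) σ w∈ | inj₂ w∈₁ | inj₂ w∈₂ | inj₁ w∈Q with w' , w'∈ , refl ← ∈-map⁻ (Q ∷_) w∈Q = byQ refl refl w'∈
 words-case e f ((b , u) ∷ σ) w∈ | inj₂ w∈₁ | inj₂ w∈₂ | inj₂ w∈B with w' , w'∈ , refl ← ∈-map⁻ (λ w -> blk b ∷ map letter u ++ w) w∈B = byB refl refl w'∈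

 words-P : ∀ e f σ {w} -> w ∈ words e f σ -> P ∷ w ∈ words (suc e) f σ
 words-P e f σ w∈ = ∈-++⁺ʳ (stop (suc e) f σ) (∈-++⁺ˡ (∈-map⁺ (P ∷_) w∈))

 words-Q : ∀ e f σ {w} -> w ∈ words e f σ -> Q ∷ w ∈ words e (suc f) σ
 words-Q e f σ w∈ = ∈-++⁺ʳ (stop e (suc f) σ) (∈-++⁺ʳ (goP e (suc f) σ) (∈-++⁺ˡ (∈-map⁺ (Q ∷_) w∈)))

 words-B : ∀ e f b u σ {w} -> w ∈ words e f σ -> blk b ∷ map letter u ++ w ∈ words e f ((b , u) ∷ σ)
 words-B e f b u σ w∈ = ∈-++⁺ʳ (stop e f ((b , u) ∷ σ)) (∈-++⁺ʳ (goP e f ((b , u) ∷ σ)) (∈-++⁺ʳ (goQ e f ((b , u) ∷ σ))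
  (∈-map⁺ (λ w -> blk b ∷ map letter u ++ w) w∈)))

 size : Word -> ℕ
 size [] = 0
 size (P ∷ w) = suc (size w)
 size (Q ∷ w) = suc (size w)
 size (blk b ∷ w) = len b + size w

 weight : Word -> ℕ
 weight [] = 0
 weight (P ∷ w) = weight w
 weight (Q ∷ w) = weight w
 weight (blk b ∷ w) = suc (len b) + weight w

 endP-++ : ∀ u w i -> endP (map letter u ++ w) i ≡ endP w (#P u + i)
 endP-++ [] w i = refl
 endP-++ (true ∷ u) w i = trans (endP-++ u w (suc i)) (cong (endP w) (+-suc (#P u) i))
 endP-++ (false ∷ u) w i = endP-++ u w i

 endQ-++ : ∀ u w j -> endQ (map letter u ++ w) j ≡ endQ w (#Q u + j)
 endQ-++ [] w j = refl
 endQ-++ (true ∷ u) w j = endQ-++ u w j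
 endQ-++ (false ∷ u) w j = trans (endQ-++ u w (suc j)) (cong (endQ w) (+-suc (#Q u) j))

 size-++ : ∀ u w -> size (map letter u ++ w) ≡ #P u + #Q u + size w
 size-++ [] w = refl
 size-++ (true ∷ u) w = cong suc (size-++ u w)
 size-++ (false ∷ u) w = trans (cong suc (size-++ u w)) (cong (_+ size w) (sym (+-suc (#P u) (#Q u))))

 weight-++ : ∀ u w -> weight (map letter u ++ w) ≡ weight w
 weight-++ [] w = refl
 weight-++ (true ∷ u) w = weight-++ u w
 weight-++ (false ∷ u) w = weight-++ u w

 assignment-++ : ∀ u w i j -> assignment (map letter u ++ w) i j ≡ assignment w (#P u + i) (#Q u + j)
 assignment-++ [] w i j = refl
 assignment-++ (true ∷ u) w i j = trans (assignment-++ u w (suc i) j) (cong (λ i -> assignment w i (#Q u + j)) (+-suc (#P u) i))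
 assignment-++ (false ∷ u) w i j = trans (assignment-++ u w i (suc j)) (cong (assignment w _) (+-suc (#Q u) j))

 words-endP : ∀ e f σ {w} -> w ∈ words e f σ -> ∀ i -> endP w i ≡ e + ΣP σ + Σlen σ + i
 words-endP e f σ w∈ i with words-case e f σ w∈
 ... | stopped refl refl refl refl = refl
 ... | byP {e'} refl refl w'∈ = trans (words-endP e' f σ w'∈ (suc i)) (+-suc _ i)
 ... | byQ {f'} refl refl w'∈ = words-endP e f' σ w'∈ i
 ... | byB {b} {u} {σ'} {w'} refl refl w'∈ = trans (endP-++ u w' _) (trans (words-endP e f σ' w'∈ _)
  (trans (cong (λ z -> e + ΣP σ' + Σlen σ' + (#P u + z)) (shift≡ (len b) i)) (rearrange e (ΣP σ') (Σlen σ') (#P u) (len b) i)))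
  where
  rearrange : ∀ e a l p b i -> e + a + l + (p + (b + i)) ≡ e + (p + a) + (b + l) + i
  rearrange = solve-∀

 words-endQ : ∀ e f σ {w} -> w ∈ words e f σ -> ∀ j -> endQ w j ≡ f + ΣQ σ + Σlen σ + j
 words-endQ e f σ w∈ j with words-case e f σ w∈
 ... | stopped refl refl refl refl = refl
 ... | byP {e'} refl refl w'∈ = words-endQ e' f σ w'∈ j
 ... | byQ {f'} refl refl w'∈ = trans (words-endQ e f' σ w'∈ (suc j)) (+-suc _ j)
 ... | byB {b} {u} {σ'} {w'} refl refl w'∈ = trans (endQ-++ u w' _) (trans (words-endQ e f σ' w'∈ _)
  (trans (cong (λ z -> f + ΣQ σ' + Σlen σ' + (#Q u + z)) (shift≡ (len b) j)) (rearrange f (ΣQ σ') (Σlen σ') (#Q u) (len b) j)))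
  where
  rearrange : ∀ e a l p b i -> e + a + l + (p + (b + i)) ≡ e + (p + a) + (b + l) + i
  rearrange = solve-∀

 words-size : ∀ e f σ {w} -> w ∈ words e f σ -> size w ≡ (e + ΣP σ) + (f + ΣQ σ) + Σlen σ
 words-size e f σ w∈ with words-case e f σ w∈
 ... | stopped refl refl refl refl = refl
 ... | byP {e'} refl refl w'∈ = cong suc (words-size e' f σ w'∈)
 ... | byQ {f'} refl refl w'∈ = trans (cong suc (words-size e f' σ w'∈)) (cong (_+ Σlen σ) (sym (+-suc _ _)))
 ... | byB {b} {u} {σ'} {w'} refl refl w'∈ = trans (cong (len b +_) (trans (size-++ u w') (cong (#P u + #Q u +_) (words-size e f σ' w'∈))))
  (rearrange (len b) (#P u) (#Q u) e (ΣP σ') f (ΣQ σ') (Σlen σ'))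
  where
  rearrange : ∀ b p q e a f c l -> b + (p + q + (e + a + (f + c) + l)) ≡ e + (p + a) + (f + (q + c)) + (b + l)
  rearrange = solve-∀

 words-weight : ∀ e f σ {w} -> w ∈ words e f σ -> weight w ≡ Σlen σ + length σ
 words-weight e f σ w∈ with words-case e f σ w∈
 ... | stopped refl refl refl refl = refl
 ... | byP {e'} refl refl w'∈ = words-weight e' f σ w'∈
 ... | byQ {f'} refl refl w'∈ = words-weight e f' σ w'∈
 ... | byB {b} {u} {σ'} {w'} refl refl w'∈ = trans (cong (suc (len b) +_) (trans (weight-++ u w') (words-weight e f σ' w'∈)))
  (rearrange (len b) (Σlen σ') (length σ'))
  where
  rearrange : ∀ b l c -> suc b + (l + c) ≡ b + l + suc c
  rearrange = solve-∀

 assignment-length : ∀ w i j -> length (assignment w i j) ≡ weight w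
 assignment-length [] i j = refl
 assignment-length (P ∷ w) i j = assignment-length w (suc i) j
 assignment-length (Q ∷ w) i j = assignment-length w i (suc j)
 assignment-length (blk b ∷ w) i j = trans (List.length-++ (blockAssignment b i j)) (cong₂ _+_ (block-length b) (assignment-length w _ _))
  where
  run-length : ∀ m i j -> length (run m i j) ≡ m
  run-length zero i j = refl
  run-length (suc m) i j = cong suc (run-length m (suc i) (suc j))
  block-length : ∀ b -> length (blockAssignment b i j) ≡ suc (len b)
  block-length zero = refl
  block-length (suc l) = run-length (suc (suc l)) i j

 -- What `FarFrom` demands of the letters after a block: both paths advance, by at least three edges
 -- in total.
 record Separating (u : List Bool) : Set where
  field
   1≤#P : 1 ≤ #P u
   1≤#Q : 1 ≤ #Q u
   3≤ : 3 ≤ #P u + #Q u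

 BlockFree-++ : ∀ u w -> 1 ≤ #P u -> BlockFree (map letter u ++ w)
 BlockFree-++ (true ∷ u) w _ = tt
 BlockFree-++ (false ∷ u) w _ = tt

 NoAdj-++ : ∀ u w -> NoAdj w -> NoAdj (map letter u ++ w)
 NoAdj-++ [] w na = na
 NoAdj-++ (true ∷ u) w na = NoAdj-++ u w na
 NoAdj-++ (false ∷ u) w na = NoAdj-++ u w na

 Spread-++ : ∀ u w i j -> Spread w (#P u + i) (#Q u + j) -> Spread (map letter u ++ w) i j
 Spread-++ [] w i j s = s
 Spread-++ (true ∷ u) w i j s = Spread-++ u w (suc i) j (subst (λ i -> Spread w i (#Q u + j)) (sym (+-suc (#P u) i)) s)
 Spread-++ (false ∷ u) w i j s = Spread-++ u w i (suc j) (subst (Spread w _) (sym (+-suc (#Q u) j)) s)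

 words-noAdj : ∀ e f σ {w} -> All (Separating ∘ proj₂) σ -> w ∈ words e f σ -> NoAdj w
 words-noAdj e f σ sep w∈ with words-case e f σ w∈
 words-noAdj e f σ sep w∈ | stopped refl refl refl refl = tt
 words-noAdj e f σ sep w∈ | byP {e'} refl refl w'∈ = words-noAdj e' f σ sep w'∈
 words-noAdj e f σ sep w∈ | byQ {f'} refl refl w'∈ = words-noAdj e f' σ sep w'∈
 words-noAdj e f ((b , u) ∷ σ) (sepᵘ ∷ sep) w∈ | byB {w' = w'} refl refl w'∈ =
  BlockFree-++ u w' (Separating.1≤#P sepᵘ) , NoAdj-++ u w' (words-noAdj e f σ sep w'∈)

 words-spread : ∀ e f σ {w} -> All (Separating ∘ proj₂) σ -> w ∈ words e f σ -> ∀ i j -> Spread w i j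
 words-spread e f σ sep w∈ i j with words-case e f σ w∈
 words-spread e f σ sep w∈ i j | stopped refl refl refl refl = tt
 words-spread e f σ sep w∈ i j | byP {e'} refl refl w'∈ = words-spread e' f σ sep w'∈ (suc i) j
 words-spread e f σ sep w∈ i j | byQ {f'} refl refl w'∈ = words-spread e f' σ sep w'∈ i (suc j)
 words-spread e f ((b , u) ∷ σ) (sepᵘ ∷ sep) w∈ i j | byB {w' = w'} refl refl w'∈ =
  subst (FarFrom i' j') (sym (assignment-++ u w' i' j')) (All.tabulate far) ,
  Spread-++ u w' i' j' (words-spread e f σ sep w'∈ _ _)
  where
  open Separating sepᵘ
  i' = shift (len b) i
  j' = shift (len b) j
  far : ∀ {c} -> c ∈ assignment w' (#P u + i') (#Q u + j') -> j' < proj₁ c × i' < proj₂ c × 3 + (i' + j') ≤ proj₂ c + proj₁ c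
  far c∈ = let (p≥ , v≥) = assignment-≥ w' c∈ in
   ≤-trans (+-monoˡ-≤ j' 1≤#Q) p≥ , ≤-trans (+-monoˡ-≤ i' 1≤#P) v≥ ,
   ≤-trans (+-monoˡ-≤ (i' + j') 3≤) (≡≤ (rearrange (#P u) (#Q u) i' j') (+-mono-≤ v≥ p≥))
   where
   rearrange : ∀ p q i j -> p + q + (i + j) ≡ (p + i) + (q + j)
   rearrange = solve-∀

 countP countQ : Word -> ℕ
 countP [] = 0
 countP (P ∷ w) = suc (countP w)
 countP (Q ∷ w) = countP w
 countP (blk _ ∷ w) = countP w
 countQ [] = 0
 countQ (P ∷ w) = countQ w
 countQ (Q ∷ w) = suc (countQ w)
 countQ (blk _ ∷ w) = countQ w

 blocks : Word -> List Tag
 blocks [] = []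
 blocks (P ∷ w) = blocks w
 blocks (Q ∷ w) = blocks w
 blocks (blk b ∷ w) = (b , []) ∷ blocks w

 words-complete : ∀ w -> w ∈ words (countP w) (countQ w) (blocks w)
 words-complete [] = here refl
 words-complete (P ∷ w) = words-P (countP w) (countQ w) (blocks w) (words-complete w)
 words-complete (Q ∷ w) = words-Q (countP w) (countQ w) (blocks w) (words-complete w)
 words-complete (blk b ∷ w) = words-B (countP w) (countQ w) b [] (blocks w) (words-complete w)

 ++-split : ∀ (u u' : List Bool) {w w'} -> length u ≡ length u' -> map letter u ++ w ≡ map letter u' ++ w' -> u ≡ u' × w ≡ w'
 ++-split [] [] _ eq = refl , eq
 ++-split (true ∷ u)  (true ∷ u')  l≡ eq = let (p , q) = ++-split u u' (suc-injective l≡) (List.∷-injectiveʳ eq) in cong (true ∷_) p , q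
 ++-split (false ∷ u) (false ∷ u') l≡ eq = let (p , q) = ++-split u u' (suc-injective l≡) (List.∷-injectiveʳ eq) in cong (false ∷_) p , q
 ++-split (true ∷ u) (false ∷ u') l≡ eq = absurd (List.∷-injectiveˡ eq) λ ()
 ++-split (false ∷ u) (true ∷ u') l≡ eq = absurd (List.∷-injectiveˡ eq) λ ()

 -- Separators of one common length can be read off behind each block, so the families for different
 -- tag lists are disjoint.
 words-tags : ∀ {g} e f σ e' f' σ' {w} -> All ((_≡ g) ∘ length ∘ proj₂) σ -> All ((_≡ g) ∘ length ∘ proj₂) σ' ->
       w ∈ words e f σ -> w ∈ words e' f' σ' -> σ ≡ σ'
 words-tags e f σ e' f' σ' g g' w∈ w∈' with words-case e f σ w∈ | words-case e' f' σ' w∈'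
 ... | stopped _ _ refl refl | stopped _ _ refl _ = refl
 ... | byP {e1} refl refl w₁∈ | byP {e2} refl refl w₂∈ = words-tags e1 f σ e2 f' σ' g g' w₁∈ w₂∈
 ... | byQ {f1} refl refl w₁∈ | byQ {f2} refl refl w₂∈ = words-tags e f1 σ e' f2 σ' g g' w₁∈ w₂∈
 words-tags e f ((b , u) ∷ σ) e' f' ((b' , u') ∷ σ') (gᵘ ∷ g) (gᵘ' ∷ g') w∈ w∈' | byB refl refl w₁∈ | byB refl eq w₂∈
  with refl ← List.∷-injectiveˡ eq | refl , refl ← ++-split u u' (trans gᵘ (sym gᵘ')) (List.∷-injectiveʳ eq)
  = cong ((b , u) ∷_) (words-tags e f σ e' f' σ' g g' w₁∈ w₂∈)
 words-tags e f σ e' f' σ' g g' w∈ w∈' | stopped _ _ refl refl | byP _ () _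
 words-tags e f σ e' f' σ' g g' w∈ w∈' | stopped _ _ refl refl | byQ _ () _
 words-tags e f σ e' f' σ' g g' w∈ w∈' | stopped _ _ refl refl | byB _ () _
 words-tags e f σ e' f' σ' g g' w∈ w∈' | byP _ refl _ | stopped _ _ _ ()
 words-tags e f σ e' f' σ' g g' w∈ w∈' | byP _ refl _ | byQ _ () _
 words-tags e f σ e' f' σ' g g' w∈ w∈' | byP _ refl _ | byB _ () _
 words-tags e f σ e' f' σ' g g' w∈ w∈' | byQ _ refl _ | stopped _ _ _ ()
 words-tags e f σ e' f' σ' g g' w∈ w∈' | byQ _ refl _ | byP _ () _
 words-tags e f σ e' f' σ' g g' w∈ w∈' | byQ _ refl _ | byB _ () _
 words-tags e f σ e' f' σ' g g' w∈ w∈' | byB _ refl _ | stopped _ _ _ ()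
 words-tags e f σ e' f' σ' g g' w∈ w∈' | byB _ refl _ | byP _ () _
 words-tags e f σ e' f' σ' g g' w∈ w∈' | byB _ refl _ | byQ _ () _

 words-unique : ∀ e f σ -> Unique (words e f σ)
 words-unique e f σ = Unique.++⁺ (stop-unique e f σ) (Unique.++⁺ (P-unique e f σ) (Unique.++⁺ (Q-unique e f σ) (B-unique e f σ)
  (λ (q , b) -> let (_ , eq) = headQ e f σ q ; (_ , _ , eq') = headB e f σ b in absurd (trans (sym eq) eq') λ ()))
  (λ (p , qb) -> let (_ , eq) = headP e f σ p in case ∈-++⁻ (goQ e f σ) qb of λ where
   (inj₁ q) -> let (_ , eq') = headQ e f σ q in absurd (trans (sym eq) eq') λ ()
   (inj₂ b) -> let (_ , _ , eq') = headB e f σ b in absurd (trans (sym eq) eq') λ ()))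
  (λ (s , pqb) -> let eq = headS e f σ s in case ∈-++⁻ (goP e f σ) pqb of λ where
   (inj₁ p) -> let (_ , eq') = headP e f σ p in absurd (trans (sym eq) eq') λ ()
   (inj₂ qb) -> case ∈-++⁻ (goQ e f σ) qb of λ where
    (inj₁ q) -> let (_ , eq') = headQ e f σ q in absurd (trans (sym eq) eq') λ ()
    (inj₂ b) -> let (_ , _ , eq') = headB e f σ b in absurd (trans (sym eq) eq') λ ())
  where
  headS : ∀ e f σ {w} -> w ∈ stop e f σ -> w ≡ []
  headS zero zero [] (here refl) = refl
  headP : ∀ e f σ {w} -> w ∈ goP e f σ -> ∃ λ w' -> w ≡ P ∷ w'
  headP (suc e) f σ w∈ = let (w' , _ , eq) = ∈-map⁻ (P ∷_) w∈ in w' , eq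
  headQ : ∀ e f σ {w} -> w ∈ goQ e f σ -> ∃ λ w' -> w ≡ Q ∷ w'
  headQ e (suc f) σ w∈ = let (w' , _ , eq) = ∈-map⁻ (Q ∷_) w∈ in w' , eq
  headB : ∀ e f σ {w} -> w ∈ goB e f σ -> ∃ λ b -> ∃ λ w' -> w ≡ blk b ∷ w'
  headB e f ((b , u) ∷ σ) w∈ = let (w' , _ , eq) = ∈-map⁻ (λ w -> blk b ∷ map letter u ++ w) w∈ in b , _ , eq
  stop-unique : ∀ e f σ -> Unique (stop e f σ)
  stop-unique zero zero [] = [] ∷ []
  stop-unique zero zero (_ ∷ _) = []
  stop-unique zero (suc f) σ = []
  stop-unique (suc e) f σ = []
  P-unique : ∀ e f σ -> Unique (goP e f σ)
  P-unique zero f σ = []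
  P-unique (suc e) f σ = Unique.map⁺ List.∷-injectiveʳ (words-unique e f σ)
  Q-unique : ∀ e f σ -> Unique (goQ e f σ)
  Q-unique e zero σ = []
  Q-unique e (suc f) σ = Unique.map⁺ List.∷-injectiveʳ (words-unique e f σ)
  B-unique : ∀ e f σ -> Unique (goB e f σ)
  B-unique e f [] = []
  B-unique e f ((b , u) ∷ σ) = Unique.map⁺ (λ eq -> List.++-cancelˡ (map letter u) _ _ (List.∷-injectiveʳ eq)) (words-unique e f σ)

 length-words : ∀ e f σ -> length (words e f σ) ≡ length (stop e f σ) + (length (goP e f σ) + (length (goQ e f σ) + length (goB e f σ)))
 length-words e f σ = trans (List.length-++ (stop e f σ)) (cong (length (stop e f σ) +_)
  (trans (List.length-++ (goP e f σ)) (cong (length (goP e f σ) +_) (List.length-++ (goQ e f σ)))))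

 -- A multinomial coefficient: as `σ` fixes the order of the tagged blocks, they act as
 -- indistinguishable placeholders among the letters.
 words-count : ∀ e f σ -> length (words e f σ) * (e ! * f ! * length σ !) ≡ (e + f + length σ) !
 P-count : ∀ e f σ {s} -> e + f + length σ ≡ suc s -> length (goP e f σ) * (e ! * f ! * length σ !) ≡ e * s !
 Q-count : ∀ e f σ {s} -> e + f + length σ ≡ suc s -> length (goQ e f σ) * (e ! * f ! * length σ !) ≡ f * s !
 B-count : ∀ e f σ {s} -> e + f + length σ ≡ suc s -> length (goB e f σ) * (e ! * f ! * length σ !) ≡ length σ * s !

 combine : ∀ e f σ s -> e + f + length σ ≡ suc s -> length (stop e f σ) ≡ 0 ->
      length (words e f σ) * (e ! * f ! * length σ !) ≡ (e + f + length σ) !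

 words-count zero zero [] = refl
 words-count zero zero (t ∷ σ) = combine zero zero (t ∷ σ) _ refl refl
 words-count zero (suc f) σ = combine zero (suc f) σ _ refl refl
 words-count (suc e) f σ = combine (suc e) f σ _ refl refl

 combine e f σ s eq stop≡ = begin
  length (words e f σ) * K ≡⟨ cong (_* K) (trans (length-words e f σ) (cong (_+ (p + (q + b))) stop≡)) ⟩
  (p + (q + b)) * K ≡⟨ distribute p q b K ⟩
  p * K + q * K + b * K ≡⟨ cong₂ _+_ (cong₂ _+_ (P-count e f σ eq) (Q-count e f σ eq)) (B-count e f σ eq) ⟩
  e * s ! + f * s ! + length σ * s ! ≡⟨ collect e f (length σ) (s !) ⟩
  (e + f + length σ) * s ! ≡⟨ cong (_* s !) eq ⟩
  suc s ! ≡⟨ cong _! eq ⟨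
  (e + f + length σ) ! ∎
  where
  open ≡-Reasoning
  K = e ! * f ! * length σ !
  p = length (goP e f σ)
  q = length (goQ e f σ)
  b = length (goB e f σ)
  distribute : ∀ p q b K -> (p + (q + b)) * K ≡ p * K + q * K + b * K
  distribute = solve-∀
  collect : ∀ e f c s -> e * s + f * s + c * s ≡ (e + f + c) * s
  collect = solve-∀

 P-count zero f σ eq = refl
 P-count (suc e) f σ {s} eq = begin
  length (goP (suc e) f σ) * (suc e ! * f ! * length σ !) ≡⟨ cong (_* (suc e ! * f ! * length σ !)) (List.length-map (P ∷_) (words e f σ)) ⟩
  length (words e f σ) * (suc e * e ! * f ! * length σ !) ≡⟨ pull (length (words e f σ)) (suc e) (e !) (f !) (length σ !) ⟩
  suc e * (length (words e f σ) * (e ! * f ! * length σ !)) ≡⟨ cong (suc e *_) (words-count e f σ) ⟩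
  suc e * (e + f + length σ) ! ≡⟨ cong (λ s -> suc e * s !) (suc-injective eq) ⟩
  suc e * s ! ∎
  where
  open ≡-Reasoning
  pull : ∀ l s e f c -> l * (s * e * f * c) ≡ s * (l * (e * f * c))
  pull = solve-∀
 Q-count e zero σ eq = refl
 Q-count e (suc f) σ {s} eq = begin
  length (goQ e (suc f) σ) * (e ! * suc f ! * length σ !) ≡⟨ cong (_* (e ! * suc f ! * length σ !)) (List.length-map (Q ∷_) (words e f σ)) ⟩
  length (words e f σ) * (e ! * (suc f * f !) * length σ !) ≡⟨ pull (length (words e f σ)) (e !) (suc f) (f !) (length σ !) ⟩
  suc f * (length (words e f σ) * (e ! * f ! * length σ !)) ≡⟨ cong (suc f *_) (words-count e f σ) ⟩
  suc f * (e + f + length σ) ! ≡⟨ cong (λ s -> suc f * s !) (suc-injective (trans (sym (cong (_+ length σ) (+-suc e f))) eq)) ⟩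
  suc f * s ! ∎
  where
  open ≡-Reasoning
  pull : ∀ l e s f c -> l * (e * (s * f) * c) ≡ s * (l * (e * f * c))
  pull = solve-∀
 B-count e f [] eq = refl
 B-count e f ((b , u) ∷ σ) {s} eq = begin
  length (goB e f ((b , u) ∷ σ)) * (e ! * f ! * suc (length σ) !) ≡⟨ cong (_* (e ! * f ! * suc (length σ) !)) (List.length-map (λ w -> blk b ∷ map letter u ++ w) (words e f σ)) ⟩
  length (words e f σ) * (e ! * f ! * (suc (length σ) * length σ !)) ≡⟨ pull (length (words e f σ)) (e !) (f !) (suc (length σ)) (length σ !) ⟩
  suc (length σ) * (length (words e f σ) * (e ! * f ! * length σ !)) ≡⟨ cong (suc (length σ) *_) (words-count e f σ) ⟩
  suc (length σ) * (e + f + length σ) ! ≡⟨ cong (λ s -> suc (length σ) * s !) (suc-injective (trans (sym (+-suc (e + f) (length σ))) eq)) ⟩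
  suc (length σ) * s ! ∎
  where
  open ≡-Reasoning
  pull : ∀ l e f s c -> l * (e * f * (s * c)) ≡ s * (l * (e * f * c))
  pull = solve-∀

 -- Each of the e + f + length σ steps has at most three continuations.
 words-count-≤ : ∀ e f σ -> length (words e f σ) ≤ 3 ^ (e + f + length σ)
 P-≤ : ∀ e f σ {s} -> e + f + length σ ≡ suc s -> length (goP e f σ) ≤ 3 ^ s
 Q-≤ : ∀ e f σ {s} -> e + f + length σ ≡ suc s -> length (goQ e f σ) ≤ 3 ^ s
 B-≤ : ∀ e f σ {s} -> e + f + length σ ≡ suc s -> length (goB e f σ) ≤ 3 ^ s
 combine-≤ : ∀ e f σ s -> e + f + length σ ≡ suc s -> length (stop e f σ) ≡ 0 -> length (words e f σ) ≤ 3 ^ (e + f + length σ)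

 words-count-≤ zero zero [] = ≤-refl
 words-count-≤ zero zero (t ∷ σ) = combine-≤ zero zero (t ∷ σ) _ refl refl
 words-count-≤ zero (suc f) σ = combine-≤ zero (suc f) σ _ refl refl
 words-count-≤ (suc e) f σ = combine-≤ (suc e) f σ _ refl refl

 combine-≤ e f σ s eq stop≡ = begin
  length (words e f σ) ≡⟨ trans (length-words e f σ) (cong (_+ (length (goP e f σ) + (length (goQ e f σ) + length (goB e f σ)))) stop≡) ⟩
  length (goP e f σ) + (length (goQ e f σ) + length (goB e f σ))
   ≤⟨ +-mono-≤ (P-≤ e f σ eq) (+-mono-≤ (Q-≤ e f σ eq) (≤≡ (B-≤ e f σ eq) (sym (+-identityʳ _)))) ⟩
  3 ^ suc s ≡⟨ cong (3 ^_) eq ⟨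
  3 ^ (e + f + length σ) ∎
  where open ≤-Reasoning
 P-≤ zero f σ eq = z≤n
 P-≤ (suc e) f σ eq = subst₂ _≤_ (sym (List.length-map (P ∷_) (words e f σ))) (cong (3 ^_) (suc-injective eq)) (words-count-≤ e f σ)
 Q-≤ e zero σ eq = z≤n
 Q-≤ e (suc f) σ eq = subst₂ _≤_ (sym (List.length-map (Q ∷_) (words e f σ)))
  (cong (3 ^_) (suc-injective (trans (sym (cong (_+ length σ) (+-suc e f))) eq))) (words-count-≤ e f σ)
 B-≤ e f [] eq = z≤n
 B-≤ e f ((b , u) ∷ σ) eq = subst₂ _≤_ (sym (List.length-map (λ w -> blk b ∷ map letter u ++ w) (words e f σ)))
  (cong (3 ^_) (suc-injective (trans (sym (+-suc (e + f) (length σ))) eq))) (words-count-≤ e f σ)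

 lists : {A : Set} -> ℕ -> List A -> List (List A)
 lists zero xs = [] ∷ []
 lists (suc c) xs = cartesianProductWith _∷_ xs (lists c xs)

 ∈-lists⁺ : {A : Set} {xs ys : List A} -> All (_∈ xs) ys -> ys ∈ lists (length ys) xs
 ∈-lists⁺ [] = here refl
 ∈-lists⁺ (y∈ ∷ ys) = ∈-cartesianProductWith⁺ _∷_ y∈ (∈-lists⁺ ys)

 ∈-lists⁻ : {A : Set} {xs : List A} -> ∀ c {ys} -> ys ∈ lists c xs -> length ys ≡ c × All (_∈ xs) ys
 ∈-lists⁻ zero (here refl) = refl , []
 ∈-lists⁻ {xs = xs} (suc c) ys∈ with y , ys , y∈ , ys∈' , refl ← ∈-cartesianProductWith⁻ _∷_ xs (lists c xs) ys∈ =
  let (l≡ , all) = ∈-lists⁻ c ys∈' in cong suc l≡ , y∈ ∷ all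

 lists-unique : {A : Set} {xs : List A} -> Unique xs -> ∀ c -> Unique (lists c xs)
 lists-unique u zero = [] ∷ []
 lists-unique u (suc c) = Unique.cartesianProductWith⁺ _∷_ (λ eq -> List.∷-injectiveˡ eq , List.∷-injectiveʳ eq) u (lists-unique u c)

 -- Edges of Hamiltonian paths and pairs of increasing paths

 Same : {A : Set} -> A -> A -> A -> A -> Set
 Same u v u' v' = (u ≡ u' × v ≡ v') ⊎ (u ≡ v' × v ≡ u')

 module _ {n : ℕ} where

  private
   ends : Edge n -> ℕ × ℕ
   ends (j , i) = toℕ j , toℕ i

   ends-injective : ∀ {e e'} -> ends e ≡ ends e' -> e ≡ e'
   ends-injective {j , i} {j' , i'} eq with refl ← Fin.toℕ-injective {i = j} {j'} (cong proj₁ eq) =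
    cong (j ,_) (Fin.toℕ-injective (cong proj₂ eq))

   ends-edge : ∀ u v (u≢v : u ≢ v) -> (ends (edge u v u≢v) ≡ (toℕ v , toℕ u) × toℕ u < toℕ v) ⊎ (ends (edge u v u≢v) ≡ (toℕ u , toℕ v) × toℕ v < toℕ u)
   ends-edge u v u≢v with Fin.<-cmp u v
   ... | tri< u<v _ _ = inj₁ (cong (toℕ v ,_) (Fin.toℕ-fromℕ< u<v) , u<v)
   ... | tri≈ _ u≡v _ = absurd u≡v u≢v
   ... | tri> _ _ v<u = inj₂ (cong (toℕ u ,_) (Fin.toℕ-fromℕ< v<u) , v<u)

  edge≡⁻ : ∀ {u v u' v' : Fin n} p p' -> edge u v p ≡ edge u' v' p' -> Same u v u' v'
  edge≡⁻ {u} {v} {u'} {v'} p p' eq with ends-edge u v p | ends-edge u' v' p'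
  ... | inj₁ (q , _) | inj₁ (q' , _) = let r = trans (sym q) (trans (cong ends eq) q') in inj₁ (Fin.toℕ-injective (cong proj₂ r) , Fin.toℕ-injective (cong proj₁ r))
  ... | inj₁ (q , _) | inj₂ (q' , _) = let r = trans (sym q) (trans (cong ends eq) q') in inj₂ (Fin.toℕ-injective (cong proj₂ r) , Fin.toℕ-injective (cong proj₁ r))
  ... | inj₂ (q , _) | inj₁ (q' , _) = let r = trans (sym q) (trans (cong ends eq) q') in inj₂ (Fin.toℕ-injective (cong proj₁ r) , Fin.toℕ-injective (cong proj₂ r))
  ... | inj₂ (q , _) | inj₂ (q' , _) = let r = trans (sym q) (trans (cong ends eq) q') in inj₁ (Fin.toℕ-injective (cong proj₁ r) , Fin.toℕ-injective (cong proj₂ r))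

  edge≡⁺ : ∀ {u v u' v' : Fin n} p p' -> Same u v u' v' -> edge u v p ≡ edge u' v' p'
  edge≡⁺ {u} {v} p p' (inj₁ (refl , refl)) with ends-edge u v p | ends-edge u v p'
  ... | inj₁ (q , _) | inj₁ (q' , _) = ends-injective (trans q (sym q'))
  ... | inj₂ (q , _) | inj₂ (q' , _) = ends-injective (trans q (sym q'))
  ... | inj₁ (_ , u<v) | inj₂ (_ , v<u) = absurd u<v (ℕ.<⇒≯ v<u)
  ... | inj₂ (_ , v<u) | inj₁ (_ , u<v) = absurd u<v (ℕ.<⇒≯ v<u)
  edge≡⁺ {u} {v} p p' (inj₂ (refl , refl)) with ends-edge u v p | ends-edge v u p'
  ... | inj₁ (q , _) | inj₂ (q' , _) = ends-injective (trans q (sym q'))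
  ... | inj₂ (q , _) | inj₁ (q' , _) = ends-injective (trans q (sym q'))
  ... | inj₁ (_ , u<v) | inj₁ (_ , v<u) = absurd u<v (ℕ.<⇒≯ v<u)
  ... | inj₂ (_ , v<u) | inj₂ (_ , u<v) = absurd u<v (ℕ.<⇒≯ v<u)

 -- Graphs with at least one edge, so that the edges of a path extend to a function on ℕ.
 module PathEdges (N' : ℕ) where

  private
   N n : ℕ
   N = suc N'
   n = suc N

  -- The value at equal ends is a dummy, since consecutive vertices of a path differ; a total
  -- function lets `pathEdge` be defined on all of ℕ.
  edge⁺ : Fin n -> Fin n -> Edge n
  edge⁺ u v with u Fin.≟ v
  ... | yes _ = suc zero , zero
  ... | no u≢v = edge u v u≢v

  edge⁺≡ : ∀ {u v} (u≢v : u ≢ v) -> edge⁺ u v ≡ edge u v u≢v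
  edge⁺≡ {u} {v} u≢v with u Fin.≟ v
  ... | yes u≡v = absurd u≡v u≢v
  ... | no p = edge≡⁺ p u≢v (inj₁ (refl , refl))

  edge⁺-≡⁻ : ∀ {u v u' v'} -> u ≢ v -> u' ≢ v' -> edge⁺ u v ≡ edge⁺ u' v' -> Same u v u' v'
  edge⁺-≡⁻ p p' eq = edge≡⁻ p p' (trans (sym (edge⁺≡ p)) (trans eq (edge⁺≡ p')))

  edge⁺-≡⁺ : ∀ {u v u' v'} -> u ≢ v -> u' ≢ v' -> Same u v u' v' -> edge⁺ u v ≡ edge⁺ u' v'
  edge⁺-≡⁺ p p' s = trans (edge⁺≡ p) (trans (edge≡⁺ p p' s) (sym (edge⁺≡ p')))

  fin : ℕ -> Fin n
  fin j with j ℕ.<? n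
  ... | yes j<n = fromℕ< j<n
  ... | no _ = zero

  fin-toℕ : ∀ (a : Fin n) -> fin (toℕ a) ≡ a
  fin-toℕ a with toℕ a ℕ.<? n
  ... | yes a<n = Fin.fromℕ<-toℕ a a<n
  ... | no a≮n = absurd (Fin.toℕ<n a) a≮n

  toℕ-fin : ∀ {j} -> j < n -> toℕ (fin j) ≡ j
  toℕ-fin {j} j<n with j ℕ.<? n
  ... | yes p = Fin.toℕ-fromℕ< p
  ... | no j≮n = absurd j<n j≮n

  fin-injective : ∀ {i j} -> i < n -> j < n -> fin i ≡ fin j -> i ≡ j
  fin-injective i<n j<n eq = trans (sym (toℕ-fin i<n)) (trans (cong toℕ eq) (toℕ-fin j<n))

  vertex : HamiltonianPath n -> ℕ -> Fin n
  vertex v j = Bijection.to v (fin j)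

  vertex-injective : ∀ v {i j} -> i < n -> j < n -> vertex v i ≡ vertex v j -> i ≡ j
  vertex-injective v i<n j<n eq = fin-injective i<n j<n (Bijection.injective v eq)

  pathEdge : HamiltonianPath n -> ℕ -> Edge n
  pathEdge v i = edge⁺ (vertex v i) (vertex v (suc i))

  private
   consecutive : List (Fin n) -> List (Edge n)
   consecutive [] = []
   consecutive (u ∷ []) = []
   consecutive (u ∷ v ∷ vs) = edge⁺ u v ∷ consecutive (v ∷ vs)

   walkEdges≡ : ∀ {vs} (l : Linked _≢_ vs) -> walkEdges l ≡ consecutive vs
   walkEdges≡ [] = refl
   walkEdges≡ [-] = refl
   walkEdges≡ (u≢v ∷ l) = cong₂ _∷_ (sym (edge⁺≡ u≢v)) (walkEdges≡ l)

   tabulate≡ : ∀ {A : Set} m (f : Fin m -> A) (g : ℕ -> A) -> (∀ i -> f i ≡ g (toℕ i)) -> tabulate f ≡ applyUpTo g m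
   tabulate≡ zero f g eq = refl
   tabulate≡ (suc m) f g eq = cong₂ _∷_ (eq zero) (tabulate≡ m (f ∘ suc) (g ∘ suc) (eq ∘ suc))

   consecutive-applyUpTo : ∀ g m -> consecutive (applyUpTo g (suc m)) ≡ applyUpTo (λ i -> edge⁺ (g i) (g (suc i))) m
   consecutive-applyUpTo g zero = refl
   consecutive-applyUpTo g (suc m) = cong (_ ∷_) (consecutive-applyUpTo (g ∘ suc) m)

  pathEdges≡ : ∀ v -> pathEdges v ≡ applyUpTo (pathEdge v) N
  pathEdges≡ v = trans (walkEdges≡ {tabulate (Bijection.to v)} (Linked.AllPairs⇒Linked (Unique.tabulate⁺ (Bijection.injective v)))) (trans (cong consecutive (tabulate≡ n (Bijection.to v) (vertex v)
   (λ i -> cong (Bijection.to v) (sym (fin-toℕ i))))) (consecutive-applyUpTo (vertex v) N))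

  label : EdgeOrdering n -> Edge n -> ℕ
  label f e = toℕ (Bijection.to f e)

  private
   Linked-applyUpTo⁻ : ∀ {A : Set} {R : A -> A -> Set} (g : ℕ -> A) m -> Linked R (applyUpTo g m) -> ∀ {i} -> suc i < m -> R (g i) (g (suc i))
   Linked-applyUpTo⁻ g (suc (suc m)) (r ∷ _) {zero} _ = r
   Linked-applyUpTo⁻ g (suc (suc m)) (_ ∷ l) {suc i} (s≤s lt) = Linked-applyUpTo⁻ (g ∘ suc) (suc m) l lt
   Linked-applyUpTo⁻ g (suc zero) _ (s≤s ())

   chain : ∀ (g : ℕ -> ℕ) m -> (∀ {i} -> suc i < m -> g i < g (suc i)) -> ∀ {i i'} -> i < i' -> i' < m -> g i < g i'
   chain g m step {i} {suc i'} (s≤s i≤i') <m = case ℕ.m≤n⇒m<n∨m≡n i≤i' of λ where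
    (inj₁ i<i') -> <-trans (chain g m step i<i' (<-trans ≤-refl <m)) (step <m)
    (inj₂ refl) -> step <m

   labels≡ : ∀ (f : EdgeOrdering n) v -> map (Bijection.to f) (pathEdges v) ≡ applyUpTo (Bijection.to f ∘ pathEdge v) N
   labels≡ f v = trans (cong (map (Bijection.to f)) (pathEdges≡ v)) (List.map-applyUpTo (pathEdge v) (Bijection.to f) N)

  abstract

   Inc : EdgeOrdering n -> HamiltonianPath n -> Set
   Inc f v = Increasing f v

   inc? : ∀ f v -> Dec (Inc f v)
   inc? f v = increasing? f v

   inc?≡ : ∀ f v -> ⟦ inc? f v ⟧ ≡ ⟦ increasing? f v ⟧
   inc?≡ f v = refl

   Inc⁻ : ∀ f v -> Inc f v -> ∀ {i i'} -> i < i' -> i' < N -> label f (pathEdge v i) < label f (pathEdge v i')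
   Inc⁻ f v inc = chain (label f ∘ pathEdge v) N (Linked-applyUpTo⁻ (Bijection.to f ∘ pathEdge v) N (subst (Linked Fin._<_) (labels≡ f v) inc))

   Inc⁺ : ∀ f v -> (∀ {i i'} -> i < i' -> i' < N -> label f (pathEdge v i) < label f (pathEdge v i')) -> Inc f v
   Inc⁺ f v inc = subst (Linked Fin._<_) (sym (labels≡ f v)) (Linked.applyUpTo⁺₁ (Bijection.to f ∘ pathEdge v) N (inc ≤-refl))

  open Counting N using (at; at-injective; few?)

  module Pair (v R : HamiltonianPath n) where

   ρ = at R
   eP = pathEdge v
   eQ = pathEdge (v ∘⤖ R)

   private
    vertex-∘ : ∀ {j} -> j < n -> vertex (v ∘⤖ R) j ≡ vertex v (ρ j)
    vertex-∘ {j} j<n = cong (Bijection.to v) (sym (trans (cong fin (trans (cong ρ (sym (toℕ-fin j<n))) (extend-toℕ (Bijection.to R) (fin j)))) (fin-toℕ _)))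

    ρ-< : ∀ {j} -> j < n -> ρ j < n
    ρ-< = extend-< (Bijection.to R)

    distinct : ∀ w {i} -> i < N -> vertex w i ≢ vertex w (suc i)
    distinct w i<N eq = ℕ.<⇒≢ ≤-refl (vertex-injective w (m≤n⇒m≤1+n i<N) (s≤s i<N) eq)

    injective : ∀ w {i i'} -> i < N -> i' < N -> pathEdge w i ≡ pathEdge w i' -> i ≡ i'
    injective w {i} {i'} i<N i'<N eq with edge⁺-≡⁻ (distinct w i<N) (distinct w i'<N) eq
    ... | inj₁ (p , _) = vertex-injective w (m≤n⇒m≤1+n i<N) (m≤n⇒m≤1+n i'<N) p
    ... | inj₂ (p , q) with refl ← vertex-injective w (m≤n⇒m≤1+n i<N) (s≤s i'<N) p | eq' ← vertex-injective w (s≤s i<N) (m≤n⇒m≤1+n i'<N) q =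
     absurd (sym eq') (m≢1+n+m _ {1})

    common⇒coin : ∀ {i j} -> i < N -> j < N -> eP i ≡ eQ j -> ∃ λ o -> Coin ρ (i , j , o)
    common⇒coin {i} {j} i<N j<N eq with edge⁺-≡⁻ (distinct v i<N) (distinct (v ∘⤖ R) j<N) eq
    ... | inj₁ (p , q) = true ,
     sym (vertex-injective v (m≤n⇒m≤1+n i<N) (ρ-< (m≤n⇒m≤1+n j<N)) (trans p (vertex-∘ (m≤n⇒m≤1+n j<N)))) ,
     sym (vertex-injective v (s≤s i<N) (ρ-< (s≤s j<N)) (trans q (vertex-∘ (s≤s j<N))))
    ... | inj₂ (p , q) = false ,
     sym (vertex-injective v (s≤s i<N) (ρ-< (m≤n⇒m≤1+n j<N)) (trans q (vertex-∘ (m≤n⇒m≤1+n j<N)))) ,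
     sym (vertex-injective v (m≤n⇒m≤1+n i<N) (ρ-< (s≤s j<N)) (trans p (vertex-∘ (s≤s j<N))))

    coin⇒common : ∀ {i j} o -> i < N -> j < N -> Coin ρ (i , j , o) -> eP i ≡ eQ j
    coin⇒common true i<N j<N (p , q) = edge⁺-≡⁺ (distinct v i<N) (distinct (v ∘⤖ R) j<N)
     (inj₁ (sym (trans (vertex-∘ (m≤n⇒m≤1+n j<N)) (cong (vertex v) p)) , sym (trans (vertex-∘ (s≤s j<N)) (cong (vertex v) q))))
    coin⇒common false i<N j<N (p , q) = edge⁺-≡⁺ (distinct v i<N) (distinct (v ∘⤖ R) j<N)
     (inj₂ (sym (trans (vertex-∘ (s≤s j<N)) (cong (vertex v) q)) , sym (trans (vertex-∘ (m≤n⇒m≤1+n j<N)) (cong (vertex v) p))))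

   open Merging N eP eQ ρ (injective v) (injective (v ∘⤖ R)) common⇒coin coin⇒common public

   merged-length : ∀ w i j -> length (merged w i j) ≡ size w
   merged-length [] i j = refl
   merged-length (P ∷ w) i j = cong suc (merged-length w (suc i) j)
   merged-length (Q ∷ w) i j = cong suc (merged-length w i (suc j))
   merged-length (blk b ∷ w) i j = trans (List.length-++ (segment (len b) i)) (cong₂ _+_ (segment-length (len b) i) (merged-length w _ _))
    where
    segment-length : ∀ m i -> length (segment m i) ≡ m
    segment-length zero i = refl
    segment-length (suc m) i = cong suc (segment-length m (suc i))

   covered⇔few : ∀ w -> (Covered w 0 0 -> extras N (commonCells w 0 0) ρ ≤ 0) × (extras N (commonCells w 0 0) ρ ≤ 0 -> Covered w 0 0)
   covered⇔few w = to , from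
    where
    D = commonCells w 0 0
    to : Covered w 0 0 -> extras N D ρ ≤ 0
    to cov = ≤-reflexive (trans (∑-cong-∈ (cells N) (λ {(i , j , o)} c∈ -> let (i<N , j<N) = ∈-cells⁻ c∈ in
     ⟦⟧-no (extra? D ρ (i , j , o)) (λ (co , c∉) -> c∉ (cov o z≤n i<N z≤n j<N co)))) (∑-zero (cells N)))
    from : extras N D ρ ≤ 0 -> Covered w 0 0
    from none {i} {j} o _ i<N _ j<N co = case (i , j , o) ∈ᶜ? D of λ where
     (yes c∈) -> c∈
     (no c∉) -> absurd (≤-trans (∑-⟦⟧-≥ (extra? D ρ) (∈-cells⁺ o i<N j<N) (co , c∉)) none) λ ()

  open Labelling (searchEdge {n}) {Ω = edgeOrderings n} (edgeOrderings-enumerates n) public using (sorting; sorting-count; label-injective)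

  orderings : ℕ
  orderings = length (edgeOrderings n)

  module _ (v R : HamiltonianPath n) (w : Word) (endP≡ : endP w 0 ≡ N) (endQ≡ : endQ w 0 ≡ N) where

   open Pair v R

   private
    D = commonCells w 0 0
    m = merged w 0 0

   -- If the merged edges are distinct, `covers` leaves no further common edge, and a fraction 1 /
   -- (size w)! of the orderings sorts them. If an edge repeats, no ordering does.
   sorting-merged-≤ : ⟦ sat? ρ (assignment w 0 0) ⟧ * (sorting m * size w !) ≤ ⟦ sat? ρ (assignment w 0 0) ⟧ * ⟦ few? D 0 ρ ⟧ * orderings
   sorting-merged-≤ = ≤≡ (⟦⟧*-≤ (sat? ρ (assignment w 0 0)) bound) (sym (*-assoc ⟦ sat? ρ (assignment w 0 0) ⟧ _ _))
    where
    open DecUnique (Searchable._≟_ (searchEdge {n})) using (unique?)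
    bound : Sat ρ (assignment w 0 0) -> sorting m * size w ! ≤ ⟦ few? D 0 ρ ⟧ * orderings
    bound s = case unique? m of λ where
     (yes u) -> ≤-reflexive (trans (trans (cong (λ k -> sorting m * k !) (sym (merged-length w 0 0))) (sorting-count m u))
      (sym (trans (cong (_* orderings) (⟦⟧-yes (few? D 0 ρ) (proj₁ (covered⇔few w) (λ o _ i<N _ j<N ->
       covers w 0 0 (≤-reflexive endP≡) (≤-reflexive endQ≡) s u o z≤n (subst (_ <_) (sym endP≡) i<N) z≤n (subst (_ <_) (sym endQ≡) j<N)))))
       (*-identityˡ _))))
     (no ¬u) -> ≡≤ (cong (_* size w !) (trans
      (∑-cong (edgeOrderings n) (λ f -> ⟦⟧-no (ordered? (label f) m) (¬u ∘ Ordered⇒Unique))) (∑-zero (edgeOrderings n)))) z≤n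

   -- Conversely, without coincidences outside the cells of `w` the merged edges are distinct by
   -- `merged-unique`.
   sorting-merged-≥ : ⟦ sat? ρ (assignment w 0 0) ⟧ * ⟦ few? D 0 ρ ⟧ * orderings ≤ ⟦ sat? ρ (assignment w 0 0) ⟧ * (sorting m * size w !)
   sorting-merged-≥ = ≡≤ (*-assoc ⟦ sat? ρ (assignment w 0 0) ⟧ _ _) (⟦⟧*-≤ (sat? ρ (assignment w 0 0)) λ s ->
    ⟦⟧*≤' (few? D 0 ρ) (λ few -> ≤-reflexive (sym (trans (cong (λ k -> sorting m * k !) (sym (merged-length w 0 0)))
     (sorting-count m (merged-unique w 0 0 (≤-reflexive endP≡) (≤-reflexive endQ≡) (proj₂ (covered⇔few w) few)))))))

  noAdj? : ∀ w -> Dec (NoAdj w)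
  noAdj? [] = yes tt
  noAdj? (P ∷ w) = noAdj? w
  noAdj? (Q ∷ w) = noAdj? w
  noAdj? (blk b ∷ w) = blockFree? w ×-dec noAdj? w

  plainTags : List Tag
  plainTags = map (_, []) (upTo (suc N))

  plainWords : List Tag -> List Word
  plainWords σ = words (N ∸ Σlen σ) (N ∸ Σlen σ) σ

  private
   bothIncreasing? : ∀ f v R -> Dec (Inc f v × Inc f (v ∘⤖ R))
   bothIncreasing? f v R = inc? f v ×-dec inc? f (v ∘⤖ R)

   untagged : ∀ w -> ΣP (blocks w) ≡ 0 × ΣQ (blocks w) ≡ 0
   untagged [] = refl , refl
   untagged (P ∷ w) = untagged w
   untagged (Q ∷ w) = untagged w
   untagged (blk b ∷ w) = untagged w

   b≤len : ∀ b -> b ≤ len b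
   b≤len zero = z≤n
   b≤len (suc b) = ≤-refl

   1≤len : ∀ b -> 1 ≤ len b
   1≤len zero = ≤-refl
   1≤len (suc b) = s≤s z≤n

   blocks-bounds : ∀ w -> length (blocks w) ≤ Σlen (blocks w) × (∀ {N} -> Σlen (blocks w) ≤ N -> All (_∈ map (_, []) (upTo (suc N))) (blocks w))
   blocks-bounds [] = z≤n , λ _ -> []
   blocks-bounds (P ∷ w) = blocks-bounds w
   blocks-bounds (Q ∷ w) = blocks-bounds w
   blocks-bounds (blk b ∷ w) = let (l≤ , all) = blocks-bounds w in
    +-mono-≤ (1≤len b) l≤ ,
    (λ ≤N -> ∈-map⁺ (_, []) (∈-upTo⁺ (s≤s (≤-trans (b≤len b) (≤-trans (m≤m+n (len b) _) ≤N)))) ∷ all (≤-trans (m≤n+m _ (len b)) ≤N))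

   count-from-end : ∀ a k {x} -> a + 0 + k + 0 ≡ x -> a ≡ x ∸ k × k ≤ x
   count-from-end a k {x} eq = trans (sym (ℕ.m+n∸n≡m a k)) (cong (_∸ k) eq') , subst (k ≤_) eq' (m≤n+m k a)
    where
    eq' : a + k ≡ x
    eq' = trans (cong (_+ k) (sym (+-identityʳ a))) (trans (sym (+-identityʳ _)) eq)

   plainWords-complete : ∀ w -> endP w 0 ≡ N -> endQ w 0 ≡ N ->
    let σ = blocks w in (length σ ∈ upTo (suc N) × σ ∈ lists (length σ) plainTags) × (Σlen σ ≤ N × w ∈ plainWords σ)
   plainWords-complete w endP≡ endQ≡ =
    (∈-upTo⁺ (s≤s (≤-trans (proj₁ (blocks-bounds w)) k≤)) , ∈-lists⁺ (proj₂ (blocks-bounds w) k≤)) ,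
    k≤ , subst₂ (λ e f -> w ∈ words e f σ) (proj₁ p) (proj₁ q) (words-complete w)
    where
    σ = blocks w
    p = count-from-end (countP w) (Σlen σ) (trans (cong (λ a -> countP w + a + Σlen σ + 0) (sym (proj₁ (untagged w)))) (trans (sym (words-endP (countP w) (countQ w) σ (words-complete w) 0)) endP≡))
    q = count-from-end (countQ w) (Σlen σ) (trans (cong (λ a -> countQ w + a + Σlen σ + 0) (sym (proj₂ (untagged w)))) (trans (sym (words-endQ (countP w) (countQ w) σ (words-complete w) 0)) endQ≡))
    k≤ = proj₂ p

  plainTags-free : ∀ σ -> All (_∈ plainTags) σ -> ΣP σ ≡ 0 × ΣQ σ ≡ 0
  plainTags-free [] [] = refl , refl
  plainTags-free (t ∷ σ) (t∈ ∷ ts) with _ , _ , refl ← ∈-map⁻ (_, []) t∈ = plainTags-free σ ts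

  plainWords-end : ∀ c {σ w} -> σ ∈ lists c plainTags -> Σlen σ ≤ N -> w ∈ plainWords σ -> endP w 0 ≡ N × endQ w 0 ≡ N
  plainWords-end c {σ} σ∈ k≤N w∈ = end (proj₁ (plainTags-free σ (proj₂ (∈-lists⁻ c σ∈)))) (words-endP (N ∸ Σlen σ) (N ∸ Σlen σ) σ w∈ 0) , end (proj₂ (plainTags-free σ (proj₂ (∈-lists⁻ c σ∈)))) (words-endQ (N ∸ Σlen σ) (N ∸ Σlen σ) σ w∈ 0)
   where
   end : ∀ {a x} -> a ≡ 0 -> x ≡ N ∸ Σlen σ + a + Σlen σ + 0 -> x ≡ N
   end refl eq = trans eq (trans (+-identityʳ _) (trans (cong (_+ Σlen σ) (+-identityʳ _)) (m∸n+n≡m k≤N)))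

  -- The merge of the two paths is one of the words on the right: its blocks determine `c` and `σ`,
  -- and the lengths of the paths determine the numbers of single letters.
  bothIncreasing-≤ : ∀ f v R -> let open Pair v R in
   ⟦ inc? f v ⟧ * ⟦ inc? f (v ∘⤖ R) ⟧ ≤
   ∑ (upTo (suc N)) (λ c -> ∑ (lists c plainTags) (λ σ -> ⟦ Σlen σ ℕ.≤? N ⟧ * ∑ (plainWords σ) (λ w ->
    ⟦ noAdj? w ⟧ * (⟦ sat? ρ (assignment w 0 0) ⟧ * ⟦ ordered? (label f) (merged w 0 0) ⟧))))
  bothIncreasing-≤ f v R = ≡≤ (sym (⟦⟧-× (inc? f v) (inc? f (v ∘⤖ R))))
   (⟦⟧≤ (bothIncreasing? f v R) λ (incP , incQ) ->
    let open Pair v R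
        (w , na , s , ord , endP≡ , endQ≡) = merge-exists (label f) (label-injective f) (Inc⁻ f v incP) (Inc⁻ f (v ∘⤖ R) incQ)
        ((c∈ , σ∈) , (k≤ , w∈)) = plainWords-complete w endP≡ endQ≡
        term = λ w -> ⟦ noAdj? w ⟧ * (⟦ sat? ρ (assignment w 0 0) ⟧ * ⟦ ordered? (label f) (merged w 0 0) ⟧)
        inner = λ σ -> ⟦ Σlen σ ℕ.≤? N ⟧ * ∑ (plainWords σ) term
    in ≤-trans
     (≡≤ (sym (trans (cong (_* term w) (⟦⟧-yes (Σlen (blocks w) ℕ.≤? N) k≤)) (trans (*-identityˡ _)
       (cong₂ _*_ (⟦⟧-yes (noAdj? w) na) (cong₂ _*_ (⟦⟧-yes (sat? ρ (assignment w 0 0)) s) (⟦⟧-yes (ordered? (label f) (merged w 0 0)) ord))))))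
      (*-monoʳ-≤ ⟦ Σlen (blocks w) ℕ.≤? N ⟧ (∑-member term w∈)))
     (≤-trans (∑-member inner σ∈) (∑-member (λ c -> ∑ (lists c plainTags) inner) c∈)))

  -- Conversely, at most one word from a family with separating tags of equal length is a merge.
  module _ (g : ℕ) (σs : List (List Tag)) (σs-unique : Unique σs)
   (σs-good : ∀ {σ} -> σ ∈ σs -> All (Separating ∘ proj₂) σ × All ((_≡ g) ∘ length ∘ proj₂) σ × Σlen σ + ΣP σ ≤ N × Σlen σ + ΣQ σ ≤ N) where

   freeP freeQ : List Tag -> ℕ
   freeP σ = N ∸ (Σlen σ + ΣP σ)
   freeQ σ = N ∸ (Σlen σ + ΣQ σ)

   taggedWords : List Tag -> List Word
   taggedWords σ = words (freeP σ) (freeQ σ) σ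

   taggedWords-end : ∀ {σ w} -> σ ∈ σs -> w ∈ taggedWords σ -> endP w 0 ≡ N × endQ w 0 ≡ N
   taggedWords-end {σ} σ∈ w∈ = let (_ , _ , p≤ , q≤) = σs-good σ∈ in
    trans (words-endP (freeP σ) (freeQ σ) σ w∈ 0) (end (Σlen σ) (ΣP σ) p≤) , trans (words-endQ (freeP σ) (freeQ σ) σ w∈ 0) (end (Σlen σ) (ΣQ σ) q≤)
    where
    end : ∀ k a -> k + a ≤ N -> N ∸ (k + a) + a + k + 0 ≡ N
    end k a ≤N = trans (+-identityʳ _) (trans (ℕ.+-assoc _ a k) (trans (cong (N ∸ (k + a) +_) (ℕ.+-comm a k)) (m∸n+n≡m ≤N)))

   private
    allWords : List Word
    allWords = concatMap taggedWords σs

    disjoint : ∀ {σ σ'} -> σ ∈ σs -> σ' ∈ σs -> σ ≢ σ' -> Disjoint (taggedWords σ) (taggedWords σ')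
    disjoint {σ} {σ'} σ∈ σ'∈ σ≢ (w∈ , w∈') = σ≢ (words-tags (freeP σ) (freeQ σ) σ (freeP σ') (freeQ σ') σ' (proj₁ (proj₂ (σs-good σ∈))) (proj₁ (proj₂ (σs-good σ'∈))) w∈ w∈')

    all-disjoint : ∀ τs -> (∀ {σ} -> σ ∈ τs -> σ ∈ σs) -> Unique τs -> AllPairs (λ σ σ' -> Disjoint (taggedWords σ) (taggedWords σ')) τs
    all-disjoint [] _ _ = []
    all-disjoint (τ ∷ τs) sub (τ≢ ∷ u) = All.tabulate (λ σ∈ -> disjoint (sub (here refl)) (sub (there σ∈)) (All.lookup τ≢ σ∈)) ∷ all-disjoint τs (sub ∘ there) u

    allWords-unique : Unique allWords
    allWords-unique = Unique.concat⁺ (All.map⁺ (All.tabulate {xs = σs} (λ {σ} _ -> words-unique (freeP σ) (freeQ σ) σ))) (AllPairs.map⁺ (all-disjoint σs id σs-unique))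

    ∈-allWords⁻ : ∀ τs {w} -> w ∈ concatMap taggedWords τs -> ∃ λ σ -> σ ∈ τs × w ∈ taggedWords σ
    ∈-allWords⁻ (τ ∷ τs) w∈ with ∈-++⁻ (taggedWords τ) w∈
    ... | inj₁ w∈τ = τ , here refl , w∈τ
    ... | inj₂ w∈τs = let (σ , σ∈ , w∈σ) = ∈-allWords⁻ τs w∈τs in σ , there σ∈ , w∈σ

   bothIncreasing-≥ : ∀ f v R -> let open Pair v R in
    ∑ σs (λ σ -> ∑ (taggedWords σ) (λ w -> ⟦ sat? ρ (assignment w 0 0) ⟧ * ⟦ ordered? (label f) (merged w 0 0) ⟧)) ≤
    ⟦ inc? f v ⟧ * ⟦ inc? f (v ∘⤖ R) ⟧
   bothIncreasing-≥ f v R = begin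
    ∑ σs (λ σ -> ∑ (taggedWords σ) (λ w -> ⟦ sat? ρ (assignment w 0 0) ⟧ * ⟦ ordered? (label f) (merged w 0 0) ⟧))
     ≡⟨ ∑-concatMap σs taggedWords _ ⟨
    ∑ allWords (λ w -> ⟦ sat? ρ (assignment w 0 0) ⟧ * ⟦ ordered? (label f) (merged w 0 0) ⟧)
     ≡⟨ ∑-cong allWords (λ w -> ⟦⟧-× (sat? ρ (assignment w 0 0)) (ordered? (label f) (merged w 0 0))) ⟨
    ∑ allWords (λ w -> ⟦ fits? w ⟧)
     ≤⟨ ∑-mono-∈ allWords (λ {w} w∈ -> ≡≤ (sym (*-identityˡ _)) (bound w w∈)) ⟩
    ∑ allWords (λ w -> ⟦ bothIncreasing? f v R ⟧ * ⟦ merges? w ⟧)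
     ≡⟨ ∑-*ˡ allWords ⟦ bothIncreasing? f v R ⟧ (λ w -> ⟦ merges? w ⟧) ⟩
    ⟦ bothIncreasing? f v R ⟧ * ∑ allWords (λ w -> ⟦ merges? w ⟧)
     ≤⟨ *-monoʳ-≤ ⟦ bothIncreasing? f v R ⟧ (∑-at-most-one merges? allWords allWords-unique
        (λ {w} {w'} m m' -> merge-unique (label f) (label-injective f) w w' m m')) ⟩
    ⟦ bothIncreasing? f v R ⟧ * 1
     ≡⟨ trans (*-identityʳ _) (⟦⟧-× (inc? f v) (inc? f (v ∘⤖ R))) ⟩
    ⟦ inc? f v ⟧ * ⟦ inc? f (v ∘⤖ R) ⟧ ∎
    where
    open ≤-Reasoning
    open Pair v R
    fits? : ∀ w -> Dec (Sat ρ (assignment w 0 0) × Ordered (label f) (merged w 0 0))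
    fits? w = sat? ρ (assignment w 0 0) ×-dec ordered? (label f) (merged w 0 0)
    merges? : ∀ w -> Dec (Merges (label f) (label-injective f) w 0 0)
    merges? w = noAdj? w ×-dec (sat? ρ (assignment w 0 0) ×-dec (ordered? (label f) (merged w 0 0) ×-dec ((endP w 0 ℕ.≟ N) ×-dec (endQ w 0 ℕ.≟ N))))
    bound : ∀ w -> w ∈ allWords -> 1 * ⟦ fits? w ⟧ ≤ ⟦ bothIncreasing? f v R ⟧ * ⟦ merges? w ⟧
    bound w w∈ = ≡≤ (*-identityˡ _) (⟦⟧≤ (fits? w) λ (s , ord) ->
     let (σ , σ∈ , w∈σ) = ∈-allWords⁻ σs w∈
         (endP≡ , endQ≡) = taggedWords-end σ∈ w∈σ
         m = words-noAdj (freeP σ) (freeQ σ) σ (proj₁ (σs-good σ∈)) w∈σ , s , ord , endP≡ , endQ≡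
         (incP , incQ) = merges⇒increasing (label f) (label-injective f) w m
     in ≤-reflexive (sym (cong₂ _*_ (⟦⟧-yes (bothIncreasing? f v R) (Inc⁺ f v (incP z≤n) , Inc⁺ f (v ∘⤖ R) (incQ z≤n))) (⟦⟧-yes (merges? w) m))))

 -- Estimates for factorials

 ≢0 : ∀ {n} -> 1 ≤ n -> NonZero n
 ≢0 {suc n} _ = _

 !-+-≤ : ∀ m a -> (m + a) ! ≤ m ! * (m + a) ^ a
 !-+-≤ m zero = ≤-reflexive (trans (cong _! (+-identityʳ m)) (sym (*-identityʳ (m !))))
 !-+-≤ m (suc a) = begin
  (m + suc a) ! ≡⟨ cong _! (+-suc m a) ⟩
  suc (m + a) * (m + a) ! ≤⟨ *-monoʳ-≤ (suc (m + a)) (≤-trans (!-+-≤ m a) (*-monoʳ-≤ (m !) (^-monoˡ-≤ a (n≤1+n (m + a))))) ⟩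
  suc (m + a) * (m ! * suc (m + a) ^ a) ≡⟨ lem (suc (m + a)) (m !) (suc (m + a) ^ a) ⟩
  m ! * suc (m + a) ^ suc a ≡⟨ cong (λ z -> m ! * z ^ suc a) (+-suc m a) ⟨
  m ! * (m + suc a) ^ suc a ∎
  where
  open ≤-Reasoning
  lem : ∀ x y z -> x * (y * z) ≡ y * (x * z)
  lem = solve-∀

 !-+-≥ : ∀ m a -> m ! * suc m ^ a ≤ (m + a) !
 !-+-≥ m zero = ≤-reflexive (trans (*-identityʳ (m !)) (cong _! (sym (+-identityʳ m))))
 !-+-≥ m (suc a) = begin
  m ! * (suc m * suc m ^ a) ≡⟨ lem (m !) (suc m) (suc m ^ a) ⟩
  suc m * (m ! * suc m ^ a) ≤⟨ *-mono-≤ (s≤s (m≤m+n m a)) (!-+-≥ m a) ⟩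
  suc (m + a) * (m + a) ! ≡⟨ cong _! (+-suc m a) ⟨
  (m + suc a) ! ∎
  where
  open ≤-Reasoning
  lem : ∀ x y z -> x * (y * z) ≡ y * (x * z)
  lem = solve-∀

 !-+-≥' : ∀ m a -> m ! * m ^ a ≤ (m + a) !
 !-+-≥' m a = ≤-trans (*-monoʳ-≤ (m !) (^-monoˡ-≤ a (n≤1+n m))) (!-+-≥ m a)

 !*!-≤ : ∀ a b -> a ! * b ! ≤ (a + b) !
 !*!-≤ a zero = ≤-reflexive (trans (*-identityʳ (a !)) (cong _! (sym (+-identityʳ a))))
 !*!-≤ a (suc b) = begin
  a ! * (suc b * b !) ≡⟨ lem (a !) (suc b) (b !) ⟩
  suc b * (a ! * b !) ≤⟨ *-mono-≤ (s≤s (m≤n+m b a)) (!*!-≤ a b) ⟩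
  suc (a + b) * (a + b) ! ≡⟨ cong _! (+-suc a b) ⟨
  (a + suc b) ! ∎
  where
  open ≤-Reasoning
  lem : ∀ x y z -> x * (y * z) ≡ y * (x * z)
  lem = solve-∀

 !-≤-^ : ∀ n -> n ! ≤ n ^ n
 !-≤-^ n = ≤≡ (!-+-≤ 0 n) (*-identityˡ (n ^ n))

 -- The binomial coefficient counts the words with `a` letters P and `b` letters Q, so
 -- `words-count-≤` applies.
 binomial-≤ : ∀ a b -> (a + b) ! ≤ 3 ^ (a + b) * (a ! * b !)
 binomial-≤ a b = subst₂ _≤_ (trans (cong (length (words a b []) *_) (sym (*-identityʳ _))) (trans (words-count a b []) (cong _! (+-identityʳ (a + b)))))
  (cong (λ k -> 3 ^ k * (a ! * b !)) (+-identityʳ (a + b))) (*-monoˡ-≤ (a ! * b !) (words-count-≤ a b []))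

 ^-distrib-* : ∀ a b n -> (a * b) ^ n ≡ a ^ n * b ^ n
 ^-distrib-* a b zero = refl
 ^-distrib-* a b (suc n) = trans (cong (a * b *_) (^-distrib-* a b n)) (lem a b (a ^ n) (b ^ n))
  where
  lem : ∀ a b x y -> a * b * (x * y) ≡ a * x * (b * y)
  lem = solve-∀

 -- The quotient of factorials behind coef, when the number m of letters grows

 module Growth (A B c k m : ℕ) where

  -- Shifts of the arguments for `N = m + γ`: there are 2m + α letters and blocks to arrange, m + β
  -- free values, m + δ and m + ε free letters P and Q, 2m + η merged edges, and N + 1 = m + ζ. As α
  -- + β + γ = δ + ε + η + 1, numerator and denominator have the same growth in m. The number `z`
  -- dominates every shift.
  α β γ δ ε ζ η exponent : ℕ
  α = A + B + 3 * c
  β = A + B + 1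
  γ = A + B + c + k
  δ = B + c
  ε = A + c
  ζ = suc γ
  η = 2 * (A + B + c) + k
  exponent = α + β + γ

  z : ℕ
  z = 3 * (A + B + c) + k + 1

  numerator denominator : ℕ
  numerator = (2 * m + α) ! * (m + β) ! * (m + γ) !
  denominator = (m + δ) ! * (m + ε) ! * (2 * m + η) ! * (m + ζ)

  private
   exponent≡ : exponent ≡ δ + ε + η + 1
   exponent≡ = lem A B c k
    where
    lem : ∀ A B c k -> A + B + 3 * c + (A + B + 1) + (A + B + c + k) ≡ B + c + (A + c) + (2 * (A + B + c) + k) + 1
    lem = solve-∀

   base = (2 * m) ! * m ! * m !

   α≤ : 2 * m + α ≤ 2 * (m + z)
   α≤ = ≤≡ (m≤m+n _ (5 * A + 5 * B + 3 * c + 2 * k + 2)) (lem A B c k m)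
    where
    lem : ∀ A B c k m -> 2 * m + (A + B + 3 * c) + (5 * A + 5 * B + 3 * c + 2 * k + 2) ≡ 2 * (m + (3 * (A + B + c) + k + 1))
    lem = solve-∀
   β≤ : m + β ≤ m + z
   β≤ = ≤≡ (m≤m+n _ (2 * A + 2 * B + 3 * c + k)) (lem A B c k m)
    where
    lem : ∀ A B c k m -> m + (A + B + 1) + (2 * A + 2 * B + 3 * c + k) ≡ m + (3 * (A + B + c) + k + 1)
    lem = solve-∀
   ζ≤ : m + ζ ≤ m + z
   ζ≤ = ≤≡ (m≤m+n _ (2 * A + 2 * B + 2 * c)) (lem A B c k m)
    where
    lem : ∀ A B c k m -> m + suc (A + B + c + k) + (2 * A + 2 * B + 2 * c) ≡ m + (3 * (A + B + c) + k + 1)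
    lem = solve-∀
   γ≤ : m + γ ≤ m + z
   γ≤ = ≤-trans (+-monoʳ-≤ m (n≤1+n γ)) ζ≤
   δ≤ : m + δ ≤ m + z
   δ≤ = ≤≡ (m≤m+n _ (3 * A + 2 * B + 2 * c + k + 1)) (lem A B c k m)
    where
    lem : ∀ A B c k m -> m + (B + c) + (3 * A + 2 * B + 2 * c + k + 1) ≡ m + (3 * (A + B + c) + k + 1)
    lem = solve-∀
   ε≤ : m + ε ≤ m + z
   ε≤ = ≤≡ (m≤m+n _ (2 * A + 3 * B + 2 * c + k + 1)) (lem A B c k m)
    where
    lem : ∀ A B c k m -> m + (A + c) + (2 * A + 3 * B + 2 * c + k + 1) ≡ m + (3 * (A + B + c) + k + 1)
    lem = solve-∀
   η≤ : 2 * m + η ≤ 2 * (m + z)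
   η≤ = ≤≡ (m≤m+n _ (4 * A + 4 * B + 4 * c + k + 2)) (lem A B c k m)
    where
    lem : ∀ A B c k m -> 2 * m + (2 * (A + B + c) + k) + (4 * A + 4 * B + 4 * c + k + 2) ≡ 2 * (m + (3 * (A + B + c) + k + 1))
    lem = solve-∀

   up : ∀ {x y} a b -> x + a ≤ y -> b ≡ x -> (x + a) ! ≤ b ! * y ^ a
   up {x} a b le refl = ≤-trans (!-+-≤ x a) (*-monoʳ-≤ (x !) (^-monoˡ-≤ a le))

   numerator-≤ : numerator ≤ base * (2 ^ α * (m + z) ^ exponent)
   numerator-≤ = begin
    (2 * m + α) ! * (m + β) ! * (m + γ) ! ≤⟨ *-mono-≤ (*-mono-≤ (up α (2 * m) α≤ refl) (up β m β≤ refl)) (up γ m γ≤ refl) ⟩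
    (2 * m) ! * (2 * (m + z)) ^ α * (m ! * (m + z) ^ β) * (m ! * (m + z) ^ γ)
     ≡⟨ cong (λ w -> (2 * m) ! * w * (m ! * (m + z) ^ β) * (m ! * (m + z) ^ γ)) (^-distrib-* 2 (m + z) α) ⟩
    (2 * m) ! * (2 ^ α * (m + z) ^ α) * (m ! * (m + z) ^ β) * (m ! * (m + z) ^ γ)
     ≡⟨ lem ((2 * m) !) (m !) (2 ^ α) ((m + z) ^ α) ((m + z) ^ β) ((m + z) ^ γ) ⟩
    base * (2 ^ α * ((m + z) ^ α * (m + z) ^ β * (m + z) ^ γ))
     ≡⟨ cong (λ w -> base * (2 ^ α * w)) (trans (cong (_* (m + z) ^ γ) (sym (^-distribˡ-+-* (m + z) α β))) (sym (^-distribˡ-+-* (m + z) (α + β) γ))) ⟩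
    base * (2 ^ α * (m + z) ^ exponent) ∎
    where
    open ≤-Reasoning
    lem : ∀ t f a x y w -> t * (a * x) * (f * y) * (f * w) ≡ t * f * f * (a * (x * y * w))
    lem = solve-∀

   numerator-≥ : base * (2 ^ α * m ^ exponent) ≤ numerator
   numerator-≥ = begin
    base * (2 ^ α * m ^ exponent)
     ≡⟨ cong (λ w -> base * (2 ^ α * w)) (trans (^-distribˡ-+-* m (α + β) γ) (cong (_* m ^ γ) (^-distribˡ-+-* m α β))) ⟩
    base * (2 ^ α * (m ^ α * m ^ β * m ^ γ)) ≡⟨ lem ((2 * m) !) (m !) (2 ^ α) (m ^ α) (m ^ β) (m ^ γ) ⟨
    (2 * m) ! * (2 ^ α * m ^ α) * (m ! * m ^ β) * (m ! * m ^ γ) ≡⟨ cong (λ w -> (2 * m) ! * w * (m ! * m ^ β) * (m ! * m ^ γ)) (^-distrib-* 2 m α) ⟨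
    (2 * m) ! * (2 * m) ^ α * (m ! * m ^ β) * (m ! * m ^ γ) ≤⟨ *-mono-≤ (*-mono-≤ (!-+-≥' (2 * m) α) (!-+-≥' m β)) (!-+-≥' m γ) ⟩
    numerator ∎
    where
    open ≤-Reasoning
    lem : ∀ t f a x y w -> t * (a * x) * (f * y) * (f * w) ≡ t * f * f * (a * (x * y * w))
    lem = solve-∀

   powers : ∀ x -> x ^ δ * x ^ ε * x ^ η * x ≡ x ^ exponent
   powers x = trans (cong₂ (λ u v -> u * x ^ η * v) (sym (^-distribˡ-+-* x δ ε)) (sym (*-identityʳ x)))
    (trans (cong (_* x ^ 1) (sym (^-distribˡ-+-* x (δ + ε) η))) (trans (sym (^-distribˡ-+-* x (δ + ε + η) 1)) (cong (x ^_) (sym exponent≡))))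

   denominator-≥ : base * (2 ^ η * m ^ exponent) ≤ denominator
   denominator-≥ = begin
    base * (2 ^ η * m ^ exponent) ≡⟨ cong (λ w -> base * (2 ^ η * w)) (powers m) ⟨
    base * (2 ^ η * (m ^ δ * m ^ ε * m ^ η * m)) ≡⟨ lem ((2 * m) !) (m !) (2 ^ η) (m ^ δ) (m ^ ε) (m ^ η) m ⟩
    m ! * m ^ δ * (m ! * m ^ ε) * ((2 * m) ! * (2 ^ η * m ^ η)) * m ≡⟨ cong (λ w -> m ! * m ^ δ * (m ! * m ^ ε) * ((2 * m) ! * w) * m) (^-distrib-* 2 m η) ⟨
    m ! * m ^ δ * (m ! * m ^ ε) * ((2 * m) ! * (2 * m) ^ η) * m
     ≤⟨ *-mono-≤ (*-mono-≤ (*-mono-≤ (!-+-≥' m δ) (!-+-≥' m ε)) (!-+-≥' (2 * m) η)) (m≤m+n m ζ) ⟩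
    denominator ∎
    where
    open ≤-Reasoning
    lem : ∀ t f a x y w m -> t * f * f * (a * (x * y * w * m)) ≡ f * x * (f * y) * (t * (a * w)) * m
    lem = solve-∀

   denominator-≤ : denominator ≤ base * (2 ^ η * (m + z) ^ exponent)
   denominator-≤ = begin
    denominator
     ≤⟨ *-mono-≤ (*-mono-≤ (*-mono-≤ (up δ m δ≤ refl) (up ε m ε≤ refl)) (up η (2 * m) η≤ refl)) ζ≤ ⟩
    m ! * x ^ δ * (m ! * x ^ ε) * ((2 * m) ! * (2 * x) ^ η) * x ≡⟨ cong (λ w -> m ! * x ^ δ * (m ! * x ^ ε) * ((2 * m) ! * w) * x) (^-distrib-* 2 x η) ⟩
    m ! * x ^ δ * (m ! * x ^ ε) * ((2 * m) ! * (2 ^ η * x ^ η)) * x ≡⟨ lem ((2 * m) !) (m !) (2 ^ η) (x ^ δ) (x ^ ε) (x ^ η) x ⟨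
    base * (2 ^ η * (x ^ δ * x ^ ε * x ^ η * x)) ≡⟨ cong (λ w -> base * (2 ^ η * w)) (powers x) ⟩
    base * (2 ^ η * x ^ exponent) ∎
    where
    open ≤-Reasoning
    x = m + z
    lem : ∀ t f a x y w m -> t * f * f * (a * (x * y * w * m)) ≡ f * x * (f * y) * (t * (a * w)) * m
    lem = solve-∀

   interchange : ∀ b x y -> b * x * y ≡ b * y * x
   interchange = solve-∀

  -- Both products are (2m)! m! m! times a power of 2 and `exponent` factors between m and m + z.
  -- Hence the quotient is 2^(α - η) up to a factor ((m + z) / m)^exponent in either direction.
  growth-≤ : numerator * (2 ^ η * m ^ exponent) ≤ denominator * (2 ^ α * (m + z) ^ exponent)
  growth-≤ = ≤-trans (*-monoˡ-≤ (2 ^ η * m ^ exponent) numerator-≤) (≡≤ (interchange base (2 ^ α * (m + z) ^ exponent) (2 ^ η * m ^ exponent))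
   (*-monoˡ-≤ (2 ^ α * (m + z) ^ exponent) denominator-≥))

  growth-≥ : denominator * (2 ^ α * m ^ exponent) ≤ numerator * (2 ^ η * (m + z) ^ exponent)
  growth-≥ = ≤-trans (*-monoˡ-≤ (2 ^ α * m ^ exponent) denominator-≤) (≡≤ (interchange base (2 ^ η * (m + z) ^ exponent) (2 ^ α * m ^ exponent))
   (*-monoˡ-≤ (2 ^ η * (m + z) ^ exponent) numerator-≥))

 -- For c ≤ r the c extra factors on the left are at most 5 r and are paid for by those of (r + c)!.
 -- For r ≤ c the binomial bound costs 3^(2M + c), at most 3^(5 c); this is the origin of 243 = 3^5.
 many-blocks : ∀ c r {M} -> c + r ≡ suc M -> (2 * M + c) ! * r ! ≤ 243 ^ c * ((2 * M) ! * suc M !)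
 many-blocks c r {M} eq = case c ℕ.≤? r of λ where
   (yes c≤r) -> few c≤r
   (no c≰r) -> many (ℕ.<⇒≤ (ℕ.≰⇒> c≰r))
  where
  open ≤-Reasoning
  2M+c≤ : ∀ x -> suc M ≤ 2 * x -> c ≤ x -> 2 * M + c ≤ 5 * x
  2M+c≤ x le c≤x = ≤≡ (+-mono-≤ (*-monoʳ-≤ 2 (≤-trans (n≤1+n M) le)) c≤x) (lem x)
   where
   lem : ∀ x -> 2 * (2 * x) + x ≡ 5 * x
   lem = solve-∀
  few : c ≤ r -> (2 * M + c) ! * r ! ≤ 243 ^ c * ((2 * M) ! * suc M !)
  few c≤r = begin
   (2 * M + c) ! * r ! ≤⟨ *-monoˡ-≤ (r !) (≤-trans (!-+-≤ (2 * M) c) (*-monoʳ-≤ ((2 * M) !) (^-monoˡ-≤ c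
    (≤-trans (2M+c≤ r (subst (_≤ 2 * r) eq (≤≡ (+-monoˡ-≤ r c≤r) (cong (r +_) (sym (+-identityʳ r))))) c≤r)
     (*-mono-≤ {5} {243} (m≤m+n 5 238) (n≤1+n r)))))) ⟩
   (2 * M) ! * (243 * suc r) ^ c * r ! ≡⟨ cong (λ x -> (2 * M) ! * x * r !) (^-distrib-* 243 (suc r) c) ⟩
   (2 * M) ! * (243 ^ c * suc r ^ c) * r ! ≡⟨ lem ((2 * M) !) (243 ^ c) (suc r ^ c) (r !) ⟩
   243 ^ c * ((2 * M) ! * (r ! * suc r ^ c)) ≤⟨ *-monoʳ-≤ (243 ^ c) (*-monoʳ-≤ ((2 * M) !) (≤≡ (!-+-≥ r c) (cong _! (trans (ℕ.+-comm r c) eq)))) ⟩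
   243 ^ c * ((2 * M) ! * suc M !) ∎
   where
   lem : ∀ t a s r -> t * (a * s) * r ≡ a * (t * (r * s))
   lem = solve-∀
  many : r ≤ c -> (2 * M + c) ! * r ! ≤ 243 ^ c * ((2 * M) ! * suc M !)
  many r≤c = begin
   (2 * M + c) ! * r ! ≤⟨ *-monoˡ-≤ (r !) (≤-trans (binomial-≤ (2 * M) c) (*-monoˡ-≤ ((2 * M) ! * c !)
    (≤≡ (ℕ.^-monoʳ-≤ 3 (2M+c≤ c (subst (_≤ 2 * c) eq (≤≡ (+-monoʳ-≤ c r≤c) (cong (c +_) (sym (+-identityʳ c))))) ≤-refl))
     (sym (ℕ.^-*-assoc 3 5 c))))) ⟩
   243 ^ c * ((2 * M) ! * c !) * r ! ≡⟨ lem (243 ^ c) ((2 * M) !) (c !) (r !) ⟩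
   243 ^ c * ((2 * M) ! * (c ! * r !)) ≤⟨ *-monoʳ-≤ (243 ^ c) (*-monoʳ-≤ ((2 * M) !) (≤≡ (!*!-≤ c r) (cong _! eq))) ⟩
   243 ^ c * ((2 * M) ! * suc M !) ∎
   where
   lem : ∀ a t c r -> a * (t * c) * r ≡ a * (t * (c * r))
   lem = solve-∀

 -- One more common edge multiplies the quotient by (k + M + 1) / (2M + k + 1). This is at most 128
 -- / 129 while the new number of edges k + 1 + M stays within 128 M.
 common-edges-decay : ∀ M k -> k + M ≤ 128 * M -> 129 ^ k * ((k + M) ! * (2 * M) !) ≤ 128 ^ k * (M ! * (2 * M + k) !)
 common-edges-decay M zero _ = ≤-reflexive (cong (λ x -> 1 * (M ! * x !)) (sym (+-identityʳ (2 * M))))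
 common-edges-decay M (suc k) le = begin
  129 * 129 ^ k * (suc (k + M) * (k + M) ! * (2 * M) !) ≡⟨ lem1 129 (129 ^ k) (suc (k + M)) ((k + M) !) ((2 * M) !) ⟩
  129 * suc (k + M) * (129 ^ k * ((k + M) ! * (2 * M) !)) ≤⟨ *-mono-≤ step (common-edges-decay M k (≤-trans (n≤1+n _) le)) ⟩
  128 * suc (2 * M + k) * (128 ^ k * (M ! * (2 * M + k) !)) ≡⟨ lem2 128 (suc (2 * M + k)) (128 ^ k) (M !) ((2 * M + k) !) ⟩
  128 * 128 ^ k * (M ! * (suc (2 * M + k) * (2 * M + k) !)) ≡⟨ cong (λ x -> 128 * 128 ^ k * (M ! * x !)) (+-suc (2 * M) k) ⟨
  128 * 128 ^ k * (M ! * (2 * M + suc k) !) ∎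
  where
  open ≤-Reasoning
  lem1 : ∀ a x s f t -> a * x * (s * f * t) ≡ a * s * (x * (f * t))
  lem1 = solve-∀
  lem2 : ∀ a s x f t -> a * s * (x * (f * t)) ≡ a * x * (f * (s * t))
  lem2 = solve-∀
  step : 129 * suc (k + M) ≤ 128 * suc (2 * M + k)
  step = ≤≡ (+-monoˡ-≤ (128 * suc (k + M)) le) (lem M k)
   where
   lem : ∀ M k -> 128 * M + 128 * suc (k + M) ≡ 128 * suc (2 * M + k)
   lem = solve-∀

 -- After h! ≤ M^h and 3^(2M + g + 1) ≤ 3 · 27^M, each of h factors is 27 · 2 · M = 54 M, which is
 -- below N, and N^M N! ≤ (N + M)! absorbs them. The gain 2^h makes the sum over h converge.
 few-letters : ∀ M g h N -> g + h ≡ M -> 128 * M < N ->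
  N ^ g * (3 ^ (2 * M + suc g) * h ! * N !) * 2 ^ h ≤ 3 * 27 ^ g * (N + M) !
 few-letters M g h N refl M<N = begin
  N ^ g * (3 ^ (2 * M + suc g) * h ! * N !) * 2 ^ h ≤⟨ *-monoˡ-≤ (2 ^ h) (*-monoʳ-≤ (N ^ g) (*-monoˡ-≤ (N !)
   (*-mono-≤ power (≤-trans (!-≤-^ h) (^-monoˡ-≤ h (m≤n+m h g)))))) ⟩
  N ^ g * (3 * 27 ^ g * 27 ^ h * M ^ h * N !) * 2 ^ h ≡⟨ lem1 (N ^ g) (3 * 27 ^ g) (27 ^ h) (M ^ h) (N !) (2 ^ h) ⟩
  3 * 27 ^ g * (N ^ g * (27 ^ h * 2 ^ h * M ^ h) * N !) ≡⟨ cong (λ x -> 3 * 27 ^ g * (N ^ g * x * N !)) (trans (cong (_* M ^ h) (sym (^-distrib-* 27 2 h))) (sym (^-distrib-* 54 M h))) ⟩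
  3 * 27 ^ g * (N ^ g * (54 * M) ^ h * N !) ≤⟨ *-monoʳ-≤ (3 * 27 ^ g) (*-monoˡ-≤ (N !) (*-monoʳ-≤ (N ^ g)
   (^-monoˡ-≤ h (≤-trans (*-monoˡ-≤ M (m≤m+n 54 74)) (ℕ.<⇒≤ M<N))))) ⟩
  3 * 27 ^ g * (N ^ g * N ^ h * N !) ≡⟨ cong (λ x -> 3 * 27 ^ g * x) (trans (cong (_* N !) (sym (^-distribˡ-+-* N g h))) (ℕ.*-comm (N ^ M) (N !))) ⟩
  3 * 27 ^ g * (N ! * N ^ M) ≤⟨ *-monoʳ-≤ (3 * 27 ^ g) (!-+-≥' N M) ⟩
  3 * 27 ^ g * (N + M) ! ∎
  where
  open ≤-Reasoning
  lem1 : ∀ n a b m f t -> n * (a * b * m * f) * t ≡ a * (n * (b * t * m) * f)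
  lem1 = solve-∀
  power : 3 ^ (2 * (g + h) + suc g) ≤ 3 * 27 ^ g * 27 ^ h
  power = begin
   3 ^ (2 * (g + h) + suc g) ≤⟨ ℕ.^-monoʳ-≤ 3 (≤≡ (m≤m+n _ h) (lem g h)) ⟩
   3 ^ suc (3 * (g + h)) ≡⟨ cong (3 *_) (sym (ℕ.^-*-assoc 3 3 (g + h))) ⟩
   3 * 27 ^ (g + h) ≡⟨ cong (3 *_) (^-distribˡ-+-* 27 g h) ⟩
   3 * (27 ^ g * 27 ^ h) ≡⟨ *-assoc 3 (27 ^ g) (27 ^ h) ⟨
   3 * 27 ^ g * 27 ^ h ∎
   where
   lem : ∀ g h -> 2 * (g + h) + suc g + h ≡ suc (3 * (g + h))
   lem = solve-∀

-- From natural numbers to rational estimates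

open Combinatorics
open import Data.Integer.Base using (+_)
import Data.Integer.Base as ℤ
open import Data.Nat.Base using (_^_)
import Data.Nat.Properties as N
open import Data.Nat.Base as N using (ℕ; zero; suc; _!; _∸_; z≤n; s≤s)
open import Data.Nat.Tactic.RingSolver using () renaming (solve-∀ to ℕ-ring)
open import Data.Rational.Base
open import Data.Nat.Properties using (*-mono-≤; *-monoʳ-≤; *-monoˡ-≤; +-suc; m*n≢0; m+[n∸m]≡n; m^n>0; m≤m+n; m≤n*m; m≤n+m; n≤1+n)
open import Data.Rational.Properties using (*-assoc; *-comm; *-distribʳ-+; *-distribˡ-+; *-identityʳ; *-identityˡ; *-zeroˡ; +-assoc; +-comm; +-identityʳ; +-identityˡ; +-mono-≤; +-monoʳ-≤; +-monoˡ-≤; module ≤-Reasoning; positive⁻¹; ≤-refl; ≤-reflexive; ≤-total; ≤-trans)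
open import Tactic.RingSolver using (solve-∀)
open import Defs using (inv!; e-sum; 𝔼; 𝔼[H²]; H; HamiltonianPath; EdgeOrdering; hamiltonianPaths; edgeOrderings; increasing?; searchFin; searchEdge)

≡≤ᵣ : ∀ {a b c} -> a ≡ b -> b ≤ c -> a ≤ c
≡≤ᵣ refl b≤c = b≤c

≤≡ᵣ : ∀ {a b c} -> a ≤ b -> b ≡ c -> a ≤ c
≤≡ᵣ a≤b refl = a≤b

ring : AlmostCommutativeRing _ _
ring = fromCommutativeRing ℚ.+-*-commutativeRing λ x -> dec⇒maybe (0ℚ ℚ.≟ x)

open Summation (CommutativeRing.isCommutativeSemiring ℚ.+-*-commutativeRing) _≤_ ≤-refl +-mono-≤ public using ()
 renaming (∑ to ∑ᵣ; ∑-cong to ∑ᵣ-cong; ∑-cong-∈ to ∑ᵣ-cong-∈; ∑-mono to ∑ᵣ-mono; ∑-mono-∈ to ∑ᵣ-mono-∈; ∑-zero to ∑ᵣ-zero;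
      ∑-⊕ to ∑ᵣ-+; ∑-*ˡ to ∑ᵣ-*ˡ; ∑-*ʳ to ∑ᵣ-*ʳ; ∑-++ to ∑ᵣ-++; ∑-swap to ∑ᵣ-swap; ∑-map to ∑ᵣ-map;
      ∑-cartesianProductWith to ∑ᵣ-cartesianProductWith)

private
 toℚᵘ-/ : ∀ a d .{{_ : N.NonZero d}} -> toℚᵘ (+ a / d) ℚᵘ.≃ (+ a ℚᵘ./ d)
 toℚᵘ-/ a (suc d) = ℚ.toℚᵘ-fromℚᵘ (ℚᵘ.mkℚᵘ (+ a) d)

abstract

 ι : ℕ -> ℚ
 ι n = + n / 1

 ι≡ : ∀ n -> ι n ≡ + n / 1
 ι≡ n = refl

 ι-+ : ∀ m n -> ι (m N.+ n) ≡ ι m + ι n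
 ι-+ m n = ℚ.toℚᵘ-injective (begin
  toℚᵘ (ι (m N.+ n)) ≈⟨ toℚᵘ-/ (m N.+ n) 1 ⟩
  (+ (m N.+ n) ℚᵘ./ 1) ≈⟨ ℚᵘ.*≡* (cong (ℤ._* + 1) (sym (cong₂ ℤ._+_ (ℤ.*-identityʳ (+ m)) (ℤ.*-identityʳ (+ n))))) ⟩
  (+ m ℚᵘ./ 1) ℚᵘ.+ (+ n ℚᵘ./ 1) ≈⟨ ℚᵘ.+-cong (toℚᵘ-/ m 1) (toℚᵘ-/ n 1) ⟨
  toℚᵘ (ι m) ℚᵘ.+ toℚᵘ (ι n) ≈⟨ ℚ.toℚᵘ-homo-+ (ι m) (ι n) ⟨
  toℚᵘ (ι m + ι n) ∎)
  where open import Relation.Binary.Reasoning.Setoid ℚᵘ.≃-setoid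

 ι-* : ∀ m n -> ι (m N.* n) ≡ ι m * ι n
 ι-* m n = ℚ.toℚᵘ-injective (begin
  toℚᵘ (ι (m N.* n)) ≈⟨ toℚᵘ-/ (m N.* n) 1 ⟩
  (+ (m N.* n) ℚᵘ./ 1) ≈⟨ ℚᵘ.*≡* (cong (ℤ._* + 1) (ℤ.pos-* m n)) ⟩
  (+ m ℚᵘ./ 1) ℚᵘ.* (+ n ℚᵘ./ 1) ≈⟨ ℚᵘ.*-cong (toℚᵘ-/ m 1) (toℚᵘ-/ n 1) ⟨
  toℚᵘ (ι m) ℚᵘ.* toℚᵘ (ι n) ≈⟨ ℚ.toℚᵘ-homo-* (ι m) (ι n) ⟨
  toℚᵘ (ι m * ι n) ∎)
  where open import Relation.Binary.Reasoning.Setoid ℚᵘ.≃-setoid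

 ι-mono : ∀ {m n} -> m N.≤ n -> ι m ≤ ι n
 ι-mono {m} {n} m≤n = ℚ.toℚᵘ-cancel-≤ (begin
  toℚᵘ (ι m) ≃⟨ toℚᵘ-/ m 1 ⟩
  (+ m ℚᵘ./ 1) ≤⟨ ℚᵘ.*≤* (ℤ.*-monoʳ-≤-nonNeg (+ 1) (ℤ.+≤+ m≤n)) ⟩
  (+ n ℚᵘ./ 1) ≃⟨ toℚᵘ-/ n 1 ⟨
  toℚᵘ (ι n) ∎)
  where open ℚᵘ.≤-Reasoning

 ι-/ : ∀ a d .{{_ : N.NonZero d}} -> ι d * (+ a / d) ≡ ι a
 ι-/ a d@(suc d-1) = ℚ.toℚᵘ-injective (begin
  toℚᵘ (ι d * (+ a / d)) ≈⟨ ℚ.toℚᵘ-homo-* (ι d) (+ a / d) ⟩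
  toℚᵘ (ι d) ℚᵘ.* toℚᵘ (+ a / d) ≈⟨ ℚᵘ.*-cong (toℚᵘ-/ d 1) (toℚᵘ-/ a d) ⟩
  (+ d ℚᵘ./ 1) ℚᵘ.* (+ a ℚᵘ./ d) ≈⟨ ℚᵘ.*≡* (trans (ℤ.*-identityʳ _) (trans (ℤ.*-comm (+ d) (+ a)) (cong (λ k -> + a ℤ.* + k) (sym (N.+-identityʳ d))))) ⟩
  (+ a ℚᵘ./ 1) ≈⟨ toℚᵘ-/ a 1 ⟨
  toℚᵘ (ι a) ∎)
  where open import Relation.Binary.Reasoning.Setoid ℚᵘ.≃-setoid

 ι-0 : ι 0 ≡ 0ℚ
 ι-0 = refl

 ι-1 : ι 1 ≡ 1ℚ
 ι-1 = refl

ι-suc : ∀ n -> ι (suc n) ≡ 1ℚ + ι n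
ι-suc n = trans (ι-+ 1 n) (cong (_+ ι n) ι-1)

0≤ι : ∀ n -> 0ℚ ≤ ι n
0≤ι n = subst (_≤ ι n) ι-0 (ι-mono N.z≤n)

1≤ι : ∀ {n} -> 1 N.≤ n -> 1ℚ ≤ ι n
1≤ι {n} 1≤n = subst (_≤ ι n) ι-1 (ι-mono 1≤n)

0<1 : 0ℚ < 1ℚ
0<1 = positive⁻¹ 1ℚ

0≤1 : 0ℚ ≤ 1ℚ
0≤1 = ℚ.<⇒≤ 0<1

0<ι : ∀ {n} -> 1 N.≤ n -> 0ℚ < ι n
0<ι 1≤n = ℚ.<-≤-trans 0<1 (1≤ι 1≤n)

∑ᵣ-ι : {I : Set} (xs : List I) (f : I -> ℕ) -> ι (∑ xs f) ≡ ∑ᵣ xs (ι ∘ f)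
∑ᵣ-ι [] f = ι-0
∑ᵣ-ι (x ∷ xs) f = trans (ι-+ (f x) (∑ xs f)) (cong (λ z -> ι (f x) + z) (∑ᵣ-ι xs f))

∑ᵣ-const : {I : Set} (xs : List I) (c : ℚ) -> ∑ᵣ xs (λ _ -> c) ≡ ι (length xs) * c
∑ᵣ-const [] c = sym (trans (cong (_* c) ι-0) (*-zeroˡ c))
∑ᵣ-const (x ∷ xs) c = trans (cong (λ z -> c + z) (∑ᵣ-const xs c)) (sym (trans (cong (_* c) (ι-suc (length xs))) (lem c (ι (length xs)))))
 where
 lem : ∀ c l -> (1ℚ + l) * c ≡ c + l * c
 lem = solve-∀ ring

*-monoˡ : ∀ {a b c} -> 0ℚ ≤ a -> b ≤ c -> a * b ≤ a * c
*-monoˡ {a} 0≤a b≤c = ℚ.*-monoˡ-≤-nonNeg a {{nonNegative 0≤a}} b≤c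

*-monoʳ : ∀ {a b c} -> 0ℚ ≤ a -> b ≤ c -> b * a ≤ c * a
*-monoʳ {a} 0≤a b≤c = ℚ.*-monoʳ-≤-nonNeg a {{nonNegative 0≤a}} b≤c

*-mono : ∀ {a b c d} -> 0ℚ ≤ a -> 0ℚ ≤ d -> a ≤ b -> c ≤ d -> a * c ≤ b * d
*-mono 0≤a 0≤d a≤b c≤d = ≤-trans (*-monoˡ 0≤a c≤d) (*-monoʳ 0≤d a≤b)

0≤* : ∀ {a b} -> 0ℚ ≤ a -> 0ℚ ≤ b -> 0ℚ ≤ a * b
0≤* {a} {b} 0≤a 0≤b = subst (_≤ a * b) (ℚ.*-zeroʳ a) (*-monoˡ 0≤a 0≤b)

0<* : ∀ {a b} -> 0ℚ < a -> 0ℚ < b -> 0ℚ < a * b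
0<* {a} {b} 0<a 0<b = positive⁻¹ (a * b) {{ℚ.pos*pos⇒pos a {{positive 0<a}} b {{positive 0<b}}}}

0≤+ : ∀ {a b} -> 0ℚ ≤ a -> 0ℚ ≤ b -> 0ℚ ≤ a + b
0≤+ {a} {b} 0≤a 0≤b = subst (_≤ a + b) (+-identityˡ 0ℚ) (+-mono-≤ 0≤a 0≤b)

≤+ʳ : ∀ {a b} -> 0ℚ ≤ b -> a ≤ a + b
≤+ʳ {a} {b} 0≤b = subst (_≤ a + b) (+-identityʳ a) (+-monoʳ-≤ a 0≤b)

≤+ˡ : ∀ {a b} -> 0ℚ ≤ a -> b ≤ a + b
≤+ˡ {a} {b} 0≤a = subst (_≤ a + b) (+-identityˡ b) (+-monoˡ-≤ b 0≤a)

*-cancelˡ : ∀ {a b c} -> 0ℚ < a -> a * b ≤ a * c -> b ≤ c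
*-cancelˡ {a} 0<a = ℚ.*-cancelˡ-≤-pos a {{positive 0<a}}

+-cancelʳ : ∀ {a b} c -> a + c ≤ b + c -> a ≤ b
+-cancelʳ {a} {b} c le = subst₂ _≤_ (lem a c) (lem b c) (+-monoˡ-≤ (- c) le)
 where
 lem : ∀ a c -> a + c + - c ≡ a
 lem = solve-∀ ring

∑ᵣ-nonneg : {I : Set} (xs : List I) {f : I -> ℚ} -> (∀ x -> 0ℚ ≤ f x) -> 0ℚ ≤ ∑ᵣ xs f
∑ᵣ-nonneg xs {f} 0≤f = subst (_≤ ∑ᵣ xs f) (∑ᵣ-zero xs) (∑ᵣ-mono xs 0≤f)

abstract

 -- 1 / (n + 1)
 recip : ℕ -> ℚ
 recip n = + 1 / suc n

 recip≡ : ∀ n -> recip n ≡ + 1 / suc n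
 recip≡ n = refl

 ι-recip : ∀ n -> ι (suc n) * recip n ≡ 1ℚ
 ι-recip n = trans (ι-/ 1 (suc n)) ι-1

 0<recip : ∀ n -> 0ℚ < recip n
 0<recip n = positive⁻¹ (recip n) {{ℚ.normalize-pos 1 (suc n)}}

 -- 1 / k!
 inv : ℕ -> ℚ
 inv = inv!

 inv≡ : ∀ k -> inv k ≡ inv! k
 inv≡ k = refl

 ι-inv : ∀ k -> ι (k !) * inv k ≡ 1ℚ
 ι-inv k = trans (ι-/ 1 (k !) {{N._!≢0 k}}) ι-1

 0≤inv : ∀ k -> 0ℚ ≤ inv k
 0≤inv k = ℚ.nonNegative⁻¹ (inv! k) {{ℚ.normalize-nonNeg 1 (k !) {{N._!≢0 k}}}}

0≤recip : ∀ n -> 0ℚ ≤ recip n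
0≤recip n = ℚ.<⇒≤ (0<recip n)

1≤! : ∀ k -> 1 N.≤ k !
1≤! k = N.>-nonZero⁻¹ (k !) {{N._!≢0 k}}

inv-suc : ∀ k -> inv (suc k) ≡ recip k * inv k
inv-suc k = begin
 inv (suc k) ≡⟨ one (inv (suc k)) ⟩
 1ℚ * 1ℚ * inv (suc k) ≡⟨ cong₂ (λ a b -> a * b * inv (suc k)) (ι-recip k) (ι-inv k) ⟨
 ι (suc k) * recip k * (ι (k !) * inv k) * inv (suc k) ≡⟨ shuffle (ι (suc k)) (recip k) (ι (k !)) (inv k) (inv (suc k)) ⟩
 ι (suc k) * ι (k !) * inv (suc k) * (recip k * inv k) ≡⟨ cong (λ z -> z * inv (suc k) * (recip k * inv k)) (ι-* (suc k) (k !)) ⟨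
 ι (suc k !) * inv (suc k) * (recip k * inv k) ≡⟨ cong (_* (recip k * inv k)) (ι-inv (suc k)) ⟩
 1ℚ * (recip k * inv k) ≡⟨ *-identityˡ _ ⟩
 recip k * inv k ∎
 where
 open ≡-Reasoning
 one : ∀ a -> a ≡ 1ℚ * 1ℚ * a
 one = solve-∀ ring
 shuffle : ∀ a b c d e -> a * b * (c * d) * e ≡ a * c * e * (b * d)
 shuffle = solve-∀ ring

recip-anti : ∀ {m n} -> m N.≤ n -> recip n ≤ recip m
recip-anti {m} {n} m≤n = *-cancelˡ (0<* (0<ι {suc n} (N.s≤s N.z≤n)) (0<ι {suc m} (N.s≤s N.z≤n))) (begin
 ι (suc n) * ι (suc m) * recip n ≡⟨ lem1 (ι (suc n)) (ι (suc m)) (recip n) ⟩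
 ι (suc n) * recip n * ι (suc m) ≡⟨ cong (_* ι (suc m)) (ι-recip n) ⟩
 1ℚ * ι (suc m) ≤⟨ *-monoˡ 0≤1 (ι-mono (N.s≤s m≤n)) ⟩
 1ℚ * ι (suc n) ≡⟨ cong (_* ι (suc n)) (ι-recip m) ⟨
 ι (suc m) * recip m * ι (suc n) ≡⟨ lem2 (ι (suc m)) (recip m) (ι (suc n)) ⟩
 ι (suc n) * ι (suc m) * recip m ∎)
 where
 open ≤-Reasoning
 lem1 : ∀ a b c -> a * b * c ≡ a * c * b
 lem1 = solve-∀ ring
 lem2 : ∀ a b c -> a * b * c ≡ c * a * b
 lem2 = solve-∀ ring

recip-small : ∀ a ε -> 0ℚ < ε -> ∃ λ N -> ι a * recip N ≤ ε
recip-small a ε@(mkℚ (+ zero) d _) 0<ε = absurd (ℚ.drop-*<* 0<ε) λ { (ℤ.+<+ ()) }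
recip-small a ε@(mkℚ (ℤ.-[1+ k ]) d _) 0<ε = absurd (ℚ.drop-*<* 0<ε) λ ()
recip-small a ε@(mkℚ ℤ.+[1+ k ] d _) 0<ε = N , ≤-trans bound unit
 where
 N = a N.* suc d
 unit : recip d ≤ ε
 unit = subst (_≤ ε) (sym (recip≡ d)) (ℚ.toℚᵘ-cancel-≤ (ℚᵘ.≤-trans (ℚᵘ.≤-reflexive (toℚᵘ-/ 1 (suc d)))
  (ℚᵘ.*≤* (ℤ.*-monoʳ-≤-nonNeg (+ suc d) (ℤ.+≤+ {1} {suc k} (N.s≤s N.z≤n))))))
 bound : ι a * recip N ≤ recip d
 bound = *-cancelˡ (0<* (0<ι {suc N} (N.s≤s N.z≤n)) (0<ι {suc d} (N.s≤s N.z≤n))) (begin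
  ι (suc N) * ι (suc d) * (ι a * recip N) ≡⟨ lem1 (ι (suc N)) (ι (suc d)) (ι a) (recip N) ⟩
  ι (suc N) * recip N * (ι a * ι (suc d)) ≡⟨ cong₂ _*_ (ι-recip N) (sym (ι-* a (suc d))) ⟩
  1ℚ * ι N ≤⟨ *-monoˡ 0≤1 (ι-mono (n≤1+n N)) ⟩
  1ℚ * ι (suc N) ≡⟨ cong (_* ι (suc N)) (ι-recip d) ⟨
  ι (suc d) * recip d * ι (suc N) ≡⟨ lem2 (ι (suc d)) (recip d) (ι (suc N)) ⟩
  ι (suc N) * ι (suc d) * recip d ∎)
  where
  open ≤-Reasoning
  lem1 : ∀ n d a r -> n * d * (a * r) ≡ n * r * (a * d)
  lem1 = solve-∀ ring
  lem2 : ∀ a b c -> a * b * c ≡ c * a * b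
  lem2 = solve-∀ ring

-- Asymptotic inequalities

Eventually : (ℕ -> Set) -> Set
Eventually A = ∃ λ N0 -> ∀ N -> N0 N.≤ N -> A N

eventually-× : ∀ {P Q} -> Eventually P -> Eventually Q -> Eventually (λ N -> P N × Q N)
eventually-× (M , p) (N , q) = M N.⊔ N , λ n ≤n -> p n (N.m⊔n≤o⇒m≤o M N ≤n) , q n (N.m⊔n≤o⇒n≤o M N ≤n)

eventually-map : ∀ {P Q : ℕ -> Set} -> (∀ N -> P N -> Q N) -> Eventually P -> Eventually Q
eventually-map f (M , p) = M , λ n ≤n -> f n (p n ≤n)

eventually-≥ : ∀ M -> Eventually (λ N -> M N.≤ N)
eventually-≥ M = M , λ _ M≤N -> M≤N

eventually-∈ : {I : Set} {P : I -> ℕ -> Set} (xs : List I) -> (∀ {x} -> x ∈ xs -> Eventually (P x)) -> Eventually (λ N -> ∀ {x} -> x ∈ xs -> P x N)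
eventually-∈ [] h = 0 , λ _ _ ()
eventually-∈ (x ∷ xs) h = eventually-map (λ N (p , q) -> λ { (here refl) -> p ; (there x∈) -> q x∈ })
 (eventually-× (h (here refl)) (eventually-∈ xs (h ∘ there)))

infix 4 _≲_
-- Hides errors tending to 0, one side at a time, because the upper and lower bounds come from
-- different families of words.
_≲_ : (ℕ -> ℚ) -> (ℕ -> ℚ) -> Set
a ≲ b = ∀ ε -> 0ℚ < ε -> Eventually (λ N -> a N ≤ b N + ε)

≤⇒≲ : ∀ {a b} -> Eventually (λ N -> a N ≤ b N) -> a ≲ b
≤⇒≲ ev ε 0<ε = eventually-map (λ N le -> ≤-trans le (≤+ʳ (ℚ.<⇒≤ 0<ε))) ev

private
 0<½* : ∀ {ε} -> 0ℚ < ε -> 0ℚ < ½ * ε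
 0<½* = 0<* (positive⁻¹ ½)

 halves : ∀ ε -> ½ * ε + ½ * ε ≡ ε
 halves ε = trans (sym (*-distribʳ-+ ε ½ ½)) (*-identityˡ ε)

≲-trans : ∀ {a b c} -> a ≲ b -> b ≲ c -> a ≲ c
≲-trans {a} {b} {c} ab bc ε 0<ε = eventually-map (λ N (p , q) -> begin
 a N ≤⟨ p ⟩
 b N + ½ * ε ≤⟨ +-monoˡ-≤ (½ * ε) q ⟩
 c N + ½ * ε + ½ * ε ≡⟨ trans (+-assoc (c N) _ _) (cong (λ z -> c N + z) (halves ε)) ⟩
 c N + ε ∎) (eventually-× (ab (½ * ε) (0<½* 0<ε)) (bc (½ * ε) (0<½* 0<ε)))
 where open ≤-Reasoning

≲-+ : ∀ {a b c d} -> a ≲ b -> c ≲ d -> (λ N -> a N + c N) ≲ (λ N -> b N + d N)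
≲-+ {a} {b} {c} {d} ab cd ε 0<ε = eventually-map (λ N (p , q) -> begin
 a N + c N ≤⟨ +-mono-≤ p q ⟩
 (b N + ½ * ε) + (d N + ½ * ε) ≡⟨ lem (b N) (d N) (½ * ε) ⟩
 b N + d N + (½ * ε + ½ * ε) ≡⟨ cong (λ z -> b N + d N + z) (halves ε) ⟩
 b N + d N + ε ∎) (eventually-× (ab (½ * ε) (0<½* 0<ε)) (cd (½ * ε) (0<½* 0<ε)))
 where
 open ≤-Reasoning
 lem : ∀ b d h -> (b + h) + (d + h) ≡ b + d + (h + h)
 lem = solve-∀ ring

bound : ∀ q -> ∃ λ n -> 1 N.≤ n × q ≤ ι n
bound q = case ≤-total q 0ℚ of λ where
  (inj₁ q≤0) -> 1 , N.≤-refl , ≤-trans q≤0 (0≤ι 1)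
  (inj₂ 0≤q) -> positive-bound q 0≤q
 where
 positive-bound : ∀ q -> 0ℚ ≤ q -> ∃ λ n -> 1 N.≤ n × q ≤ ι n
 positive-bound q 0≤q = let (n , small) = recip-small 1 (1/ c) (positive⁻¹ (1/ c) {{ℚ.1/pos⇒pos c}}) in
  suc n , N.s≤s N.z≤n , ≤-trans (≤+ˡ {1ℚ} {q} 0≤1) (*-cancelˡ {recip n} {c} {ι (suc n)} (0<recip n) (begin
   recip n * c ≤⟨ *-monoʳ {c} {recip n} {1/ c} (ℚ.<⇒≤ 0<c) (subst (_≤ 1/ c) (trans (cong (_* recip n) ι-1) (*-identityˡ _)) small) ⟩
   1/ c * c ≡⟨ ℚ.*-inverseˡ c ⟩
   1ℚ ≡⟨ trans (*-comm (recip n) _) (ι-recip n) ⟨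
   recip n * ι (suc n) ∎))
  where
  open ≤-Reasoning
  c = 1ℚ + q
  0<c : 0ℚ < c
  0<c = ℚ.<-≤-trans 0<1 (≤+ʳ 0≤q)
  instance
   c-pos : Positive c
   c-pos = positive 0<c
   c-nonZero : NonZero c
   c-nonZero = ℚ.pos⇒nonZero c

≲-*-bounded : ∀ {a b c : ℕ -> ℚ} K -> (∀ N -> 0ℚ ≤ c N) -> (∀ N -> c N ≤ K) -> a ≲ b -> (λ N -> a N * c N) ≲ (λ N -> b N * c N)
≲-*-bounded {a} {b} {c} K 0≤c c≤K ab ε 0<ε with bound K
... | suc n , _ , K≤ = eventually-map (λ N p -> begin
 a N * c N ≤⟨ *-monoʳ (0≤c N) p ⟩
 (b N + recip n * ε) * c N ≡⟨ *-distribʳ-+ (c N) (b N) _ ⟩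
 b N * c N + recip n * ε * c N ≤⟨ +-monoʳ-≤ (b N * c N) (*-monoˡ (0≤* (0≤recip n) (ℚ.<⇒≤ 0<ε)) (≤-trans (c≤K N) K≤)) ⟩
 b N * c N + recip n * ε * ι (suc n) ≡⟨ cong (λ z -> b N * c N + z) (trans (lem (recip n) ε (ι (suc n))) (trans (cong (_* ε) (ι-recip n)) (*-identityˡ ε))) ⟩
 b N * c N + ε ∎) (ab (recip n * ε) (0<* (0<recip n) 0<ε))
 where
 open ≤-Reasoning
 lem : ∀ r e i -> r * e * i ≡ i * r * e
 lem = solve-∀ ring

≲-*ʳ : ∀ {a b : ℕ -> ℚ} c -> 0ℚ ≤ c -> a ≲ b -> (λ N -> a N * c) ≲ (λ N -> b N * c)
≲-*ʳ {a} {b} c 0≤c ab = ≲-*-bounded {a} {b} {λ _ -> c} c (λ _ -> 0≤c) (λ _ -> ≤-refl {c}) ab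

≲-cong : ∀ {a a' b b' : ℕ -> ℚ} -> (∀ N -> a' N ≡ a N) -> (∀ N -> b N ≡ b' N) -> a ≲ b -> a' ≲ b'
≲-cong a≡ b≡ ab ε 0<ε = eventually-map (λ N -> subst₂ (λ x y -> x ≤ y + ε) (sym (a≡ N)) (b≡ N)) (ab ε 0<ε)

≲-refl : ∀ {a} -> a ≲ a
≲-refl {a} = ≤⇒≲ {a} {a} (0 , λ _ _ -> ≤-refl)

≲-∑ : {I : Set} (xs : List I) (a b : I -> ℕ -> ℚ) -> (∀ {x} -> x ∈ xs -> a x ≲ b x) -> (λ N -> ∑ᵣ xs (λ x -> a x N)) ≲ (λ N -> ∑ᵣ xs (λ x -> b x N))
≲-∑ [] a b h = ≲-refl {λ _ -> 0ℚ}
≲-∑ (x ∷ xs) a b h = ≲-+ {a x} {b x} {λ N -> ∑ᵣ xs (λ x -> a x N)} {λ N -> ∑ᵣ xs (λ x -> b x N)} (h (here refl)) (≲-∑ xs a b (h ∘ there))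

≲-recip : ∀ C m -> (λ N -> ι C * recip (N N.∸ m)) ≲ (λ _ -> 0ℚ)
≲-recip C m ε 0<ε = let (N0 , small) = recip-small C ε 0<ε in
 N0 N.+ m , λ N ≤N -> ≤-trans (*-monoˡ (0≤ι C) (recip-anti (N.m+n≤o⇒m≤o∸n N0 ≤N))) (≤-trans small (≤+ˡ ≤-refl))

-- Partial sums of the exponential series

pow : ℚ -> ℕ -> ℚ
pow a zero = 1ℚ
pow a (suc n) = a * pow a n

0≤pow : ∀ {a} -> 0ℚ ≤ a -> ∀ n -> 0ℚ ≤ pow a n
0≤pow 0≤a zero = 0≤1
0≤pow 0≤a (suc n) = 0≤* 0≤a (0≤pow 0≤a n)

pow-mono : ∀ {a b} -> 0ℚ ≤ a -> a ≤ b -> ∀ n -> pow a n ≤ pow b n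
pow-mono 0≤a a≤b zero = ≤-refl
pow-mono 0≤a a≤b (suc n) = *-mono 0≤a (0≤pow (≤-trans 0≤a a≤b) n) a≤b (pow-mono 0≤a a≤b n)

pow-+ : ∀ a m n -> pow a (m N.+ n) ≡ pow a m * pow a n
pow-+ a zero n = sym (*-identityˡ _)
pow-+ a (suc m) n = trans (cong (a *_) (pow-+ a m n)) (sym (*-assoc a _ _))

pow-* : ∀ a b n -> pow (a * b) n ≡ pow a n * pow b n
pow-* a b zero = refl
pow-* a b (suc n) = trans (cong (λ z -> a * b * z) (pow-* a b n)) (lem a b (pow a n) (pow b n))
 where
 lem : ∀ a b x y -> a * b * (x * y) ≡ a * x * (b * y)
 lem = solve-∀ ring

pow-1 : ∀ n -> pow 1ℚ n ≡ 1ℚ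
pow-1 zero = refl
pow-1 (suc n) = trans (*-identityˡ _) (pow-1 n)

pow-≤1 : ∀ {a} -> 0ℚ ≤ a -> a ≤ 1ℚ -> ∀ n -> pow a n ≤ 1ℚ
pow-≤1 0≤a a≤1 n = subst (pow _ n ≤_) (pow-1 n) (pow-mono 0≤a a≤1 n)

ι-^ : ∀ m n -> ι (m N.^ n) ≡ pow (ι m) n
ι-^ m zero = ι-1
ι-^ m (suc n) = trans (ι-* m (m N.^ n)) (cong (ι m *_) (ι-^ m n))

partial : (ℕ -> ℚ) -> ℕ -> ℚ
partial α zero = α 0
partial α (suc K) = α 0 + partial (α ∘ suc) K

partial-suc : ∀ α K -> partial α (suc K) ≡ partial α K + α (suc K)
partial-suc α zero = refl
partial-suc α (suc K) = trans (cong (λ z -> α 0 + z) (partial-suc (α ∘ suc) K)) (sym (+-assoc (α 0) _ _))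

partial-cong : ∀ {α β} -> (∀ n -> α n ≡ β n) -> ∀ K -> partial α K ≡ partial β K
partial-cong eq zero = eq 0
partial-cong eq (suc K) = cong₂ _+_ (eq 0) (partial-cong (eq ∘ suc) K)

partial-mono : ∀ {α β} -> (∀ n -> α n ≤ β n) -> ∀ K -> partial α K ≤ partial β K
partial-mono le zero = le 0
partial-mono le (suc K) = +-mono-≤ (le 0) (partial-mono (le ∘ suc) K)

partial-* : ∀ c α K -> partial (λ n -> c * α n) K ≡ c * partial α K
partial-* c α zero = refl
partial-* c α (suc K) = trans (cong (λ z -> c * α 0 + z) (partial-* c (α ∘ suc) K)) (sym (*-distribˡ-+ c (α 0) _))

0≤partial : ∀ {α} -> (∀ n -> 0ℚ ≤ α n) -> ∀ K -> 0ℚ ≤ partial α K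
0≤partial 0≤α zero = 0≤α 0
0≤partial 0≤α (suc K) = 0≤+ (0≤α 0) (0≤partial (0≤α ∘ suc) K)

partial-≤ : ∀ {α} -> (∀ n -> 0ℚ ≤ α n) -> ∀ {J K} -> J N.≤ K -> partial α J ≤ partial α K
partial-≤ {α} 0≤α {zero} {zero} _ = ≤-refl
partial-≤ {α} 0≤α {zero} {suc K} _ = ≤+ʳ (0≤partial (0≤α ∘ suc) K)
partial-≤ {α} 0≤α {suc J} {suc K} (N.s≤s le) = +-monoʳ-≤ (α 0) (partial-≤ (0≤α ∘ suc) le)

conv : (ℕ -> ℚ) -> (ℕ -> ℚ) -> ℕ -> ℚ
conv α β zero = α 0 * β 0
conv α β (suc n) = α 0 * β (suc n) + conv (α ∘ suc) β n

private
 conv-0≤ : ∀ {α β} -> (∀ n -> 0ℚ ≤ α n) -> (∀ n -> 0ℚ ≤ β n) -> ∀ n -> 0ℚ ≤ conv α β n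
 conv-0≤ 0≤α 0≤β zero = 0≤* (0≤α 0) (0≤β 0)
 conv-0≤ 0≤α 0≤β (suc n) = 0≤+ (0≤* (0≤α 0) (0≤β (suc n))) (conv-0≤ (0≤α ∘ suc) 0≤β n)

 conv-cong : ∀ {α α' β β'} -> (∀ n -> α n ≡ α' n) -> (∀ n -> β n ≡ β' n) -> ∀ n -> conv α β n ≡ conv α' β' n
 conv-cong p q zero = cong₂ _*_ (p 0) (q 0)
 conv-cong p q (suc n) = cong₂ _+_ (cong₂ _*_ (p 0) (q (suc n))) (conv-cong (p ∘ suc) q n)

 conv-*ˡ : ∀ c α β n -> conv (λ i -> c * α i) β n ≡ c * conv α β n
 conv-*ˡ c α β zero = *-assoc c _ _
 conv-*ˡ c α β (suc n) = trans (cong (λ z -> c * α 0 * β (suc n) + z) (conv-*ˡ c (α ∘ suc) β n)) (lem c (α 0) (β (suc n)) _)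
  where
  lem : ∀ c a b d -> c * a * b + c * d ≡ c * (a * b + d)
  lem = solve-∀ ring

 conv-+ˡ : ∀ α α' β n -> conv (λ i -> α i + α' i) β n ≡ conv α β n + conv α' β n
 conv-+ˡ α α' β zero = *-distribʳ-+ (β 0) (α 0) (α' 0)
 conv-+ˡ α α' β (suc n) = trans (cong (λ z -> (α 0 + α' 0) * β (suc n) + z) (conv-+ˡ (α ∘ suc) (α' ∘ suc) β n)) (lem (α 0) (α' 0) (β (suc n)) _ _)
  where
  lem : ∀ a a' b x y -> (a + a') * b + (x + y) ≡ (a * b + x) + (a' * b + y)
  lem = solve-∀ ring

 -- Leibniz's rule: the weight n is split as i + (n - i).
 conv-weight : ∀ α β n -> conv (λ i -> ι i * α i) β n + conv α (λ j -> ι j * β j) n ≡ ι n * conv α β n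
 conv-weight α β zero = trans (cong (λ z -> z * α 0 * β 0 + α 0 * (z * β 0)) ι-0) (trans (lem (α 0) (β 0)) (cong (_* (α 0 * β 0)) (sym ι-0)))
  where
  lem : ∀ a b -> 0ℚ * a * b + a * (0ℚ * b) ≡ 0ℚ * (a * b)
  lem = solve-∀ ring
 conv-weight α β (suc n) = begin
  (ι 0 * α 0 * β (suc n) + conv (λ i -> ι (suc i) * α (suc i)) β n) + (α 0 * (ι (suc n) * β (suc n)) + conv α' (λ j -> ι j * β j) n)
   ≡⟨ cong (λ z -> (ι 0 * α 0 * β (suc n) + z) + (α 0 * (ι (suc n) * β (suc n)) + conv α' (λ j -> ι j * β j) n))
      (trans (conv-cong {β = β} (λ i -> trans (cong (_* α' i) (ι-suc i)) (expand (ι i) (α' i))) (λ _ -> refl) n) (conv-+ˡ (λ i -> ι i * α' i) α' β n)) ⟩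
  (ι 0 * α 0 * β (suc n) + (conv (λ i -> ι i * α' i) β n + conv α' β n)) + (α 0 * (ι (suc n) * β (suc n)) + conv α' (λ j -> ι j * β j) n)
   ≡⟨ cong₂ (λ z s -> (z * α 0 * β (suc n) + (conv (λ i -> ι i * α' i) β n + conv α' β n)) + (α 0 * (s * β (suc n)) + conv α' (λ j -> ι j * β j) n)) ι-0 (ι-suc n) ⟩
  (0ℚ * α 0 * β (suc n) + (conv (λ i -> ι i * α' i) β n + conv α' β n)) + (α 0 * ((1ℚ + ι n) * β (suc n)) + conv α' (λ j -> ι j * β j) n)
   ≡⟨ collect (α 0) (β (suc n)) (conv (λ i -> ι i * α' i) β n) (conv α' β n) (conv α' (λ j -> ι j * β j) n) (ι n) ⟩
  (conv (λ i -> ι i * α' i) β n + conv α' (λ j -> ι j * β j) n) + (conv α' β n + (1ℚ + ι n) * (α 0 * β (suc n)))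
   ≡⟨ cong (_+ (conv α' β n + (1ℚ + ι n) * (α 0 * β (suc n)))) (conv-weight α' β n) ⟩
  ι n * conv α' β n + (conv α' β n + (1ℚ + ι n) * (α 0 * β (suc n)))
   ≡⟨ final (ι n) (conv α' β n) (α 0 * β (suc n)) ⟩
  (1ℚ + ι n) * (α 0 * β (suc n) + conv α' β n)
   ≡⟨ cong (_* (α 0 * β (suc n) + conv α' β n)) (ι-suc n) ⟨
  ι (suc n) * (α 0 * β (suc n) + conv α' β n) ∎
  where
  open ≡-Reasoning
  α' = α ∘ suc
  expand : ∀ i a -> (1ℚ + i) * a ≡ i * a + a
  expand = solve-∀ ring
  collect : ∀ a b x y z i -> (0ℚ * a * b + (x + y)) + (a * ((1ℚ + i) * b) + z) ≡ (x + z) + (y + (1ℚ + i) * (a * b))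
  collect = solve-∀ ring
  final : ∀ i y w -> i * y + (y + (1ℚ + i) * w) ≡ (1ℚ + i) * (w + y)
  final = solve-∀ ring

 conv-shiftʳ : ∀ α β γ b -> γ 0 ≡ 0ℚ -> (∀ j -> γ (suc j) ≡ b * β j) -> ∀ n -> conv α γ (suc n) ≡ b * conv α β n
 conv-shiftʳ α β γ b γ0 γs zero = trans (cong₂ (λ x y -> α 0 * x + α 1 * y) (γs 0) γ0) (lem (α 0) (α 1) (β 0) b)
  where
  lem : ∀ a a' x b -> a * (b * x) + a' * 0ℚ ≡ b * (a * x)
  lem = solve-∀ ring
 conv-shiftʳ α β γ b γ0 γs (suc n) = trans (cong₂ (λ x y -> α 0 * x + y) (γs (suc n)) (conv-shiftʳ (α ∘ suc) β γ b γ0 γs n)) (lem (α 0) (β (suc n)) b _)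
  where
  lem : ∀ a x b y -> a * (b * x) + b * y ≡ b * (a * x + y)
  lem = solve-∀ ring

 partial-conv : ∀ α β K -> partial (conv α β) (suc K) ≡ α 0 * partial β (suc K) + partial (conv (α ∘ suc) β) K
 partial-conv α β K = trans (cong (λ z -> α 0 * β 0 + z) (step K β)) (trans (sym (+-assoc (α 0 * β 0) _ _))
  (cong (_+ partial (conv (α ∘ suc) β) K) (sym (*-distribˡ-+ (α 0) (β 0) _))))
  where
  split : ∀ (f g : ℕ -> ℚ) K -> partial (λ n -> f n + g n) K ≡ partial f K + partial g K
  split f g zero = refl
  split f g (suc K) = trans (cong (λ z -> f 0 + g 0 + z) (split (f ∘ suc) (g ∘ suc) K)) (lem (f 0) (g 0) _ _)
   where
   lem : ∀ a b c d -> a + b + (c + d) ≡ (a + c) + (b + d)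
   lem = solve-∀ ring
  step : ∀ K β -> partial (λ n -> α 0 * β (suc n) + conv (α ∘ suc) β n) K ≡ α 0 * partial (β ∘ suc) K + partial (conv (α ∘ suc) β) K
  step K β = trans (split (λ n -> α 0 * β (suc n)) (conv (α ∘ suc) β) K) (cong (_+ partial (conv (α ∘ suc) β) K) (partial-* (α 0) (β ∘ suc) K))

-- The terms are nonnegative and the triangle i + j ≤ K lies in the square of side K. In
-- `partial-conv-≥` the rectangle i ≤ J, j ≤ K lies in the triangle i + j ≤ J + K.
partial-conv-≤ : ∀ {α β} -> (∀ n -> 0ℚ ≤ α n) -> (∀ n -> 0ℚ ≤ β n) -> ∀ K -> partial (conv α β) K ≤ partial α K * partial β K
partial-conv-≤ 0≤α 0≤β zero = ≤-refl
partial-conv-≤ {α} {β} 0≤α 0≤β (suc K) = begin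
 partial (conv α β) (suc K) ≡⟨ partial-conv α β K ⟩
 α 0 * partial β (suc K) + partial (conv (α ∘ suc) β) K ≤⟨ +-monoʳ-≤ (α 0 * partial β (suc K)) (≤-trans (partial-conv-≤ (0≤α ∘ suc) 0≤β K)
  (*-monoˡ (0≤partial (0≤α ∘ suc) K) (partial-≤ 0≤β (n≤1+n K)))) ⟩
 α 0 * partial β (suc K) + partial (α ∘ suc) K * partial β (suc K) ≡⟨ *-distribʳ-+ (partial β (suc K)) (α 0) _ ⟨
 partial α (suc K) * partial β (suc K) ∎
 where open ≤-Reasoning

partial-conv-≥ : ∀ {α β} -> (∀ n -> 0ℚ ≤ α n) -> (∀ n -> 0ℚ ≤ β n) -> ∀ J K -> partial α J * partial β K ≤ partial (conv α β) (J N.+ K)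
partial-conv-≥ {α} {β} 0≤α 0≤β zero K = subst (_≤ partial (conv α β) K) (partial-* (α 0) β K) (partial-mono first K)
 where
 first : ∀ n -> α 0 * β n ≤ conv α β n
 first zero = ≤-refl
 first (suc n) = ≤+ʳ (conv-0≤ (0≤α ∘ suc) 0≤β n)
partial-conv-≥ {α} {β} 0≤α 0≤β (suc J) K = begin
 partial α (suc J) * partial β K ≡⟨ *-distribʳ-+ (partial β K) (α 0) _ ⟩
 α 0 * partial β K + partial (α ∘ suc) J * partial β K ≤⟨ +-mono-≤ (*-monoˡ (0≤α 0) (partial-≤ 0≤β (m≤n+m K (suc J))))
  (partial-conv-≥ (0≤α ∘ suc) 0≤β J K) ⟩
 α 0 * partial β (suc (J N.+ K)) + partial (conv (α ∘ suc) β) (J N.+ K) ≡⟨ partial-conv α β (J N.+ K) ⟨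
 partial (conv α β) (suc (J N.+ K)) ∎
 where open ≤-Reasoning

expTerm : ℚ -> ℕ -> ℚ
expTerm a n = pow a n * inv n

exp : ℚ -> ℕ -> ℚ
exp a = partial (expTerm a)

0≤expTerm : ∀ {a} -> 0ℚ ≤ a -> ∀ n -> 0ℚ ≤ expTerm a n
0≤expTerm 0≤a n = 0≤* (0≤pow 0≤a n) (0≤inv n)

0≤exp : ∀ {a} -> 0ℚ ≤ a -> ∀ K -> 0ℚ ≤ exp a K
0≤exp 0≤a = 0≤partial (0≤expTerm 0≤a)

exp-mono : ∀ {a b} -> 0ℚ ≤ a -> a ≤ b -> ∀ K -> exp a K ≤ exp b K
exp-mono 0≤a a≤b = partial-mono (λ n -> *-monoʳ (0≤inv n) (pow-mono 0≤a a≤b n))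

inv-0 : inv 0 ≡ 1ℚ
inv-0 = inv≡ 0

expTerm-suc : ∀ a n -> ι (suc n) * expTerm a (suc n) ≡ a * expTerm a n
expTerm-suc a n = begin
 ι (suc n) * (a * pow a n * inv (suc n)) ≡⟨ cong (λ z -> ι (suc n) * (a * pow a n * z)) (inv-suc n) ⟩
 ι (suc n) * (a * pow a n * (recip n * inv n)) ≡⟨ lem (ι (suc n)) a (pow a n) (recip n) (inv n) ⟩
 ι (suc n) * recip n * (a * (pow a n * inv n)) ≡⟨ cong (_* (a * expTerm a n)) (ι-recip n) ⟩
 1ℚ * (a * expTerm a n) ≡⟨ *-identityˡ _ ⟩
 a * expTerm a n ∎
 where
 open ≡-Reasoning
 lem : ∀ s a p r i -> s * (a * p * (r * i)) ≡ s * r * (a * (p * i))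
 lem = solve-∀ ring

cancel-ι : ∀ n {x y} -> ι (suc n) * x ≡ ι (suc n) * y -> x ≡ y
cancel-ι n eq = ℚ.≤-antisym (*-cancelˡ (0<ι {suc n} (N.s≤s N.z≤n)) (≤-reflexive eq)) (*-cancelˡ (0<ι {suc n} (N.s≤s N.z≤n)) (≤-reflexive (sym eq)))

-- The binomial theorem by Leibniz's rule: both sides are multiplied by n + 1, `conv-weight` shares
-- this weight between the two factors, and `expTerm-suc` lowers the index of the weighted factor.
conv-expTerm : ∀ a b n -> conv (expTerm a) (expTerm b) n ≡ expTerm (a + b) n
conv-expTerm a b zero = trans (cong (λ z -> 1ℚ * z * (1ℚ * z)) inv-0) (cong (1ℚ *_) (sym inv-0))
conv-expTerm a b (suc n) = cancel-ι n (begin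
 ι (suc n) * conv (expTerm a) (expTerm b) (suc n) ≡⟨ conv-weight (expTerm a) (expTerm b) (suc n) ⟨
 (ι 0 * expTerm a 0 * expTerm b (suc n) + conv (λ i -> ι (suc i) * expTerm a (suc i)) (expTerm b) n) + conv (expTerm a) (λ j -> ι j * expTerm b j) (suc n)
  ≡⟨ cong₂ _+_ (cong₂ (λ z w -> z * expTerm a 0 * expTerm b (suc n) + w) ι-0
     (trans (conv-cong {β = expTerm b} (expTerm-suc a) (λ _ -> refl) n) (conv-*ˡ a (expTerm a) (expTerm b) n)))
     (conv-shiftʳ (expTerm a) (expTerm b) (λ j -> ι j * expTerm b j) b (trans (cong (_* expTerm b 0) ι-0) (*-zeroˡ (expTerm b 0))) (expTerm-suc b) n) ⟩
 (0ℚ * expTerm a 0 * expTerm b (suc n) + a * C) + b * C ≡⟨ lem (expTerm a 0) (expTerm b (suc n)) a b C ⟩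
 (a + b) * C ≡⟨ cong ((a + b) *_) (conv-expTerm a b n) ⟩
 (a + b) * expTerm (a + b) n ≡⟨ expTerm-suc (a + b) n ⟨
 ι (suc n) * expTerm (a + b) (suc n) ∎)
 where
 open ≡-Reasoning
 C = conv (expTerm a) (expTerm b) n
 lem : ∀ x y a b c -> (0ℚ * x * y + a * c) + b * c ≡ (a + b) * c
 lem = solve-∀ ring

exp-+-≤ : ∀ {a b} -> 0ℚ ≤ a -> 0ℚ ≤ b -> ∀ K -> exp (a + b) K ≤ exp a K * exp b K
exp-+-≤ {a} {b} 0≤a 0≤b K = subst (_≤ exp a K * exp b K) (partial-cong (conv-expTerm a b) K) (partial-conv-≤ (0≤expTerm 0≤a) (0≤expTerm 0≤b) K)

exp-+-≥ : ∀ {a b} -> 0ℚ ≤ a -> 0ℚ ≤ b -> ∀ J K -> exp a J * exp b K ≤ exp (a + b) (J N.+ K)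
exp-+-≥ {a} {b} 0≤a 0≤b J K = subst (exp a J * exp b K ≤_) (partial-cong (conv-expTerm a b) (J N.+ K)) (partial-conv-≥ (0≤expTerm 0≤a) (0≤expTerm 0≤b) J K)

exp-1≡ : ∀ K -> exp 1ℚ K ≡ e-sum K
exp-1≡ zero = trans (*-identityˡ _) (inv≡ 0)
exp-1≡ (suc K) = trans (partial-suc (expTerm 1ℚ) K) (cong₂ _+_ (exp-1≡ K) (trans (cong (_* inv (suc K)) (pow-1 (suc K))) (trans (*-identityˡ _) (inv≡ (suc K)))))

-- `remainder` strengthens the claim by adding the last term once more; this is inductive because 2
-- / (K + 2)! ≤ 1 / (K + 1)!.
exp-1≤3 : ∀ K -> exp 1ℚ K ≤ ι 3
exp-1≤3 zero = subst (_≤ ι 3) (sym (trans (*-identityˡ _) inv-0)) (1≤ι (N.s≤s N.z≤n))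
exp-1≤3 (suc K) = ≤-trans (≤+ʳ (0≤inv (suc K))) (remainder K)
 where
 expTerm-1 : ∀ n -> expTerm 1ℚ n ≡ inv n
 expTerm-1 n = trans (cong (_* inv n) (pow-1 n)) (*-identityˡ _)
 remainder : ∀ K -> exp 1ℚ (suc K) + inv (suc K) ≤ ι 3
 remainder zero = ≤-reflexive (cong₂ (λ a b -> 1ℚ * a + 1ℚ * 1ℚ * b + b) inv-0 (inv≡ 1) ⟨trans⟩ sym (ι≡ 3))
  where
  _⟨trans⟩_ : ∀ {A : Set} {x y z : A} -> x ≡ y -> y ≡ z -> x ≡ z
  _⟨trans⟩_ = trans
 remainder (suc K) = begin
  exp 1ℚ (suc (suc K)) + i2 ≡⟨ cong (_+ i2) (trans (partial-suc (expTerm 1ℚ) (suc K)) (cong (λ z -> exp 1ℚ (suc K) + z) (expTerm-1 (suc (suc K))))) ⟩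
  exp 1ℚ (suc K) + i2 + i2 ≡⟨ +-assoc (exp 1ℚ (suc K)) i2 i2 ⟩
  exp 1ℚ (suc K) + (i2 + i2) ≤⟨ +-monoʳ-≤ (exp 1ℚ (suc K)) (*-cancelˡ (0<ι {suc (suc K)} (N.s≤s N.z≤n)) (begin
   ι (suc (suc K)) * (i2 + i2) ≡⟨ cong (λ z -> ι (suc (suc K)) * (z + z)) (inv-suc (suc K)) ⟩
   ι (suc (suc K)) * (recip (suc K) * i1 + recip (suc K) * i1) ≡⟨ lem (ι (suc (suc K))) (recip (suc K)) i1 ⟩
   ι (suc (suc K)) * recip (suc K) * (i1 + i1) ≡⟨ cong (_* (i1 + i1)) (ι-recip (suc K)) ⟩
   1ℚ * (i1 + i1) ≡⟨ two i1 ⟩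
   (1ℚ + 1ℚ) * i1 ≤⟨ *-monoʳ (0≤inv (suc K)) (≡≤ᵣ (trans (cong (λ z -> 1ℚ + z) (sym ι-1)) (sym (ι-suc 1))) (ι-mono (N.s≤s (N.s≤s N.z≤n)))) ⟩
   ι (suc (suc K)) * i1 ∎)) ⟩
  exp 1ℚ (suc K) + i1 ≤⟨ remainder K ⟩
  ι 3 ∎
  where
  open ≤-Reasoning
  i1 = inv (suc K)
  i2 = inv (suc (suc K))
  lem : ∀ s r i -> s * (r * i + r * i) ≡ s * r * (i + i)
  lem = solve-∀ ring
  two : ∀ i -> 1ℚ * (i + i) ≡ (1ℚ + 1ℚ) * i
  two = solve-∀ ring

exp-ι-≤ : ∀ y K -> exp (ι y) K ≤ ι (3 N.^ y)
exp-ι-≤ zero K = ≤-reflexive (trans (cong (λ a -> exp a K) ι-0) (trans (exp-0 K) (sym ι-1)))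
 where
 exp-0 : ∀ K -> exp 0ℚ K ≡ 1ℚ
 exp-0 zero = trans (*-identityˡ _) inv-0
 exp-0 (suc K) = trans (partial-suc (expTerm 0ℚ) K) (trans (cong₂ _+_ (exp-0 K)
  (trans (cong (_* inv (suc K)) (*-zeroˡ (pow 0ℚ K))) (*-zeroˡ (inv (suc K))))) (+-identityʳ 1ℚ))
exp-ι-≤ (suc y) K = begin
 exp (ι (suc y)) K ≡⟨ cong (λ a -> exp a K) (ι-suc y) ⟩
 exp (1ℚ + ι y) K ≤⟨ exp-+-≤ 0≤1 (0≤ι y) K ⟩
 exp 1ℚ K * exp (ι y) K ≤⟨ *-mono (0≤exp 0≤1 K) (0≤ι (3 N.^ y)) (exp-1≤3 K) (exp-ι-≤ y K) ⟩
 ι 3 * ι (3 N.^ y) ≡⟨ ι-* 3 (3 N.^ y) ⟨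
 ι (3 N.^ suc y) ∎
 where open ≤-Reasoning

-- The number of coincidences is asymptotically Poisson

private
 fall-2 : ∀ N -> fall (suc N) 2 ≡ suc N N.* N
 fall-2 N = cong (N._* N) (N.*-identityˡ (suc N))

module Discrepancy (N : ℕ) where

 open SteinChen N public using (F; G; G-zero; G-increment)
 open SteinChen N using (G-≤; G-≥; markov)
 open Counting N using (#S-[]; #A-≤-#S)
 private n = suc N

 F≤n! : ∀ y -> F y N.≤ n !
 F≤n! y = subst (F y N.≤_) #S-[] (#A-≤-#S [] y [])
  where open import Data.List.Base using ([])

 -- The 2 N² cells number at most 2 `fall n 2`, which yields the mean 2. The constant is 34 = 2 (1 +
 -- 16), from the cell itself and from the switchings.
 G-≤' : ∀ q y -> suc (q N.+ 2) N.≤ n -> q N.* G (suc y) N.≤ q N.* (2 N.* F y) N.+ 34 N.* n !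
 G-≤' q y le@(N.s≤s q+2≤N) = N.*-cancelˡ-≤ (f N.* f) {{m*n≢0 f f {{f≢0}} {{f≢0}}}} (begin
  f N.* f N.* (q N.* G (suc y)) ≡⟨ lem1 f q (G (suc y)) ⟩
  q N.* (f N.* (f N.* G (suc y))) ≡⟨ cong (λ f -> q N.* (f N.* (f N.* G (suc y)))) (fall-2 N) ⟨
  q N.* (fall n 2 N.* (fall n 2 N.* G (suc y))) ≤⟨ G-≤ q y le ⟩
  N N.* (N N.* 2) N.* (fall n 2 N.* (q N.* F y) N.+ q N.* n ! N.+ fall n 2 N.* (16 N.* n !))
                       ≡⟨ cong (λ f -> N N.* (N N.* 2) N.* (f N.* (q N.* F y) N.+ q N.* n ! N.+ f N.* (16 N.* n !))) (fall-2 N) ⟩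
  N N.* (N N.* 2) N.* (f N.* (q N.* F y) N.+ q N.* n ! N.+ f N.* (16 N.* n !))
   ≤⟨ *-mono-≤ (≤≡ (*-monoˡ-≤ (N N.* 2) (n≤1+n N)) (lem2 N))
      (N.+-monoˡ-≤ (f N.* (16 N.* n !)) (N.+-monoʳ-≤ (f N.* (q N.* F y)) (*-monoˡ-≤ (n !) q≤f))) ⟩
  2 N.* f N.* (f N.* (q N.* F y) N.+ f N.* n ! N.+ f N.* (16 N.* n !)) ≡⟨ lem3 f q (F y) (n !) ⟩
  f N.* f N.* (q N.* (2 N.* F y) N.+ 34 N.* n !) ∎)
  where
  open N.≤-Reasoning
  f = suc N N.* N
  q≤N : q N.≤ N
  q≤N = N.≤-trans (m≤m+n q 2) q+2≤N
  1≤N : 1 N.≤ N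
  1≤N = N.≤-trans (N.≤-trans (N.s≤s N.z≤n) (m≤n+m 2 q)) q+2≤N
  f≢0 : N.NonZero f
  f≢0 = m*n≢0 (suc N) N {{_}} {{N.>-nonZero 1≤N}}
  q≤f : q N.≤ f
  q≤f = N.≤-trans q≤N (m≤n*m N (suc N))
  lem1 : ∀ f q g -> f N.* f N.* (q N.* g) ≡ q N.* (f N.* (f N.* g))
  lem1 = ℕ-ring
  lem2 : ∀ N -> suc N N.* (N N.* 2) ≡ 2 N.* (suc N N.* N)
  lem2 = ℕ-ring
  lem3 : ∀ f q a t -> 2 N.* f N.* (f N.* (q N.* a) N.+ f N.* t N.+ f N.* (16 N.* t)) ≡ f N.* f N.* (q N.* (2 N.* a) N.+ 34 N.* t)
  lem3 = ℕ-ring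

 -- Here 2 N² falls short of 2 N (N + 1) by 2 N; this deficit contributes the 2 in 34 = 32 + 2.
 G-≥' : ∀ q y -> suc (q N.+ 2) N.≤ n -> q N.* (2 N.* F y) N.≤ q N.* G (suc y) N.+ 34 N.* n !
 G-≥' q y le@(N.s≤s q+2≤N) = N.*-cancelˡ-≤ (suc N N.* N) {{m*n≢0 (suc N) N {{_}} {{N.>-nonZero 1≤N}}}} (begin
  suc N N.* N N.* (q N.* (2 N.* F y)) ≡⟨ lem1 N q (F y) ⟩
  N N.* (N N.* 2) N.* (q N.* F y) N.+ N N.* (q N.* (2 N.* F y)) ≤⟨ N.+-mono-≤ (G-≥ q y le)
   (*-monoʳ-≤ N (*-mono-≤ (N.m≤n⇒m≤1+n q≤N) (*-monoʳ-≤ 2 (F≤n! y)))) ⟩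
  q N.* (fall n 2 N.* G (suc y)) N.+ N N.* (N N.* 2) N.* (16 N.* n !) N.+ N N.* (suc N N.* (2 N.* n !))
   ≤⟨ N.+-monoˡ-≤ _ (N.+-mono-≤ (N.≤-reflexive (cong (λ f -> q N.* (f N.* G (suc y))) (fall-2 N)))
      (*-monoˡ-≤ (16 N.* n !) (*-monoˡ-≤ (N N.* 2) (n≤1+n N)))) ⟩
  q N.* (suc N N.* N N.* G (suc y)) N.+ suc N N.* (N N.* 2) N.* (16 N.* n !) N.+ N N.* (suc N N.* (2 N.* n !))
                       ≡⟨ lem2 q N (G (suc y)) (n !) ⟩
  suc N N.* N N.* (q N.* G (suc y) N.+ 34 N.* n !) ∎)
  where
  open N.≤-Reasoning
  q≤N : q N.≤ N
  q≤N = N.≤-trans (m≤m+n q 2) q+2≤N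
  1≤N : 1 N.≤ N
  1≤N = N.≤-trans (N.≤-trans (N.s≤s N.z≤n) (m≤n+m 2 q)) q+2≤N
  lem1 : ∀ N q a -> suc N N.* N N.* (q N.* (2 N.* a)) ≡ N N.* (N N.* 2) N.* (q N.* a) N.+ N N.* (q N.* (2 N.* a))
  lem1 = ℕ-ring
  lem2 : ∀ q N g t -> q N.* (suc N N.* N N.* g) N.+ suc N N.* (N N.* 2) N.* (16 N.* t) N.+ N N.* (suc N N.* (2 N.* t)) ≡ suc N N.* N N.* (q N.* g N.+ 34 N.* t)
  lem2 = ℕ-ring

 markov' : ∀ y -> 1 N.≤ N -> suc y N.* n ! N.≤ suc y N.* F y N.+ 2 N.* n !
 markov' y 1≤N = N.*-cancelˡ-≤ f {{m*n≢0 (suc N) N {{_}} {{N.>-nonZero 1≤N}}}} (begin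
  f N.* (suc y N.* n !) ≡⟨ cong (N._* (suc y N.* n !)) (fall-2 N) ⟨
  fall n 2 N.* (suc y N.* n !) ≤⟨ markov y ⟩
  fall n 2 N.* (suc y N.* F y) N.+ N N.* (N N.* 2) N.* n ! ≤⟨ N.+-mono-≤ (N.≤-reflexive (cong (N._* (suc y N.* F y)) (fall-2 N)))
   (*-monoˡ-≤ (n !) (*-monoˡ-≤ (N N.* 2) (n≤1+n N))) ⟩
  f N.* (suc y N.* F y) N.+ suc N N.* (N N.* 2) N.* n ! ≡⟨ lem N (suc y N.* F y) (n !) ⟩
  f N.* (suc y N.* F y N.+ 2 N.* n !) ∎)
  where
  open N.≤-Reasoning
  f = suc N N.* N
  lem : ∀ N a t -> suc N N.* N N.* a N.+ suc N N.* (N N.* 2) N.* t ≡ suc N N.* N N.* (a N.+ 2 N.* t)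
  lem = ℕ-ring

divide-! : ∀ m q {X Y c} -> suc q N.* X N.≤ suc q N.* Y N.+ c N.* m ! -> ι X * inv m ≤ ι Y * inv m + ι c * recip q
divide-! m q {X} {Y} {c} le = *-cancelˡ (0<ι {suc q} (N.s≤s N.z≤n)) (begin
 ι (suc q) * (ι X * inv m) ≡⟨ trans (sym (*-assoc (ι (suc q)) (ι X) (inv m))) (cong (_* inv m) (sym (ι-* (suc q) X))) ⟩
 ι (suc q N.* X) * inv m ≤⟨ *-monoʳ (0≤inv m) (ι-mono le) ⟩
 ι (suc q N.* Y N.+ c N.* m !) * inv m ≡⟨ cong (_* inv m) (trans (ι-+ (suc q N.* Y) (c N.* m !)) (cong₂ _+_ (ι-* (suc q) Y) (ι-* c (m !)))) ⟩
 (ι (suc q) * ι Y + ι c * ι (m !)) * inv m ≡⟨ lem1 (ι (suc q)) (ι Y) (ι c) (ι (m !)) (inv m) ⟩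
 ι (suc q) * (ι Y * inv m) + ι c * (ι (m !) * inv m) ≡⟨ cong (λ a -> ι (suc q) * (ι Y * inv m) + ι c * a) (trans (ι-inv m) (sym (ι-recip q))) ⟩
 ι (suc q) * (ι Y * inv m) + ι c * (ι (suc q) * recip q) ≡⟨ lem2 (ι (suc q)) (ι Y * inv m) (ι c) (recip q) ⟩
 ι (suc q) * (ι Y * inv m + ι c * recip q) ∎)
 where
 open ≤-Reasoning
 lem1 : ∀ q y c t i -> (q * y + c * t) * i ≡ q * (y * i) + c * (t * i)
 lem1 = solve-∀ ring
 lem2 : ∀ q y c r -> q * y + c * (q * r) ≡ q * (y + c * r)
 lem2 = solve-∀ ring

infix 4 _≈_
_≈_ : (ℕ -> ℚ) -> (ℕ -> ℚ) -> Set
a ≈ b = a ≲ b × b ≲ a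

private
 ≈-+ : ∀ {a b c d} -> a ≈ b -> c ≈ d -> (λ N -> a N + c N) ≈ (λ N -> b N + d N)
 ≈-+ {a} {b} {c} {d} (p0 , q) (r , s) = ≲-+ {a} {b} {c} {d} p0 r , ≲-+ {b} {a} {d} {c} q s

 ≲-neg : ∀ {a b} -> a ≲ b -> (λ N -> - b N) ≲ (λ N -> - a N)
 ≲-neg {a} {b} ab ε 0<ε = eventually-map (λ N p0 -> +-cancelʳ (b N + a N) (subst₂ _≤_ (lem1 (a N) (b N)) (lem2 (a N) (b N) ε) p0)) (ab ε 0<ε)
  where
  lem1 : ∀ a b -> a ≡ - b + (b + a)
  lem1 = solve-∀ ring
  lem2 : ∀ a b e -> b + e ≡ - a + e + (b + a)
  lem2 = solve-∀ ring

 ≈-neg : ∀ {a b} -> a ≈ b -> (λ N -> - a N) ≈ (λ N -> - b N)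
 ≈-neg {a} {b} (p0 , q) = ≲-neg {b} {a} q , ≲-neg {a} {b} p0

 ≈-*ʳ : ∀ {a b} c -> 0ℚ ≤ c -> a ≈ b -> (λ N -> a N * c) ≈ (λ N -> b N * c)
 ≈-*ʳ {a} {b} c 0≤c (p0 , q) = ≲-*ʳ {a} {b} c 0≤c p0 , ≲-*ʳ {b} {a} c 0≤c q

 ≈-trans : ∀ {a b c} -> a ≈ b -> b ≈ c -> a ≈ c
 ≈-trans {a} {b} {c} (p0 , q) (r , s) = ≲-trans {a} {b} {c} p0 r , ≲-trans {c} {b} {a} s q

 ≈-cong : ∀ {a a' b b' : ℕ -> ℚ} -> (∀ N -> a' N ≡ a N) -> (∀ N -> b N ≡ b' N) -> a ≈ b -> a' ≈ b'
 ≈-cong {a} {a'} {b} {b'} p0 q (r , s) = ≲-cong {a} {a'} {b} {b'} p0 q r , ≲-cong {b} {b'} {a} {a'} (sym ∘ q) (sym ∘ p0) s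

-- P(X ≤ y) and E[X ; X ≤ y]
φ μ : ℕ -> ℕ -> ℚ
φ y N = ι (Discrepancy.F N y) * inv (suc N)
μ y N = ι (Discrepancy.G N y) * inv (suc N)

0≤φ : ∀ y N -> 0ℚ ≤ φ y N
0≤φ y N = 0≤* (0≤ι (Discrepancy.F N y)) (0≤inv (suc N))

φ≤1 : ∀ y N -> φ y N ≤ 1ℚ
φ≤1 y N = ≤≡ᵣ (*-monoʳ (0≤inv (suc N)) (ι-mono (Discrepancy.F≤n! N y))) (ι-inv (suc N))

private
 shift-3 : ∀ {N} -> 3 N.≤ N -> suc (suc (N N.∸ 3) N.+ 2) N.≤ suc N
 shift-3 {N} 3≤N = N.s≤s (N.≤-reflexive (trans (cong suc (N.+-comm (N N.∸ 3) 2)) (m+[n∸m]≡n 3≤N)))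

 ι2* : ∀ y N -> ι (2 N.* Discrepancy.F N y) * inv (suc N) ≡ φ y N * ι 2
 ι2* y N = trans (cong (_* inv (suc N)) (ι-* 2 (Discrepancy.F N y))) (lem (ι 2) (ι (Discrepancy.F N y)) (inv (suc N)))
  where
  lem : ∀ t f i -> t * f * i ≡ f * i * t
  lem = solve-∀ ring

 μ≈2φ : ∀ y -> μ (suc y) ≈ (λ N -> φ y N * ι 2)
 μ≈2φ y =
  ≲-trans {μ (suc y)} {λ N -> φ y N * ι 2 + ι 34 * recip (N N.∸ 3)} {λ N -> φ y N * ι 2}
   (≤⇒≲ {μ (suc y)} {λ N -> φ y N * ι 2 + ι 34 * recip (N N.∸ 3)} (eventually-map (λ N 3≤N -> subst (λ z -> μ (suc y) N ≤ z + ι 34 * recip (N N.∸ 3)) (ι2* y N)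
    (divide-! (suc N) (N N.∸ 3) (Discrepancy.G-≤' N (suc (N N.∸ 3)) y (shift-3 3≤N)))) (eventually-≥ 3)))
   (small (λ N -> φ y N * ι 2)) ,
  ≲-trans {λ N -> φ y N * ι 2} {λ N -> μ (suc y) N + ι 34 * recip (N N.∸ 3)} {μ (suc y)}
   (≤⇒≲ {λ N -> φ y N * ι 2} {λ N -> μ (suc y) N + ι 34 * recip (N N.∸ 3)} (eventually-map (λ N 3≤N -> subst (_≤ μ (suc y) N + ι 34 * recip (N N.∸ 3)) (ι2* y N)
    (divide-! (suc N) (N N.∸ 3) (Discrepancy.G-≥' N (suc (N N.∸ 3)) y (shift-3 3≤N)))) (eventually-≥ 3)))
   (small (μ (suc y)))
  where
  small : ∀ a -> (λ N -> a N + ι 34 * recip (N N.∸ 3)) ≲ a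
  small a = ≲-cong {λ N -> a N + ι 34 * recip (N N.∸ 3)} {_} {λ N -> a N + 0ℚ} {a} (λ _ -> refl) (λ N -> +-identityʳ (a N))
   (≲-+ {a} {a} {λ N -> ι 34 * recip (N N.∸ 3)} {λ _ -> 0ℚ} (≲-refl {a}) (≲-recip 34 3))

 φ-step : ∀ y N -> φ (suc y) N ≡ (μ (suc y) N + φ y N * ι (suc y) + - μ y N) * recip y
 φ-step y N = begin
  φ (suc y) N ≡⟨ *-identityʳ _ ⟨
  φ (suc y) N * 1ℚ ≡⟨ cong (φ (suc y) N *_) (ι-recip y) ⟨
  φ (suc y) N * (ι (suc y) * recip y) ≡⟨ lem1 (ι (F (suc y))) i (ι (suc y)) (recip y) (μ y N) ⟩
  (μ y N + ι (suc y) * ι (F (suc y)) * i + - μ y N) * recip y ≡⟨ cong (λ z -> (z + - μ y N) * recip y) counts ⟩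
  (μ (suc y) N + φ y N * ι (suc y) + - μ y N) * recip y ∎
  where
  open ≡-Reasoning
  open Discrepancy N using (F; G; G-increment)
  i = inv (suc N)
  lem1 : ∀ f i s r g -> f * i * (s * r) ≡ (g + s * f * i + - g) * r
  lem1 = solve-∀ ring
  lem2 : ∀ g s f i -> g * i + s * f * i ≡ (g + s * f) * i
  lem2 = solve-∀ ring
  lem3 : ∀ g s f i -> (g + s * f) * i ≡ g * i + f * i * s
  lem3 = solve-∀ ring
  counts : μ y N + ι (suc y) * ι (F (suc y)) * i ≡ μ (suc y) N + φ y N * ι (suc y)
  counts = trans (lem2 (ι (G y)) (ι (suc y)) (ι (F (suc y))) i)
   (trans (cong (_* i) (trans (cong (λ z -> ι (G y) + z) (sym (ι-* (suc y) (F (suc y))))) (trans (sym (ι-+ (G y) _)) (trans (cong ι (sym (G-increment y)))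
    (trans (ι-+ (G (suc y)) _) (cong (λ z -> ι (G (suc y)) + z) (ι-* (suc y) (F y)))))))) (lem3 (ι (G (suc y))) (ι (suc y)) (ι (F y)) i))

 E : ℕ -> ℚ
 E = exp (ι 2)

 -- The partial sums of exp 2 satisfy exactly the recursion that `φ-step` becomes when each
 -- `μ (suc y)` is replaced by twice `φ y`.
 E-step : ∀ y -> E (suc (suc y)) ≡ (E (suc y) * ι 2 + E (suc y) * ι (suc (suc y)) + - (E y * ι 2)) * recip (suc y)
 E-step y = cancel-ι (suc y) (begin
  s * E (suc (suc y)) ≡⟨ cong (s *_) (partial-suc (expTerm (ι 2)) (suc y)) ⟩
  s * (E (suc y) + expTerm (ι 2) (suc (suc y))) ≡⟨ *-distribˡ-+ s _ _ ⟩
  s * E (suc y) + s * expTerm (ι 2) (suc (suc y)) ≡⟨ cong (λ z -> s * E (suc y) + z) (expTerm-suc (ι 2) (suc y)) ⟩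
  s * E (suc y) + ι 2 * t ≡⟨ lem1 s (E y) t (ι 2) (E (suc y)) (partial-suc (expTerm (ι 2)) y) ⟩
  1ℚ * (E (suc y) * ι 2 + E (suc y) * s + - (E y * ι 2)) ≡⟨ cong (_* (E (suc y) * ι 2 + E (suc y) * s + - (E y * ι 2))) (ι-recip (suc y)) ⟨
  s * r * (E (suc y) * ι 2 + E (suc y) * s + - (E y * ι 2)) ≡⟨ lem2 s r (E (suc y) * ι 2 + E (suc y) * s + - (E y * ι 2)) ⟩
  s * ((E (suc y) * ι 2 + E (suc y) * s + - (E y * ι 2)) * r) ∎)
  where
  open ≡-Reasoning
  s = ι (suc (suc y))
  r = recip (suc y)
  t = expTerm (ι 2) (suc y)
  lem1 : ∀ s a t c b -> b ≡ a + t -> s * b + c * t ≡ 1ℚ * (b * c + b * s + - (a * c))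
  lem1 s a t c b refl = lem s a t c
   where
   lem : ∀ s a t c -> s * (a + t) + c * t ≡ 1ℚ * ((a + t) * c + (a + t) * s + - (a * c))
   lem = solve-∀ ring
  lem2 : ∀ s r x -> s * r * x ≡ s * (x * r)
  lem2 = solve-∀ ring

 p0 : ℕ -> ℚ
 p0 = φ 0

 recip-0 : recip 0 ≡ 1ℚ
 recip-0 = trans (sym (*-identityˡ (recip 0))) (trans (cong (_* recip 0) (sym ι-1)) (ι-recip 0))

 E-0 : E 0 ≡ 1ℚ
 E-0 = trans (*-identityˡ (inv 0)) inv-0

 E-1 : E 1 ≡ 1ℚ + ι 2
 E-1 = cong₂ _+_ E-0 (trans (cong (ι 2 * 1ℚ *_) (trans (inv-suc 0) (cong₂ _*_ recip-0 inv-0))) (lem (ι 2)))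
  where
  lem : ∀ a -> a * 1ℚ * (1ℚ * 1ℚ) ≡ a
  lem = solve-∀ ring

 μ-0 : ∀ N -> μ 0 N ≡ 0ℚ
 μ-0 N = trans (cong (λ g -> ι g * inv (suc N)) (Discrepancy.G-zero N)) (trans (cong (_* inv (suc N)) ι-0) (*-zeroˡ (inv (suc N))))

 φ≈ : ∀ y -> (φ y ≈ (λ N -> p0 N * E y)) × (φ (suc y) ≈ (λ N -> p0 N * E (suc y)))
 φ≈ zero = ≈-cong {p0} {p0} {p0} {λ N -> p0 N * E 0} (λ _ -> refl) (λ N -> sym (trans (cong (p0 N *_) E-0) (*-identityʳ (p0 N)))) (≲-refl {p0} , ≲-refl {p0}) ,
  ≈-cong {λ N -> μ 1 N + p0 N} {φ 1} {λ N -> p0 N * ι 2 + p0 N} {λ N -> p0 N * E 1}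
   (λ N -> trans (φ-step 0 N) (trans (cong₂ (λ g r -> (μ 1 N + p0 N * ι 1 + - g) * r) (μ-0 N) recip-0) (trans (cong (λ z -> (μ 1 N + p0 N * z + - 0ℚ) * 1ℚ) ι-1) (lem1 (μ 1 N) (p0 N)))))
   (λ N -> trans (lem2 (p0 N) (ι 2)) (cong (p0 N *_) (sym E-1)))
   (≈-+ {μ 1} {λ N -> p0 N * ι 2} {p0} {p0} (μ≈2φ 0) (≲-refl {p0} , ≲-refl {p0}))
  where
  lem1 : ∀ g p0 -> (g + p0 * 1ℚ + - 0ℚ) * 1ℚ ≡ g + p0
  lem1 = solve-∀ ring
  lem2 : ∀ p0 t -> p0 * t + p0 ≡ p0 * (1ℚ + t)
  lem2 = solve-∀ ring
 φ≈ (suc y) = proj₂ (φ≈ y) ,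
  ≈-cong {λ N -> (μ (2 N.+ y) N + φ (suc y) N * s + - μ (suc y) N) * r} {φ (2 N.+ y)} {λ N -> (p0 N * E (suc y) * ι 2 + p0 N * E (suc y) * s + - (p0 N * E y * ι 2)) * r} {λ N -> p0 N * E (2 N.+ y)}
   (φ-step (suc y)) (λ N -> trans (lem (p0 N) (E (suc y)) (ι 2) s (E y) r) (cong (p0 N *_) (sym (E-step y))))
   (≈-*ʳ {λ N -> μ (2 N.+ y) N + φ (suc y) N * s + - μ (suc y) N} {λ N -> p0 N * E (suc y) * ι 2 + p0 N * E (suc y) * s + - (p0 N * E y * ι 2)} r (0≤recip (suc y))
    (≈-+ {λ N -> μ (2 N.+ y) N + φ (suc y) N * s} {λ N -> p0 N * E (suc y) * ι 2 + p0 N * E (suc y) * s} {λ N -> - μ (suc y) N} {λ N -> - (p0 N * E y * ι 2)}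
     (≈-+ {μ (2 N.+ y)} {λ N -> p0 N * E (suc y) * ι 2} {λ N -> φ (suc y) N * s} {λ N -> p0 N * E (suc y) * s}
      (≈-trans {μ (2 N.+ y)} {λ N -> φ (suc y) N * ι 2} {λ N -> p0 N * E (suc y) * ι 2} (μ≈2φ (suc y)) (≈-*ʳ {φ (suc y)} {λ N -> p0 N * E (suc y)} (ι 2) (0≤ι 2) (proj₂ (φ≈ y))))
      (≈-*ʳ {φ (suc y)} {λ N -> p0 N * E (suc y)} s (0≤ι (2 N.+ y)) (proj₂ (φ≈ y))))
     (≈-neg {μ (suc y)} {λ N -> p0 N * E y * ι 2} (≈-trans {μ (suc y)} {λ N -> φ y N * ι 2} {λ N -> p0 N * E y * ι 2} (μ≈2φ y) (≈-*ʳ {φ y} {λ N -> p0 N * E y} (ι 2) (0≤ι 2) (proj₁ (φ≈ y)))))))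
  where
  s = ι (suc (suc y))
  r = recip (suc y)
  lem : ∀ p0 e t s e' r -> (p0 * e * t + p0 * e * s + - (p0 * e' * t)) * r ≡ p0 * ((e * t + e * s + - (e' * t)) * r)
  lem = solve-∀ ring

-- Because P(X ≤ K) is at most 1. Together with `φ₀*exp-≥`, where Markov's inequality bounds the
-- tail by 2 / (K + 1), this pins `φ 0` to e⁻² without naming that number.
φ₀*exp-≤ : ∀ K -> (λ N -> φ 0 N * exp (ι 2) K) ≲ (λ _ -> 1ℚ)
φ₀*exp-≤ K = ≲-trans {λ N -> φ 0 N * exp (ι 2) K} {φ K} {λ _ -> 1ℚ} (proj₂ (proj₁ (φ≈ K))) (≤⇒≲ {φ K} {λ _ -> 1ℚ} (0 , λ N _ -> φ≤1 K N))

φ₀*exp-≥ : ∀ K -> (λ _ -> 1ℚ) ≲ (λ N -> φ 0 N * exp (ι 2) K + ι 2 * recip K)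
φ₀*exp-≥ K = ≲-trans {λ _ -> 1ℚ} {λ N -> φ K N + ι 2 * recip K} {λ N -> φ 0 N * exp (ι 2) K + ι 2 * recip K}
 (≤⇒≲ {λ _ -> 1ℚ} {λ N -> φ K N + ι 2 * recip K} (eventually-map tail (eventually-≥ 1)))
 (≲-+ {φ K} {λ N -> φ 0 N * exp (ι 2) K} {λ _ -> ι 2 * recip K} {λ _ -> ι 2 * recip K} (proj₁ (proj₁ (φ≈ K))) (≲-refl {λ _ -> ι 2 * recip K}))
 where
 tail : ∀ N -> 1 N.≤ N -> 1ℚ ≤ φ K N + ι 2 * recip K
 tail N 1≤N = subst (_≤ φ K N + ι 2 * recip K) (ι-inv (suc N))
  (divide-! (suc N) K {suc N !} {Discrepancy.F N K} {2} (Discrepancy.markov' N K 1≤N))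

-- Permutations matching a word

∑⟦⟧-witness : {I : Set} {P : I -> Set} (P? : ∀ i -> Dec (P i)) (xs : List I) -> 1 N.≤ ∑ xs (λ x -> ⟦ P? x ⟧) -> ∃ λ x -> x ∈ xs × P x
∑⟦⟧-witness P? (x ∷ xs) pos = case P? x of λ where
 (yes px) -> x , here refl , px
 (no ¬px) -> let (y , y∈ , py) = ∑⟦⟧-witness P? xs (subst (λ z -> 1 N.≤ z N.+ ∑ xs (λ x -> ⟦ P? x ⟧)) (⟦⟧-no (P? x) ¬px) pos) in y , there y∈ , py

commonCells-< : ∀ w {i j i0 j0 o} -> (i0 , j0 , o) ∈ commonCells w i j -> i0 N.< endP w i × j0 N.< endQ w j
commonCells-< (P ∷ w) c∈ = commonCells-< w c∈
commonCells-< (Q ∷ w) c∈ = commonCells-< w c∈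
commonCells-< (blk b ∷ w) {i} {j} c∈ with ∈-++⁻ (blockCells b i j) c∈
... | inj₁ c∈b = let (i< , j<) = blockCells-bounds b c∈b in N.<-≤-trans i< (≤-endP w _) , N.<-≤-trans j< (≤-endQ w _)
... | inj₂ c∈w = commonCells-< w c∈w

commonCells-length : ∀ w i j -> length (commonCells w i j) N.≤ weight w
commonCells-length [] i j = z≤n
commonCells-length (P ∷ w) i j = commonCells-length w (suc i) j
commonCells-length (Q ∷ w) i j = commonCells-length w i (suc j)
commonCells-length (blk b ∷ w) i j = subst (N._≤ suc (len b) N.+ weight w) (sym (List.length-++ (blockCells b i j)))
 (N.+-mono-≤ (≡≤ (block-length b) (n≤1+n (len b))) (commonCells-length w _ _))
 where
 run-length : ∀ m i j -> length (cellRun m i j) ≡ m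
 run-length zero i j = refl
 run-length (suc m) i j = cong suc (run-length m (suc i) (suc j))
 block-length : ∀ b -> length (blockCells b i j) ≡ len b
 block-length zero = refl
 block-length (suc l) = run-length (suc l) i j

Sat⇒unique : ∀ {ρ τ} -> (∀ {a b} -> ρ a ≡ ρ b -> a ≡ b) -> Sat ρ τ -> Unique τ -> Unique (dom τ) × Unique (ran τ)
Sat⇒unique {ρ} inj [] [] = [] , []
Sat⇒unique {ρ} {(p , v) ∷ τ} inj (refl ∷ s) (c≢ ∷ u) = let (ud , ur) = Sat⇒unique inj s u in
 (All.map⁺ (All.tabulate (λ {c} c∈ p≡ -> All.lookup c≢ c∈ (trans (cong (λ p -> p , ρ p) p≡) (cong (proj₁ c ,_) (All.lookup s c∈))))) ∷ ud) ,
 (All.map⁺ (All.tabulate (λ {c} c∈ v≡ -> let p≡ = inj (trans v≡ (sym (All.lookup s c∈))) in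
  All.lookup c≢ c∈ (trans (cong (λ p -> p , ρ p) p≡) (cong (proj₁ c ,_) (All.lookup s c∈))))) ∷ ur)

module WordCount (N : ℕ) where

 private n = suc N

 open Counting N
 open SteinChen N using (F; #A-[]≡; fall2-#S)

 matching : Word -> ℕ
 matching w = #A (commonCells w 0 0) 0 (assignment w 0 0)

 module _ (w : Word) (endP≡ : endP w 0 ≡ N) (endQ≡ : endQ w 0 ≡ N) where

  private
   D = commonCells w 0 0
   τ = assignment w 0 0
   t = length τ

  -- Blocks may demand contradictory values, for instance when only letters P stand between them. If
  -- some permutation satisfies the assignment, its injectivity makes positions and values distinct,
  -- because `NoAdj` keeps the entries distinct as pairs.
  valid-or-empty : NoAdj w -> matching w ≡ 0 ⊎ Valid n τ
  valid-or-empty na = case #S τ N.≟ 0 of λ where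
   (yes none) -> inj₁ (N.n≤0⇒n≡0 (subst (matching w N.≤_) none (#A-≤-#S D 0 τ)))
   (no some) ->
    let (ω , _ , s) = ∑⟦⟧-witness (λ ω -> sat? (at ω) τ) perms (N.n≢0⇒n>0 some)
        (ud , ur) = Sat⇒unique (at-injective ω) s (assignment-unique w 0 0 na) in
    inj₂ record
     { dom-< = All.map⁺ (All.tabulate (λ c∈ -> s≤s (subst (_ N.≤_) endQ≡ (proj₁ (assignment-≤ w c∈)))))
     ; ran-< = All.map⁺ (All.tabulate (λ c∈ -> s≤s (subst (_ N.≤_) endP≡ (proj₂ (assignment-≤ w c∈)))))
     ; dom-unique = ud ; ran-unique = ur }

  valid-length : Valid n τ -> t N.≤ n
  valid-length valid = subst (t N.≤_) (freeCount-+ n τ (Valid.dom-< valid) (Valid.dom-unique valid)) (m≤n+m t _)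

  -- Ignores all further coincidences; this is the estimate for long assignments, where switching
  -- errors would be too large.
  valid-≤ : Valid n τ -> matching w N.≤ (n ∸ t) !
  valid-≤ valid = ≤≡ (#A-≤-#S D 0 τ) (N.*-cancelˡ-≡ _ _ (fall n t) {{nz}}
   (trans (fall-#S τ valid) (trans #S-[] (sym (fall-! n t (valid-length valid))))))
   where
   nz : N.NonZero (fall n t)
   nz = N.m*n≢0⇒m≢0 (fall n t) {(n ∸ t) !} {{subst N.NonZero (sym (fall-! n t (valid-length valid))) (N._!≢0 n)}}

  private
   D⊆cells : ∀ {c} -> c ∈ D -> c ∈ cells N
   D⊆cells {i , j , o} c∈ = let (i< , j<) = commonCells-< w c∈ in ∈-cells⁺ o (subst (i N.<_) endP≡ i<) (subst (j N.<_) endQ≡ j<)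

   few-D : #A D 0 [] N.≤ F 0 N.+ ∑ D (λ c -> #S (coinAssignment c))
   few-D = begin
    #A D 0 [] ≡⟨ #A-[]≡ D 0 ⟩
    ∑ perms (λ ω -> ⟦ few? D 0 (at ω) ⟧) ≤⟨ ∑-mono perms pointwise ⟩
    ∑ perms (λ ω -> ⟦ few? [] 0 (at ω) ⟧ N.+ ∑ D (λ c -> ⟦ sat? (at ω) (coinAssignment c) ⟧))
                        ≡⟨ ∑-⊕ perms _ _ ⟩
    ∑ perms (λ ω -> ⟦ few? [] 0 (at ω) ⟧) N.+ ∑ perms (λ ω -> ∑ D (λ c -> ⟦ sat? (at ω) (coinAssignment c) ⟧))
     ≡⟨ cong₂ N._+_ (sym (#A-[]≡ [] 0)) (∑-swap perms D (λ ω c -> ⟦ sat? (at ω) (coinAssignment c) ⟧)) ⟩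
    F 0 N.+ ∑ D (λ c -> #S (coinAssignment c)) ∎
    where
    open N.≤-Reasoning
    pointwise : ∀ ω -> ⟦ few? D 0 (at ω) ⟧ N.≤ ⟦ few? [] 0 (at ω) ⟧ N.+ ∑ D (λ c -> ⟦ sat? (at ω) (coinAssignment c) ⟧)
    pointwise ω = ⟦⟧≤ (few? D 0 (at ω)) λ few -> case extras N [] (at ω) N.≟ 0 of λ where
     (yes none) -> ≡≤ (sym (⟦⟧-yes (few? [] 0 (at ω)) (N.≤-reflexive none))) (m≤m+n _ _)
     (no some)  -> let (c , c∈ , co , _) = ∑⟦⟧-witness (extra? [] (at ω)) (cells N) (N.n≢0⇒n>0 some) in case c ∈ᶜ? D of λ where
      (yes c∈D) -> ≡≤ (trans (sym (⟦⟧-yes (coin? (at ω) c) co)) (coin⇔sat (at ω) c))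
       (N.≤-trans (∑-member (λ c -> ⟦ sat? (at ω) (coinAssignment c) ⟧) c∈D) (m≤n+m _ ⟦ few? [] 0 (at ω) ⟧))
      (no c∉D) -> absurd (N.≤-trans (∑-⟦⟧-≥ (extra? D (at ω)) c∈ (co , c∉D)) few) λ ()

  -- The error 9 t is 8 t from the switchings plus one for each of the at most t cells of `D`:
  -- emptiness outside `D` differs from emptiness only if such a cell occurs, and that has
  -- probability 1 / `fall n 2`, at most 1 / q.
  matching-≤ : ∀ q -> Valid n τ -> suc (q N.+ t) N.≤ n -> q N.* (fall n t N.* matching w) N.≤ q N.* F 0 N.+ 9 N.* t N.* n !
  matching-≤ q valid le = begin
   q N.* (fall n t N.* matching w) ≤⟨ assign-≤ D 0 q τ valid le ⟩
   q N.* #A D 0 [] N.+ 8 N.* t N.* #S [] ≤⟨ N.+-mono-≤ (*-monoʳ-≤ q few-D) (N.≤-reflexive (cong (8 N.* t N.*_) #S-[])) ⟩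
   q N.* (F 0 N.+ ∑ D (λ c -> #S (coinAssignment c))) N.+ 8 N.* t N.* n ! ≡⟨ cong (N._+ 8 N.* t N.* n !) (trans (N.*-distribˡ-+ q _ _)
    (cong (q N.* F 0 N.+_) (sym (∑-*ˡ D q (λ c -> #S (coinAssignment c)))))) ⟩
   q N.* F 0 N.+ ∑ D (λ c -> q N.* #S (coinAssignment c)) N.+ 8 N.* t N.* n !
    ≤⟨ N.+-monoˡ-≤ _ (N.+-monoʳ-≤ (q N.* F 0) (∑-mono-∈ D (λ {c} c∈ -> ≤≡ (*-monoˡ-≤ (#S (coinAssignment c)) q≤fall) (fall2-#S (D⊆cells c∈))))) ⟩
   q N.* F 0 N.+ ∑ D (λ _ -> n !) N.+ 8 N.* t N.* n ! ≤⟨ N.+-monoˡ-≤ _ (N.+-monoʳ-≤ (q N.* F 0)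
    (≡≤ (∑-const D (n !)) (*-monoˡ-≤ (n !) (subst (length D N.≤_) (sym (assignment-length w 0 0)) (commonCells-length w 0 0))))) ⟩
   q N.* F 0 N.+ t N.* n ! N.+ 8 N.* t N.* n ! ≡⟨ lem (q N.* F 0) t (n !) ⟩
   q N.* F 0 N.+ 9 N.* t N.* n ! ∎
   where
   open N.≤-Reasoning
   lem : ∀ a t f -> a N.+ t N.* f N.+ 8 N.* t N.* f ≡ a N.+ 9 N.* t N.* f
   lem = ℕ-ring
   q≤N : q N.≤ N
   q≤N = N.≤-trans (m≤m+n q t) (N.≤-pred le)
   q≤fall : q N.≤ fall n 2
   q≤fall = case q N.≟ 0 of λ where
    (yes refl) -> z≤n
    (no q≢0) -> N.≤-trans q≤N (≤≡ (m≤n*m N (suc N)) (cong (N._* N) (sym (N.*-identityˡ (suc N)))))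

  matching-≥ : ∀ q -> Spread w 0 0 -> suc (q N.+ t) N.≤ n -> q N.* F 0 N.≤ q N.* (fall n t N.* matching w) N.+ 8 N.* t N.* n !
  matching-≥ q spread le = begin
   q N.* F 0 ≤⟨ *-monoʳ-≤ q (SteinChen.F-≤-#A N D 0) ⟩
   q N.* #A D 0 [] ≤⟨ assign-≥ D 0 q τ (Spread-valid w endP≡ endQ≡ spread) (Spread-closed w 0 0 spread) le ⟩
   q N.* (fall n t N.* matching w) N.+ 8 N.* t N.* #S [] ≡⟨ cong (λ s -> q N.* (fall n t N.* matching w) N.+ 8 N.* t N.* s) #S-[] ⟩
   q N.* (fall n t N.* matching w) N.+ 8 N.* t N.* n ! ∎
   where open N.≤-Reasoning

  private
   inv-fall : t N.≤ n -> ι (fall n t) * inv n ≡ inv (n ∸ t)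
   inv-fall t≤n = begin
    ι (fall n t) * inv n ≡⟨ *-identityʳ _ ⟨
    ι (fall n t) * inv n * 1ℚ ≡⟨ cong (ι (fall n t) * inv n *_) (ι-inv (n ∸ t)) ⟨
    ι (fall n t) * inv n * (ι ((n ∸ t) !) * inv (n ∸ t)) ≡⟨ lem (ι (fall n t)) (inv n) (ι ((n ∸ t) !)) (inv (n ∸ t)) ⟩
    ι (fall n t) * ι ((n ∸ t) !) * inv n * inv (n ∸ t) ≡⟨ cong (λ z -> z * inv n * inv (n ∸ t)) (trans (sym (ι-* (fall n t) ((n ∸ t) !))) (cong ι (fall-! n t t≤n))) ⟩
    ι (n !) * inv n * inv (n ∸ t) ≡⟨ trans (cong (_* inv (n ∸ t)) (ι-inv n)) (*-identityˡ _) ⟩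
    inv (n ∸ t) ∎
    where
    open ≡-Reasoning
    lem : ∀ f i r j -> f * i * (r * j) ≡ f * r * i * j
    lem = solve-∀ ring

   ι-fall : ∀ x -> t N.≤ n -> ι (fall n t N.* x) * inv n ≡ ι x * inv (n ∸ t)
   ι-fall x t≤n = trans (cong (_* inv n) (ι-* (fall n t) x)) (trans (lem (ι (fall n t)) (ι x) (inv n)) (cong (ι x *_) (inv-fall t≤n)))
    where
    lem : ∀ f x i -> f * x * i ≡ x * (f * i)
    lem = solve-∀ ring

  matching-≤-φ : ∀ q -> Valid n τ -> suc (suc q N.+ t) N.≤ n -> ι (matching w) * inv (n ∸ t) ≤ φ 0 N + ι (9 N.* t) * recip q
  matching-≤-φ q valid le = subst (_≤ φ 0 N + ι (9 N.* t) * recip q) (ι-fall (matching w) (valid-length valid))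
   (divide-! n q (matching-≤ (suc q) valid le))

  matching-≥-φ : ∀ q -> Spread w 0 0 -> suc (suc q N.+ t) N.≤ n -> φ 0 N ≤ ι (matching w) * inv (n ∸ t) + ι (8 N.* t) * recip q
  matching-≥-φ q spread le = subst (λ z -> φ 0 N ≤ z + ι (8 N.* t) * recip q) (ι-fall (matching w) (N.≤-trans (m≤n+m t (suc (suc q))) le))
   (divide-! n q (matching-≥ (suc q) spread le))

-- The second moment as a sum over words

∑-filter : {A : Set} {P : A -> Set} (P? : Decidable P) (xs : List A) -> length (filter P? xs) ≡ ∑ xs (λ x -> ⟦ P? x ⟧)
∑-filter P? [] = refl
∑-filter P? (x ∷ xs) with P? x
... | yes px = cong₂ N._+_ (sym (⟦⟧-yes (yes px) px)) (∑-filter P? xs)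
... | no ¬px = cong₂ N._+_ (sym (⟦⟧-no (no ¬px) ¬px)) (∑-filter P? xs)

ι-𝔼 : {A : Set} (Ω : List A) (X : A -> ℕ) -> 1 N.≤ length Ω -> ι (length Ω) * 𝔼 Ω X ≡ ι (∑ Ω X)
ι-𝔼 Ω@(_ ∷ _) X _ = trans (ι-/ (sum (map X Ω)) (length Ω)) (cong ι (sum≡∑ Ω X))

ι-𝔼-* : {A : Set} (Ω : List A) (X : A -> ℕ) (r : ℚ) -> 1 N.≤ length Ω -> ι (length Ω) * (𝔼 Ω X * r) ≡ ι (∑ Ω X) * r
ι-𝔼-* Ω X r 1≤Ω = trans (sym (*-assoc (ι (length Ω)) (𝔼 Ω X) r)) (cong (_* r) (ι-𝔼 Ω X 1≤Ω))

ι-words-count : ∀ e f σ -> ι (length (words e f σ)) ≡ ι ((e N.+ f N.+ length σ) !) * inv e * inv f * inv (length σ)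
ι-words-count e f σ = begin
 L ≡⟨ one L ⟩
 L * 1ℚ * 1ℚ * 1ℚ ≡⟨ cong₂ (λ a b -> L * a * b * 1ℚ) (sym (ι-inv e)) (sym (ι-inv f)) ⟩
 L * (ι (e !) * inv e) * (ι (f !) * inv f) * 1ℚ ≡⟨ cong (L * (ι (e !) * inv e) * (ι (f !) * inv f) *_) (sym (ι-inv c)) ⟩
 L * (ι (e !) * inv e) * (ι (f !) * inv f) * (ι (c !) * inv c) ≡⟨ shuffle L (ι (e !)) (inv e) (ι (f !)) (inv f) (ι (c !)) (inv c) ⟩
 L * (ι (e !) * ι (f !) * ι (c !)) * inv e * inv f * inv c ≡⟨ cong (λ z -> z * inv e * inv f * inv c) (trans (cong (L *_) (trans (cong (_* ι (c !)) (sym (ι-* (e !) (f !)))) (sym (ι-* (e ! N.* f !) (c !)))))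
                      (trans (sym (ι-* _ _)) (cong ι (words-count e f σ)))) ⟩
 ι ((e N.+ f N.+ c) !) * inv e * inv f * inv c ∎
 where
 open ≡-Reasoning
 c = length σ
 L = ι (length (words e f σ))
 one : ∀ l -> l ≡ l * 1ℚ * 1ℚ * 1ℚ
 one = solve-∀ ring
 shuffle : ∀ l a a' b b' c c' -> l * (a * a') * (b * b') * (c * c') ≡ l * (a * b * c) * a' * b' * c'
 shuffle = solve-∀ ring

-- The contribution of a sequence of c blocks with e + f further letters, merging to s edges and
-- leaving r values of the permutation free.
coef : ℕ -> ℕ -> ℕ -> ℕ -> ℕ -> ℕ -> ℚ
coef e f c s r N = ι ((e N.+ f N.+ c) !) * inv e * inv f * inv c * ι (r !) * inv s * ι (N !) * recip N

0≤coef : ∀ e f c s r N -> 0ℚ ≤ coef e f c s r N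
0≤coef e f c s r N = 0≤* (0≤* (0≤* (0≤* (0≤* (0≤* (0≤* (0≤ι _) (0≤inv e)) (0≤inv f)) (0≤inv c)) (0≤ι (r !))) (0≤inv s)) (0≤ι (N !))) (0≤recip N)

∑-pairs-const : {I : Set} (xs : List I) (a : I -> ℕ) (c : ℕ) {l : ℕ} -> length xs ≡ l -> ∑ xs (λ _ -> ∑ xs (λ x -> a x N.* c)) ≡ l N.* (∑ xs a N.* c)
∑-pairs-const xs a c refl = trans (∑-cong xs (λ _ -> ∑-*ʳ xs c a)) (∑-const xs (∑ xs a N.* c))

∑-pairs-*ʳ : {I : Set} (xs : List I) (a : I -> ℕ) (f : I -> I -> ℕ) (c : ℕ) ->
      ∑ xs (λ v -> ∑ xs (λ x -> a x N.* f v x)) N.* c ≡ ∑ xs (λ v -> ∑ xs (λ x -> a x N.* (f v x N.* c)))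
∑-pairs-*ʳ xs a f c = trans (sym (∑-*ʳ xs c (λ v -> ∑ xs (λ x -> a x N.* f v x)))) (∑-cong xs (λ v -> trans (sym (∑-*ʳ xs c (λ x -> a x N.* f v x)))
 (∑-cong xs (λ x -> N.*-assoc (a x) (f v x) c))))

-- Contribution to E[H²] / n² of a word with `m` matching permutations and `s` merged edges: (N +
-- 1)! first paths, probability 1 / s!, and (N + 1)! / (N + 1)² = N! / (N + 1).
shareOf : ℕ -> ℕ -> ℕ -> ℚ
shareOf N m s = ι m * inv s * (ι (N !) * recip N)

module _ (N g m o s : ℕ) where

 private
  r = recip N * recip N

  left : ι (g N.* s !) * inv s * r ≡ ι g * r
  left = cong (_* r) (trans (cong (_* inv s) (ι-* g (s !))) (trans (*-assoc (ι g) (ι (s !)) (inv s)) (trans (cong (ι g *_) (ι-inv s)) (*-identityʳ (ι g)))))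

  !-recip : ι (suc N !) * r ≡ ι (N !) * recip N
  !-recip = trans (cong (_* r) (ι-* (suc N) (N !))) (trans (lem (ι (suc N)) (ι (N !)) (recip N)) (trans (cong (_* (ι (N !) * recip N)) (ι-recip N)) (*-identityˡ _)))
   where
   lem : ∀ a b r -> a * b * (r * r) ≡ a * r * (b * r)
   lem = solve-∀ ring

  right : ι (suc N ! N.* (m N.* o)) * inv s * r ≡ ι o * shareOf N m s
  right = trans (cong (λ z -> z * inv s * r) (trans (ι-* (suc N !) (m N.* o)) (cong (ι (suc N !) *_) (ι-* m o))))
   (trans (lem (ι (suc N !)) (ι m) (ι o) (inv s) r) (cong (λ z -> ι o * (ι m * inv s * z)) !-recip))
   where
   lem : ∀ a m o i r -> a * (m * o) * i * r ≡ o * (m * i * (a * r))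
   lem = solve-∀ ring

  0≤scale : 0ℚ ≤ inv s * r
  0≤scale = 0≤* (0≤inv s) (0≤* (0≤recip N) (0≤recip N))

  scale : ∀ {a b} -> a N.≤ b -> ι a * inv s * r ≤ ι b * inv s * r
  scale {a} {b} a≤b = subst₂ _≤_ (sym (*-assoc (ι a) (inv s) r)) (sym (*-assoc (ι b) (inv s) r)) (*-monoʳ 0≤scale (ι-mono a≤b))

 shareOf-≥ : g N.* s ! N.≤ suc N ! N.* (m N.* o) -> ι g * r ≤ ι o * shareOf N m s
 shareOf-≥ le = subst₂ _≤_ left right (scale le)

 shareOf-≤ : suc N ! N.* (m N.* o) N.≤ g N.* s ! -> ι o * shareOf N m s ≤ ι g * r
 shareOf-≤ le = subst₂ _≤_ right left (scale le)

module Scaling (r o : ℚ) where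

 pull : {I : Set} (xs : List I) {f : I -> ℕ} {g : I -> ℚ} -> (∀ {x} -> x ∈ xs -> ι (f x) * r ≤ o * g x) -> ι (∑ xs f) * r ≤ o * ∑ᵣ xs g
 pull xs {f} {g} h = subst₂ _≤_ (trans (∑ᵣ-*ʳ xs r (ι ∘ f)) (cong (_* r) (sym (∑ᵣ-ι xs f)))) (∑ᵣ-*ˡ xs o g) (∑ᵣ-mono-∈ xs h)

 push : {I : Set} (xs : List I) {f : I -> ℕ} {g : I -> ℚ} -> (∀ {x} -> x ∈ xs -> o * g x ≤ ι (f x) * r) -> o * ∑ᵣ xs g ≤ ι (∑ xs f) * r
 push xs {f} {g} h = subst₂ _≤_ (∑ᵣ-*ˡ xs o g) (trans (∑ᵣ-*ʳ xs r (ι ∘ f)) (cong (_* r) (sym (∑ᵣ-ι xs f)))) (∑ᵣ-mono-∈ xs h)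

 indicator-≤ : ∀ {P : Set} (p? : Dec P) {a x} -> 0ℚ ≤ o -> 0ℚ ≤ x -> (P -> ι a * r ≤ o * x) -> ι (⟦ p? ⟧ N.* a) * r ≤ o * x
 indicator-≤ p? {a} {x} 0≤o 0≤x h = case p? of λ where
  (yes p) -> subst (λ z -> ι z * r ≤ o * x) (sym (trans (cong (N._* a) (⟦⟧-yes p? p)) (N.*-identityˡ a))) (h p)
  (no ¬p) -> ≡≤ᵣ (trans (cong (λ z -> ι (z N.* a) * r) (⟦⟧-no p? ¬p)) (trans (cong (_* r) ι-0) (*-zeroˡ r))) (0≤* 0≤o 0≤x)

count-shares : ∀ N e f σ (s r : ℕ) (b : ℚ) -> ι (length (words e f σ)) * (ι (r !) * b * inv s * (ι (N !) * recip N)) ≡ coef e f (length σ) s r N * b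
count-shares N e f σ s r b = trans (cong (_* (ι (r !) * b * inv s * (ι (N !) * recip N))) (ι-words-count e f σ))
 (lem (ι ((e N.+ f N.+ length σ) !)) (inv e) (inv f) (inv (length σ)) (ι (r !)) b (inv s) (ι (N !)) (recip N))
 where
 lem : ∀ a e f c r b s n i -> a * e * f * c * (r * b * s * (n * i)) ≡ a * e * f * c * r * s * n * i * b
 lem = solve-∀ ring

unscale : ∀ x r -> x ≡ ι (r !) * (x * inv r)
unscale x r = sym (trans (lem (ι (r !)) x (inv r)) (trans (cong (_* x) (ι-inv r)) (*-identityˡ x)))
 where
 lem : ∀ a x i -> a * (x * i) ≡ a * i * x
 lem = solve-∀ ring

enumeration-nonempty : {A : Set} {_≈_ : A -> A -> Set} (_≈?_ : ∀ a b -> Dec (a ≈ b)) (xs : List A) -> Enumerates _≈?_ xs -> A -> 1 N.≤ length xs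
enumeration-nonempty _≈?_ [] enum a = absurd (enum a) λ ()
enumeration-nonempty _≈?_ (_ ∷ _) enum a = s≤s z≤n

module SecondMoment (N' : ℕ) where

 private
  N n : ℕ
  N = suc N'
  n = suc N

 open PathEdges N'
 open Counting N using (at; perms; few?; length-perms; #S-[])
 open WordCount N

 private
  Ω = edgeOrderings n

  1≤Ω : 1 N.≤ orderings
  1≤Ω = enumeration-nonempty (⤖-≗? searchEdge searchFin) (edgeOrderings n) (edgeOrderings-enumerates n) (someEdgeOrdering n)

  inc-resp : ∀ f {v v'} -> Bijection.to v ≗ Bijection.to v' -> ⟦ inc? f v ⟧ ≡ ⟦ inc? f v' ⟧
  inc-resp f {v} {v'} eq = ⟦⟧-cong (inc? f v) (inc? f v') (move eq) (move (sym ∘ eq))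
   where
   move : ∀ {v v'} -> Bijection.to v ≗ Bijection.to v' -> Inc f v -> Inc f v'
   move {v} {v'} eq inc = Inc⁺ f v' λ {i} {i'} i< <N -> subst₂ (λ e e' -> label f e N.< label f e') (edges eq i) (edges eq i') (Inc⁻ f v inc {i} {i'} i< <N)
    where
    edges : Bijection.to v ≗ Bijection.to v' -> ∀ i -> pathEdge v i ≡ pathEdge v' i
    edges eq i = cong₂ edge⁺ (eq (fin i)) (eq (fin (suc i)))

  H≡ : ∀ f -> H f ≡ ∑ perms (λ v -> ⟦ inc? f v ⟧)
  H≡ f = trans (∑-filter (increasing? f) perms) (∑-cong perms (λ v -> sym (inc?≡ f v)))

  H² : ∀ f -> H f N.^ 2 ≡ ∑ perms (λ v -> ∑ perms (λ R -> ⟦ inc? f v ⟧ N.* ⟦ inc? f (v ∘⤖ R) ⟧))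
  H² f = begin
   H f N.* (H f N.* 1) ≡⟨ cong₂ N._*_ (H≡ f) (trans (N.*-identityʳ (H f)) (H≡ f)) ⟩
   ∑ perms (λ v -> ⟦ inc? f v ⟧) N.* h ≡⟨ ∑-*ʳ perms h (λ v -> ⟦ inc? f v ⟧) ⟨
   ∑ perms (λ v -> ⟦ inc? f v ⟧ N.* h) ≡⟨ ∑-cong perms (λ v -> trans (cong (⟦ inc? f v ⟧ N.*_) (sym (relabel v)))
    (sym (∑-*ˡ perms ⟦ inc? f v ⟧ (λ R -> ⟦ inc? f (v ∘⤖ R) ⟧)))) ⟩
   ∑ perms (λ v -> ∑ perms (λ R -> ⟦ inc? f v ⟧ N.* ⟦ inc? f (v ∘⤖ R) ⟧)) ∎
   where
   open ≡-Reasoning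
   h = ∑ perms (λ v -> ⟦ inc? f v ⟧)
   relabel : ∀ v -> ∑ perms (λ R -> ⟦ inc? f (v ∘⤖ R) ⟧) ≡ h
   relabel v = reindex (⤖-≗? searchFin searchFin) (⤖-≗? searchFin searchFin) perms perms
    (hamiltonianPaths-enumerates n) (hamiltonianPaths-enumerates n) (v ∘⤖_) ((v ⁻¹⤖) ∘⤖_)
    (λ {R} {u} eq a -> sym (trans (cong (inverse v) (eq a)) (inverse-to v _)))
    (λ {R} {u} eq a -> sym (trans (cong (Bijection.to v) (eq a)) (to-inverse v _)))
    (λ u -> ⟦ inc? f u ⟧) (λ {u} {u'} -> inc-resp f {u} {u'})

 total : ℕ
 total = ∑ Ω (λ f -> H f N.^ 2)

 private
  ρ-sat? : ∀ w (R : HamiltonianPath n) -> Dec (Sat (at R) (assignment w 0 0))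
  ρ-sat? w R = sat? (at R) (assignment w 0 0)

 merges# : Word -> ℕ
 merges# w = ∑ perms (λ v -> ∑ perms (λ R -> ⟦ ρ-sat? w R ⟧ N.* sorting (Pair.merged v R w 0 0)))

 private
  exchange : (g : EdgeOrdering n -> HamiltonianPath n -> HamiltonianPath n -> Word -> ℕ) (w : Word) ->
       (∀ f v R -> g f v R w ≡ ⟦ ρ-sat? w R ⟧ N.* ⟦ ordered? (label f) (Pair.merged v R w 0 0) ⟧) ->
       ∑ Ω (λ f -> ∑ perms (λ v -> ∑ perms (λ R -> g f v R w))) ≡ merges# w
  exchange g w eq = trans (∑-swap Ω perms _) (∑-cong perms (λ v -> trans (∑-swap Ω perms _) (∑-cong perms (λ R ->
   trans (∑-cong Ω (λ f -> eq f v R)) (∑-*ˡ Ω ⟦ ρ-sat? w R ⟧ (λ f -> ⟦ ordered? (label f) (Pair.merged v R w 0 0) ⟧))))))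

  swap3 : {I : Set} (xs : List I) (g : EdgeOrdering n -> HamiltonianPath n -> HamiltonianPath n -> I -> ℕ) ->
      ∑ Ω (λ f -> ∑ perms (λ v -> ∑ perms (λ R -> ∑ xs (g f v R)))) ≡ ∑ xs (λ x -> ∑ Ω (λ f -> ∑ perms (λ v -> ∑ perms (λ R -> g f v R x))))
  swap3 xs g = trans (∑-cong Ω (λ f -> trans (∑-cong perms (λ v -> ∑-swap perms xs (g f v))) (∑-swap perms xs _))) (∑-swap Ω xs _)

  scale3 : (a : ℕ) (g : EdgeOrdering n -> HamiltonianPath n -> HamiltonianPath n -> ℕ) ->
       ∑ Ω (λ f -> ∑ perms (λ v -> ∑ perms (λ R -> a N.* g f v R))) ≡ a N.* ∑ Ω (λ f -> ∑ perms (λ v -> ∑ perms (g f v)))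
  scale3 a g = trans (∑-cong Ω (λ f -> trans (∑-cong perms (λ v -> ∑-*ˡ perms a (g f v))) (∑-*ˡ perms a (λ v -> ∑ perms (g f v))))) (∑-*ˡ Ω a _)

 total-≤ : total N.≤ ∑ (upTo (suc N)) (λ c -> ∑ (lists c plainTags) (λ σ -> ⟦ Σlen σ N.≤? N ⟧ N.* ∑ (plainWords σ) (λ w -> ⟦ noAdj? w ⟧ N.* merges# w)))
 total-≤ = begin
  ∑ Ω (λ f -> H f N.^ 2) ≤⟨ ∑-mono Ω (λ f -> ≡≤ (H² f)
                      (∑-mono perms (λ v -> ∑-mono perms (λ R -> bothIncreasing-≤ f v R)))) ⟩
  ∑ Ω (λ f -> ∑ perms (λ v -> ∑ perms (λ R -> ∑ (upTo (suc N)) (λ c -> ∑ (lists c plainTags) (λ σ -> κ σ N.* ∑ (plainWords σ) (λ w -> ν w N.* term f v R w))))))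
                      ≡⟨ swap3 (upTo (suc N)) _ ⟩
  ∑ (upTo (suc N)) (λ c -> ∑ Ω (λ f -> ∑ perms (λ v -> ∑ perms (λ R -> ∑ (lists c plainTags) (λ σ -> κ σ N.* ∑ (plainWords σ) (λ w -> ν w N.* term f v R w))))))
   ≡⟨ ∑-cong (upTo (suc N)) (λ c -> trans (swap3 (lists c plainTags) _) (∑-cong (lists c plainTags) (λ σ ->
      trans (scale3 (κ σ) _) (cong (κ σ N.*_) (trans (swap3 (plainWords σ) _) (∑-cong (plainWords σ) (λ w ->
       trans (scale3 (ν w) _) (cong (ν w N.*_) (exchange term w (λ _ _ _ -> refl)))))))))) ⟩
  ∑ (upTo (suc N)) (λ c -> ∑ (lists c plainTags) (λ σ -> κ σ N.* ∑ (plainWords σ) (λ w -> ν w N.* merges# w))) ∎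
  where
  open N.≤-Reasoning
  κ : List Tag -> ℕ
  κ σ = ⟦ Σlen σ N.≤? N ⟧
  ν : Word -> ℕ
  ν w = ⟦ noAdj? w ⟧
  term : EdgeOrdering n -> HamiltonianPath n -> HamiltonianPath n -> Word -> ℕ
  term f v R w = ⟦ ρ-sat? w R ⟧ N.* ⟦ ordered? (label f) (Pair.merged v R w 0 0) ⟧

 private
  sum-factor : ∀ w -> ∑ perms (λ v -> ∑ perms (λ R -> ⟦ ρ-sat? w R ⟧ N.* ⟦ few? (commonCells w 0 0) 0 (at R) ⟧ N.* orderings)) ≡ n ! N.* (matching w N.* orderings)
  sum-factor w = ∑-pairs-const perms (λ R -> ⟦ ρ-sat? w R ⟧ N.* ⟦ few? (commonCells w 0 0) 0 (at R) ⟧) orderings length-perms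

  sum-size : ∀ w -> merges# w N.* size w ! ≡ ∑ perms (λ v -> ∑ perms (λ R -> ⟦ ρ-sat? w R ⟧ N.* (sorting (Pair.merged v R w 0 0) N.* size w !)))
  sum-size w = ∑-pairs-*ʳ perms (λ R -> ⟦ ρ-sat? w R ⟧) (λ v R -> sorting (Pair.merged v R w 0 0)) (size w !)

 merges#-≤ : ∀ w -> endP w 0 ≡ N -> endQ w 0 ≡ N -> merges# w N.* size w ! N.≤ n ! N.* (matching w N.* orderings)
 merges#-≤ w endP≡ endQ≡ = subst₂ N._≤_ (sym (sum-size w)) (sum-factor w) (∑-mono perms (λ v -> ∑-mono perms (λ R -> sorting-merged-≤ v R w endP≡ endQ≡)))

 merges#-≥ : ∀ w -> endP w 0 ≡ N -> endQ w 0 ≡ N -> n ! N.* (matching w N.* orderings) N.≤ merges# w N.* size w !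
 merges#-≥ w endP≡ endQ≡ = subst₂ N._≤_ (sum-factor w) (sym (sum-size w)) (∑-mono perms (λ v -> ∑-mono perms (λ R -> sorting-merged-≥ v R w endP≡ endQ≡)))

 -- 𝔼[H²] / n²
 ratio : ℚ
 ratio = 𝔼[H²] n * (recip N * recip N)

 private
  0<Ω : 0ℚ < ι orderings
  0<Ω = 0<ι 1≤Ω

  ι-ratio : ι orderings * ratio ≡ ι total * (recip N * recip N)
  ι-ratio = ι-𝔼-* Ω (λ f -> H f N.^ 2) (recip N * recip N) 1≤Ω

  share : Word -> ℚ
  share w = shareOf N (matching w) (size w)

  merges-≤-share : ∀ w -> endP w 0 ≡ N -> endQ w 0 ≡ N -> ι (merges# w) * (recip N * recip N) ≤ ι orderings * share w
  merges-≤-share w p q = shareOf-≥ N (merges# w) (matching w) orderings (size w) (merges#-≤ w p q)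

  merges-≥-share : ∀ w -> endP w 0 ≡ N -> endQ w 0 ≡ N -> ι orderings * share w ≤ ι (merges# w) * (recip N * recip N)
  merges-≥-share w p q = shareOf-≤ N (merges# w) (matching w) orderings (size w) (merges#-≥ w p q)

  open Scaling (recip N * recip N) (ι orderings)

 -- A valid assignment prescribes k + c of the n values, so k + c ≤ n; words beyond this match no
 -- permutation and are dropped.
 present? : ∀ c k -> Dec (k N.≤ N × k N.+ c N.≤ n)
 present? c k = (k N.≤? N) ×-dec (k N.+ c N.≤? n)

 plainCoef : ℕ -> ℕ -> ℚ
 plainCoef c k = coef (N ∸ k) (N ∸ k) c ((N ∸ k) N.+ (N ∸ k) N.+ k) (n ∸ (k N.+ c)) N

 -- `π` is left open so that the switching estimate can serve for few common edges and the trivial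
 -- bound 1 for the others.
 ratio-≤ : (π : ℕ -> ℕ -> ℚ) -> (∀ k c -> 0ℚ ≤ π k c) ->
  (∀ w k c -> endP w 0 ≡ N -> endQ w 0 ≡ N -> length (assignment w 0 0) ≡ k N.+ c -> Valid n (assignment w 0 0) ->
    ι (matching w) * inv (n ∸ (k N.+ c)) ≤ π k c) ->
  ratio ≤ ∑ᵣ (upTo (suc N)) (λ c -> ∑ᵣ (lists c plainTags) (λ σ -> ι ⟦ present? c (Σlen σ) ⟧ * (plainCoef c (Σlen σ) * π (Σlen σ) c)))
 ratio-≤ π 0≤π π-bound = *-cancelˡ 0<Ω (≡≤ᵣ ι-ratio (≤-trans (*-monoʳ (0≤* (0≤recip N) (0≤recip N)) (ι-mono total-≤))
  (pull (upTo (suc N)) (λ {c} _ -> pull (lists c plainTags) (λ {σ} σ∈ -> indicator-≤ (Σlen σ N.≤? N) (ℚ.<⇒≤ 0<Ω)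
   (0≤* (0≤ι ⟦ present? c (Σlen σ) ⟧) (0≤* (0≤coef (N ∸ Σlen σ) (N ∸ Σlen σ) c ((N ∸ Σlen σ) N.+ (N ∸ Σlen σ) N.+ Σlen σ) (n ∸ (Σlen σ N.+ c)) N) (0≤π (Σlen σ) c)))
   (per-σ c σ σ∈))))))
  where
  per-σ : ∀ c σ -> σ ∈ lists c plainTags -> Σlen σ N.≤ N -> ι (∑ (plainWords σ) (λ w -> ⟦ noAdj? w ⟧ N.* merges# w)) * (recip N * recip N) ≤
      ι orderings * (ι ⟦ present? c (Σlen σ) ⟧ * (plainCoef c (Σlen σ) * π (Σlen σ) c))
  per-σ c σ σ∈ k≤N = ≤≡ᵣ (pull (plainWords σ) {g = λ _ -> B} per-w)
   (cong (ι orderings *_) (trans (∑ᵣ-const (plainWords σ) B) (trans (lem L (ι ⟦ present? c k ⟧) _)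
    (cong (ι ⟦ present? c k ⟧ *_) (trans (count-shares N M M σ s r (π k c)) (cong (λ c -> coef M M c s r N * π k _) length≡))))))
   where
   k = Σlen σ
   M = N ∸ k
   s = M N.+ M N.+ k
   r = n ∸ (k N.+ c)
   L = ι (length (plainWords σ))
   length≡ : length σ ≡ c
   length≡ = proj₁ (∈-lists⁻ c σ∈)
   B = ι ⟦ present? c k ⟧ * (ι (r !) * π k c * inv s * (ι (N !) * recip N))
   lem : ∀ l i x -> l * (i * x) ≡ i * (l * x)
   lem = solve-∀ ring
   0≤B : 0ℚ ≤ B
   0≤B = 0≤* (0≤ι _) (0≤* (0≤* (0≤* (0≤ι (r !)) (0≤π k c)) (0≤inv s)) (0≤* (0≤ι (N !)) (0≤recip N)))
   per-w : ∀ {w} -> w ∈ plainWords σ -> ι (⟦ noAdj? w ⟧ N.* merges# w) * (recip N * recip N) ≤ ι orderings * B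
   per-w {w} w∈ = indicator-≤ (noAdj? w) (ℚ.<⇒≤ 0<Ω) 0≤B
    (λ na -> ≤-trans (merges-≤-share w (proj₁ ends) (proj₂ ends)) (*-monoˡ (ℚ.<⇒≤ 0<Ω) (share-≤ na)))
    where
    ends = plainWords-end c σ∈ k≤N w∈
    tags-free : ∀ σ -> All (_∈ plainTags) σ -> ΣP σ ≡ 0 × ΣQ σ ≡ 0
    tags-free = plainTags-free
    free = tags-free σ (proj₂ (∈-lists⁻ c σ∈))
    size≡ : size w ≡ s
    size≡ = trans (words-size M M σ w∈) (cong₂ (λ a b -> a N.+ b N.+ k) (trans (cong (M N.+_) (proj₁ free)) (N.+-identityʳ M)) (trans (cong (M N.+_) (proj₂ free)) (N.+-identityʳ M)))
    t≡ : length (assignment w 0 0) ≡ k N.+ c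
    t≡ = trans (assignment-length w 0 0) (trans (words-weight M M σ w∈) (cong (k N.+_) length≡))
    share-≤ : NoAdj w -> share w ≤ B
    share-≤ na = case valid-or-empty w (proj₁ ends) (proj₂ ends) na of λ where
     (inj₁ empty) -> ≡≤ᵣ (trans (cong (λ m -> m * inv (size w) * (ι (N !) * recip N)) (trans (cong ι empty) ι-0))
      (trans (cong (_* (ι (N !) * recip N)) (*-zeroˡ (inv (size w)))) (*-zeroˡ (ι (N !) * recip N)))) 0≤B
     (inj₂ valid) -> ≤≡ᵣ (*-monoʳ (0≤* (0≤ι (N !)) (0≤recip N)) (*-monoʳ (0≤inv (size w)) (≡≤ᵣ (unscale (ι (matching w)) r)
       (*-monoˡ (0≤ι (r !)) (π-bound w k c (proj₁ ends) (proj₂ ends) t≡ valid)))))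
      (trans (cong (λ s -> ι (r !) * π k c * inv s * (ι (N !) * recip N)) size≡)
       (sym (trans (cong (_* (ι (r !) * π k c * inv s * (ι (N !) * recip N))) (trans (cong ι (⟦⟧-yes (present? c k) (k≤N , subst (N._≤ n) t≡ (valid-length w (proj₁ ends) (proj₂ ends) valid)))) ι-1)) (*-identityˡ _))))

 taggedCoef : List Tag -> ℚ
 taggedCoef σ = coef e f (length σ) ((e N.+ ΣP σ) N.+ (f N.+ ΣQ σ) N.+ Σlen σ) (n ∸ (Σlen σ N.+ length σ)) N
  where
  e = N ∸ (Σlen σ N.+ ΣP σ)
  f = N ∸ (Σlen σ N.+ ΣQ σ)

 module _ (g : ℕ) (σs : List (List Tag)) (σs-unique : Unique σs)
  (σs-good : ∀ {σ} -> σ ∈ σs -> All (Separating ∘ proj₂) σ × All ((_≡ g) ∘ length ∘ proj₂) σ × Σlen σ N.+ ΣP σ N.≤ N × Σlen σ N.+ ΣQ σ N.≤ N) where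

  private
   tagged : List Tag -> List Word
   tagged = taggedWords g σs σs-unique σs-good

   total-≥ : ∑ σs (λ σ -> ∑ (tagged σ) merges#) N.≤ total
   total-≥ = begin
    ∑ σs (λ σ -> ∑ (tagged σ) merges#)
     ≡⟨ ∑-cong σs (λ σ -> trans (∑-cong (tagged σ) (λ w -> sym (exchange term w (λ _ _ _ -> refl)))) (sym (swap3 (tagged σ) term))) ⟩
    ∑ σs (λ σ -> ∑ Ω (λ f -> ∑ perms (λ v -> ∑ perms (λ R -> ∑ (tagged σ) (term f v R)))))
     ≡⟨ swap3 σs (λ f v R σ -> ∑ (tagged σ) (term f v R)) ⟨
    ∑ Ω (λ f -> ∑ perms (λ v -> ∑ perms (λ R -> ∑ σs (λ σ -> ∑ (tagged σ) (term f v R)))))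
     ≤⟨ ∑-mono Ω (λ f -> ≤≡ (∑-mono perms (λ v -> ∑-mono perms (λ R -> bothIncreasing-≥ g σs σs-unique σs-good f v R))) (sym (H² f))) ⟩
    ∑ Ω (λ f -> H f N.^ 2) ∎
    where
    open N.≤-Reasoning
    term : EdgeOrdering n -> HamiltonianPath n -> HamiltonianPath n -> Word -> ℕ
    term f v R w = ⟦ ρ-sat? w R ⟧ N.* ⟦ ordered? (label f) (Pair.merged v R w 0 0) ⟧

  ratio-≥ : (ℓ : ℚ) ->
   (∀ {σ} -> σ ∈ σs -> ∀ w -> endP w 0 ≡ N -> endQ w 0 ≡ N -> length (assignment w 0 0) ≡ Σlen σ N.+ length σ -> Spread w 0 0 ->
    ℓ ≤ ι (matching w) * inv (n ∸ (Σlen σ N.+ length σ))) ->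
   ∑ᵣ σs (λ σ -> taggedCoef σ * ℓ) ≤ ratio
  ratio-≥ ℓ ℓ-bound = *-cancelˡ 0<Ω (≤-trans (push σs per-σ) (≤≡ᵣ (*-monoʳ (0≤* (0≤recip N) (0≤recip N)) (ι-mono total-≥)) (sym ι-ratio)))
   where
   per-σ : ∀ {σ} -> σ ∈ σs -> ι orderings * (taggedCoef σ * ℓ) ≤ ι (∑ (tagged σ) merges#) * (recip N * recip N)
   per-σ {σ} σ∈ = ≡≤ᵣ (cong (ι orderings *_) (sym (trans (∑ᵣ-const (tagged σ) B) (count-shares N e f σ s r ℓ)))) (push (tagged σ) {g = λ _ -> B} per-w)
    where
    e = N ∸ (Σlen σ N.+ ΣP σ)
    f = N ∸ (Σlen σ N.+ ΣQ σ)
    s = (e N.+ ΣP σ) N.+ (f N.+ ΣQ σ) N.+ Σlen σ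
    r = n ∸ (Σlen σ N.+ length σ)
    B = ι (r !) * ℓ * inv s * (ι (N !) * recip N)
    per-w : ∀ {w} -> w ∈ tagged σ -> ι orderings * B ≤ ι (merges# w) * (recip N * recip N)
    per-w {w} w∈ = ≤-trans (*-monoˡ (ℚ.<⇒≤ 0<Ω) share-≥) (merges-≥-share w (proj₁ ends) (proj₂ ends))
     where
     ends = taggedWords-end g σs σs-unique σs-good σ∈ w∈
     share-≥ : B ≤ share w
     share-≥ = ≤-trans (*-monoʳ (0≤* (0≤ι (N !)) (0≤recip N)) (≡≤ᵣ (cong (λ s -> ι (r !) * ℓ * inv s) (sym (words-size e f σ w∈)))
      (*-monoʳ (0≤inv (size w)) (≤≡ᵣ (*-monoˡ (0≤ι (r !)) (ℓ-bound σ∈ w (proj₁ ends) (proj₂ ends) (trans (assignment-length w 0 0) (words-weight e f σ w∈))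
       (words-spread e f σ (proj₁ (σs-good σ∈)) w∈ 0 0))) (sym (unscale (ι (matching w)) r)))))) ≤-refl

-- Limits of the coefficients

module _ (e f c s r N : ℕ) where

 private
  i : ℚ
  i = inv e * inv f * inv s * recip N

  numerator denominator : ℕ
  numerator = (e N.+ f N.+ c) ! N.* r ! N.* N !
  denominator = e ! N.* f ! N.* s ! N.* suc N

  coef≡ : coef e f c s r N ≡ ι numerator * i * inv c
  coef≡ = trans (lem (ι ((e N.+ f N.+ c) !)) (inv e) (inv f) (inv c) (ι (r !)) (inv s) (ι (N !)) (recip N))
   (cong (λ x -> x * i * inv c) (sym (trans (ι-* ((e N.+ f N.+ c) ! N.* r !) (N !)) (cong (_* ι (N !)) (ι-* ((e N.+ f N.+ c) !) (r !))))))
   where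
   lem : ∀ a e f c r s n q -> a * e * f * c * r * s * n * q ≡ a * r * n * (e * f * s * q) * c
   lem = solve-∀ ring

  denominator*i : ι denominator * i ≡ 1ℚ
  denominator*i = begin
   ι denominator * i
    ≡⟨ cong (_* i) (trans (ι-* (e ! N.* f ! N.* s !) (suc N)) (cong (_* ι (suc N)) (trans (ι-* (e ! N.* f !) (s !)) (cong (_* ι (s !)) (ι-* (e !) (f !)))))) ⟩
   ι (e !) * ι (f !) * ι (s !) * ι (suc N) * i
    ≡⟨ lem (ι (e !)) (ι (f !)) (ι (s !)) (ι (suc N)) (inv e) (inv f) (inv s) (recip N) ⟩
   (ι (e !) * inv e) * (ι (f !) * inv f) * (ι (s !) * inv s) * (ι (suc N) * recip N)
    ≡⟨ cong₂ _*_ (cong₂ _*_ (cong₂ _*_ (ι-inv e) (ι-inv f)) (ι-inv s)) (ι-recip N) ⟩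
   1ℚ * 1ℚ * 1ℚ * 1ℚ
    ≡⟨⟩
   1ℚ ∎
   where
   open ≡-Reasoning
   lem : ∀ a b c d w x y z -> a * b * c * d * (w * x * y * z) ≡ (a * w) * (b * x) * (c * y) * (d * z)
   lem = solve-∀ ring

  0≤i : 0ℚ ≤ i
  0≤i = 0≤* (0≤* (0≤* (0≤inv e) (0≤inv f)) (0≤inv s)) (0≤recip N)

  left : ∀ y -> coef e f c s r N * ι y ≡ i * inv c * ι (numerator N.* y)
  left y = trans (cong (_* ι y) coef≡) (trans (lem (ι numerator) i (inv c) (ι y)) (cong (i * inv c *_) (sym (ι-* numerator y))))
   where
   lem : ∀ n i c y -> n * i * c * y ≡ i * c * (n * y)
   lem = solve-∀ ring

  right : ∀ x -> i * inv c * ι (denominator N.* x) ≡ inv c * ι x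
  right x = trans (cong (i * inv c *_) (ι-* denominator x)) (trans (lem (ι denominator) i (inv c) (ι x)) (trans (cong (_* (inv c * ι x)) denominator*i) (*-identityˡ _)))
   where
   lem : ∀ d i c x -> i * c * (d * x) ≡ d * i * (c * x)
   lem = solve-∀ ring

 coef-≤ : ∀ x y -> numerator N.* y N.≤ denominator N.* x -> coef e f c s r N * ι y ≤ inv c * ι x
 coef-≤ x y le = subst₂ _≤_ (sym (left y)) (right x) (*-monoˡ (0≤* 0≤i (0≤inv c)) (ι-mono le))

 coef-≥ : ∀ x y -> denominator N.* x N.≤ numerator N.* y -> inv c * ι x ≤ coef e f c s r N * ι y
 coef-≥ x y le = subst₂ _≤_ (right x) (sym (left y)) (*-monoˡ (0≤* 0≤i (0≤inv c)) (ι-mono le))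

½*2 : ½ * ι 2 ≡ 1ℚ
½*2 = trans (cong (½ *_) (ι≡ 2)) refl

0≤½ : 0ℚ ≤ ½
0≤½ = ℚ.<⇒≤ (positive⁻¹ ½)

½^*2^ : ∀ n -> pow ½ n * pow (ι 2) n ≡ 1ℚ
½^*2^ n = trans (sym (pow-* ½ (ι 2) n)) (trans (cong (λ a -> pow a n) ½*2) (pow-1 n))

-- The limit of `letterCoef`, where `j` counts separator letters. Each of them costs ½, as if P and
-- Q were chosen by a fair coin, so all strings of a given length together weigh 1.
limit : ℕ -> ℕ -> ℕ -> ℚ
limit c k j = inv c * (pow (ι 2) c * pow ½ (k N.+ j))

0≤limit : ∀ c k j -> 0ℚ ≤ limit c k j
0≤limit c k j = 0≤* (0≤inv c) (0≤* (0≤pow (0≤ι 2) c) (0≤pow 0≤½ (k N.+ j)))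

-- `A` and `B` are the numbers of separator letters P and Q; `e` and `f` letters are left to be
-- placed freely.
letterCoef : ℕ -> ℕ -> ℕ -> ℕ -> ℕ -> ℚ
letterCoef A B c k N = coef e f c ((e N.+ A) N.+ (f N.+ B) N.+ k) (suc N ∸ (k N.+ c)) N
 where
 e = N ∸ (k N.+ A)
 f = N ∸ (k N.+ B)

-- For 0 ≤ x ≤ 1 one more factor 1 + x at most triples the coefficient t of x, since x + t x² ≤ 2 t
-- x.
pow-1+-≤ : ∀ {x} -> 0ℚ ≤ x -> x ≤ 1ℚ -> ∀ n -> pow (1ℚ + x) n ≤ 1ℚ + ι (3 N.^ n) * x
pow-1+-≤ {x} 0≤x x≤1 zero = ≤+ʳ (0≤* (0≤ι 1) 0≤x)
pow-1+-≤ {x} 0≤x x≤1 (suc n) = begin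
 (1ℚ + x) * pow (1ℚ + x) n ≤⟨ *-monoˡ (0≤+ 0≤1 0≤x) (pow-1+-≤ 0≤x x≤1 n) ⟩
 (1ℚ + x) * (1ℚ + t * x) ≡⟨ lem1 x t ⟩
 1ℚ + t * x + (1ℚ * x + t * x * x) ≤⟨ +-monoʳ-≤ (1ℚ + t * x) (+-mono-≤ (*-monoʳ 0≤x (1≤ι (m^n>0 3 n))) (*-monoˡ (0≤* (0≤ι (3 N.^ n)) 0≤x) x≤1)) ⟩
 1ℚ + t * x + (t * x + t * x * 1ℚ) ≡⟨ lem2 x t ⟩
 1ℚ + (1ℚ + (1ℚ + 1ℚ)) * t * x ≡⟨ cong (λ y -> 1ℚ + y * x) (trans (cong (_* t) (sym (trans (ι≡ 3) refl))) (sym (ι-* 3 (3 N.^ n)))) ⟩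
 1ℚ + ι (3 N.^ suc n) * x ∎
 where
 open ≤-Reasoning
 t = ι (3 N.^ n)
 lem1 : ∀ x t -> (1ℚ + x) * (1ℚ + t * x) ≡ 1ℚ + t * x + (1ℚ * x + t * x * x)
 lem1 = solve-∀ ring
 lem2 : ∀ x t -> 1ℚ + t * x + (t * x + t * x * 1ℚ) ≡ 1ℚ + (1ℚ + (1ℚ + 1ℚ)) * t * x
 lem2 = solve-∀ ring

0≤letterCoef : ∀ A B c k N -> 0ℚ ≤ letterCoef A B c k N
0≤letterCoef A B c k N = 0≤coef e f c ((e N.+ A) N.+ (f N.+ B) N.+ k) (suc N ∸ (k N.+ c)) N
 where
 e = N ∸ (k N.+ A)
 f = N ∸ (k N.+ B)

growthBound : ℕ -> ℕ -> ℕ -> ℕ -> ℕ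
growthBound A B c k = 3 N.^ Growth.exponent A B c k 0 N.* Growth.z A B c k 0

module _ (A B c k m-1 : ℕ) where

 private
  m = suc m-1
  open Growth A B c k m

  x : ℚ
  x = ι z * recip m-1

  N = m N.+ γ

  cancel : ∀ a b d -> m N.+ γ ≡ d N.+ (a N.+ b) -> N ∸ (a N.+ b) ≡ d
  cancel a b d eq = trans (cong (_∸ (a N.+ b)) eq) (N.m+n∸n≡m d (a N.+ b))

  letterCoef≡ : letterCoef A B c k N ≡ coef (m N.+ δ) (m N.+ ε) c (2 N.* m N.+ η) (m N.+ β) N
  letterCoef≡ = trans (cong₂ (λ e f -> coef e f c ((e N.+ A) N.+ (f N.+ B) N.+ k) (suc N ∸ (k N.+ c)) N)
    (cancel k A (m N.+ δ) (l1 A B c k m)) (cancel k B (m N.+ ε) (l2 A B c k m)))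
   (cong₂ (λ s r -> coef (m N.+ δ) (m N.+ ε) c s r N) (l3 A B c k m) (trans (cong (_∸ (k N.+ c)) (l₄ A B c k m)) (N.m+n∸n≡m (m N.+ β) (k N.+ c))))
   where
   l1 : ∀ A B c k m -> m N.+ (A N.+ B N.+ c N.+ k) ≡ m N.+ (B N.+ c) N.+ (k N.+ A)
   l1 = ℕ-ring
   l2 : ∀ A B c k m -> m N.+ (A N.+ B N.+ c N.+ k) ≡ m N.+ (A N.+ c) N.+ (k N.+ B)
   l2 = ℕ-ring
   l3 : ∀ A B c k m -> m N.+ (B N.+ c) N.+ A N.+ (m N.+ (A N.+ c) N.+ B) N.+ k ≡ 2 N.* m N.+ (2 N.* (A N.+ B N.+ c) N.+ k)
   l3 = ℕ-ring
   l₄ : ∀ A B c k m -> suc (m N.+ (A N.+ B N.+ c N.+ k)) ≡ m N.+ (A N.+ B N.+ 1) N.+ (k N.+ c)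
   l₄ = ℕ-ring

  numerator≡ : (m N.+ δ N.+ (m N.+ ε) N.+ c) ! N.* (m N.+ β) ! N.* N ! ≡ numerator
  numerator≡ = cong (λ t -> t ! N.* (m N.+ β) ! N.* N !) (l A B c m)
   where
   l : ∀ A B c m -> m N.+ (B N.+ c) N.+ (m N.+ (A N.+ c)) N.+ c ≡ 2 N.* m N.+ (A N.+ B N.+ 3 N.* c)
   l = ℕ-ring

  denominator≡ : (m N.+ δ) ! N.* (m N.+ ε) ! N.* (2 N.* m N.+ η) ! N.* suc N ≡ denominator
  denominator≡ = cong (λ t -> (m N.+ δ) ! N.* (m N.+ ε) ! N.* (2 N.* m N.+ η) ! N.* t) (sym (+-suc m γ))

  t = letterCoef A B c k N

  S = pow (1ℚ + x) exponent

  m+z : ι (m N.+ z) ≡ ι m * (1ℚ + x)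
  m+z = trans (ι-+ m z) (sym (trans (lem (ι m) (ι z) (recip m-1)) (trans (cong (λ u -> ι m + u * ι z) (ι-recip m-1)) (cong (λ u -> ι m + u) (*-identityˡ (ι z))))))
   where
   lem : ∀ m z r -> m * (1ℚ + z * r) ≡ m + m * r * z
   lem = solve-∀ ring

  X Y M : ℚ
  X = pow (ι 2) η
  Y = pow (ι 2) α
  M = pow (ι m) exponent

  split-powers : ∀ b n -> ι (2 N.^ b N.* n N.^ exponent) ≡ pow (ι 2) b * pow (ι n) exponent
  split-powers b n = trans (ι-* (2 N.^ b) (n N.^ exponent)) (cong₂ _*_ (ι-^ 2 b) (ι-^ n exponent))

  shifted : pow (ι (m N.+ z)) exponent ≡ M * S
  shifted = trans (cong (λ u -> pow u exponent) m+z) (pow-* (ι m) (1ℚ + x) exponent)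

  0<M : 0ℚ < M
  0<M = subst (0ℚ <_) (ι-^ m exponent) (0<ι (m^n>0 m exponent))

  -- α + (A + B + k) = η + c
  limit≡ : limit c k (A N.+ B) * X ≡ inv c * Y
  limit≡ = begin
   inv c * (pow (ι 2) c * h) * X ≡⟨ l1 (inv c) (pow (ι 2) c) h X ⟩
   inv c * (X * pow (ι 2) c) * h ≡⟨ cong (λ u -> inv c * u * h) (trans (sym (pow-+ (ι 2) η c)) (trans (cong (pow (ι 2)) (l A B c k)) (pow-+ (ι 2) α (k N.+ (A N.+ B))))) ⟩
   inv c * (Y * pow (ι 2) (k N.+ (A N.+ B))) * h ≡⟨ l2 (inv c) Y (pow (ι 2) (k N.+ (A N.+ B))) h ⟩
   inv c * Y * (h * pow (ι 2) (k N.+ (A N.+ B))) ≡⟨ cong (inv c * Y *_) (½^*2^ (k N.+ (A N.+ B))) ⟩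
   inv c * Y * 1ℚ ≡⟨ *-identityʳ _ ⟩
   inv c * Y ∎
   where
   open ≡-Reasoning
   h = pow ½ (k N.+ (A N.+ B))
   l : ∀ A B c k -> 2 N.* (A N.+ B N.+ c) N.+ k N.+ c ≡ A N.+ B N.+ 3 N.* c N.+ (k N.+ (A N.+ B))
   l = ℕ-ring
   l1 : ∀ i t h x -> i * (t * h) * x ≡ i * (x * t) * h
   l1 = solve-∀ ring
   l2 : ∀ i y p h -> i * (y * p) * h ≡ i * y * (h * p)
   l2 = solve-∀ ring

  0<X*M : 0ℚ < X * M
  0<X*M = 0<* (subst (0ℚ <_) (ι-^ 2 η) (0<ι (m^n>0 2 η))) 0<M

  upper : t ≤ limit c k (A N.+ B) * S
  upper = *-cancelˡ 0<X*M (begin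
   X * M * t ≡⟨ trans (*-comm (X * M) t) (cong (t *_) (sym (split-powers η m))) ⟩
   t * ι (2 N.^ η N.* m N.^ exponent) ≤⟨ subst (λ u -> u * ι (2 N.^ η N.* m N.^ exponent) ≤ inv c * ι (2 N.^ α N.* (m N.+ z) N.^ exponent)) (sym letterCoef≡)
    (coef-≤ (m N.+ δ) (m N.+ ε) c (2 N.* m N.+ η) (m N.+ β) N _ _ (subst₂ (λ u v -> u N.* (2 N.^ η N.* m N.^ exponent) N.≤ v N.* (2 N.^ α N.* (m N.+ z) N.^ exponent)) (sym numerator≡) (sym denominator≡) growth-≤)) ⟩
   inv c * ι (2 N.^ α N.* (m N.+ z) N.^ exponent) ≡⟨ cong (inv c *_) (trans (split-powers α (m N.+ z)) (cong (Y *_) shifted)) ⟩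
   inv c * (Y * (M * S)) ≡⟨ trans (sym (*-assoc (inv c) Y _)) (cong (_* (M * S)) (sym limit≡)) ⟩
   limit c k (A N.+ B) * X * (M * S) ≡⟨ l (limit c k (A N.+ B)) X M S ⟩
   X * M * (limit c k (A N.+ B) * S) ∎)
   where
   open ≤-Reasoning
   l : ∀ w x q p -> w * x * (q * p) ≡ x * q * (w * p)
   l = solve-∀ ring

  lower : limit c k (A N.+ B) ≤ t * S
  lower = *-cancelˡ 0<X*M (begin
   X * M * limit c k (A N.+ B) ≡⟨ l (limit c k (A N.+ B)) X M ⟩
   limit c k (A N.+ B) * X * M ≡⟨ trans (cong (_* M) limit≡) (*-assoc (inv c) Y M) ⟩
   inv c * (Y * M) ≡⟨ cong (inv c *_) (sym (split-powers α m)) ⟩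
   inv c * ι (2 N.^ α N.* m N.^ exponent) ≤⟨ subst (λ u -> inv c * ι (2 N.^ α N.* m N.^ exponent) ≤ u * ι (2 N.^ η N.* (m N.+ z) N.^ exponent)) (sym letterCoef≡)
    (coef-≥ (m N.+ δ) (m N.+ ε) c (2 N.* m N.+ η) (m N.+ β) N _ _ (subst₂ (λ u v -> v N.* (2 N.^ α N.* m N.^ exponent) N.≤ u N.* (2 N.^ η N.* (m N.+ z) N.^ exponent)) (sym numerator≡) (sym denominator≡) growth-≥)) ⟩
   t * ι (2 N.^ η N.* (m N.+ z) N.^ exponent) ≡⟨ cong (t *_) (trans (split-powers η (m N.+ z)) (cong (X *_) shifted)) ⟩
   t * (X * (M * S)) ≡⟨ l' t X M S ⟩
   X * M * (t * S) ∎)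
   where
   open ≤-Reasoning
   l : ∀ w x q -> x * q * w ≡ w * x * q
   l = solve-∀ ring
   l' : ∀ w x q p -> w * (x * (q * p)) ≡ x * q * (w * p)
   l' = solve-∀ ring

  0≤t : 0ℚ ≤ t
  0≤t = 0≤letterCoef A B c k N

 module _ {N' : ℕ} (N≡ : N' ≡ m N.+ γ) (z≤m : z N.≤ m) where

  private
   y = ι (growthBound A B c k) * recip m-1

   S≤ : S ≤ 1ℚ + y
   S≤ = ≤≡ᵣ (pow-1+-≤ (0≤* (0≤ι z) (0≤recip m-1)) (subst (x ≤_) (ι-recip m-1) (*-monoʳ (0≤recip m-1) (ι-mono z≤m))) exponent)
    (cong (λ u -> 1ℚ + u) (trans (sym (*-assoc (ι (3 N.^ exponent)) (ι z) (recip m-1)))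
     (cong (_* recip m-1) (trans (sym (ι-* (3 N.^ exponent) z)) (cong ι growthBound≡)))))
    where
    growthBound≡ : 3 N.^ exponent N.* z ≡ growthBound A B c k
    growthBound≡ = refl

  letterCoef-≤ : letterCoef A B c k N' ≤ limit c k (A N.+ B) * (1ℚ + y)
  letterCoef-≤ = subst (λ M -> letterCoef A B c k M ≤ limit c k (A N.+ B) * (1ℚ + y)) (sym N≡) (≤-trans upper (*-monoˡ (0≤limit c k (A N.+ B)) S≤))

  letterCoef-≥ : limit c k (A N.+ B) ≤ letterCoef A B c k N' * (1ℚ + y)
  letterCoef-≥ = subst (λ M -> limit c k (A N.+ B) ≤ letterCoef A B c k M * (1ℚ + y)) (sym N≡) (≤-trans lower (*-monoˡ 0≤t S≤))

Eventually-suc : {P : ℕ -> Set} -> Eventually P -> Eventually (P ∘ suc)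
Eventually-suc (N0 , p) = N0 , λ N ≤N -> p (suc N) (N.m≤n⇒m≤1+n ≤N)

≲-relative : ∀ (a b : ℕ -> ℚ) B -> Eventually (λ N -> b N ≤ B) -> (∀ ε -> 0ℚ < ε -> Eventually (λ N -> a N ≤ b N * (1ℚ + ε))) -> a ≲ b
≲-relative a b B b≤B close ε 0<ε with bound B
... | suc n , _ , B≤ = eventually-map (λ N (b≤ , p) -> begin
   a N ≤⟨ p ⟩
   b N * (1ℚ + recip n * ε) ≡⟨ lem (b N) (recip n * ε) ⟩
   b N + b N * (recip n * ε) ≤⟨ +-monoʳ-≤ (b N) (*-monoʳ (0≤* (0≤recip n) (ℚ.<⇒≤ 0<ε)) (≤-trans b≤ B≤)) ⟩
   b N + ι (suc n) * (recip n * ε) ≡⟨ cong (λ u -> b N + u) (trans (sym (*-assoc (ι (suc n)) (recip n) ε)) (trans (cong (_* ε) (ι-recip n)) (*-identityˡ ε))) ⟩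
   b N + ε ∎) (eventually-× b≤B (close (recip n * ε) (0<* (0<recip n) 0<ε)))
  where
  open ≤-Reasoning
  lem : ∀ l e -> l * (1ℚ + e) ≡ l + l * e
  lem = solve-∀ ring

module _ (A B c k : ℕ) where

 private
  d z : ℕ
  d = A N.+ B N.+ c N.+ k
  z = Growth.z A B c k 0

  split : ∀ b {N} -> suc b N.+ d N.≤ N -> ∃ λ m -> N ≡ suc m N.+ d × b N.≤ m
  split b {N} ≤N = N ∸ suc d , sym (trans (sym (+-suc (N ∸ suc d) d)) (N.m∸n+n≡m (N.≤-trans (s≤s (m≤n+m d b)) ≤N)))
   , N.m+n≤o⇒m≤o∸n b (≡≤ (+-suc b d) ≤N)

  L = limit c k (A N.+ B)

 eventually-letterCoef : ∀ ε -> 0ℚ < ε -> Eventually (λ N -> letterCoef A B c k N ≤ L * (1ℚ + ε) × L ≤ letterCoef A B c k N * (1ℚ + ε))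
 eventually-letterCoef ε 0<ε = suc (N1 N.+ z) N.+ d , close
  where
  N1 = proj₁ (recip-small (growthBound A B c k) ε 0<ε)
  close : ∀ N -> suc (N1 N.+ z) N.+ d N.≤ N -> letterCoef A B c k N ≤ L * (1ℚ + ε) × L ≤ letterCoef A B c k N * (1ℚ + ε)
  close N ≤N = ≤-trans (letterCoef-≤ A B c k m {N} N≡ z≤m) (*-monoˡ (0≤limit c k (A N.+ B)) y≤ε)
       , ≤-trans (letterCoef-≥ A B c k m {N} N≡ z≤m) (*-monoˡ (0≤letterCoef A B c k N) y≤ε)
   where
   m = proj₁ (split (N1 N.+ z) ≤N)
   N≡ : N ≡ suc m N.+ d
   N≡ = proj₁ (proj₂ (split (N1 N.+ z) ≤N))
   ≤m : N1 N.+ z N.≤ m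
   ≤m = proj₂ (proj₂ (split (N1 N.+ z) ≤N))
   z≤m : z N.≤ suc m
   z≤m = N.≤-trans (m≤n+m z N1) (N.m≤n⇒m≤1+n ≤m)
   y≤ε : 1ℚ + ι (growthBound A B c k) * recip m ≤ 1ℚ + ε
   y≤ε = +-monoʳ-≤ 1ℚ (≤-trans (*-monoˡ (0≤ι (growthBound A B c k)) (recip-anti (N.≤-trans (m≤m+n N1 z) ≤m))) (proj₂ (recip-small (growthBound A B c k) ε 0<ε)))

 letterCoef-≲ : letterCoef A B c k ≲ (λ _ -> L)
 letterCoef-≲ = ≲-relative (letterCoef A B c k) (λ _ -> L) L (0 , λ _ _ -> ≤-refl) (λ ε 0<ε -> eventually-map (λ _ -> proj₁) (eventually-letterCoef ε 0<ε))

 -- A relative error is small in absolute terms only for a bounded sequence; the bound `L + 1ℚ`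
 -- comes from `letterCoef-≲` with error 1.
 letterCoef-≳ : (λ _ -> L) ≲ letterCoef A B c k
 letterCoef-≳ = ≲-relative (λ _ -> L) (letterCoef A B c k) (L + 1ℚ) (letterCoef-≲ 1ℚ 0<1) (λ ε 0<ε -> eventually-map (λ _ -> proj₂) (eventually-letterCoef ε 0<ε))

-- Bounds for words with many common edges

module _ (c k M : ℕ) (c≤ : c N.≤ suc M) where

 private
  r = suc M ∸ c
  N = k N.+ M
  s = M N.+ M N.+ k
  t = coef M M c s r N

  double : ∀ M -> M N.+ M ≡ 2 N.* M
  double = ℕ-ring

 -- `many-blocks` pays 243^c for the blocks, harmless against 1 / c!, and `common-edges-decay` gains
 -- (128 / 129)^k; note that `recip 128` is 1 / 129.
 coef-decay : N N.≤ 128 N.* M -> t ≤ inv c * (pow (ι 243) c * pow (ι 128 * recip 128) k)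
 coef-decay N≤ = *-cancelˡ {ι (129 N.^ k)} (0<ι (m^n>0 129 k)) (begin
  ι (129 N.^ k) * t ≡⟨ *-comm (ι (129 N.^ k)) t ⟩
  t * ι (129 N.^ k) ≤⟨ coef-≤ M M c s r N (243 N.^ c N.* 128 N.^ k) (129 N.^ k) counts ⟩
  inv c * ι (243 N.^ c N.* 128 N.^ k) ≡⟨ cong (inv c *_) (trans (ι-* (243 N.^ c) (128 N.^ k)) (cong₂ _*_ (ι-^ 243 c) powers)) ⟩
  inv c * (pow (ι 243) c * (pow (ι 129) k * pow (ι 128 * recip 128) k)) ≡⟨ lem (inv c) (pow (ι 243) c) (pow (ι 129) k) _ ⟩
  pow (ι 129) k * (inv c * (pow (ι 243) c * pow (ι 128 * recip 128) k)) ≡⟨ cong (_* (inv c * (pow (ι 243) c * pow (ι 128 * recip 128) k))) (sym (ι-^ 129 k)) ⟩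
  ι (129 N.^ k) * (inv c * (pow (ι 243) c * pow (ι 128 * recip 128) k)) ∎)
  where
  open ≤-Reasoning
  lem : ∀ i a b d -> i * (a * (b * d)) ≡ b * (i * (a * d))
  lem = solve-∀ ring
  shuffle : ∀ a b r -> a * (b * r) ≡ b * (a * r)
  shuffle = solve-∀ ring
  powers : ι (128 N.^ k) ≡ pow (ι 129) k * pow (ι 128 * recip 128) k
  powers = trans (ι-^ 128 k) (trans (cong (λ a -> pow a k) (sym (trans (shuffle (ι 129) (ι 128) (recip 128)) (trans (cong (ι 128 *_) (ι-recip 128)) (*-identityʳ (ι 128)))))) (pow-* (ι 129) (ι 128 * recip 128) k))
  counts : (M N.+ M N.+ c) ! N.* r ! N.* N ! N.* 129 N.^ k N.≤ M ! N.* M ! N.* s ! N.* suc N N.* (243 N.^ c N.* 128 N.^ k)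
  counts = R.begin
   (M N.+ M N.+ c) ! N.* r ! N.* N ! N.* 129 N.^ k
    R.≤⟨ *-monoˡ-≤ (129 N.^ k) (*-monoˡ-≤ (N !) (subst (λ d -> (d N.+ c) ! N.* r ! N.≤ 243 N.^ c N.* ((2 N.* M) ! N.* suc M !)) (sym (double M)) (many-blocks c r {M} (m+[n∸m]≡n c≤)))) ⟩
   243 N.^ c N.* ((2 N.* M) ! N.* (suc M N.* M !)) N.* N ! N.* 129 N.^ k
    R.≡⟨ l1 (243 N.^ c) ((2 N.* M) !) (suc M) (M !) (N !) (129 N.^ k) ⟩
   243 N.^ c N.* M ! N.* (129 N.^ k N.* (N ! N.* (2 N.* M) !)) N.* suc M
    R.≤⟨ *-mono-≤ (*-monoʳ-≤ (243 N.^ c N.* M !) (common-edges-decay M k N≤)) (s≤s (m≤n+m M k)) ⟩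
   243 N.^ c N.* M ! N.* (128 N.^ k N.* (M ! N.* (2 N.* M N.+ k) !)) N.* suc N
    R.≡⟨ l2 (243 N.^ c) (M !) (128 N.^ k) ((2 N.* M N.+ k) !) (suc N) ⟩
   M ! N.* M ! N.* (2 N.* M N.+ k) ! N.* suc N N.* (243 N.^ c N.* 128 N.^ k)
    R.≡⟨ cong (λ d -> M ! N.* M ! N.* (d N.+ k) ! N.* suc N N.* (243 N.^ c N.* 128 N.^ k)) (sym (double M)) ⟩
   M ! N.* M ! N.* s ! N.* suc N N.* (243 N.^ c N.* 128 N.^ k) R.∎
   where
   module R = N.≤-Reasoning
   l1 : ∀ a t m f n b -> a N.* (t N.* (m N.* f)) N.* n N.* b ≡ a N.* f N.* (b N.* (n N.* t)) N.* m
   l1 = ℕ-ring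
   l2 : ∀ a f b u m -> a N.* f N.* (b N.* (f N.* u)) N.* m ≡ f N.* f N.* u N.* m N.* (a N.* b)
   l2 = ℕ-ring

-- `C` stands for the number of lists of g + 1 blocks with k edges, at most 2^(g+1) k^g / g!. As k ≤
-- N, `few-letters` absorbs the power k^g, and 2^(g+1) · 3 · 27^g = 6 · 54^g.
few-letters-≤ : ∀ g h k C (σ : List Tag) -> let M = g N.+ h ; N = k N.+ M in length σ ≡ suc g -> 128 N.* M N.< N -> g ! N.* C N.≤ 2 N.^ suc g N.* k N.^ g ->
 ι C * coef M M (suc g) (M N.+ M N.+ k) (suc M ∸ suc g) N ≤ ι 6 * expTerm (ι 54) g * pow ½ h * recip N
few-letters-≤ g h k C σ length≡ M<N C≤ = *-cancelˡ {ι (g ! N.* 2 N.^ h)} (0<ι (*-mono-≤ (1≤! g) (m^n>0 2 h))) (begin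
 ι (g ! N.* 2 N.^ h) * (ι C * coef M M (suc g) s (suc M ∸ suc g) N)
  ≡⟨ cong (λ r -> ι (g ! N.* 2 N.^ h) * (ι C * coef M M (suc g) s r N)) (N.m+n∸m≡n g h) ⟩
 ι (g ! N.* 2 N.^ h) * (ι C * coef M M (suc g) s h N)
  ≡⟨ cong (λ u -> ι (g ! N.* 2 N.^ h) * (ι C * (u * ι (h !) * inv s * ι (N !) * recip N)))
     (trans (cong (λ c -> ι ((M N.+ M N.+ c) !) * inv M * inv M * inv c) (sym length≡)) (sym (ι-words-count M M σ))) ⟩
 ι (g ! N.* 2 N.^ h) * (ι C * (ι W * ι (h !) * inv s * ι (N !) * recip N))
  ≡⟨ cong (_* (ι C * (ι W * ι (h !) * inv s * ι (N !) * recip N))) (ι-* (g !) (2 N.^ h)) ⟩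
 ι (g !) * ι (2 N.^ h) * (ι C * (ι W * ι (h !) * inv s * ι (N !) * recip N))
  ≡⟨ l1 (ι (g !)) (ι (2 N.^ h)) (ι C) (ι W) (ι (h !)) (inv s) (ι (N !)) (recip N) ⟩
 (ι (g !) * ι C) * ((ι W * ι (h !) * ι (N !)) * ι (2 N.^ h)) * (inv s * recip N)
  ≡⟨ cong (_* (inv s * recip N)) (trans (cong₂ _*_ (sym (ι-* (g !) C)) (trans (cong (_* ι (2 N.^ h)) (trans (cong (_* ι (N !)) (sym (ι-* W (h !)))) (sym (ι-* (W N.* h !) (N !))))) (sym (ι-* (W N.* h ! N.* N !) (2 N.^ h))))) (sym (ι-* (g ! N.* C) _))) ⟩
 ι (g ! N.* C N.* (W N.* h ! N.* N ! N.* 2 N.^ h)) * (inv s * recip N)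
  ≤⟨ *-monoʳ (0≤* (0≤inv s) (0≤recip N)) (ι-mono counts) ⟩
 ι (6 N.* 54 N.^ g N.* s !) * (inv s * recip N)
  ≡⟨ cong (_* (inv s * recip N)) (trans (ι-* (6 N.* 54 N.^ g) (s !)) (cong (_* ι (s !)) (trans (ι-* 6 (54 N.^ g)) (cong (ι 6 *_) (ι-^ 54 g))))) ⟩
 ι 6 * pow (ι 54) g * ι (s !) * (inv s * recip N)
  ≡⟨ trans (l2 (ι 6) (pow (ι 54) g) (ι (s !)) (inv s) (recip N)) (cong (λ u -> ι 6 * pow (ι 54) g * recip N * u) (trans (ι-inv s) (sym units))) ⟩
 ι 6 * pow (ι 54) g * recip N * (ι (g !) * inv g * (pow ½ h * ι (2 N.^ h)))
  ≡⟨ trans (l3 (ι 6) (pow (ι 54) g) (recip N) (ι (g !)) (inv g) (pow ½ h) (ι (2 N.^ h))) (cong (_* (ι 6 * (pow (ι 54) g * inv g) * pow ½ h * recip N)) (sym (ι-* (g !) (2 N.^ h)))) ⟩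
 ι (g ! N.* 2 N.^ h) * (ι 6 * expTerm (ι 54) g * pow ½ h * recip N) ∎)
 where
 open ≤-Reasoning
 M = g N.+ h
 N = k N.+ M
 s = M N.+ M N.+ k
 W = length (words M M σ)
 units : ι (g !) * inv g * (pow ½ h * ι (2 N.^ h)) ≡ 1ℚ
 units = trans (cong₂ _*_ (ι-inv g) (trans (cong (pow ½ h *_) (ι-^ 2 h)) (½^*2^ h))) refl
 l1 : ∀ g p c w h i n r -> g * p * (c * (w * h * i * n * r)) ≡ (g * c) * ((w * h * n) * p) * (i * r)
 l1 = solve-∀ ring
 l2 : ∀ a b f i r -> a * b * f * (i * r) ≡ a * b * r * (f * i)
 l2 = solve-∀ ring
 l3 : ∀ a b r g i p q -> a * b * r * (g * i * (p * q)) ≡ g * q * (a * (b * i) * p * r)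
 l3 = solve-∀ ring
 counts : g ! N.* C N.* (W N.* h ! N.* N ! N.* 2 N.^ h) N.≤ 6 N.* 54 N.^ g N.* s !
 counts = R.begin
  g ! N.* C N.* (W N.* h ! N.* N ! N.* 2 N.^ h)
   R.≤⟨ *-mono-≤ (N.≤-trans C≤ (*-monoʳ-≤ (2 N.^ suc g) (N.^-monoˡ-≤ g (m≤m+n k M))))
       (*-monoˡ-≤ (2 N.^ h) (*-monoˡ-≤ (N !) (*-monoˡ-≤ (h !) (≤≡ (words-count-≤ M M σ) (cong₂ (λ a b -> 3 N.^ (a N.+ b)) (double M) length≡))))) ⟩
  2 N.^ suc g N.* N N.^ g N.* (3 N.^ (2 N.* M N.+ suc g) N.* h ! N.* N ! N.* 2 N.^ h)
   R.≡⟨ m1 (2 N.^ suc g) (N N.^ g) (3 N.^ (2 N.* M N.+ suc g) N.* h ! N.* N !) (2 N.^ h) ⟩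
  2 N.^ suc g N.* (N N.^ g N.* (3 N.^ (2 N.* M N.+ suc g) N.* h ! N.* N !) N.* 2 N.^ h)
   R.≤⟨ *-monoʳ-≤ (2 N.^ suc g) (few-letters M g h N refl M<N) ⟩
  2 N.^ suc g N.* (3 N.* 27 N.^ g N.* (N N.+ M) !)
   R.≡⟨ m2 (2 N.^ g) (27 N.^ g) ((N N.+ M) !) ⟩
  6 N.* (2 N.^ g N.* 27 N.^ g) N.* (N N.+ M) !
   R.≡⟨ cong₂ (λ a b -> 6 N.* a N.* b !) (sym (^-distrib-* 2 27 g)) (m3 k M) ⟩
  6 N.* 54 N.^ g N.* s ! R.∎
  where
  module R = N.≤-Reasoning
  double : ∀ M -> M N.+ M ≡ 2 N.* M
  double = ℕ-ring
  m1 : ∀ a b c d -> a N.* b N.* (c N.* d) ≡ a N.* (b N.* c N.* d)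
  m1 = ℕ-ring
  m2 : ∀ a b f -> 2 N.* a N.* (3 N.* b N.* f) ≡ 6 N.* (a N.* b) N.* f
  m2 = ℕ-ring
  m3 : ∀ k M -> k N.+ M N.+ M ≡ M N.+ M N.+ k
  m3 = ℕ-ring

-- Sums over lists of blocks

upTo-suc : ∀ n -> upTo (suc n) ≡ 0 ∷ map suc (upTo n)
upTo-suc n = cong (0 ∷_) (sym (List.map-upTo suc n))

∑ᵣ-upTo : ∀ n (f : ℕ -> ℚ) -> ∑ᵣ (upTo (suc n)) f ≡ partial f n
∑ᵣ-upTo n f = trans (cong (λ xs -> ∑ᵣ xs f) (upTo-suc n)) (trans (cong (λ z -> f 0 + z) (∑ᵣ-map (upTo n) suc f)) (rest n))
 where
 rest : ∀ n -> f 0 + ∑ᵣ (upTo n) (f ∘ suc) ≡ partial f n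
 rest zero = +-identityʳ (f 0)
 rest (suc n) = cong (λ z -> f 0 + z) (∑ᵣ-upTo n (f ∘ suc))

geometric : ∀ {a d} -> a + d ≡ 1ℚ -> ∀ n -> d * partial (pow a) n + pow a (suc n) ≡ 1ℚ
geometric {a} {d} a+d zero = trans (lem a d) a+d
 where
 lem : ∀ a d -> d * 1ℚ + a * 1ℚ ≡ a + d
 lem = solve-∀ ring
geometric {a} {d} a+d (suc n) = begin
 d * (1ℚ + partial (λ i -> a * pow a i) n) + a * pow a (suc n) ≡⟨ cong (λ z -> d * (1ℚ + z) + a * pow a (suc n)) (partial-* a (pow a) n) ⟩
 d * (1ℚ + a * partial (pow a) n) + a * pow a (suc n) ≡⟨ lem a d (partial (pow a) n) (pow a (suc n)) ⟩
 a * (d * partial (pow a) n + pow a (suc n)) + d ≡⟨ cong (λ z -> a * z + d) (geometric {a} {d} a+d n) ⟩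
 a * 1ℚ + d ≡⟨ trans (cong (_+ d) (*-identityʳ a)) a+d ⟩
 1ℚ ∎
 where
 open ≡-Reasoning
 lem : ∀ a d p q -> d * (1ℚ + a * p) + a * q ≡ a * (d * p + q) + d
 lem = solve-∀ ring

∑-blocks : ℚ -> ℕ -> ℚ
∑-blocks a n = ∑ᵣ (upTo (suc n)) (λ b -> pow a (len b))

-- The weights of the blocks 1, 2, … form a geometric series; the block 0 weighs as much as the block 1.
∑-blocks≡ : ∀ a n -> ∑-blocks a (suc n) ≡ a * (1ℚ + partial (pow a) n)
∑-blocks≡ a n = trans (∑ᵣ-upTo (suc n) (λ b -> pow a (len b))) (trans (cong (λ z -> a * 1ℚ + z) (partial-* a (pow a) n)) (sym (*-distribˡ-+ a 1ℚ (partial (pow a) n))))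

∑-blocks-≤ : ∀ {a d} -> 0ℚ ≤ a -> a + d ≡ 1ℚ -> 0ℚ ≤ d -> ∀ n -> d * ∑-blocks a n ≤ a * (1ℚ + d)
∑-blocks-≤ {a} {d} 0≤a a+d 0≤d n = ≤-trans (*-monoˡ 0≤d (grow n)) (begin
 d * ∑-blocks a (suc n) ≡⟨ cong (d *_) (∑-blocks≡ a n) ⟩
 d * (a * (1ℚ + partial (pow a) n)) ≡⟨ lem a d (partial (pow a) n) ⟩
 a * (d * partial (pow a) n + d) ≤⟨ *-monoˡ 0≤a (+-monoˡ-≤ d (≤≡ᵣ (≤+ʳ {d * partial (pow a) n} {pow a (suc n)} (0≤pow 0≤a (suc n))) (geometric {a} {d} a+d n))) ⟩
 a * (1ℚ + d) ∎)
 where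
 open ≤-Reasoning
 lem : ∀ a d p -> d * (a * (1ℚ + p)) ≡ a * (d * p + d)
 lem = solve-∀ ring
 grow : ∀ n -> ∑-blocks a n ≤ ∑-blocks a (suc n)
 grow n = subst₂ _≤_ (sym (∑ᵣ-upTo n (λ b -> pow a (len b)))) (sym (∑ᵣ-upTo (suc n) (λ b -> pow a (len b)))) (partial-≤ {λ b -> pow a (len b)} (λ b -> 0≤pow 0≤a (len b)) (n≤1+n n))

∑-blocks-½ : ∀ n -> ι 2 * ∑-blocks ½ (suc n) + pow ½ n ≡ ι 3
∑-blocks-½ n = begin
 ι 2 * ∑-blocks ½ (suc n) + pow ½ n ≡⟨ cong₂ (λ s t -> t * s + pow ½ n) (∑-blocks≡ ½ n) (ι≡ 2) ⟩
 (1ℚ + 1ℚ) * (½ * (1ℚ + p)) + q ≡⟨ l1 ½ p q ⟩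
 -- The unjustified equalities compute (1 + 1) * ½ to 1; the ring identities between them treat ½ as
 -- a variable.
 (1ℚ + 1ℚ) * ½ * (1ℚ + p) + 1ℚ * q ≡⟨⟩
 1ℚ * (1ℚ + p) + (1ℚ + 1ℚ) * ½ * q ≡⟨ l2 ½ p q ⟩
 1ℚ + (1ℚ * p + (1ℚ + 1ℚ) * ½ * q) ≡⟨⟩
 1ℚ + ((1ℚ + 1ℚ) * ½ * p + (1ℚ + 1ℚ) * ½ * q) ≡⟨ l3 ½ p q ⟩
 1ℚ + (1ℚ + 1ℚ) * (½ * p + ½ * q) ≡⟨ cong (λ z -> 1ℚ + (1ℚ + 1ℚ) * z) (geometric {½} {½} refl n) ⟩
 1ℚ + (1ℚ + 1ℚ) * 1ℚ ≡⟨ ι≡ 3 ⟨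
 ι 3 ∎
 where
 open ≡-Reasoning
 p = partial (pow ½) n
 q = pow ½ n
 l1 : ∀ h p q -> (1ℚ + 1ℚ) * (h * (1ℚ + p)) + q ≡ (1ℚ + 1ℚ) * h * (1ℚ + p) + 1ℚ * q
 l1 = solve-∀ ring
 l2 : ∀ h p q -> 1ℚ * (1ℚ + p) + (1ℚ + 1ℚ) * h * q ≡ 1ℚ + (1ℚ * p + (1ℚ + 1ℚ) * h * q)
 l2 = solve-∀ ring
 l3 : ∀ h p q -> 1ℚ + ((1ℚ + 1ℚ) * h * p + (1ℚ + 1ℚ) * h * q) ≡ 1ℚ + (1ℚ + 1ℚ) * (h * p + h * q)
 l3 = solve-∀ ring

weights : {A : Set} -> (A -> ℚ) -> List A -> ℚ
weights w [] = 1ℚ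
weights w (x ∷ xs) = w x * weights w xs

∑-lists : {A : Set} (xs : List A) (w : A -> ℚ) -> ∀ c -> ∑ᵣ (lists c xs) (weights w) ≡ pow (∑ᵣ xs w) c
∑-lists xs w zero = +-identityʳ 1ℚ
∑-lists xs w (suc c) = begin
 ∑ᵣ (cartesianProductWith _∷_ xs (lists c xs)) (weights w) ≡⟨ ∑ᵣ-cartesianProductWith _∷_ xs (lists c xs) (weights w) ⟩
 ∑ᵣ xs (λ x -> ∑ᵣ (lists c xs) (λ ys -> w x * weights w ys)) ≡⟨ ∑ᵣ-cong xs (λ x -> trans (∑ᵣ-*ˡ (lists c xs) (w x) (weights w)) (cong (w x *_) (∑-lists xs w c))) ⟩
 ∑ᵣ xs (λ x -> w x * pow (∑ᵣ xs w) c) ≡⟨ ∑ᵣ-*ʳ xs (pow (∑ᵣ xs w) c) w ⟩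
 ∑ᵣ xs w * pow (∑ᵣ xs w) c ∎
 where open ≡-Reasoning

0≤weights : {A : Set} {w : A -> ℚ} -> (∀ x -> 0ℚ ≤ w x) -> ∀ xs -> 0ℚ ≤ weights w xs
0≤weights 0≤w [] = 0≤1
0≤weights 0≤w (x ∷ xs) = 0≤* (0≤w x) (0≤weights 0≤w xs)

lists≤ : {A : Set} -> ℕ -> List A -> List (List A)
lists≤ zero xs = [] ∷ []
lists≤ (suc c) xs = [] ∷ cartesianProductWith _∷_ xs (lists≤ c xs)

-- With `h = inv` a list weighs 1 / c! times the product of the weights of its entries, and the sum
-- is a partial sum of exp at the total weight.
∑-lists≤ : {A : Set} (xs : List A) (w : A -> ℚ) (h : ℕ -> ℚ) -> ∀ c ->
     ∑ᵣ (lists≤ c xs) (λ ys -> h (length ys) * weights w ys) ≡ partial (λ c -> h c * pow (∑ᵣ xs w) c) c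
∑-lists≤ xs w h zero = +-identityʳ (h 0 * 1ℚ)
∑-lists≤ xs w h (suc c) = cong (λ z -> h 0 * 1ℚ + z) (begin
 ∑ᵣ (cartesianProductWith _∷_ xs (lists≤ c xs)) (λ ys -> h (length ys) * weights w ys)
  ≡⟨ ∑ᵣ-cartesianProductWith _∷_ xs (lists≤ c xs) (λ ys -> h (length ys) * weights w ys) ⟩
 ∑ᵣ xs (λ x -> ∑ᵣ (lists≤ c xs) (λ ys -> h (suc (length ys)) * (w x * weights w ys)))
  ≡⟨ ∑ᵣ-cong xs (λ x -> trans (∑ᵣ-cong (lists≤ c xs) (λ ys -> lem (h (suc (length ys))) (w x) (weights w ys)))
     (trans (∑ᵣ-*ˡ (lists≤ c xs) (w x) (λ ys -> h (suc (length ys)) * weights w ys)) (cong (w x *_) (∑-lists≤ xs w (h ∘ suc) c)))) ⟩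
 ∑ᵣ xs (λ x -> w x * partial (λ c -> h (suc c) * pow Ω c) c)
  ≡⟨ ∑ᵣ-*ʳ xs (partial (λ c -> h (suc c) * pow Ω c) c) w ⟩
 Ω * partial (λ c -> h (suc c) * pow Ω c) c
  ≡⟨ trans (sym (partial-* Ω (λ c -> h (suc c) * pow Ω c) c)) (partial-cong (λ i -> lem Ω (h (suc i)) (pow Ω i)) c) ⟩
 partial (λ c -> h (suc c) * pow Ω (suc c)) c ∎)
 where
 open ≡-Reasoning
 Ω = ∑ᵣ xs w
 lem : ∀ a b c -> a * (b * c) ≡ b * (a * c)
 lem = solve-∀ ring

bits : List Bool
bits = true ∷ false ∷ []

bitWeight : ℚ -> ℚ -> List Bool -> ℚ
bitWeight x y u = pow x (#P u) * pow y (#Q u)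

∑-bits : ∀ x y n -> ∑ᵣ (lists n bits) (bitWeight x y) ≡ pow (x + y) n
∑-bits x y n = trans (∑ᵣ-cong (lists n bits) weights≡) (trans (∑-lists bits w n) (cong (λ a -> pow a n) (cong (λ z -> x + z) (+-identityʳ y))))
 where
 w : Bool -> ℚ
 w true = x
 w false = y
 weights≡ : ∀ u -> bitWeight x y u ≡ weights w u
 weights≡ [] = refl
 weights≡ (true ∷ u) = trans (*-assoc x (pow x (#P u)) (pow y (#Q u))) (cong (x *_) (weights≡ u))
 weights≡ (false ∷ u) = trans (lem (pow x (#P u)) y (pow y (#Q u))) (cong (y *_) (weights≡ u))
  where
  lem : ∀ a b c -> a * (b * c) ≡ b * (a * c)
  lem = solve-∀ ring

∑ᵣ-filter-≥ : {A : Set} {P : A -> Set} (P? : Decidable P) (f g : A -> ℚ) -> (∀ x -> 0ℚ ≤ g x) -> (∀ x -> ¬ P x -> f x ≤ g x) ->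
      ∀ xs -> ∑ᵣ xs f ≤ ∑ᵣ (filter P? xs) f + ∑ᵣ xs g
∑ᵣ-filter-≥ P? f g 0≤g f≤g [] = ≤+ʳ ≤-refl
∑ᵣ-filter-≥ P? f g 0≤g f≤g (x ∷ xs) with P? x
... | yes _ = ≤≡ᵣ (+-monoʳ-≤ (f x) (≤-trans (∑ᵣ-filter-≥ P? f g 0≤g f≤g xs) (+-monoʳ-≤ (∑ᵣ (filter P? xs) f) (≤+ˡ (0≤g x)))))
 (sym (+-assoc (f x) (∑ᵣ (filter P? xs) f) _))
... | no ¬p = ≤≡ᵣ (+-mono-≤ (f≤g x ¬p) (∑ᵣ-filter-≥ P? f g 0≤g f≤g xs)) (lem (g x) (∑ᵣ (filter P? xs) f) (∑ᵣ xs g))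
 where
 lem : ∀ a b c -> a + (b + c) ≡ b + (a + c)
 lem = solve-∀ ring

compositions : List ℕ -> ℕ -> ℕ -> ℕ
compositions bs c k = ∑ (lists c (map (_, []) bs)) (λ σ -> ⟦ Σlen σ N.≟ k ⟧)

sumBelow : (ℕ -> ℕ) -> ℕ -> ℕ
sumBelow f zero = 0
sumBelow f (suc k) = f k N.+ sumBelow f k

sumBelow-mono : ∀ {f g} -> (∀ i -> f i N.≤ g i) -> ∀ k -> sumBelow f k N.≤ sumBelow g k
sumBelow-mono f≤g zero = z≤n
sumBelow-mono f≤g (suc k) = N.+-mono-≤ (f≤g k) (sumBelow-mono f≤g k)

sumBelow-* : ∀ a f k -> a N.* sumBelow f k ≡ sumBelow (λ i -> a N.* f i) k
sumBelow-* a f zero = N.*-zeroʳ a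
sumBelow-* a f (suc k) = trans (N.*-distribˡ-+ a (f k) (sumBelow f k)) (cong (a N.* f k N.+_) (sumBelow-* a f k))

term-≤-sumBelow : ∀ f {j k} -> j N.< k -> f j N.≤ sumBelow f k
term-≤-sumBelow f {j} {suc k} (s≤s j≤k) = case j N.≟ k of λ where
 (yes refl) -> m≤m+n (f k) (sumBelow f k)
 (no j≢k) -> N.≤-trans (term-≤-sumBelow f (N.≤∧≢⇒< j≤k j≢k)) (m≤n+m (sumBelow f k) (f k))

-- Telescoping: (j + 1)^(g+1) exceeds j^(g+1) by at least (g + 1) j^g.
sumBelow-^ : ∀ g k -> suc g N.* sumBelow (N._^ g) k N.≤ k N.^ suc g
sumBelow-^ g zero = N.≤-reflexive (N.*-zeroʳ g)
sumBelow-^ g (suc k) = begin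
 suc g N.* (k N.^ g N.+ sumBelow (N._^ g) k) ≡⟨ N.*-distribˡ-+ (suc g) (k N.^ g) _ ⟩
 suc g N.* k N.^ g N.+ suc g N.* sumBelow (N._^ g) k ≤⟨ N.+-monoʳ-≤ (suc g N.* k N.^ g) (sumBelow-^ g k) ⟩
 suc g N.* k N.^ g N.+ k N.^ suc g ≤⟨ step g ⟩
 suc k N.^ suc g ∎
 where
 open N.≤-Reasoning
 step : ∀ g -> suc g N.* k N.^ g N.+ k N.^ suc g N.≤ suc k N.^ suc g
 step zero = N.≤-reflexive (lem k)
  where
  lem : ∀ k -> 1 N.* 1 N.+ k N.* 1 ≡ suc k N.* 1
  lem = ℕ-ring
 step (suc g) = begin
  suc (suc g) N.* k N.^ suc g N.+ k N.* k N.^ suc g ≤⟨ m≤m+n _ (suc g N.* k N.^ g) ⟩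
  suc (suc g) N.* (k N.* k N.^ g) N.+ k N.* (k N.* k N.^ g) N.+ suc g N.* k N.^ g ≡⟨ lem g k (k N.^ g) ⟩
  suc k N.* (suc g N.* k N.^ g N.+ k N.^ suc g) ≤⟨ *-monoʳ-≤ (suc k) (step g) ⟩
  suc k N.* suc k N.^ suc g ∎
  where
  lem : ∀ g k p -> suc (suc g) N.* (k N.* p) N.+ k N.* (k N.* p) N.+ suc g N.* p ≡ suc k N.* (suc g N.* p N.+ k N.* p)
  lem = ℕ-ring

-- A block takes between 1 and k of the k edges; there are two blocks of length 1.
∑-first-block : ∀ B k (f g : ℕ -> ℕ) -> (∀ l j -> l N.+ j ≡ k -> f l N.≤ g j) -> (∀ l -> k N.< l -> f l ≡ 0) ->
      ∑ (upTo B) (f ∘ len) N.≤ 2 N.* sumBelow g k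
∑-first-block zero k f g h h0 = z≤n
∑-first-block (suc B) k f g h h0 = begin
 ∑ (upTo (suc B)) (f ∘ len) ≡⟨ cong (λ xs -> ∑ xs (f ∘ len)) (upTo-suc B) ⟩
 f 1 N.+ ∑ (map suc (upTo B)) (f ∘ len) ≡⟨ cong (f 1 N.+_) (∑-map (upTo B) suc (f ∘ len)) ⟩
 f 1 N.+ ∑ (upTo B) (f ∘ suc) ≤⟨ N.+-mono-≤ zeroth (≤≡ (rest B 0 k refl) (sym (N.+-identityʳ _))) ⟩
 2 N.* sumBelow g k ∎
 where
 open N.≤-Reasoning
 zeroth : f 1 N.≤ sumBelow g k
 zeroth = case k N.≟ 0 of λ where
  (yes k≡0) -> ≡≤ (h0 1 (subst (N._< 1) (sym k≡0) (s≤s z≤n))) z≤n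
  (no k≢0) -> N.≤-trans (h 1 (N.pred k) (N.suc-pred k {{N.≢-nonZero k≢0}})) (term-≤-sumBelow g (N.≤-reflexive (N.suc-pred k {{N.≢-nonZero k≢0}})))
 rest : ∀ B l0 k' -> l0 N.+ k' ≡ k -> ∑ (upTo B) (λ l -> f (suc (l0 N.+ l))) N.≤ sumBelow g k'
 rest zero l0 k' eq = z≤n
 rest (suc B) l0 zero eq = ≡≤ (trans (∑-cong (upTo (suc B)) (λ l -> h0 (suc (l0 N.+ l)) (s≤s (≡≤ (sym (trans (sym (N.+-identityʳ l0)) eq)) (m≤m+n l0 l)))))
  (∑-zero (upTo (suc B)))) z≤n
 rest (suc B) l0 (suc k') eq = begin
  ∑ (upTo (suc B)) (λ l -> f (suc (l0 N.+ l))) ≡⟨ cong (λ xs -> ∑ xs (λ l -> f (suc (l0 N.+ l)))) (upTo-suc B) ⟩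
  f (suc (l0 N.+ 0)) N.+ ∑ (map suc (upTo B)) (λ l -> f (suc (l0 N.+ l)))
   ≡⟨ cong₂ N._+_ (cong (f ∘ suc) (N.+-identityʳ l0)) (trans (∑-map (upTo B) suc (λ l -> f (suc (l0 N.+ l)))) (∑-cong (upTo B) (λ l -> cong (f ∘ suc) (+-suc l0 l)))) ⟩
  f (suc l0) N.+ ∑ (upTo B) (λ l -> f (suc (suc l0 N.+ l)))
   ≤⟨ N.+-mono-≤ (h (suc l0) k' (trans (sym (+-suc l0 k')) eq)) (rest B (suc l0) k' (trans (sym (+-suc l0 k')) eq)) ⟩
  g k' N.+ sumBelow g k' ∎

compositions-suc : ∀ B c k -> compositions (upTo B) (suc c) k N.≤ 2 N.* sumBelow (compositions (upTo B) c) k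
compositions-suc B c k = ≡≤ unfold (∑-first-block B k f (compositions (upTo B) c) below above)
 where
 tags = map (_, []) (upTo B)
 f : ℕ -> ℕ
 f l = ∑ (lists c tags) (λ σ -> ⟦ l N.+ Σlen σ N.≟ k ⟧)
 unfold : compositions (upTo B) (suc c) k ≡ ∑ (upTo B) (f ∘ len)
 unfold = trans (∑-cartesianProductWith _∷_ tags (lists c tags) (λ σ -> ⟦ Σlen σ N.≟ k ⟧)) (∑-map (upTo B) (_, []) (f ∘ len ∘ proj₁))
 below : ∀ l j -> l N.+ j ≡ k -> f l N.≤ compositions (upTo B) c j
 below l j eq = ∑-mono (lists c tags) (λ σ -> ⟦⟧-mono (l N.+ Σlen σ N.≟ k) (Σlen σ N.≟ j) (λ e -> N.+-cancelˡ-≡ l _ _ (trans e (sym eq))))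
 above : ∀ l -> k N.< l -> f l ≡ 0
 above l k<l = trans (∑-cong (lists c tags) (λ σ -> ⟦⟧-no (l N.+ Σlen σ N.≟ k) (λ e -> N.<⇒≱ k<l (≤≡ (m≤m+n l (Σlen σ)) e)))) (∑-zero (lists c tags))

-- The first block leaves a smaller number of edges to the others. The factor 2 per block allows for
-- the two blocks of one edge, and `sumBelow-^` estimates the sum over the remaining number like an
-- integral of j^g.
compositions-≤ : ∀ B g k -> g ! N.* compositions (upTo B) (suc g) k N.≤ 2 N.^ suc g N.* k N.^ g
compositions-≤ B zero k = begin
 1 N.* compositions (upTo B) 1 k ≡⟨ N.*-identityˡ _ ⟩
 compositions (upTo B) 1 k ≤⟨ compositions-suc B 0 k ⟩
 2 N.* sumBelow (compositions (upTo B) 0) k ≤⟨ *-monoʳ-≤ 2 (empty k) ⟩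
 2 N.* 1 ∎
 where
 open N.≤-Reasoning
 empty : ∀ k -> sumBelow (compositions (upTo B) 0) k N.≤ 1
 empty zero = z≤n
 empty (suc zero) = ≡≤ (trans (N.+-identityʳ _) (N.+-identityʳ _)) (⟦⟧≤1 (0 N.≟ 0))
 empty (suc (suc k)) = ≡≤ (cong (N._+ sumBelow (compositions (upTo B) 0) (suc k)) (trans (N.+-identityʳ _) (⟦⟧-no (0 N.≟ suc k) λ ()))) (empty (suc k))
compositions-≤ B (suc g) k = begin
 suc g N.* g ! N.* compositions (upTo B) (suc (suc g)) k ≤⟨ *-monoʳ-≤ (suc g N.* g !) (compositions-suc B (suc g) k) ⟩
 suc g N.* g ! N.* (2 N.* sumBelow C k) ≡⟨ l1 (suc g) (g !) 2 (sumBelow C k) ⟩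
 2 N.* suc g N.* (g ! N.* sumBelow C k) ≡⟨ cong (2 N.* suc g N.*_) (sumBelow-* (g !) C k) ⟩
 2 N.* suc g N.* sumBelow (λ j -> g ! N.* C j) k ≤⟨ *-monoʳ-≤ (2 N.* suc g) (sumBelow-mono (compositions-≤ B g) k) ⟩
 2 N.* suc g N.* sumBelow (λ j -> 2 N.^ suc g N.* j N.^ g) k ≡⟨ cong (2 N.* suc g N.*_) (sym (sumBelow-* (2 N.^ suc g) (N._^ g) k)) ⟩
 2 N.* suc g N.* (2 N.^ suc g N.* sumBelow (N._^ g) k) ≡⟨ l2 2 (suc g) (2 N.^ suc g) (sumBelow (N._^ g) k) ⟩
 2 N.* 2 N.^ suc g N.* (suc g N.* sumBelow (N._^ g) k) ≤⟨ *-monoʳ-≤ (2 N.* 2 N.^ suc g) (sumBelow-^ g k) ⟩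
 2 N.^ suc (suc g) N.* k N.^ suc g ∎
 where
 open N.≤-Reasoning
 C = compositions (upTo B) (suc g)
 l1 : ∀ a b c d -> a N.* b N.* (c N.* d) ≡ c N.* a N.* (b N.* d)
 l1 = ℕ-ring
 l2 : ∀ a b c d -> a N.* b N.* (c N.* d) ≡ a N.* c N.* (b N.* d)
 l2 = ℕ-ring

pow-Σlen : ∀ a σ -> pow a (Σlen σ) ≡ weights (pow a ∘ len ∘ proj₁) σ
pow-Σlen a [] = refl
pow-Σlen a ((b , u) ∷ σ) = trans (pow-+ a (len b) (Σlen σ)) (cong (pow a (len b) *_) (pow-Σlen a σ))

∑-pow-Σlen : ∀ a n c -> ∑ᵣ (lists c (map (_, []) (upTo (suc n)))) (pow a ∘ Σlen) ≡ pow (∑-blocks a n) c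
∑-pow-Σlen a n c = trans (∑ᵣ-cong (lists c tags) (pow-Σlen a)) (trans (∑-lists tags (pow a ∘ len ∘ proj₁) c) (cong (λ x -> pow x c) (∑ᵣ-map (upTo (suc n)) (_, []) (pow a ∘ len ∘ proj₁))))
 where
 tags : List Tag
 tags = map (_, []) (upTo (suc n))

open SecondMoment using (ratio)

-- Lower bound from separated blocks

bothLetters? : ∀ u -> Dec (1 N.≤ #P u × 1 N.≤ #Q u)
bothLetters? u = (1 N.≤? #P u) ×-dec (1 N.≤? #Q u)

-- Both letters and a length of at least 3 make these strings `Separating`. Only two strings are
-- excluded, of total weight 2 · ½^(3 + J).
separators : ℕ -> List (List Bool)
separators J = filter bothLetters? (lists (3 N.+ J) bits)

separatedTags : ℕ -> List Tag
separatedTags J = cartesianProductWith _,_ (upTo (3 N.+ J)) (separators J)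

tagWeight : Tag -> ℚ
tagWeight (b , u) = ι 2 * (pow ½ (len b) * bitWeight ½ ½ u)

0≤bitWeight : ∀ {x y} -> 0ℚ ≤ x -> 0ℚ ≤ y -> ∀ u -> 0ℚ ≤ bitWeight x y u
0≤bitWeight 0≤x 0≤y u = 0≤* (0≤pow 0≤x (#P u)) (0≤pow 0≤y (#Q u))

totalWeight : ℕ -> ℚ
totalWeight J = ∑ᵣ (separatedTags J) tagWeight

n<2^n : ∀ n -> n N.< 2 N.^ n
n<2^n zero = s≤s z≤n
n<2^n (suc n) = N.+-mono-≤ (m^n>0 2 n) (≤≡ (n<2^n n) (sym (N.+-identityʳ (2 N.^ n))))

½^≤recip : ∀ n -> pow ½ n ≤ recip n
½^≤recip n = *-cancelˡ {ι (suc n)} {pow ½ n} {recip n} (0<ι (s≤s z≤n)) (begin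
 ι (suc n) * pow ½ n ≤⟨ *-monoʳ (0≤pow 0≤½ n) (ι-mono (n<2^n n)) ⟩
 ι (2 N.^ n) * pow ½ n ≡⟨ trans (cong (_* pow ½ n) (ι-^ 2 n)) (*-comm (pow (ι 2) n) (pow ½ n)) ⟩
 pow ½ n * pow (ι 2) n ≡⟨ ½^*2^ n ⟩
 1ℚ ≡⟨ ι-recip n ⟨
 ι (suc n) * recip n ∎)
 where open ≤-Reasoning

module _ (J : ℕ) where

 private
  S D y : ℚ
  S = ∑ᵣ (separators J) (bitWeight ½ ½)
  D = ι 2 * ∑-blocks ½ (2 N.+ J)
  y = pow ½ (suc J)

  totalWeight≡ : totalWeight J ≡ D * S
  totalWeight≡ = begin
   ∑ᵣ (separatedTags J) tagWeight
    ≡⟨ ∑ᵣ-cartesianProductWith _,_ (upTo (3 N.+ J)) (separators J) tagWeight ⟩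
   ∑ᵣ (upTo (3 N.+ J)) (λ b -> ∑ᵣ (separators J) (λ u -> ι 2 * (pow ½ (len b) * bitWeight ½ ½ u)))
    ≡⟨ ∑ᵣ-cong (upTo (3 N.+ J)) (λ b -> trans (∑ᵣ-*ˡ (separators J) (ι 2) (λ u -> pow ½ (len b) * bitWeight ½ ½ u))
       (cong (ι 2 *_) (∑ᵣ-*ˡ (separators J) (pow ½ (len b)) (bitWeight ½ ½)))) ⟩
   ∑ᵣ (upTo (3 N.+ J)) (λ b -> ι 2 * (pow ½ (len b) * S))
    ≡⟨ trans (∑ᵣ-*ˡ (upTo (3 N.+ J)) (ι 2) (λ b -> pow ½ (len b) * S)) (cong (ι 2 *_) (∑ᵣ-*ʳ (upTo (3 N.+ J)) S (λ b -> pow ½ (len b)))) ⟩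
   ι 2 * (∑-blocks ½ (2 N.+ J) * S)
    ≡⟨ *-assoc (ι 2) (∑-blocks ½ (2 N.+ J)) S ⟨
   D * S ∎
   where open ≡-Reasoning

  1≤S+y : 1ℚ ≤ S + y
  1≤S+y = begin
   1ℚ ≡⟨ trans (∑-bits ½ ½ (3 N.+ J)) (pow-1 (3 N.+ J)) ⟨
   -- As 0^0 = 1, `bitWeight 0ℚ ½ u` is the weight of `u` if it contains no P and vanishes
   -- otherwise. So the excluded strings are majorised by sums over all strings, which `∑-bits`
   -- evaluates.
   ∑ᵣ all (bitWeight ½ ½) ≤⟨ ∑ᵣ-filter-≥ bothLetters? (bitWeight ½ ½) (λ u -> bitWeight 0ℚ ½ u + bitWeight ½ 0ℚ u)
                   (λ u -> 0≤+ (0≤bitWeight ≤-refl 0≤½ u) (0≤bitWeight 0≤½ ≤-refl u)) one-letter all ⟩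
   S + ∑ᵣ all (λ u -> bitWeight 0ℚ ½ u + bitWeight ½ 0ℚ u) ≡⟨ cong (λ z -> S + z) (trans (∑ᵣ-+ all (bitWeight 0ℚ ½) (bitWeight ½ 0ℚ)) (cong₂ _+_ (∑-bits 0ℚ ½ (3 N.+ J)) (∑-bits ½ 0ℚ (3 N.+ J)))) ⟩
   S + (pow ½ (3 N.+ J) + pow ½ (3 N.+ J)) ≤⟨ +-monoʳ-≤ S (≡≤ᵣ (lem ½ y)
                   (≤≡ᵣ (*-monoʳ (0≤pow 0≤½ (suc J)) half≤1) (*-identityˡ y))) ⟩
   S + y ∎
   where
   open ≤-Reasoning
   all = lists (3 N.+ J) bits
   half≤1 : ½ * ½ + ½ * ½ ≤ 1ℚ
   half≤1 = ≤≡ᵣ (≤+ʳ 0≤½) refl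
   lem : ∀ h y -> h * (h * y) + h * (h * y) ≡ (h * h + h * h) * y
   lem = solve-∀ ring
   one-letter : ∀ u -> ¬ (1 N.≤ #P u × 1 N.≤ #Q u) -> bitWeight ½ ½ u ≤ bitWeight 0ℚ ½ u + bitWeight ½ 0ℚ u
   one-letter u ¬both with #P u | #Q u
   ... | zero | q = ≤+ʳ {pow ½ 0 * pow ½ q} {pow ½ 0 * pow 0ℚ q} (0≤* 0≤1 (0≤pow ≤-refl q))
   ... | suc p | zero = ≤+ˡ {pow 0ℚ (suc p) * 1ℚ} {pow ½ (suc p) * 1ℚ} (0≤* (0≤pow ≤-refl (suc p)) 0≤1)
   ... | suc p | suc q = absurd (s≤s z≤n , s≤s z≤n) ¬both

 -- Truncating the block lengths loses ½^(J+1), and restricting the separators loses at most 3 ·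
 -- ½^(J+1).
 totalWeight-≥ : ι 3 ≤ totalWeight J + ι 4 * recip J
 totalWeight-≥ = begin
  ι 3 ≡⟨ ∑-blocks-½ (suc J) ⟨
  D + y ≤⟨ +-monoˡ-≤ y (≡≤ᵣ (sym (*-identityʳ D)) (*-monoˡ 0≤D 1≤S+y)) ⟩
  D * (S + y) + y ≡⟨ l1 D S y ⟩
  D * S + (D * y + 1ℚ * y) ≤⟨ +-monoʳ-≤ (D * S) (+-monoˡ-≤ (1ℚ * y) (*-monoʳ (0≤pow 0≤½ (suc J)) D≤3)) ⟩
  D * S + (ι 3 * y + 1ℚ * y) ≡⟨ cong₂ _+_ (sym totalWeight≡) (trans (sym (*-distribʳ-+ y (ι 3) 1ℚ)) (cong (_* y) (trans (cong (λ z -> ι 3 + z) (sym ι-1)) (sym (ι-+ 3 1))))) ⟩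
  totalWeight J + ι 4 * y ≤⟨ +-monoʳ-≤ (totalWeight J) (*-monoˡ (0≤ι 4) (≤-trans (½^≤recip (suc J)) (recip-anti (n≤1+n J)))) ⟩
  totalWeight J + ι 4 * recip J ∎
  where
  open ≤-Reasoning
  0≤D : 0ℚ ≤ D
  0≤D = 0≤* (0≤ι 2) (∑ᵣ-nonneg (upTo (3 N.+ J)) (λ b -> 0≤pow 0≤½ (len b)))
  D≤3 : D ≤ ι 3
  D≤3 = ≤≡ᵣ (≤+ʳ {D} {y} (0≤pow 0≤½ (suc J))) (∑-blocks-½ (suc J))
  l1 : ∀ d s y -> d * (s + y) + y ≡ d * s + (d * y + 1ℚ * y)
  l1 = solve-∀ ring

0≤tagWeight : ∀ t -> 0ℚ ≤ tagWeight t
0≤tagWeight (b , u) = 0≤* (0≤ι 2) (0≤* (0≤pow 0≤½ (len b)) (0≤bitWeight 0≤½ 0≤½ u))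

tagLimit : List Tag -> ℚ
tagLimit σ = limit (length σ) (Σlen σ) (ΣP σ N.+ ΣQ σ)

tagLimit≡ : ∀ σ -> tagLimit σ ≡ inv (length σ) * weights tagWeight σ
tagLimit≡ σ = cong (inv (length σ) *_) (powers σ)
 where
 powers : ∀ σ -> pow (ι 2) (length σ) * pow ½ (Σlen σ N.+ (ΣP σ N.+ ΣQ σ)) ≡ weights tagWeight σ
 powers [] = *-identityˡ 1ℚ
 powers ((b , u) ∷ σ) = begin
  ι 2 * pow (ι 2) (length σ) * pow ½ (len b N.+ L N.+ (#P u N.+ ΣP σ N.+ (#Q u N.+ ΣQ σ)))
   ≡⟨ cong (λ x -> ι 2 * pow (ι 2) (length σ) * pow ½ x) (l1 (len b) L (#P u) (ΣP σ) (#Q u) (ΣQ σ)) ⟩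
  ι 2 * pow (ι 2) (length σ) * pow ½ (len b N.+ (#P u N.+ #Q u) N.+ R)
   ≡⟨ cong (ι 2 * pow (ι 2) (length σ) *_) (trans (pow-+ ½ (len b N.+ (#P u N.+ #Q u)) R)
      (cong (_* pow ½ R) (trans (pow-+ ½ (len b) (#P u N.+ #Q u)) (cong (pow ½ (len b) *_) (pow-+ ½ (#P u) (#Q u)))))) ⟩
  ι 2 * pow (ι 2) (length σ) * (pow ½ (len b) * bitWeight ½ ½ u * pow ½ R)
   ≡⟨ l2 (ι 2) (pow (ι 2) (length σ)) (pow ½ (len b) * bitWeight ½ ½ u) (pow ½ R) ⟩
  tagWeight (b , u) * (pow (ι 2) (length σ) * pow ½ R)
   ≡⟨ cong (tagWeight (b , u) *_) (powers σ) ⟩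
  tagWeight (b , u) * weights tagWeight σ ∎
  where
  open ≡-Reasoning
  L R : ℕ
  L = Σlen σ
  R = L N.+ (ΣP σ N.+ ΣQ σ)
  l1 : ∀ b l p p' q q' -> b N.+ l N.+ (p N.+ p' N.+ (q N.+ q')) ≡ b N.+ (p N.+ q) N.+ (l N.+ (p' N.+ q'))
  l1 = ℕ-ring
  l2 : ∀ t p w r -> t * p * (w * r) ≡ t * w * (p * r)
  l2 = solve-∀ ring

∑-tagLimit : ∀ J C -> ∑ᵣ (lists≤ C (separatedTags J)) tagLimit ≡ exp (totalWeight J) C
∑-tagLimit J C = trans (∑ᵣ-cong (lists≤ C (separatedTags J)) tagLimit≡) (trans (∑-lists≤ (separatedTags J) tagWeight inv C)
 (partial-cong (λ c -> *-comm (inv c) (pow (totalWeight J) c)) C))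

lists≤-unique : {A : Set} {xs : List A} -> Unique xs -> ∀ c -> Unique (lists≤ c xs)
lists≤-unique u zero = [] ∷ []
lists≤-unique {xs = xs} u (suc c) = All.tabulate nonempty ∷ Unique.cartesianProductWith⁺ _∷_ (λ eq -> List.∷-injectiveˡ eq , List.∷-injectiveʳ eq) u (lists≤-unique u c)
 where
 nonempty : ∀ {ys} -> ys ∈ cartesianProductWith _∷_ xs (lists≤ c xs) -> [] ≢ ys
 nonempty ys∈ refl with _ , _ , _ , _ , () ← ∈-cartesianProductWith⁻ _∷_ xs (lists≤ c xs) ys∈

∈-lists≤⁻ : {A : Set} {xs : List A} -> ∀ c {ys} -> ys ∈ lists≤ c xs -> length ys N.≤ c × All (_∈ xs) ys
∈-lists≤⁻ zero (here refl) = z≤n , []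
∈-lists≤⁻ (suc c) (here refl) = z≤n , []
∈-lists≤⁻ {xs = xs} (suc c) (there ys∈) with y , ys , y∈ , ys∈' , refl ← ∈-cartesianProductWith⁻ _∷_ xs (lists≤ c xs) ys∈ =
 let (l≤ , all) = ∈-lists≤⁻ c ys∈' in s≤s l≤ , y∈ ∷ all

#P+#Q : ∀ u -> #P u N.+ #Q u ≡ length u
#P+#Q [] = refl
#P+#Q (true ∷ u) = cong suc (#P+#Q u)
#P+#Q (false ∷ u) = trans (+-suc (#P u) (#Q u)) (cong suc (#P+#Q u))

module _ (J : ℕ) where

 private
  G : ℕ
  G = 3 N.+ J

 separatedTags-unique : Unique (separatedTags J)
 separatedTags-unique = Unique.cartesianProductWith⁺ _,_ ,-injective (Unique.upTo⁺ G)
  (Unique.filter⁺ bothLetters? (lists-unique (((λ ()) ∷ []) ∷ [] ∷ []) G))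

 ∈-separatedTags : ∀ {t} -> t ∈ separatedTags J -> Separating (proj₂ t) × length (proj₂ t) ≡ G × len (proj₁ t) N.≤ G
 ∈-separatedTags t∈ with b , u , b∈ , u∈ , refl ← ∈-cartesianProductWith⁻ _,_ (upTo G) (separators J) t∈ =
  let (u∈' , 1≤P , 1≤Q) = ∈-filter⁻ bothLetters? {xs = lists G bits} u∈
      length≡ = proj₁ (∈-lists⁻ {xs = bits} G u∈')
  in record { 1≤#P = 1≤P ; 1≤#Q = 1≤Q ; 3≤ = ≤≡ (m≤m+n 3 J) (sym (trans (#P+#Q u) length≡)) }
   , length≡ , N.≤-trans (len-≤ b) (∈-upTo⁻ b∈)
  where
  len-≤ : ∀ b -> len b N.≤ suc b
  len-≤ zero = N.≤-refl
  len-≤ (suc l) = n≤1+n (suc l)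

 Σ-bounds : ∀ {σ} -> All (_∈ separatedTags J) σ -> Σlen σ N.≤ length σ N.* G × ΣP σ N.≤ length σ N.* G × ΣQ σ N.≤ length σ N.* G
 Σ-bounds [] = z≤n , z≤n , z≤n
 Σ-bounds {(b , u) ∷ σ} (t∈ ∷ σ∈) =
  let (_ , length≡ , len≤) = ∈-separatedTags t∈
      (l , p , q) = Σ-bounds σ∈
      total = trans (#P+#Q u) length≡
  in N.+-mono-≤ len≤ l
   , N.+-mono-≤ (≤≡ (m≤m+n (#P u) (#Q u)) total) p
   , N.+-mono-≤ (≤≡ (m≤n+m (#Q u) (#P u)) total) q

 module _ (C : ℕ) where

  private
   σs : List (List Tag)
   σs = lists≤ C (separatedTags J)

   -- `T` bounds, for every tag list of the family, the number of prescribed values and the edges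
   -- fixed on either path; 8 T is the resulting constant in the switching error.
   T K : ℕ
   T = C N.* G N.+ C N.* G
   K = 8 N.* T

   δ : ℕ -> ℚ
   δ N = ι K * recip (N ∸ suc T)

   0≤δ : ∀ N -> 0ℚ ≤ δ N
   0≤δ N = 0≤* (0≤ι K) (0≤recip (N ∸ suc T))

   δ≤ : ∀ N -> δ N ≤ ι K * recip 0
   δ≤ N = *-monoˡ (0≤ι K) (recip-anti z≤n)

   t : List Tag -> ℕ -> ℚ
   t σ = letterCoef (ΣP σ) (ΣQ σ) (length σ) (Σlen σ)

   ℓ : ℕ -> ℚ
   ℓ N = φ 0 N + - δ N

   bounds : ∀ {σ} -> σ ∈ σs -> Σlen σ N.≤ C N.* G × ΣP σ N.≤ C N.* G × ΣQ σ N.≤ C N.* G × length σ N.≤ C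
   bounds σ∈ =
    let (l≤ , all) = ∈-lists≤⁻ C σ∈
        (l , p , q) = Σ-bounds all
        widen = *-monoˡ-≤ G l≤
           in N.≤-trans l widen , N.≤-trans p widen , N.≤-trans q widen , l≤

   exact : ∀ N -> 1 N.≤ N -> suc T N.≤ N -> ∀ {σ} -> σ ∈ σs -> ∀ w -> endP w 0 ≡ N -> endQ w 0 ≡ N ->
       length (assignment w 0 0) ≡ Σlen σ N.+ length σ -> Spread w 0 0 -> ℓ N ≤ ι (WordCount.matching N w) * inv (suc N ∸ (Σlen σ N.+ length σ))
   exact N 1≤N T<N {σ} σ∈ w p q t≡ spread = +-cancelʳ (δ N) (begin
    φ 0 N + - δ N + δ N ≡⟨ lem (φ 0 N) (δ N) ⟩
    φ 0 N ≤⟨ subst (λ t -> φ 0 N ≤ ι (WordCount.matching N w) * inv (suc N ∸ t) + ι (8 N.* t) * recip (N ∸ suc T)) t≡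
                    (WordCount.matching-≥-φ N w p q (N ∸ suc T) spread (s≤s enough)) ⟩
    m + ι (8 N.* s) * recip (N ∸ suc T) ≤⟨ +-monoʳ-≤ m (*-monoʳ (0≤recip (N ∸ suc T)) (ι-mono (*-monoʳ-≤ 8 s≤T))) ⟩
    m + δ N ∎)
    where
    open ≤-Reasoning
    s = Σlen σ N.+ length σ
    m = ι (WordCount.matching N w) * inv (suc N ∸ s)
    lem : ∀ a d -> a + - d + d ≡ a
    lem = solve-∀ ring
    s≤T : s N.≤ T
    s≤T = let (l , _ , _ , l≤) = bounds σ∈ in N.+-mono-≤ l (N.≤-trans l≤ (N.m≤m*n C G))
    enough : suc (N ∸ suc T) N.+ length (assignment w 0 0) N.≤ N
    enough = ≤≡ (N.+-monoʳ-≤ (suc (N ∸ suc T)) (≡≤ t≡ s≤T))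
     (trans (sym (+-suc (N ∸ suc T) T)) (N.m∸n+n≡m T<N))

   ratio-bound : ∀ N' -> suc T N.≤ suc N' -> ∑ᵣ σs (λ σ -> t σ (suc N') * ℓ (suc N')) ≤ ratio N'
   ratio-bound N' T<N = SecondMoment.ratio-≥ N' G σs (lists≤-unique separatedTags-unique C)
    (λ σ∈ ->
     let (l , p , q , _) = bounds σ∈
         all = proj₂ (∈-lists≤⁻ C σ∈)
         T≤N = N.≤-trans (n≤1+n T) T<N
          in All.map (proj₁ ∘ ∈-separatedTags) all , All.map (proj₁ ∘ proj₂ ∘ ∈-separatedTags) all
           , N.≤-trans (N.+-mono-≤ l p) T≤N , N.≤-trans (N.+-mono-≤ l q) T≤N)
    (ℓ (suc N')) (exact (suc N') (s≤s z≤n) T<N)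

   vanishing : ∀ σ -> (λ N -> t σ N * δ N) ≲ (λ _ -> 0ℚ)
   vanishing σ = ≲-trans {λ N -> t σ N * δ N} {λ N -> tagLimit σ * δ N} {λ _ -> 0ℚ}
    (≲-*-bounded {t σ} {λ _ -> tagLimit σ} {δ} (ι K * recip 0) 0≤δ δ≤ (letterCoef-≲ (ΣP σ) (ΣQ σ) (length σ) (Σlen σ)))
    (≲-cong {λ N -> δ N * tagLimit σ} {λ N -> tagLimit σ * δ N} {λ _ -> 0ℚ * tagLimit σ} {λ _ -> 0ℚ} (λ N -> *-comm (tagLimit σ) (δ N)) (λ _ -> *-zeroˡ (tagLimit σ))
     (≲-*ʳ {δ} {λ _ -> 0ℚ} (tagLimit σ) (0≤limit (length σ) (Σlen σ) (ΣP σ N.+ ΣQ σ)) (≲-recip K (suc T))))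

   A B D Z : ℕ -> ℚ
   A N = ∑ᵣ σs (λ σ -> tagLimit σ * φ 0 N)
   B N = ∑ᵣ σs (λ σ -> t σ N * φ 0 N)
   D N = ∑ᵣ σs (λ σ -> t σ N * ℓ N)
   Z N = ∑ᵣ σs (λ σ -> t σ N * δ N)

   A≲B : A ≲ B
   A≲B = ≲-∑ σs (λ σ N -> tagLimit σ * φ 0 N) (λ σ N -> t σ N * φ 0 N)
    (λ {σ} _ -> ≲-*-bounded {λ _ -> tagLimit σ} {t σ} {φ 0} 1ℚ (0≤φ 0) (φ≤1 0) (letterCoef-≳ (ΣP σ) (ΣQ σ) (length σ) (Σlen σ)))

   B≡ : ∀ N -> B N ≡ D N + Z N
   B≡ N = trans (∑ᵣ-cong σs (λ σ -> lem (t σ N) (φ 0 N) (δ N))) (∑ᵣ-+ σs (λ σ -> t σ N * ℓ N) (λ σ -> t σ N * δ N))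
    where
    lem : ∀ t p d -> t * p ≡ t * (p + - d) + t * d
    lem = solve-∀ ring

   Z≲0 : Z ≲ (λ _ -> 0ℚ)
   Z≲0 = ≲-cong {Z} {Z} {λ _ -> ∑ᵣ σs (λ _ -> 0ℚ)} {λ _ -> 0ℚ} (λ _ -> refl) (λ _ -> ∑ᵣ-zero σs) (≲-∑ σs (λ σ N -> t σ N * δ N) (λ _ _ -> 0ℚ) (λ {σ} _ -> vanishing σ))

   A≲D : A ≲ D
   A≲D = ≲-trans {A} {B} {D} A≲B (≲-cong {λ N -> D N + Z N} {B} {λ N -> D N + 0ℚ} {D} B≡ (λ N -> +-identityʳ (D N))
    (≲-+ {D} {D} {Z} {λ _ -> 0ℚ} (≲-refl {D}) Z≲0))

  -- For fixed J and C the family of tag lists is finite, so coefficients and switching errors may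
  -- pass to the limit term by term; `∑-tagLimit` evaluates the limit.
  exp-totalWeight-≲-ratio : (λ N' -> φ 0 (suc N') * exp (totalWeight J) C) ≲ ratio
  exp-totalWeight-≲-ratio ε 0<ε = eventually-map close (eventually-× (Eventually-suc (A≲D ε 0<ε)) (eventually-≥ T))
   where
   open ≤-Reasoning
   close : ∀ N' -> A (suc N') ≤ D (suc N') + ε × T N.≤ N' -> φ 0 (suc N') * exp (totalWeight J) C ≤ ratio N' + ε
   close N' (A≤D , T≤) = begin
    φ 0 (suc N') * exp (totalWeight J) C ≡⟨ trans (*-comm (φ 0 (suc N')) (exp (totalWeight J) C)) (cong (_* φ 0 (suc N')) (sym (∑-tagLimit J C))) ⟩
    ∑ᵣ σs tagLimit * φ 0 (suc N') ≡⟨ ∑ᵣ-*ʳ σs (φ 0 (suc N')) tagLimit ⟨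
    A (suc N') ≤⟨ A≤D ⟩
    D (suc N') + ε ≤⟨ +-monoˡ-≤ ε (ratio-bound N' (s≤s T≤)) ⟩
    ratio N' + ε ∎

exp-≤ : ∀ {d} -> 0ℚ ≤ d -> ∀ K -> exp d K ≤ 1ℚ + d * exp d K
exp-≤ {d} 0≤d zero = ≡≤ᵣ (trans (*-identityˡ (inv 0)) inv-0) (≤+ʳ {1ℚ} {d * exp d 0} (0≤* 0≤d (0≤exp 0≤d 0)))
exp-≤ {d} 0≤d (suc K) = +-mono-≤ (≤-reflexive (trans (*-identityˡ (inv 0)) inv-0)) (begin
 partial (λ n -> expTerm d (suc n)) K ≤⟨ partial-mono smaller K ⟩
 partial (λ n -> d * expTerm d n) K ≡⟨ partial-* d (expTerm d) K ⟩
 d * exp d K ≤⟨ *-monoˡ 0≤d (partial-≤ {expTerm d} (0≤expTerm 0≤d) (n≤1+n K)) ⟩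
 d * exp d (suc K) ∎)
 where
 open ≤-Reasoning
 recip≤1 : ∀ n -> recip n ≤ 1ℚ
 recip≤1 n = ≤≡ᵣ (recip-anti {0} {n} z≤n) (recip≡ 0)
 smaller : ∀ n -> expTerm d (suc n) ≤ d * expTerm d n
 smaller n = begin
  d * pow d n * inv (suc n) ≡⟨ trans (*-assoc d (pow d n) (inv (suc n))) (cong (λ x -> d * (pow d n * x)) (inv-suc n)) ⟩
  d * (pow d n * (recip n * inv n)) ≤⟨ *-monoˡ 0≤d (*-monoˡ (0≤pow 0≤d n) (≤≡ᵣ (*-monoʳ (0≤inv n) (recip≤1 n)) (*-identityˡ (inv n)))) ⟩
  d * expTerm d n ∎

-- ι 3 exceeds totalWeight J by at most d, and exp (x + d) ≤ exp x (1 + 81 d).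
exp-3-≤ : ∀ J C -> exp (ι 3) C ≤ exp (totalWeight J) C + ι 8748 * recip J
exp-3-≤ J C = case ≤-total (exp (ι 3) C) (exp Ω C) of λ where
  (inj₁ ≤Ω) -> ≤-trans ≤Ω (≤+ʳ {exp Ω C} {ι 8748 * recip J} (0≤* (0≤ι 8748) (0≤recip J)))
  (inj₂ Ω≤) -> far Ω≤
 where
 open ≤-Reasoning
 Ω d : ℚ
 Ω = totalWeight J
 d = ι 4 * recip J
 0≤Ω : 0ℚ ≤ Ω
 0≤Ω = ∑ᵣ-nonneg (separatedTags J) 0≤tagWeight
 0≤d : 0ℚ ≤ d
 0≤d = 0≤* (0≤ι 4) (0≤recip J)
 d≤4 : d ≤ ι 4
 d≤4 = ≤≡ᵣ (*-monoˡ (0≤ι 4) (≤≡ᵣ (recip-anti {0} {J} z≤n) (recip≡ 0))) (*-identityʳ (ι 4))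
 -- The hypothesis takes the place of an upper bound on Ω. It gives exp Ω ≤ exp 3 ≤ 27, and exp d ≤
 -- exp 4 ≤ 81, whence 8748 = 27 · 81 · 4.
 far : exp Ω C ≤ exp (ι 3) C -> exp (ι 3) C ≤ exp Ω C + ι 8748 * recip J
 far Ω≤ = begin
  exp (ι 3) C ≤⟨ exp-mono (0≤ι 3) (totalWeight-≥ J) C ⟩
  exp (Ω + d) C ≤⟨ exp-+-≤ 0≤Ω 0≤d C ⟩
  exp Ω C * exp d C ≤⟨ *-monoˡ (0≤exp 0≤Ω C) (exp-≤ 0≤d C) ⟩
  exp Ω C * (1ℚ + d * exp d C) ≡⟨ lem (exp Ω C) d (exp d C) ⟩
  exp Ω C + exp Ω C * exp d C * d ≤⟨ +-monoʳ-≤ (exp Ω C) (*-monoʳ 0≤d (*-mono (0≤exp 0≤Ω C) (0≤ι 81)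
                (≤-trans Ω≤ (exp-ι-≤ 3 C)) (≤-trans (exp-mono 0≤d d≤4 C) (exp-ι-≤ 4 C)))) ⟩
  exp Ω C + ι 27 * ι 81 * (ι 4 * recip J) ≡⟨ cong (λ x -> exp Ω C + x) (trans (sym (*-assoc (ι 27 * ι 81) (ι 4) (recip J))) (cong (_* recip J) (trans (cong (_* ι 4) (sym (ι-* 27 81))) (sym (ι-* 2187 4))))) ⟩
  exp Ω C + ι 8748 * recip J ∎
  where
  lem : ∀ w d e -> w * (1ℚ + d * e) ≡ w + w * e * d
  lem = solve-∀ ring

ι-2+1 : ι 2 + 1ℚ ≡ ι 3
ι-2+1 = trans (cong (λ x -> ι 2 + x) (sym ι-1)) (sym (ι-+ 2 1))

-- Multiplies the bound 1 ≲ `φ 0` exp 2 + 2 / (J + 1) by exp 1 and uses exp 2 · exp 1 ≤ exp 3 with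
-- the cut-off J + J. The constant is 8754 = 8748 + 2 · 3, from `exp-3-≤` and exp 1 ≤ 3.
ratio-lower : ∀ J -> (λ _ -> exp 1ℚ J) ≲ (λ N' -> ratio N' + ι 8754 * recip J)
ratio-lower J = ≲-trans {λ _ -> exp 1ℚ J} {b} {λ N' -> ratio N' + ι 8754 * recip J} first
 (≲-+ {λ N' -> φ 0 (suc N') * exp (totalWeight J) (J N.+ J)} {ratio} {λ _ -> ι 8754 * recip J} {λ _ -> ι 8754 * recip J}
  (exp-totalWeight-≲-ratio J (J N.+ J)) (≲-refl {λ _ -> ι 8754 * recip J}))
 where
 open ≤-Reasoning
 E1 E2 r : ℚ
 E1 = exp 1ℚ J
 E2 = exp (ι 2) J
 r = recip J
 0≤E₁ : 0ℚ ≤ E1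
 0≤E₁ = 0≤exp 0≤1 J
 b : ℕ -> ℚ
 b N' = φ 0 (suc N') * exp (totalWeight J) (J N.+ J) + ι 8754 * r
 product : ∀ N -> (φ 0 N * E2 + ι 2 * r) * E1 ≤ φ 0 N * exp (totalWeight J) (J N.+ J) + ι 8754 * r
 product N = begin
  (p * E2 + ι 2 * r) * E1 ≡⟨ l1 p E2 (ι 2) r E1 ⟩
  p * (E2 * E1) + ι 2 * E1 * r ≤⟨ +-mono-≤ (*-monoˡ (0≤φ 0 N) (≤≡ᵣ (exp-+-≥ (0≤ι 2) 0≤1 J J) (cong (λ x -> exp x (J N.+ J)) ι-2+1)))
                (*-monoʳ (0≤recip J) (*-monoˡ (0≤ι 2) (exp-1≤3 J))) ⟩
  p * exp (ι 3) (J N.+ J) + ι 2 * ι 3 * r ≤⟨ +-monoˡ-≤ (ι 2 * ι 3 * r) (*-monoˡ (0≤φ 0 N) (exp-3-≤ J (J N.+ J))) ⟩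
  p * (w + ι 8748 * r) + ι 2 * ι 3 * r ≡⟨ l2 p w (ι 8748) r (ι 2 * ι 3) ⟩
  p * w + (p * (ι 8748 * r) + ι 2 * ι 3 * r) ≤⟨ +-monoʳ-≤ (p * w) (+-monoˡ-≤ (ι 2 * ι 3 * r) (≤≡ᵣ (*-monoʳ (0≤* (0≤ι 8748) (0≤recip J)) (φ≤1 0 N)) (*-identityˡ (ι 8748 * r)))) ⟩
  p * w + (ι 8748 * r + ι 2 * ι 3 * r) ≡⟨ cong (λ x -> p * w + x) (trans (sym (*-distribʳ-+ r (ι 8748) (ι 2 * ι 3))) (cong (_* r) (trans (cong (λ x -> ι 8748 + x) (sym (ι-* 2 3))) (sym (ι-+ 8748 6))))) ⟩
  p * w + ι 8754 * r ∎
  where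
  p w : ℚ
  p = φ 0 N
  w = exp (totalWeight J) (J N.+ J)
  l1 : ∀ p a t r b -> (p * a + t * r) * b ≡ p * (a * b) + t * b * r
  l1 = solve-∀ ring
  l2 : ∀ p w c r s -> p * (w + c * r) + s * r ≡ p * w + (p * (c * r) + s * r)
  l2 = solve-∀ ring
 first : (λ _ -> E1) ≲ b
 first ε 0<ε = eventually-map (λ N' p -> ≤-trans p (+-monoˡ-≤ ε (product (suc N')))) (Eventually-suc (scaled ε 0<ε))
  where
  scaled : (λ _ -> E1) ≲ (λ N -> (φ 0 N * E2 + ι 2 * r) * E1)
  scaled = ≲-cong {λ _ -> 1ℚ * E1} {λ _ -> E1} {λ N -> (φ 0 N * E2 + ι 2 * r) * E1} {λ N -> (φ 0 N * E2 + ι 2 * r) * E1} (λ _ -> sym (*-identityˡ E1)) (λ _ -> refl)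
   (≲-*ʳ {λ _ -> 1ℚ} {λ N -> φ 0 N * E2 + ι 2 * r} E1 0≤E₁ (φ₀*exp-≥ J))

-- Upper bound, uniform in the number of common edges

choose : {P : Set} -> Dec P -> ℚ -> ℚ -> ℚ
choose (yes _) a b = a
choose (no _) a b = b

choose-yes : {P : Set} (p? : Dec P) {a b : ℚ} -> P -> choose p? a b ≡ a
choose-yes (yes _) p = refl
choose-yes (no ¬p) p = absurd p ¬p

choose-no : {P : Set} (p? : Dec P) {a b : ℚ} -> ¬ P -> choose p? a b ≡ b
choose-no (yes p) ¬p = absurd p ¬p
choose-no (no _) ¬p = refl

choose-elim : {P : Set} (R : ℚ -> Set) (p? : Dec P) {a b : ℚ} -> (P -> R a) -> (¬ P -> R b) -> R (choose p? a b)
choose-elim R (yes p) f g = f p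
choose-elim R (no ¬p) f g = g ¬p

plain : ℕ -> ℕ -> ℕ -> ℚ
plain N c k = coef (N ∸ k) (N ∸ k) c ((N ∸ k) N.+ (N ∸ k) N.+ k) (suc N ∸ (k N.+ c)) N

0≤plain : ∀ N c k -> 0ℚ ≤ plain N c k
0≤plain N c k = 0≤coef (N ∸ k) (N ∸ k) c ((N ∸ k) N.+ (N ∸ k) N.+ k) (suc N ∸ (k N.+ c)) N

plain≡letterCoef : ∀ N c k -> plain N c k ≡ letterCoef 0 0 c k N
plain≡letterCoef N c k = cong₂ (λ M s -> coef M M c s (suc N ∸ (k N.+ c)) N) (cong (N ∸_) (sym (N.+-identityʳ k)))
 (cong (N._+ k) (cong₂ N._+_ M≡ M≡))
 where
 M≡ : N ∸ k ≡ N ∸ (k N.+ 0) N.+ 0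
 M≡ = trans (cong (N ∸_) (sym (N.+-identityʳ k))) (sym (N.+-identityʳ _))

plain-split : ∀ c k M -> plain (k N.+ M) c k ≡ coef M M c (M N.+ M N.+ k) (suc M ∸ c) (k N.+ M)
plain-split c k M = cong₂ (λ m r -> coef m m c (m N.+ m N.+ k) r (k N.+ M)) (N.m+n∸m≡n k M)
 (trans (sym (N.∸-+-assoc (suc (k N.+ M)) k c)) (cong (_∸ c) (trans (cong (_∸ k) (sym (+-suc k M))) (N.m+n∸m≡n k (suc M)))))

plain-decay : ∀ N c k -> k N.≤ N -> k N.+ c N.≤ suc N -> N N.≤ 128 N.* (N ∸ k) -> plain N c k ≤ inv c * (pow (ι 243) c * pow (ι 128 * recip 128) k)
plain-decay N c k k≤N k+c≤ N≤ = subst (λ N -> plain N c k ≤ B) split (subst (_≤ B) (sym (plain-split c k M))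
 (coef-decay c k M (N.+-cancelˡ-≤ k c (suc M) (≤≡ k+c≤ (trans (cong suc (sym split)) (sym (+-suc k M))))) (≡≤ split N≤)))
 where
 M = N ∸ k
 B = inv c * (pow (ι 243) c * pow (ι 128 * recip 128) k)
 split : k N.+ M ≡ N
 split = m+[n∸m]≡n k≤N

-- ½ᴹ⁻ᵍ, or 0 if M < g
shiftedPow : ℕ -> ℕ -> ℚ
shiftedPow zero M = pow ½ M
shiftedPow (suc g) zero = 0ℚ
shiftedPow (suc g) (suc M) = shiftedPow g M

0≤shiftedPow : ∀ g M -> 0ℚ ≤ shiftedPow g M
0≤shiftedPow zero M = 0≤pow 0≤½ M
0≤shiftedPow (suc g) zero = ≤-refl
0≤shiftedPow (suc g) (suc M) = 0≤shiftedPow g M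

shiftedPow-+ : ∀ g h -> shiftedPow g (g N.+ h) ≡ pow ½ h
shiftedPow-+ zero h = refl
shiftedPow-+ (suc g) h = shiftedPow-+ g h

partial-shiftedPow : ∀ g N -> partial (shiftedPow g) N ≤ ι 2
partial-shiftedPow zero N = *-cancelˡ {½} {partial (pow ½) N} {ι 2} (positive⁻¹ ½) (begin
 ½ * partial (pow ½) N ≤⟨ ≤+ʳ {½ * partial (pow ½) N} {pow ½ (suc N)} (0≤pow 0≤½ (suc N)) ⟩
 ½ * partial (pow ½) N + pow ½ (suc N) ≡⟨ geometric {½} {½} refl N ⟩
 1ℚ ≡⟨ ½*2 ⟨
 ½ * ι 2 ∎)
 where open ≤-Reasoning
partial-shiftedPow (suc g) zero = 0≤ι 2
partial-shiftedPow (suc g) (suc N) = ≡≤ᵣ (+-identityˡ (partial (shiftedPow g) N)) (partial-shiftedPow g N)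

partial-reverse : ∀ f N -> partial (λ k -> f (N ∸ k)) N ≡ partial f N
partial-reverse f zero = refl
partial-reverse f (suc N) = trans (cong (λ z -> f (suc N) + z) (partial-reverse f N)) (trans (+-comm (f (suc N)) (partial f N)) (sym (partial-suc f N)))

partial-zero : ∀ {f} -> (∀ n -> f n ≤ 0ℚ) -> ∀ N -> partial f N ≤ 0ℚ
partial-zero f≤0 zero = f≤0 0
partial-zero f≤0 (suc N) = ≤≡ᵣ (+-mono-≤ (f≤0 0) (partial-zero (f≤0 ∘ suc) N)) (+-identityˡ 0ℚ)

partial-truncate : ∀ {f g} K -> (∀ n -> 0ℚ ≤ f n) -> (∀ n -> g n ≤ f n) -> (∀ n -> K N.< n -> g n ≤ 0ℚ) -> ∀ N -> partial g N ≤ partial f K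
partial-truncate {f} {g} zero 0≤f g≤f g≤0 zero = g≤f 0
partial-truncate {f} {g} (suc K) 0≤f g≤f g≤0 zero = ≤-trans (g≤f 0) (≤+ʳ {f 0} {partial (f ∘ suc) K} (0≤partial (0≤f ∘ suc) K))
partial-truncate {f} {g} zero 0≤f g≤f g≤0 (suc N) = ≤≡ᵣ (+-mono-≤ (g≤f 0) (partial-zero (λ n -> g≤0 (suc n) (s≤s z≤n)) N)) (+-identityʳ (f 0))
partial-truncate {f} {g} (suc K) 0≤f g≤f g≤0 (suc N) = +-mono-≤ (g≤f 0) (partial-truncate K (0≤f ∘ suc) (g≤f ∘ suc) (λ n K<n -> g≤0 (suc n) (s≤s K<n)) N)

few? : ∀ N c k -> Dec (k N.≤ N × k N.+ c N.≤ suc N × 128 N.* (N ∸ k) N.< N)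
few? N c k = (k N.≤? N) ×-dec ((k N.+ c N.≤? suc N) ×-dec (128 N.* (N ∸ k) N.<? N))

few : ℕ -> ℕ -> ℕ -> ℚ
few N c k = choose (few? N c k) (plain N c k) 0ℚ

0≤few : ∀ N c k -> 0ℚ ≤ few N c k
0≤few N c k = choose-elim (0ℚ ≤_) (few? N c k) (λ _ -> 0≤plain N c k) (λ _ -> ≤-refl)

-- `σ` serves as a list of length g + 1 through which the multinomial coefficient is read as a
-- number of words, so that `words-count-≤` can bound it.
few-compositions-≤ : ∀ N g k (σ : List Tag) -> length σ ≡ suc g ->
 ι (compositions (upTo (suc N)) (suc g) k) * few N (suc g) k ≤ recip N * (ι 6 * expTerm (ι 54) g) * shiftedPow g (N ∸ k)
few-compositions-≤ N g k σ length≡ = choose-elim (λ x -> ι C * x ≤ R) (few? N (suc g) k)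
 (λ (k≤N , k+c≤ , M<N) -> bound-at (N ∸ k) (m+[n∸m]≡n k≤N) (N.≤-pred (N.+-cancelˡ-≤ k (suc g) (suc (N ∸ k))
  (≤≡ k+c≤ (trans (cong suc (sym (m+[n∸m]≡n k≤N))) (sym (+-suc k (N ∸ k))))))) M<N)
 (λ _ -> ≡≤ᵣ (ℚ.*-zeroʳ (ι C)) 0≤R)
 where
 C = compositions (upTo (suc N)) (suc g) k
 R = recip N * (ι 6 * expTerm (ι 54) g) * shiftedPow g (N ∸ k)
 0≤R : 0ℚ ≤ R
 0≤R = 0≤* (0≤* (0≤recip N) (0≤* (0≤ι 6) (0≤expTerm (0≤ι 54) g))) (0≤shiftedPow g (N ∸ k))
 lem : ∀ e s r -> e * s * r ≡ r * e * s
 lem = solve-∀ ring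
 bound-at : ∀ M -> k N.+ M ≡ N -> g N.≤ M -> 128 N.* M N.< N -> ι C * plain N (suc g) k ≤ recip N * (ι 6 * expTerm (ι 54) g) * shiftedPow g M
 bound-at M refl g≤M M<N with h , refl ← N.m≤n⇒∃[o]m+o≡n g≤M = begin
  ι C * plain (k N.+ (g N.+ h)) (suc g) k
   ≡⟨ cong (ι C *_) (plain-split (suc g) k (g N.+ h)) ⟩
  ι C * coef (g N.+ h) (g N.+ h) (suc g) (g N.+ h N.+ (g N.+ h) N.+ k) (suc (g N.+ h) ∸ suc g) (k N.+ (g N.+ h))
   ≤⟨ few-letters-≤ g h k C σ length≡ M<N (compositions-≤ (suc (k N.+ (g N.+ h))) g k) ⟩
  ι 6 * expTerm (ι 54) g * pow ½ h * recip (k N.+ (g N.+ h))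
   ≡⟨ trans (lem (ι 6 * expTerm (ι 54) g) (pow ½ h) (recip (k N.+ (g N.+ h)))) (cong (recip (k N.+ (g N.+ h)) * (ι 6 * expTerm (ι 54) g) *_) (sym (shiftedPow-+ g h))) ⟩
  recip (k N.+ (g N.+ h)) * (ι 6 * expTerm (ι 54) g) * shiftedPow g (g N.+ h) ∎
  where open ≤-Reasoning

tagsBelow : ℕ -> List Tag
tagsBelow N = map (_, []) (upTo (suc N))

-- The lists are grouped by their number k of edges. Each path then has N - k letters of its own,
-- and the shifted powers of ½ sum to at most 2, whence 12 = 6 · 2.
∑-few-≤ : ∀ N g -> ∑ᵣ (lists (suc g) (tagsBelow N)) (λ σ -> few N (suc g) (Σlen σ)) ≤ recip N * (ι 12 * expTerm (ι 54) g)
∑-few-≤ N g = begin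
 ∑ᵣ σs (λ σ -> few N (suc g) (Σlen σ))
  ≤⟨ ∑ᵣ-mono σs by-length ⟩
 ∑ᵣ σs (λ σ -> ∑ᵣ (upTo (suc N)) (λ k -> ι ⟦ Σlen σ N.≟ k ⟧ * few N (suc g) k))
  ≡⟨ ∑ᵣ-swap σs (upTo (suc N)) (λ σ k -> ι ⟦ Σlen σ N.≟ k ⟧ * few N (suc g) k) ⟩
 ∑ᵣ (upTo (suc N)) (λ k -> ∑ᵣ σs (λ σ -> ι ⟦ Σlen σ N.≟ k ⟧ * few N (suc g) k))
  ≡⟨ ∑ᵣ-cong (upTo (suc N)) (λ k -> trans (∑ᵣ-*ʳ σs (few N (suc g) k) (λ σ -> ι ⟦ Σlen σ N.≟ k ⟧)) (cong (_* few N (suc g) k) (sym (∑ᵣ-ι σs (λ σ -> ⟦ Σlen σ N.≟ k ⟧))))) ⟩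
 ∑ᵣ (upTo (suc N)) (λ k -> ι (compositions (upTo (suc N)) (suc g) k) * few N (suc g) k)
  ≤⟨ ∑ᵣ-mono (upTo (suc N)) (λ k -> few-compositions-≤ N g k (σ0 (suc g)) (σ₀-length (suc g))) ⟩
 ∑ᵣ (upTo (suc N)) (λ k -> a * shiftedPow g (N ∸ k))
  ≡⟨ trans (∑ᵣ-*ˡ (upTo (suc N)) a (λ k -> shiftedPow g (N ∸ k))) (cong (a *_) (trans (∑ᵣ-upTo N (λ k -> shiftedPow g (N ∸ k))) (partial-reverse (shiftedPow g) N))) ⟩
 a * partial (shiftedPow g) N
  ≤⟨ *-monoˡ 0≤a (partial-shiftedPow g N) ⟩
 a * ι 2
  ≡⟨ lem (recip N) (ι 6) (expTerm (ι 54) g) (ι 2) ⟩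
 recip N * (ι 6 * ι 2 * expTerm (ι 54) g)
  ≡⟨ cong (λ x -> recip N * (x * expTerm (ι 54) g)) (sym (ι-* 6 2)) ⟩
 recip N * (ι 12 * expTerm (ι 54) g) ∎
 where
 open ≤-Reasoning
 σs = lists (suc g) (tagsBelow N)
 a = recip N * (ι 6 * expTerm (ι 54) g)
 0≤a : 0ℚ ≤ a
 0≤a = 0≤* (0≤recip N) (0≤* (0≤ι 6) (0≤expTerm (0≤ι 54) g))
 lem : ∀ r s e t -> r * (s * e) * t ≡ r * (s * t * e)
 lem = solve-∀ ring
 σ0 : ℕ -> List Tag
 σ0 zero = []
 σ0 (suc c) = (0 , []) ∷ σ0 c
 σ₀-length : ∀ c -> length (σ0 c) ≡ c
 σ₀-length zero = refl
 σ₀-length (suc c) = cong suc (σ₀-length c)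
 term≤ : ∀ {x : ℕ} {xs} (f : ℕ -> ℚ) -> (∀ y -> 0ℚ ≤ f y) -> x ∈ xs -> f x ≤ ∑ᵣ xs f
 term≤ {xs = x ∷ xs} f 0≤f (here refl) = ≤+ʳ {f x} {∑ᵣ xs f} (∑ᵣ-nonneg xs 0≤f)
 term≤ {xs = x ∷ xs} f 0≤f (there x∈) = ≤-trans (term≤ f 0≤f x∈) (≤+ˡ {f x} {∑ᵣ xs f} (0≤f x))
 by-length : ∀ σ -> few N (suc g) (Σlen σ) ≤ ∑ᵣ (upTo (suc N)) (λ k -> ι ⟦ Σlen σ N.≟ k ⟧ * few N (suc g) k)
 by-length σ = case Σlen σ N.≤? N of λ where
   (yes k≤N) -> ≡≤ᵣ (sym (trans (cong (_* few N (suc g) (Σlen σ)) (trans (cong ι (⟦⟧-yes (Σlen σ N.≟ Σlen σ) refl)) ι-1)) (*-identityˡ _)))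
    (term≤ (λ k -> ι ⟦ Σlen σ N.≟ k ⟧ * few N (suc g) k) 0≤term (∈-upTo⁺ (s≤s k≤N)))
   (no k≰N) -> ≡≤ᵣ (choose-no (few? N (suc g) (Σlen σ)) (k≰N ∘ proj₁)) (∑ᵣ-nonneg (upTo (suc N)) 0≤term)
  where
  0≤term : ∀ k -> 0ℚ ≤ ι ⟦ Σlen σ N.≟ k ⟧ * few N (suc g) k
  0≤term k = 0≤* (0≤ι ⟦ Σlen σ N.≟ k ⟧) (0≤few N (suc g) k)

∑∑-few-≤ : ∀ N -> 1 N.≤ N -> ∑ᵣ (upTo (suc N)) (λ c -> ∑ᵣ (lists c (tagsBelow N)) (λ σ -> few N c (Σlen σ))) ≤ ι (12 N.* 3 N.^ 54) * recip N
∑∑-few-≤ N@(suc N') _ = begin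
 ∑ᵣ (upTo (suc N)) Z ≡⟨ ∑ᵣ-upTo N Z ⟩
 Z 0 + partial (Z ∘ suc) N' ≤⟨ +-mono-≤ Z₀≤0 (partial-mono (∑-few-≤ N) N') ⟩
 0ℚ + partial (λ g -> recip N * (ι 12 * expTerm (ι 54) g)) N'
  ≡⟨ trans (+-identityˡ _) (trans (partial-* (recip N) (λ g -> ι 12 * expTerm (ι 54) g) N') (cong (recip N *_) (partial-* (ι 12) (expTerm (ι 54)) N'))) ⟩
 recip N * (ι 12 * exp (ι 54) N') ≤⟨ *-monoˡ (0≤recip N) (*-monoˡ (0≤ι 12) (exp-ι-≤ 54 N')) ⟩
 recip N * (ι 12 * ι (3 N.^ 54)) ≡⟨ trans (*-comm (recip N) (ι 12 * ι (3 N.^ 54))) (cong (_* recip N) (sym (ι-* 12 (3 N.^ 54)))) ⟩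
 ι (12 N.* 3 N.^ 54) * recip N ∎
 where
 open ≤-Reasoning
 Z : ℕ -> ℚ
 Z c = ∑ᵣ (lists c (tagsBelow N)) (λ σ -> few N c (Σlen σ))
 -- Without blocks each path keeps all its N edges, which is incompatible with keeping fewer than N
 -- / 128.
 Z₀≤0 : Z 0 ≤ 0ℚ
 Z₀≤0 = ≤-reflexive (trans (+-identityʳ (few N 0 0)) (choose-no (few? N 0 0) (λ (_ , _ , N<N) -> N.<⇒≱ N<N (m≤n*m N 128))))

-- Geometric decay in the number of common edges: 128/129 = (256/257)(257/258)

θ χ : ℚ
θ = ι 256 * recip 256
χ = ι 257 * recip 257

0≤θ : 0ℚ ≤ θ
0≤θ = 0≤* (0≤ι 256) (0≤recip 256)

0≤χ : 0ℚ ≤ χ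
0≤χ = 0≤* (0≤ι 257) (0≤recip 257)

χ≤1 : χ ≤ 1ℚ
χ≤1 = subst (χ ≤_) (ι-recip 257) (*-monoʳ (0≤recip 257) (ι-mono (n≤1+n 257)))

θχ≡ : ι 128 * recip 128 ≡ θ * χ
θχ≡ = trans (cong₂ _*_ (ι≡ 128) (recip≡ 128)) (sym (cong₂ _*_ (cong₂ _*_ (ι≡ 256) (recip≡ 256)) (cong₂ _*_ (ι≡ 257) (recip≡ 257))))

pow-antitone : ∀ {a} -> 0ℚ ≤ a -> a ≤ 1ℚ -> ∀ m n -> pow a (m N.+ n) ≤ pow a m
pow-antitone {a} 0≤a a≤1 m n = ≡≤ᵣ (pow-+ a m n) (≤≡ᵣ (*-monoˡ (0≤pow 0≤a m) (pow-≤1 0≤a a≤1 n)) (*-identityʳ (pow a m)))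

-- The power of χ is frozen at the cut-off K, where it is small for large K, while the power of θ
-- keeps the sum over all block lengths convergent.
decay-≤ : ∀ {K k} -> K N.≤ k -> pow (ι 128 * recip 128) k ≤ pow χ K * pow θ k
decay-≤ {K} {k} K≤k = begin
 pow (ι 128 * recip 128) k ≡⟨ trans (cong (λ a -> pow a k) θχ≡) (pow-* θ χ k) ⟩
 pow θ k * pow χ k ≤⟨ *-monoˡ (0≤pow 0≤θ k) (subst (λ k -> pow χ k ≤ pow χ K) (m+[n∸m]≡n K≤k) (pow-antitone 0≤χ χ≤1 K (k ∸ K))) ⟩
 pow θ k * pow χ K ≡⟨ *-comm (pow θ k) (pow χ K) ⟩
 pow χ K * pow θ k ∎
 where open ≤-Reasoning

-- The quantity (257 + K) χ^K starts at 257 and never increases, as `ratio-step` shows.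
pow-χ-≤ : ∀ K -> pow χ K ≤ ι 257 * recip K
pow-χ-≤ K = *-cancelˡ {ι (suc K)} {pow χ K} {ι 257 * recip K} (0<ι (s≤s z≤n)) (begin
 ι (suc K) * pow χ K ≤⟨ *-monoʳ (0≤pow 0≤χ K) (ι-mono (N.+-monoˡ-≤ K {1} {257} (s≤s z≤n))) ⟩
 ι (257 N.+ K) * pow χ K ≤⟨ bernoulli K ⟩
 ι 257 ≡⟨ trans (lem (ι (suc K)) (ι 257) (recip K)) (trans (cong (ι 257 *_) (ι-recip K)) (*-identityʳ (ι 257))) ⟨
 ι (suc K) * (ι 257 * recip K) ∎)
 where
 open ≤-Reasoning
 lem : ∀ a b r -> a * (b * r) ≡ b * (a * r)
 lem = solve-∀ ring
 ratio-step : ∀ K -> 257 N.* (257 N.+ suc K) N.≤ 258 N.* (257 N.+ K)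
 ratio-step K = ≤≡ (m≤m+n (257 N.* (257 N.+ suc K)) K) (lem' K)
  where
  lem' : ∀ K -> 257 N.* (257 N.+ suc K) N.+ K ≡ 258 N.* (257 N.+ K)
  lem' = ℕ-ring
 bernoulli : ∀ K -> ι (257 N.+ K) * pow χ K ≤ ι 257
 bernoulli zero = ≤-reflexive (*-identityʳ (ι 257))
 bernoulli (suc K) = begin
  ι (257 N.+ suc K) * (ι 257 * recip 257 * pow χ K) ≡⟨ l1 (ι (257 N.+ suc K)) (ι 257) (recip 257) (pow χ K) ⟩
  ι 257 * ι (257 N.+ suc K) * (recip 257 * pow χ K) ≤⟨ *-monoʳ (0≤* (0≤recip 257) (0≤pow 0≤χ K)) (subst₂ _≤_ (ι-* 257 (257 N.+ suc K)) (ι-* 258 (257 N.+ K)) (ι-mono (ratio-step K))) ⟩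
  ι 258 * ι (257 N.+ K) * (recip 257 * pow χ K) ≡⟨ l2 (ι 258) (ι (257 N.+ K)) (recip 257) (pow χ K) ⟩
  ι 258 * recip 257 * (ι (257 N.+ K) * pow χ K) ≡⟨ trans (cong (_* (ι (257 N.+ K) * pow χ K)) (ι-recip 257)) (*-identityˡ _) ⟩
  ι (257 N.+ K) * pow χ K ≤⟨ bernoulli K ⟩
  ι 257 ∎
  where
  l1 : ∀ a b r p -> a * (b * r * p) ≡ b * a * (r * p)
  l1 = solve-∀ ring
  l2 : ∀ a b r p -> a * b * (r * p) ≡ a * r * (b * p)
  l2 = solve-∀ ring

∑-blocks-½-≤ : ∀ n -> ι 2 * ∑-blocks ½ n ≤ ι 3
∑-blocks-½-≤ n = ≤≡ᵣ (*-monoˡ (0≤ι 2) (*-cancelˡ {½} {∑-blocks ½ n} {1ℚ + ½} (positive⁻¹ ½) (∑-blocks-≤ {½} {½} 0≤½ refl 0≤½ n)))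
 (trans (cong (_* (1ℚ + ½)) (ι≡ 2)) (sym (ι≡ 3)))

∑-blocks-θ-≤ : ∀ n -> ∑-blocks θ n ≤ ι 258
∑-blocks-θ-≤ n = *-cancelˡ {recip 256} {∑-blocks θ n} {ι 258} (0<recip 256) (begin
 recip 256 * ∑-blocks θ n ≤⟨ ∑-blocks-≤ {θ} {recip 256} 0≤θ θ+ (0≤recip 256) n ⟩
 θ * (1ℚ + recip 256) ≤⟨ *-monoʳ (0≤+ 0≤1 (0≤recip 256)) θ≤1 ⟩
 1ℚ * (1ℚ + recip 256) ≡⟨ trans (*-identityˡ (1ℚ + recip 256)) (cong (_+ recip 256) (sym (ι-recip 256))) ⟩
 ι 257 * recip 256 + recip 256 ≡⟨ trans (lem (ι 257) (recip 256)) (cong (recip 256 *_) (sym (ι-suc 257))) ⟩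
 recip 256 * ι 258 ∎)
 where
 open ≤-Reasoning
 lem : ∀ a r -> a * r + r ≡ r * (1ℚ + a)
 lem = solve-∀ ring
 lem' : ∀ a r -> a * r + r ≡ (1ℚ + a) * r
 lem' = solve-∀ ring
 θ+ : θ + recip 256 ≡ 1ℚ
 θ+ = trans (lem' (ι 256) (recip 256)) (trans (cong (_* recip 256) (sym (ι-suc 256))) (ι-recip 256))
 θ≤1 : θ ≤ 1ℚ
 θ≤1 = ≤≡ᵣ (≤+ʳ {θ} {recip 256} (0≤recip 256)) θ+

abstract
 -- Abstract because 3 ^ `growthRate` occurs in the bounds below and must never be computed.
 growthRate : ℕ
 growthRate = 243 N.* 258

 growthRate≡ : ι 243 * ι 258 ≡ ι growthRate
 growthRate≡ = sym (ι-* 243 258)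

decayTerm : ℕ -> ℕ -> ℕ -> ℚ
decayTerm K c k = inv c * (pow (ι 243) c * (pow χ K * pow θ k))

0≤decayTerm : ∀ K c k -> 0ℚ ≤ decayTerm K c k
0≤decayTerm K c k = 0≤* (0≤inv c) (0≤* (0≤pow (0≤ι 243) c) (0≤* (0≤pow 0≤χ K) (0≤pow 0≤θ k)))

∑-decayTerm-≤ : ∀ K N c -> ∑ᵣ (lists c (tagsBelow N)) (λ σ -> decayTerm K c (Σlen σ)) ≤ pow χ K * expTerm (ι growthRate) c
∑-decayTerm-≤ K N c = begin
 ∑ᵣ σs (λ σ -> inv c * (pow (ι 243) c * (pow χ K * pow θ (Σlen σ))))
  ≡⟨ trans (∑ᵣ-*ˡ σs (inv c) (λ σ -> pow (ι 243) c * (pow χ K * pow θ (Σlen σ)))) (cong (inv c *_)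
     (trans (∑ᵣ-*ˡ σs (pow (ι 243) c) (λ σ -> pow χ K * pow θ (Σlen σ))) (cong (pow (ι 243) c *_)
     (trans (∑ᵣ-*ˡ σs (pow χ K) (λ σ -> pow θ (Σlen σ))) (cong (pow χ K *_) (∑-pow-Σlen θ N c)))))) ⟩
 inv c * (pow (ι 243) c * (pow χ K * pow (∑-blocks θ N) c))
  ≤⟨ *-monoˡ (0≤inv c) (*-monoˡ (0≤pow (0≤ι 243) c) (*-monoˡ (0≤pow 0≤χ K) (pow-mono (∑ᵣ-nonneg (upTo (suc N)) (λ b -> 0≤pow 0≤θ (len b))) (∑-blocks-θ-≤ N) c))) ⟩
 inv c * (pow (ι 243) c * (pow χ K * pow (ι 258) c))
  ≡⟨ lem (inv c) (pow (ι 243) c) (pow χ K) (pow (ι 258) c) ⟩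
 pow χ K * (pow (ι 243) c * pow (ι 258) c * inv c)
  ≡⟨ cong (λ x -> pow χ K * (x * inv c)) (trans (sym (pow-* (ι 243) (ι 258) c)) (cong (λ a -> pow a c) growthRate≡)) ⟩
 pow χ K * expTerm (ι growthRate) c ∎
 where
 open ≤-Reasoning
 σs = lists c (tagsBelow N)
 lem : ∀ i a x b -> i * (a * (x * b)) ≡ x * (a * b * i)
 lem = solve-∀ ring

∑-limit-≤ : ∀ N c -> ∑ᵣ (lists c (tagsBelow N)) (λ σ -> limit c (Σlen σ) 0) ≤ expTerm (ι 3) c
∑-limit-≤ N c = begin
 ∑ᵣ σs (λ σ -> inv c * (pow (ι 2) c * pow ½ (Σlen σ N.+ 0)))
  ≡⟨ ∑ᵣ-cong σs (λ σ -> cong (λ k -> inv c * (pow (ι 2) c * pow ½ k)) (N.+-identityʳ (Σlen σ))) ⟩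
 ∑ᵣ σs (λ σ -> inv c * (pow (ι 2) c * pow ½ (Σlen σ)))
  ≡⟨ trans (∑ᵣ-*ˡ σs (inv c) (λ σ -> pow (ι 2) c * pow ½ (Σlen σ))) (cong (inv c *_)
     (trans (∑ᵣ-*ˡ σs (pow (ι 2) c) (λ σ -> pow ½ (Σlen σ))) (cong (pow (ι 2) c *_) (∑-pow-Σlen ½ N c)))) ⟩
 inv c * (pow (ι 2) c * pow (∑-blocks ½ N) c)
  ≡⟨ trans (cong (inv c *_) (sym (pow-* (ι 2) (∑-blocks ½ N) c))) (*-comm (inv c) (pow (ι 2 * ∑-blocks ½ N) c)) ⟩
 pow (ι 2 * ∑-blocks ½ N) c * inv c
  ≤⟨ *-monoʳ (0≤inv c) (pow-mono (0≤* (0≤ι 2) (∑ᵣ-nonneg (upTo (suc N)) (λ b -> 0≤pow 0≤½ (len b)))) (∑-blocks-½-≤ N) c) ⟩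
 expTerm (ι 3) c ∎
 where
 open ≤-Reasoning
 σs = lists c (tagsBelow N)

module _ (K : ℕ) where

 private
  small? : ∀ c k -> Dec (k N.≤ K × c N.≤ K)
  small? c k = (k N.≤? K) ×-dec (c N.≤? K)

  a : ℕ -> ℚ
  a N = φ 0 N + ι (9 N.* (K N.+ K)) * recip (N ∸ suc (K N.+ K))

  0≤a : ∀ N -> 0ℚ ≤ a N
  0≤a N = 0≤+ (0≤φ 0 N) (0≤* (0≤ι (9 N.* (K N.+ K))) (0≤recip (N ∸ suc (K N.+ K))))

  π : ℕ -> ℕ -> ℕ -> ℚ
  π N k c = choose (small? c k) (a N) 1ℚ

  0≤π : ∀ N k c -> 0ℚ ≤ π N k c
  0≤π N k c = choose-elim (0ℚ ≤_) (small? c k) (λ _ -> 0≤a N) (λ _ -> 0≤1)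

  π-bound : ∀ N -> suc (K N.+ K) N.≤ N -> ∀ w k c -> endP w 0 ≡ N -> endQ w 0 ≡ N -> length (assignment w 0 0) ≡ k N.+ c -> Valid (suc N) (assignment w 0 0) ->
       ι (WordCount.matching N w) * inv (suc N ∸ (k N.+ c)) ≤ π N k c
  π-bound N K<N w k c p q t≡ valid = choose-elim (ι m * inv (suc N ∸ (k N.+ c)) ≤_) (small? c k)
   (λ (k≤K , c≤K) -> small (N.+-mono-≤ k≤K c≤K))
   (λ _ -> subst (λ t -> ι m * inv (suc N ∸ t) ≤ 1ℚ) t≡ (≤≡ᵣ (*-monoʳ (0≤inv (suc N ∸ length (assignment w 0 0))) (ι-mono (WordCount.valid-≤ N w p q valid)))
        (ι-inv (suc N ∸ length (assignment w 0 0)))))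
   where
   m = WordCount.matching N w
   small : k N.+ c N.≤ K N.+ K -> ι m * inv (suc N ∸ (k N.+ c)) ≤ a N
   small t≤ = ≤-trans (subst (λ t -> ι m * inv (suc N ∸ t) ≤ φ 0 N + ι (9 N.* t) * recip (N ∸ suc (K N.+ K))) t≡
     (WordCount.matching-≤-φ N w p q (N ∸ suc (K N.+ K)) valid (s≤s enough)))
    (+-monoʳ-≤ (φ 0 N) (*-monoʳ (0≤recip (N ∸ suc (K N.+ K))) (ι-mono (*-monoʳ-≤ 9 t≤))))
    where
    enough : suc (N ∸ suc (K N.+ K)) N.+ length (assignment w 0 0) N.≤ N
    enough = ≤≡ (N.+-monoʳ-≤ (suc (N ∸ suc (K N.+ K))) (≡≤ t≡ t≤))
     (trans (sym (+-suc (N ∸ suc (K N.+ K)) (K N.+ K))) (N.m∸n+n≡m K<N))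

  length≤Σlen : ∀ σ -> length σ N.≤ Σlen σ
  length≤Σlen [] = z≤n
  length≤Σlen ((b , u) ∷ σ) = N.+-mono-≤ (1≤len b) (length≤Σlen σ)
   where
   1≤len : ∀ b -> 1 N.≤ len b
   1≤len zero = s≤s z≤n
   1≤len (suc l) = s≤s z≤n

  Close : ℚ -> ℕ -> Set
  Close ε N = ∀ {c} -> c ∈ upTo (suc K) -> ∀ {k} -> k ∈ upTo (suc K) -> letterCoef 0 0 c k N ≤ limit c k 0 * (1ℚ + ε)

  eventually-close : ∀ ε -> 0ℚ < ε -> Eventually (Close ε)
  eventually-close ε 0<ε = eventually-∈ (upTo (suc K)) λ {c} _ -> eventually-∈ (upTo (suc K)) λ {k} _ ->
   eventually-map (λ _ -> proj₁) (eventually-letterCoef 0 0 c k ε 0<ε)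

  module _ (ε : ℚ) (0≤ε : 0ℚ ≤ ε) (N : ℕ) (close : Close ε N) where

   main : ℕ -> ℕ -> ℚ
   main c k = choose (c N.≤? K) (a N * (1ℚ + ε) * limit c k 0) 0ℚ

   0≤a1+ε : 0ℚ ≤ a N * (1ℚ + ε)
   0≤a1+ε = 0≤* (0≤a N) (0≤+ 0≤1 0≤ε)

   0≤main : ∀ c k -> 0ℚ ≤ main c k
   0≤main c k = choose-elim (0ℚ ≤_) (c N.≤? K) (λ _ -> 0≤* 0≤a1+ε (0≤limit c k 0)) (λ _ -> ≤-refl)

   -- For k ≤ K also c ≤ K, and the nearly exact estimate goes to `main`. For k > K the probability
   -- is bounded by 1, and the coefficient is a `decayTerm` or a `few` according to whether N ≤ 128
   -- (N - k).
   term-≤ : ∀ c k -> c N.≤ k -> k N.≤ N -> k N.+ c N.≤ suc N -> plain N c k * π N k c ≤ main c k + (decayTerm K c k + few N c k)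
   term-≤ c k c≤k k≤N k+c≤ = case k N.≤? K of λ where
     (yes k≤K) -> short k≤K
     (no k≰K) -> long (N.≰⇒> k≰K)
    where
    open ≤-Reasoning
    0≤D : 0ℚ ≤ decayTerm K c k
    0≤D = 0≤decayTerm K c k
    0≤F : 0ℚ ≤ few N c k
    0≤F = 0≤few N c k
    lem : ∀ l e a -> l * e * a ≡ a * e * l
    lem = solve-∀ ring
    short : k N.≤ K -> plain N c k * π N k c ≤ main c k + (decayTerm K c k + few N c k)
    short k≤K = begin
     plain N c k * π N k c ≡⟨ cong₂ _*_ (plain≡letterCoef N c k) (choose-yes (small? c k) {a N} {1ℚ} (k≤K , c≤K)) ⟩
     letterCoef 0 0 c k N * a N ≤⟨ *-monoʳ (0≤a N) (close (∈-upTo⁺ (s≤s c≤K)) (∈-upTo⁺ (s≤s k≤K))) ⟩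
     limit c k 0 * (1ℚ + ε) * a N ≡⟨ trans (lem (limit c k 0) (1ℚ + ε) (a N)) (sym (choose-yes (c N.≤? K) c≤K)) ⟩
     main c k ≤⟨ ≤+ʳ {main c k} {decayTerm K c k + few N c k} (0≤+ 0≤D 0≤F) ⟩
     main c k + (decayTerm K c k + few N c k) ∎
     where
     c≤K = N.≤-trans c≤k k≤K
    long : K N.< k -> plain N c k * π N k c ≤ main c k + (decayTerm K c k + few N c k)
    long K<k = begin
     plain N c k * π N k c ≡⟨ trans (cong (plain N c k *_) (choose-no (small? c k) {a N} {1ℚ} (λ (k≤K , _) -> N.<⇒≱ K<k k≤K))) (*-identityʳ (plain N c k)) ⟩
     plain N c k ≤⟨ regimes ⟩
     decayTerm K c k + few N c k ≤⟨ ≤+ˡ {main c k} {decayTerm K c k + few N c k} (0≤main c k) ⟩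
     main c k + (decayTerm K c k + few N c k) ∎
     where
     regimes : plain N c k ≤ decayTerm K c k + few N c k
     regimes = case N N.≤? 128 N.* (N ∸ k) of λ where
      (yes N≤) -> ≤-trans (≤-trans (plain-decay N c k k≤N k+c≤ N≤) (*-monoˡ (0≤inv c) (*-monoˡ (0≤pow (0≤ι 243) c) (decay-≤ (N.<⇒≤ K<k)))))
       (≤+ʳ {decayTerm K c k} {few N c k} 0≤F)
      (no N≰) -> ≡≤ᵣ (sym (choose-yes (few? N c k) (k≤N , k+c≤ , N.≰⇒> N≰))) (≤+ˡ {decayTerm K c k} {few N c k} 0≤D)

   per-c : ∀ c -> ∑ᵣ (lists c (tagsBelow N)) (λ σ -> ι ⟦ (Σlen σ N.≤? N) ×-dec (Σlen σ N.+ c N.≤? suc N) ⟧ * (plain N c (Σlen σ) * π N (Σlen σ) c)) ≤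
       choose (c N.≤? K) (a N * (1ℚ + ε) * expTerm (ι 3) c) 0ℚ + (pow χ K * expTerm (ι growthRate) c + ∑ᵣ (lists c (tagsBelow N)) (λ σ -> few N c (Σlen σ)))
   per-c c = begin
    ∑ᵣ σs (λ σ -> ι ⟦ (Σlen σ N.≤? N) ×-dec (Σlen σ N.+ c N.≤? suc N) ⟧ * (plain N c (Σlen σ) * π N (Σlen σ) c))
     ≤⟨ ∑ᵣ-mono-∈ σs (λ {σ} σ∈ -> per-σ σ (≡≤ (sym (proj₁ (∈-lists⁻ c σ∈))) (length≤Σlen σ))) ⟩
    ∑ᵣ σs (λ σ -> main c (Σlen σ) + (decayTerm K c (Σlen σ) + few N c (Σlen σ)))
     ≡⟨ trans (∑ᵣ-+ σs (λ σ -> main c (Σlen σ)) (λ σ -> decayTerm K c (Σlen σ) + few N c (Σlen σ)))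
        (cong (λ z -> ∑ᵣ σs (λ σ -> main c (Σlen σ)) + z) (∑ᵣ-+ σs (λ σ -> decayTerm K c (Σlen σ)) (λ σ -> few N c (Σlen σ)))) ⟩
    ∑ᵣ σs (λ σ -> main c (Σlen σ)) + (∑ᵣ σs (λ σ -> decayTerm K c (Σlen σ)) + F)
     ≤⟨ +-mono-≤ ∑-main-≤ (+-monoˡ-≤ F (∑-decayTerm-≤ K N c)) ⟩
    choose (c N.≤? K) (a N * (1ℚ + ε) * expTerm (ι 3) c) 0ℚ + (pow χ K * expTerm (ι growthRate) c + F) ∎
    where
    open ≤-Reasoning
    σs = lists c (tagsBelow N)
    F = ∑ᵣ σs (λ σ -> few N c (Σlen σ))
    per-σ : ∀ σ -> c N.≤ Σlen σ -> ι ⟦ (Σlen σ N.≤? N) ×-dec (Σlen σ N.+ c N.≤? suc N) ⟧ * (plain N c (Σlen σ) * π N (Σlen σ) c) ≤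
        main c (Σlen σ) + (decayTerm K c (Σlen σ) + few N c (Σlen σ))
    per-σ σ c≤ = indicated ((Σlen σ N.≤? N) ×-dec (Σlen σ N.+ c N.≤? suc N)) (0≤+ (0≤main c (Σlen σ)) (0≤+ (0≤decayTerm K c (Σlen σ)) (0≤few N c (Σlen σ))))
     (λ (k≤N , k+c≤) -> term-≤ c (Σlen σ) c≤ k≤N k+c≤)
     where
     indicated : {P : Set} (p? : Dec P) {x y : ℚ} -> 0ℚ ≤ y -> (P -> x ≤ y) -> ι ⟦ p? ⟧ * x ≤ y
     indicated p? {x} {y} 0≤y h = case p? of λ where
      (yes p) -> ≡≤ᵣ (trans (cong (_* x) (trans (cong ι (⟦⟧-yes p? p)) ι-1)) (*-identityˡ x)) (h p)
      (no ¬p) -> ≡≤ᵣ (trans (cong (_* x) (trans (cong ι (⟦⟧-no p? ¬p)) ι-0)) (*-zeroˡ x)) 0≤y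
    ∑-main-≤ : ∑ᵣ σs (λ σ -> main c (Σlen σ)) ≤ choose (c N.≤? K) (a N * (1ℚ + ε) * expTerm (ι 3) c) 0ℚ
    ∑-main-≤ = case c N.≤? K of λ where
     (yes c≤K) -> ≡≤ᵣ (trans (∑ᵣ-cong σs (λ σ -> choose-yes (c N.≤? K) c≤K)) (∑ᵣ-*ˡ σs (a N * (1ℚ + ε)) (λ σ -> limit c (Σlen σ) 0)))
      (≤≡ᵣ (*-monoˡ 0≤a1+ε (∑-limit-≤ N c)) (sym (choose-yes (c N.≤? K) c≤K)))
     (no c≰K) -> ≤-reflexive (trans (trans (∑ᵣ-cong σs (λ σ -> choose-no (c N.≤? K) c≰K)) (∑ᵣ-zero σs)) (sym (choose-no (c N.≤? K) c≰K)))

   total-bound : 1 N.≤ N ->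
    ∑ᵣ (upTo (suc N)) (λ c -> ∑ᵣ (lists c (tagsBelow N)) (λ σ -> ι ⟦ (Σlen σ N.≤? N) ×-dec (Σlen σ N.+ c N.≤? suc N) ⟧ * (plain N c (Σlen σ) * π N (Σlen σ) c))) ≤
    a N * (1ℚ + ε) * exp (ι 3) K + (pow χ K * ι (3 N.^ growthRate) + ι (12 N.* 3 N.^ 54) * recip N)
   total-bound 1≤N = begin
    ∑ᵣ cs (λ c -> ∑ᵣ (lists c (tagsBelow N)) (λ σ -> ι ⟦ (Σlen σ N.≤? N) ×-dec (Σlen σ N.+ c N.≤? suc N) ⟧ * (plain N c (Σlen σ) * π N (Σlen σ) c)))
     ≤⟨ ∑ᵣ-mono cs per-c ⟩
    ∑ᵣ cs (λ c -> X c + (Y c + Z c))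
     ≡⟨ trans (∑ᵣ-+ cs X (λ c -> Y c + Z c)) (cong (λ z -> ∑ᵣ cs X + z) (∑ᵣ-+ cs Y Z)) ⟩
    ∑ᵣ cs X + (∑ᵣ cs Y + ∑ᵣ cs Z)
     ≤⟨ +-mono-≤ X-≤ (+-mono-≤ Y-≤ (∑∑-few-≤ N 1≤N)) ⟩
    a N * (1ℚ + ε) * exp (ι 3) K + (pow χ K * ι (3 N.^ growthRate) + ι (12 N.* 3 N.^ 54) * recip N) ∎
    where
    open ≤-Reasoning
    cs = upTo (suc N)
    x : ℕ -> ℚ
    x c = a N * (1ℚ + ε) * expTerm (ι 3) c
    X Y Z : ℕ -> ℚ
    X c = choose (c N.≤? K) (x c) 0ℚ
    Y c = pow χ K * expTerm (ι growthRate) c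
    Z c = ∑ᵣ (lists c (tagsBelow N)) (λ σ -> few N c (Σlen σ))
    0≤x : ∀ c -> 0ℚ ≤ x c
    0≤x c = 0≤* 0≤a1+ε (0≤expTerm (0≤ι 3) c)
    X-≤ : ∑ᵣ cs X ≤ a N * (1ℚ + ε) * exp (ι 3) K
    X-≤ = ≡≤ᵣ (∑ᵣ-upTo N X) (≤≡ᵣ (partial-truncate {x} {X} K 0≤x
      (λ c -> choose-elim (_≤ x c) (c N.≤? K) (λ _ -> ≤-refl) (λ _ -> 0≤x c))
      (λ c K<c -> ≤-reflexive (choose-no (c N.≤? K) (N.<⇒≱ K<c))) N)
     (partial-* (a N * (1ℚ + ε)) (expTerm (ι 3)) K))
    Y-≤ : ∑ᵣ cs Y ≤ pow χ K * ι (3 N.^ growthRate)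
    Y-≤ = ≡≤ᵣ (trans (∑ᵣ-upTo N Y) (partial-* (pow χ K) (expTerm (ι growthRate)) N))
     (*-monoˡ (0≤pow 0≤χ K) (exp-ι-≤ growthRate N))

 exactBound : ℕ -> ℚ
 exactBound = a

 ratio-≤-eventually : ∀ ε -> 0ℚ < ε -> Eventually (λ N' -> ratio N' ≤
  exactBound (suc N') * (1ℚ + ε) * exp (ι 3) K + (pow χ K * ι (3 N.^ growthRate) + ι (12 N.* 3 N.^ 54) * recip (suc N')))
 ratio-≤-eventually ε 0<ε = eventually-map
  (λ N' (close , K<N) -> ≤-trans (SecondMoment.ratio-≤ N' (π (suc N')) (0≤π (suc N')) (π-bound (suc N') (s≤s K<N)))
   (total-bound ε (ℚ.<⇒≤ 0<ε) (suc N') close (s≤s z≤n)))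
  (eventually-× (Eventually-suc (eventually-close ε 0<ε)) (eventually-≥ (K N.+ K)))

open import Defs

-- From the two bounds to the limit

module _ (K : ℕ) where

 private
  E3 T X c : ℚ
  E3 = exp (ι 3) K
  T = ι (3 N.^ growthRate)
  X = pow χ K * T
  c = ι (9 N.* (K N.+ K))

  C : ℕ
  C = 12 N.* 3 N.^ 54

  0≤E₃ : 0ℚ ≤ E3
  0≤E₃ = 0≤exp (0≤ι 3) K

  0≤X : 0ℚ ≤ X
  0≤X = 0≤* (0≤pow 0≤χ K) (0≤ι (3 N.^ growthRate))

  rest b : ℕ -> ℚ
  rest N = X + ι C * recip N
  b N = exactBound K N * E3 + rest N

  0≤rest : ∀ N -> 0ℚ ≤ rest N
  0≤rest N = 0≤+ 0≤X (0≤* (0≤ι C) (0≤recip N))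

  b-bounded : ∀ N -> b N ≤ (1ℚ + c * recip 0) * E3 + (X + ι C * recip 0)
  b-bounded N = +-mono-≤ (*-monoʳ 0≤E₃ (+-mono-≤ (φ≤1 0 N) (*-monoˡ (0≤ι (9 N.* (K N.+ K))) (recip-anti z≤n))))
   (+-monoʳ-≤ X (*-monoˡ (0≤ι C) (recip-anti z≤n)))

  ratio-relative : ∀ ε -> 0ℚ < ε -> Eventually (λ N' -> ratio N' ≤ b (suc N') * (1ℚ + ε))
  ratio-relative ε 0<ε = eventually-map (λ N' le -> ≤-trans le (spread N')) (ratio-≤-eventually K ε 0<ε)
   where
   open ≤-Reasoning
   lem : ∀ a e x r -> a * (1ℚ + e) * x + r * (1ℚ + e) ≡ (a * x + r) * (1ℚ + e)
   lem = solve-∀ ring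
   spread : ∀ N' -> exactBound K (suc N') * (1ℚ + ε) * E3 + rest (suc N') ≤ b (suc N') * (1ℚ + ε)
   spread N' = begin
    A * (1ℚ + ε) * E3 + r ≤⟨ +-monoʳ-≤ (A * (1ℚ + ε) * E3) (≡≤ᵣ (sym (*-identityʳ r)) (*-monoˡ (0≤rest (suc N')) (≤+ʳ {1ℚ} {ε} (ℚ.<⇒≤ 0<ε)))) ⟩
    A * (1ℚ + ε) * E3 + r * (1ℚ + ε) ≡⟨ lem A ε E3 r ⟩
    b (suc N') * (1ℚ + ε) ∎
    where
    A r : ℚ
    A = exactBound K (suc N')
    r = rest (suc N')

  e1 : ℚ
  e1 = exp 1ℚ K

  b-≲ : b ≲ (λ _ -> e1 + X)
  b-≲ = ≲-+ {λ N -> exactBound K N * E3} {λ _ -> e1} {rest} {λ _ -> X}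
   (≲-trans {λ N -> exactBound K N * E3} {λ N -> φ 0 N * E3} {λ _ -> e1}
    (≲-*ʳ {exactBound K} {φ 0} E3 0≤E₃ (≲-cong {exactBound K} {exactBound K} {λ N -> φ 0 N + 0ℚ} {φ 0} (λ _ -> refl) (λ N -> +-identityʳ (φ 0 N))
     (≲-+ {φ 0} {φ 0} {λ N -> c * recip (N ∸ suc (K N.+ K))} {λ _ -> 0ℚ} (≲-refl {φ 0}) (≲-recip (9 N.* (K N.+ K)) (suc (K N.+ K))))))
    (≲-trans {λ N -> φ 0 N * E3} {λ N -> φ 0 N * exp (ι 2) K * e1} {λ _ -> e1}
     (≤⇒≲ {λ N -> φ 0 N * E3} {λ N -> φ 0 N * exp (ι 2) K * e1} (0 , λ N _ -> product N))
     (≲-cong {λ N -> φ 0 N * exp (ι 2) K * e1} {λ N -> φ 0 N * exp (ι 2) K * e1} {λ _ -> 1ℚ * e1} {λ _ -> e1} (λ _ -> refl) (λ _ -> *-identityˡ e1)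
      (≲-*ʳ {λ N -> φ 0 N * exp (ι 2) K} {λ _ -> 1ℚ} e1 (0≤exp 0≤1 K) (φ₀*exp-≤ K)))))
   (≲-cong {rest} {rest} {λ _ -> X + 0ℚ} {λ _ -> X} (λ _ -> refl) (λ _ -> +-identityʳ X)
    (≲-+ {λ _ -> X} {λ _ -> X} {λ N -> ι C * recip N} {λ _ -> 0ℚ} (≲-refl {λ _ -> X}) (≲-recip C 0)))
   where
   product : ∀ N -> φ 0 N * E3 ≤ φ 0 N * exp (ι 2) K * e1
   product N = ≤≡ᵣ (*-monoˡ (0≤φ 0 N) (≡≤ᵣ (cong (λ x -> exp x K) (sym ι-2+1)) (exp-+-≤ (0≤ι 2) 0≤1 K)))
    (sym (*-assoc (φ 0 N) (exp (ι 2) K) e1))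

 -- With K fixed, N tends to infinity first: `φ 0` exp 3 ≤ `φ 0` exp 2 · exp 1 leaves exp 1, and
 -- what survives of the many common edges is χ^K times a constant, hence O(1 / K) by `pow-χ-≤`.
 ratio-upper : ratio ≲ (λ _ -> exp 1ℚ K + ι (257 N.* 3 N.^ growthRate) * recip K)
 ratio-upper = ≲-trans {ratio} {λ N' -> b (suc N')} {λ _ -> e1 + ι (257 N.* 3 N.^ growthRate) * recip K}
  (≲-relative ratio (λ N' -> b (suc N')) ((1ℚ + c * recip 0) * E3 + (X + ι C * recip 0)) (0 , λ N' _ -> b-bounded (suc N')) ratio-relative)
  (≲-trans {λ N' -> b (suc N')} {λ _ -> e1 + X} {λ _ -> e1 + ι (257 N.* 3 N.^ growthRate) * recip K}
   (λ ε 0<ε -> Eventually-suc (b-≲ ε 0<ε))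
   (≤⇒≲ {λ _ -> e1 + X} {λ _ -> e1 + ι (257 N.* 3 N.^ growthRate) * recip K} (0 , λ _ _ -> +-monoʳ-≤ e1 X≤)))
  where
  lem : ∀ a r t -> a * r * t ≡ a * t * r
  lem = solve-∀ ring
  X≤ : X ≤ ι (257 N.* 3 N.^ growthRate) * recip K
  X≤ = ≤≡ᵣ (*-monoʳ (0≤ι (3 N.^ growthRate)) (pow-χ-≤ K)) (trans (lem (ι 257) (recip K) T) (cong (_* recip K) (sym (ι-* 257 (3 N.^ growthRate)))))

≤-from-∣∣ : ∀ {p q η} -> ∣ p - q ∣ ≤ η -> p ≤ q + η
≤-from-∣∣ {p} {q} {η} le = ≡≤ᵣ (lem p q) (+-monoʳ-≤ q (≤-trans (p≤∣p∣ (p - q)) le))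
 where
 lem : ∀ p q -> p ≡ q + (p - q)
 lem = solve-∀ ring
 p≤∣p∣ : ∀ p -> p ≤ ∣ p ∣
 p≤∣p∣ p = case ≤-total 0ℚ p of λ where
  (inj₁ 0≤p) -> ≤-reflexive (sym (ℚ.0≤p⇒∣p∣≡p 0≤p))
  (inj₂ p≤0) -> ≤-trans p≤0 (ℚ.0≤∣p∣ p)

∣∣-≤ : ∀ {p q η} -> p ≤ q + η -> q ≤ p + η -> ∣ p - q ∣ ≤ η
∣∣-≤ {p} {q} {η} p≤ q≤ = case ℚ.∣p∣≡p∨∣p∣≡-p (p - q) of λ where
  (inj₁ eq) -> ≡≤ᵣ eq (+-cancelʳ q (≡≤ᵣ (l1 p q) (≤≡ᵣ p≤ (+-comm q η))))
  (inj₂ eq) -> ≡≤ᵣ eq (+-cancelʳ p (≡≤ᵣ (l2 p q) (≤≡ᵣ q≤ (+-comm p η))))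
 where
 l1 : ∀ p q -> p - q + q ≡ p
 l1 = solve-∀ ring
 l2 : ∀ p q -> - (p - q) + p ≡ q
 l2 = solve-∀ ring

ratio-limit : ∀ ε -> 0ℚ < ε -> Eventually (λ N' -> ∃ λ K -> ∀ k -> K N.≤ k -> ratio N' ≤ e-sum k + ε × e-sum k ≤ ratio N' + ε)
ratio-limit ε 0<ε = eventually-map (λ N' (up , low) -> j , λ k j≤k -> above N' k j≤k up , below N' k j≤k low)
  (eventually-× (ratio-upper j η 0<η) (ratio-lower j η 0<η))
 where
 open ≤-Reasoning
 η : ℚ
 -- A quarter of ε covers the three errors: the tail of the series for e, the cut-off `j`, and the
 -- limit in N.
 η = ½ * (½ * ε)
 0<½ : 0ℚ < ½
 0<½ = positive⁻¹ ½
 0<η : 0ℚ < η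
 0<η = 0<* 0<½ (0<* 0<½ 0<ε)
 quarters : η + η + η ≤ ε
 quarters = ≤≡ᵣ (≤+ʳ {η + η + η} {η} (ℚ.<⇒≤ 0<η)) (trans (lem1 ½ (½ * ε)) (trans (lem2 ((1ℚ + 1ℚ) * ½) ½ ε) (*-identityˡ ε)))
  where
  lem1 : ∀ h x -> h * x + h * x + h * x + h * x ≡ ((1ℚ + 1ℚ) * h) * ((1ℚ + 1ℚ) * x)
  lem1 = solve-∀ ring
  lem2 : ∀ u h e -> u * ((1ℚ + 1ℚ) * (h * e)) ≡ u * ((1ℚ + 1ℚ) * h) * e
  lem2 = solve-∀ ring
 A : ℕ
 A = 257 N.* 3 N.^ growthRate
 j1 j2 j3 j : ℕ
 j1 = proj₁ (recip-small A η 0<η)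
 j2 = proj₁ (recip-small 8754 η 0<η)
 j3 = proj₁ (cauchy e η 0<η)
 j = j1 N.+ j2 N.+ j3
 j₁≤ : j1 N.≤ j
 j₁≤ = N.≤-trans (m≤m+n j1 j2) (m≤m+n (j1 N.+ j2) j3)
 j₂≤ : j2 N.≤ j
 j₂≤ = N.≤-trans (m≤n+m j2 j1) (m≤m+n (j1 N.+ j2) j3)
 j₃≤ : j3 N.≤ j
 j₃≤ = m≤n+m j3 (j1 N.+ j2)
 A-small : ι A * recip j ≤ η
 A-small = ≤-trans (*-monoˡ (0≤ι A) (recip-anti j₁≤)) (proj₂ (recip-small A η 0<η))
 B-small : ι 8754 * recip j ≤ η
 B-small = ≤-trans (*-monoˡ (0≤ι 8754) (recip-anti j₂≤)) (proj₂ (recip-small 8754 η 0<η))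
 above : ∀ N' k -> j N.≤ k -> ratio N' ≤ exp 1ℚ j + ι A * recip j + η -> ratio N' ≤ e-sum k + ε
 above N' k j≤k up = begin
  ratio N' ≤⟨ up ⟩
  exp 1ℚ j + ι A * recip j + η ≤⟨ +-monoˡ-≤ η (+-mono-≤ (≡≤ᵣ (exp-1≡ j) (≤-from-∣∣ (proj₂ (cauchy e η 0<η) j k j₃≤ (N.≤-trans j₃≤ j≤k)))) A-small) ⟩
  e-sum k + η + η + η ≡⟨ lem (e-sum k) η ⟩
  e-sum k + (η + η + η) ≤⟨ +-monoʳ-≤ (e-sum k) quarters ⟩
  e-sum k + ε ∎
  where
  lem : ∀ e h -> e + h + h + h ≡ e + (h + h + h)
  lem = solve-∀ ring
 below : ∀ N' k -> j N.≤ k -> exp 1ℚ j ≤ ratio N' + ι 8754 * recip j + η -> e-sum k ≤ ratio N' + ε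
 below N' k j≤k low = begin
  e-sum k ≤⟨ ≤-from-∣∣ (proj₂ (cauchy e η 0<η) k j (N.≤-trans j₃≤ j≤k) j₃≤) ⟩
  e-sum j + η ≤⟨ +-monoˡ-≤ η (≡≤ᵣ (sym (exp-1≡ j)) (≤-trans low (+-monoˡ-≤ η (+-monoʳ-≤ R B-small)))) ⟩
  R + η + η + η ≡⟨ lem R η ⟩
  R + (η + η + η) ≤⟨ +-monoʳ-≤ R quarters ⟩
  R + ε ∎
  where
  R : ℚ
  R = ratio N'
  lem : ∀ e h -> e + h + h + h ≡ e + (h + h + h)
  lem = solve-∀ ring

1≤e-sum : ∀ k -> 1ℚ ≤ e-sum k
1≤e-sum k = begin
 1ℚ ≡⟨ trans (*-identityˡ (inv 0)) inv-0 ⟨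
 exp 1ℚ 0 ≤⟨ partial-≤ {expTerm 1ℚ} (0≤expTerm 0≤1) {0} {k} z≤n ⟩
 exp 1ℚ k ≡⟨ exp-1≡ k ⟩
 e-sum k ∎
 where open ≤-Reasoning

-- n² ((E / n²) - eₖ) against ε n² eₖ, where q = n²
relative-error : ∀ {E q R x ε} -> 0ℚ ≤ q -> 0ℚ ≤ ε -> E ≡ q * R -> 1ℚ ≤ x -> R ≤ x + ε -> x ≤ R + ε -> ∣ E - q * x ∣ ≤ ε * ∣ q * x ∣
relative-error {E} {q} {R} {x} {ε} 0≤q 0≤ε refl 1≤x R≤ x≤ = begin
 ∣ q * R - q * x ∣ ≤⟨ ∣∣-≤ {q * R} {q * x} {q * ε} (scaled R≤) (scaled x≤) ⟩
 q * ε ≡⟨ *-comm q ε ⟩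
 ε * q ≤⟨ *-monoˡ 0≤ε (≡≤ᵣ (sym (*-identityʳ q)) (*-monoˡ 0≤q 1≤x)) ⟩
 ε * (q * x) ≡⟨ cong (ε *_) (ℚ.0≤p⇒∣p∣≡p (0≤* 0≤q (≤-trans 0≤1 1≤x))) ⟨
 ε * ∣ q * x ∣ ∎
 where
 open ≤-Reasoning
 scaled : ∀ {u v} -> u ≤ v + ε -> q * u ≤ q * v + q * ε
 scaled {u} {v} le = ≤≡ᵣ (*-monoˡ 0≤q le) (*-distribˡ-+ q v ε)

𝔼[H²]≡ : ∀ N' -> 𝔼[H²] (suc (suc N')) ≡ (+ (suc (suc N') ^ 2) / 1) * ratio N'
𝔼[H²]≡ N' = rescale (suc N') (𝔼[H²] (suc (suc N')))
 where
 rescale : ∀ N x -> x ≡ (+ (suc N ^ 2) / 1) * (x * (recip N * recip N))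
 rescale N x = sym (trans (cong (_* (x * (recip N * recip N))) (trans (sym (ι≡ (suc N ^ 2))) (trans (cong ι (cong (suc N N.*_) (N.*-identityʳ (suc N)))) (ι-* (suc N) (suc N)))))
  (trans (lem (ι (suc N)) x (recip N)) (trans (cong₂ (λ u v -> x * (u * v)) (ι-recip N) (ι-recip N)) (*-identityʳ x))))
  where
  lem : ∀ a x r -> a * a * (x * (r * r)) ≡ x * (a * r * (a * r))
  lem = solve-∀ ring

mainTheorem3 : (λ n → fromℚ (𝔼[H²] n)) ∼ (λ n → (+ (n ^ 2) / 1) · e)
-- Starting at n = 2 gives the graph an edge, as `PathEdges` requires. Since e ≥ 1, an absolute
-- error ε of E[H²] / n² is also a relative one.
mainTheorem3 ε 0<ε = suc (suc N0) , λ where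
  (suc (suc N')) (s≤s (s≤s N₀≤)) ε' 0<ε' -> let (K , close) = proj₂ (ratio-limit ε 0<ε) N' N₀≤ in
   K , λ k K≤k -> let (R≤ , ≤R) = close k K≤k in
    ≤-trans (relative-error (subst (0ℚ ≤_) (ι≡ (suc (suc N') ^ 2)) (0≤ι (suc (suc N') ^ 2))) (ℚ.<⇒≤ 0<ε) (𝔼[H²]≡ N') (1≤e-sum k) R≤ ≤R)
     (≤+ʳ (ℚ.<⇒≤ 0<ε'))
 where
 N0 = proj₁ (ratio-limit ε 0<ε)
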